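{- Let $n\in\mathbb{N}$. Then \begin{align*} N(1, 1, 1,2;n) =&-2 \sigma_{\chi_0,\chi_2}(n) +8 \sigma_{\chi_2,\chi_0}(n),\\ N(1,1,5,10 ;n) = & \tfrac{2}{13}\big(2 \sigma_{\chi_0,\chi_2}(n) -15\sigma_{\chi_0,\chi_2}(n/5) +8\sigma_{\chi_2,\chi_0}(n) + 60\sigma_{\chi_2,\chi_0}(n/5)\big) + \tfrac{8}{13}\big(6 c_1(n) - 4 c_2(n) - 3 c_3(n) + 4 c_4(n)\big),\\ N(1, 2, 2,2;n) =&-2 \sigma_{\chi_0,\chi_2}(n) +4 \sigma_{\chi_2,\chi_0}(n),\\ N(1, 2, 5,5;n) =&-\tfrac{2}{13}\big(3 \sigma_{\chi_0,\chi_2}(n) +10\sigma_{\chi_0,\chi_2}(n/5) - 12 \sigma_{\chi_2,\chi_0}(n) +40\sigma_{\chi_2,\chi_0}(n/5) \big) + \tfrac{8}{13}\big(-2 c_2(n) - 5 c_3(n) + c_4(n)\big),\\ N(1,2,10,10;n) = &\tfrac{2}{13}\big(-3 \sigma_{\chi_0,\chi_2}(n) -10\sigma_{\chi_0,\chi_2}(n/5) +6\sigma_{\chi_2,\chi_0}(n) - 20\sigma_{\chi_2,\chi_0}(n/5)\big) + \tfrac{4}{13}\big(2 c_1(n) - 2 c_3(n) + 5c_4(n)\big),\\ N(2,2,5,10;n)= &\tfrac{2}{13}\big(2 \sigma_{\chi_0,\chi_2}(n) -15\sigma_{\chi_0,\chi_2}(n/5) +4 \sigma_{\chi_2,\chi_0}(n)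 + 30\sigma_{\chi_2,\chi_0}(n/5)\big) + \tfrac{4}{13}\big(-4 c_1(n) + 12 c_2(n) + 8c_3(n) - 3 c_4(n)\big). \end{align*}
   Context: For $a_1,a_2,a_3,a_4\in\mathbb{N}$ and $n\in\mathbb{N}_0$, $N(a_1,a_2,a_3,a_4;n)$ denotes the number of $(x_1,x_2,x_3,x_4)\in\mathbb{Z}^4$ with $n=a_1x_1^2+a_2x_2^2+a_3x_3^2+a_4x_4^2$. Let $\chi_0$ be the trivial character and $\chi_2(m)=\left(\frac{8}{m}\right)$ (Kronecker symbol). For Dirichlet characters $\chi,\psi$ and $x\in\mathbb{N}$, $\sigma_{\chi,\psi}(x)=\sum_{m\mid x}\psi(m)\chi(x/m)\,m$ (sum over positive divisors $m$); if $x\notin\mathbb{N}$, $\sigma_{\chi,\psi}(x)=0$. Let $q=e^{2\pi i z}$ with $\mathrm{Im}(z)>0$ and $\eta(z)=q^{1/24}\prod_{m\ge1}(1-q^m)$. The integers $c_k(n)$ are defined by $\sum_{n\ge1}c_1(n)q^n=\dfrac{\eta^2(z)\eta(8z)\eta^2(10z)\eta(40z)}{\eta(2z)\eta(20z)}$, $\sum_{n\ge1}c_2(n)q^n=\dfrac{\eta(z)\eta(5z)\eta^2(8z)\eta^2(20z)}{\eta(4z)\eta(10z)}$, $\sum_{n\ge1}c_3(n)q^n=\dfrac{\eta^6(2z)\eta(10z)\eta^2(40z)}{\eta^2(z)\eta^2(4z)\eta(20z)}$, $\sum_{n\ge1}c_4(n)q^n=\dfrac{\eta^6(4z)\eta^2(5z)\eta(20z)}{\eta^2(2z)\eta^2(8z)\eta(10z)}$.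 -}

module Defs where

open import Data.Nat as ℕ using (ℕ; zero; suc; _∸_; _<ᵇ_)
open import Data.Nat.Divisibility using (_∣_; _∣?_)
open import Data.Nat.DivMod using (_/_; _%_)
open import Data.Integer as ℤ using (ℤ; +_; -[1+_]; ∣_∣)
open import Data.List using (List; []; _∷_; map; upTo; filter; length; foldr)
open import Data.Product using (_×_; _,_)
open import Data.Bool using (Bool; true; false; if_then_else_)
open import Relation.Nullary.Decidable using (does)
open import Relation.Binary.PropositionalEquality using (_≡_)

sumℤ : List ℤ → ℤ
sumℤ = foldr ℤ._+_ (+ 0)

-- N(a1,a2,a3,a4;n): number of (x1,x2,x3,x4) ∈ ℤ⁴ with
-- n = a1 x1² + a2 x2² + a3 x3² + a4 x4².
-- Since every a_i ≥ 1, any solution has |x_i| ≤ n, so it suffices to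
-- count tuples in [-n, n]⁴ (this is exactly the full solution set).

intRange : ℕ → List ℤ
intRange n = map (λ i → + i ℤ.- + n) (upTo (suc (n ℕ.+ n)))

sq : ℤ → ℤ
sq x = x ℤ.* x

quadForm : ℕ → ℕ → ℕ → ℕ → ℤ → ℤ → ℤ → ℤ → ℤ
quadForm a1 a2 a3 a4 x1 x2 x3 x4 =
  + a1 ℤ.* sq x1 ℤ.+ + a2 ℤ.* sq x2 ℤ.+ + a3 ℤ.* sq x3 ℤ.+ + a4 ℤ.* sq x4

indicator : Bool → ℕ
indicator true  = 1
indicator false = 0

Nrep : ℕ → ℕ → ℕ → ℕ → ℕ → ℕ
Nrep a1 a2 a3 a4 n =
  let R = intRange n in
  foldr ℕ._+_ 0 (map (λ x1 →
  foldr ℕ._+_ 0 (map (λ x2 →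
  foldr ℕ._+_ 0 (map (λ x3 →
  foldr ℕ._+_ 0 (map (λ x4 →
    indicator (does (quadForm a1 a2 a3 a4 x1 x2 x3 x4 ℤ.≟ + n))) R)) R)) R)) R)

χ₀ : ℕ → ℤ
χ₀ _ = + 1

-- χ₂(m) = (8/m) Kronecker symbol: 0 for even m, and for odd m
-- equal to 1 if m ≡ ±1 (mod 8), -1 if m ≡ ±3 (mod 8).
χ₂ : ℕ → ℤ
χ₂ m with m % 8
... | 1 = + 1
... | 7 = + 1
... | 3 = ℤ.- + 1
... | 5 = ℤ.- + 1
... | _ = + 0

σ : (ℕ → ℤ) → (ℕ → ℤ) → ℕ → ℤ
σ χ ψ x = sumℤ (map term (upTo (suc x)))
  where
  term : ℕ → ℤ
  term zero = + 0
  term (suc k) =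
    if does (suc k ∣? x)
    then ψ (suc k) ℤ.* χ (x / suc k) ℤ.* + suc k
    else + 0

-- σ_{χ,ψ}(x / d), with the convention that it is 0 if x/d ∉ ℕ
-- (i.e. d ∤ x, or x = 0).
σfrac : (ℕ → ℤ) → (ℕ → ℤ) → ℕ → (d : ℕ) → ℤ
σfrac χ ψ x zero    = + 0
σfrac χ ψ zero (suc d) = + 0
σfrac χ ψ (suc x) (suc d) =
  if does (suc d ∣? suc x) then σ χ ψ (suc x / suc d) else + 0

Series : Set
Series = ℕ → ℤ

oneS : Series
oneS zero    = + 1
oneS (suc _) = + 0

_⊛_ : Series → Series → Series
(f ⊛ g) k = sumℤ (map (λ i → f i ℤ.* g (k ∸ i)) (upTo (suc k)))

powS : Series → ℕ → Series
powS f zero    = oneS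
powS f (suc r) = f ⊛ powS f r

oneMinus : ℕ → Series
oneMinus d k =
  if does (k ℕ.≟ 0) then + 1
  else if does (k ℕ.≟ d) then ℤ.- + 1 else + 0

-- (1 - q^d)^{-1} = Σ_{j ≥ 0} q^{dj}   (d ≥ 1)
geomS : ℕ → Series
geomS d k = if does (d ∣? k) then + 1 else + 0

factorPow : ℕ → ℤ → Series
factorPow d (+ r)     = powS (oneMinus d) r
factorPow d -[1+ r ]  = powS (geomS d) (suc r)

etaFactorTrunc : ℕ → ℤ → ℕ → Series
etaFactorTrunc δ r zero    = oneS
etaFactorTrunc δ r (suc K) = factorPow (δ ℕ.* suc K) r ⊛ etaFactorTrunc δ r K

-- An eta quotient ∏_δ η(δz)^{r_δ} is given by the list of pairs (δ , r_δ).
EtaQuotient : Set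
EtaQuotient = List (ℕ × ℤ)

etaProdTrunc : EtaQuotient → ℕ → Series
etaProdTrunc []            K = oneS
etaProdTrunc ((δ , r) ∷ e) K = etaFactorTrunc δ r K ⊛ etaProdTrunc e K

-- exponent of the leading power q^{(Σ δ r_δ)/24}
etaShift : EtaQuotient → ℕ
etaShift e = ∣ sumℤ (map (λ { (δ , r) → r ℤ.* + δ }) e) ∣ / 24

-- coefficient of q^n in  q^{(Σ δ r_δ)/24} ∏_δ ∏_{m ≥ 1} (1 - q^{δ m})^{r_δ}.
-- Factors with δ m > n do not affect the coefficient of q^n, so the
-- product truncated at m ≤ n gives the exact coefficient.
etaCoeff : EtaQuotient → ℕ → ℤ
etaCoeff e n =
  if n <ᵇ etaShift e then + 0
  else etaProdTrunc e n (n ∸ etaShift e)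

eq₁ eq₂ eq₃ eq₄ : EtaQuotient
eq₁ = (1 , + 2) ∷ (8 , + 1) ∷ (10 , + 2) ∷ (40 , + 1) ∷ (2 , ℤ.- + 1) ∷ (20 , ℤ.- + 1) ∷ []
eq₂ = (1 , + 1) ∷ (5 , + 1) ∷ (8 , + 2) ∷ (20 , + 2) ∷ (4 , ℤ.- + 1) ∷ (10 , ℤ.- + 1) ∷ []
eq₃ = (2 , + 6) ∷ (10 , + 1) ∷ (40 , + 2) ∷ (1 , ℤ.- + 2) ∷ (4 , ℤ.- + 2) ∷ (20 , ℤ.- + 1) ∷ []
eq₄ = (4 , + 6) ∷ (5 , + 2) ∷ (20 , + 1) ∷ (2 , ℤ.- + 2) ∷ (8 , ℤ.- + 2) ∷ (10 , ℤ.- + 1) ∷ []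

c₁ c₂ c₃ c₄ : ℕ → ℤ
c₁ = etaCoeff eq₁
c₂ = etaCoeff eq₂
c₃ = etaCoeff eq₃
c₄ = etaCoeff eq₄

N : ℕ → ℕ → ℕ → ℕ → ℕ → ℤ
N a1 a2 a3 a4 n = + Nrep a1 a2 a3 a4 n

-- Put φ(q) = Σ q^(n²) and ψ(q) = Σ_{n≥0} q^(n(n+1)/2), so that N(a₁,a₂,a₃,a₄;n) is the coefficient of qⁿ in ∏ φ(q^aᵢ).
-- By Jacobi's triple product φ and ψ are quotients of Euler products, whence the eta quotients of the c_k are products
-- of theta functions. The relations of level 5 between φ and ψ come from two lattice sums: Gaussian integers modulo 2 + i
-- for φ(q)² - φ(q⁵)², and m + n modulo 6 for φ(q)φ(-q⁵) - φ(-q)φ(q⁵). Substituting q ↦ qᵏ and q ↦ -q, eliminating, and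
-- cancelling in the domain ℤ[[q]] writes every c_k as a quartic form in thetas and reduces the six products to
-- φ(q)³φ(q²), φ(q)φ(q²)³, their images under q ↦ q⁵, and the c_k.
-- For A = Σ σ_{χ₀,χ₂}(n) qⁿ, 1 - 2A is 1 plus twice the logarithmic derivative q d/dq of the quotient of the theta
-- functions ∏ (1 - q^(8i±1))(1 - q^(8i)) and ∏ (1 - q^(8i±3))(1 - q^(8i)); a change of variables in the double sum and
-- Jacobi's formula for ∏ (1 - qⁱ)³ turn it into φ(q)φ(q²)φ(-q)².
-- For B = Σ σ_{χ₂,χ₀}(n) qⁿ, B(q) - 2B(q²) is the twist of A by χ₂, which determines B = qφ(q)φ(q²)ψ(q⁴)².
module Submission where

open import Defs
open import Data.Nat as ℕ using (ℕ; zero; suc; _∸_; z≤n; s≤s; NonZero; _≡ᵇ_; _<ᵇ_)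
import Data.Nat.Properties as ℕₚ
open import Data.Nat.Divisibility using (_∣_; _∣?_; ∣m+n∣m⇒∣n; ∣m∣n⇒∣m+n; ∣-refl; _∣0; ∣⇒≤; divides; *-cancelʳ-∣; *-monoˡ-∣)
open import Data.Nat.DivMod using (_/_; _%_; [m+kn]%n≡m%n; %-distribˡ-*; m%n%n≡m%n; m%n<n; m*n/o*n≡m/o; m/n*n≡m; m*n/n≡m; m≡m%n+[m/n]*n)
open import Data.Nat.Induction using (<-rec)
open import Data.Nat.Tactic.RingSolver using () renaming (solve-∀ to ℕ-solve-∀)
open import Data.Integer as ℤ using (ℤ; +_; -[1+_]; ∣_∣)
import Data.Integer.Properties as ℤₚ
import Data.Integer.DivMod as ℤᵈ
open import Data.Integer.Tactic.RingSolver using (solve-∀)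
open import Data.Fin as Fin using (Fin; #_; zero; suc; toℕ; fromℕ<)
import Data.Fin.Properties as Finₚ
open import Data.Vec as Vec using (Vec; []; _∷_; lookup; allFin)
open import Data.Vec.N-ary using (N-ary; _$ⁿ_)
open import Data.List using (List; []; _∷_; map; foldr; upTo; applyUpTo; _++_; cartesianProduct)
import Data.List.Properties as Listₚ
open import Data.Maybe using (Maybe; just; nothing)
open import Data.Product using (Σ; _×_; _,_; proj₁; proj₂)
open import Data.Product.Properties using (≡-dec; ,-injectiveˡ; ,-injectiveʳ)
open import Data.Sum using (inj₁; inj₂)
open import Data.Empty using (⊥-elim)
open import Data.Unit using (tt)
open import Data.Bool using (Bool; true; false; if_then_else_; T)
open import Algebra.Bundles using (CommutativeRing)
open import Level using (0ℓ)
open import Relation.Nullary using (Dec; yes; no; ¬_)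
open import Relation.Nullary.Decidable using (does; toWitness)
open import Relation.Binary.Bundles using (Setoid)
open import Relation.Binary.Definitions using (DecidableEquality)
open import Relation.Binary.PropositionalEquality as ≡ using (_≡_; _≢_; refl; sym; trans; cong; cong₂; subst)

-- Nothing is inverted and no root is extracted. A quotient of series becomes an equation between
-- products, from which a factor with nonzero constant term, or a power of q, is cancelled. A
-- relation known only up to sign, from two equal squares, is settled by the constant term or the
-- coefficient of q in the sum of both sides. The count behind the elimination: let x, y, a, b be φ
-- at q, q², q⁵, q¹⁰, and put m = 2qψ(q⁴)², n = 2q⁵ψ(q²⁰)². The six products and the c_k lie in the
-- span of the eight products of xy or ab with y², b², m or n. The divisor sums, through x³y, xy³,
-- a³b, ab³, give the four products xyy², xym, abb², abn. The c_k are four linear combinations of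
-- the eight, and determine the other four, xyb², xyn, aby², abm. Up to sign and a power of 2 the
-- determinant of that system is 13², whence the denominator 13.

∀Vec : ∀ {A : Set} n → (Vec A n → Set) → Set
∀Vec zero    P = P []
∀Vec {A} (suc n) P = (x : A) → ∀Vec n (λ xs → P (x ∷ xs))

∀Vec-intro : ∀ {A : Set} n {P : Vec A n → Set} → (∀ xs → P xs) → ∀Vec n P
∀Vec-intro zero    p = p []
∀Vec-intro (suc n) p = λ x → ∀Vec-intro n (λ xs → p (x ∷ xs))

-- Polynomial identities in commutative rings by normal forms

record ℤ-Algebra : Set₁ where
  field
    commutativeRing : CommutativeRing 0ℓ 0ℓ
  open CommutativeRing commutativeRing public hiding (zero) renaming (refl to ≈refl; sym to ≈sym; trans to ≈trans)
  field
    ι   : ℤ → Carrier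
    ι-+ : ∀ x y → ι (x ℤ.+ y) ≈ ι x + ι y
    ι-* : ∀ x y → ι (x ℤ.* y) ≈ ι x * ι y
    ι-0 : ι (+ 0) ≈ 0#
    ι-1 : ι (+ 1) ≈ 1#

-- Normal forms have integer coefficients, because equality of integers is decided by evaluation
-- while equality in the carrier (power series, or dual numbers over them) is not; `ι` interprets
-- the coefficients.
module PolySolver (𝓡 : ℤ-Algebra) where

  open ℤ-Algebra 𝓡
  open import Relation.Binary.Reasoning.Setoid setoid
  open import Algebra.Properties.Ring ring using (-1*x≈-x)
  import Algebra.Properties.CommutativeSemigroup *-commutativeSemigroup as *-CSG
  import Algebra.Properties.CommutativeSemigroup +-commutativeSemigroup as +-CSG

  infixr 8 _^_
  _^_ : Carrier → ℕ → Carrier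
  x ^ zero  = 1#
  x ^ suc n = x * x ^ n

  infixl 6 _:+_ _:-_
  infixl 7 _:*_
  infix  8 :-_
  infixr 9 _:^_
  infix  4 _:=_

  data Expr (n : ℕ) : Set where
    var  : Fin n → Expr n
    con  : ℤ → Expr n
    _:+_ _:*_ : Expr n → Expr n → Expr n
    :-_  : Expr n → Expr n
    _:^_ : Expr n → ℕ → Expr n

  _:-_ : ∀ {n} → Expr n → Expr n → Expr n
  e :- f = e :+ :- f

  _:=_ : ∀ {n} → Expr n → Expr n → Expr n × Expr n
  _:=_ = _,_

  ⟦_⟧ : ∀ {n} → Expr n → Vec Carrier n → Carrier
  ⟦ var i ⟧ ρ   = lookup ρ i
  ⟦ con z ⟧ ρ   = ι z
  ⟦ e :+ f ⟧ ρ  = ⟦ e ⟧ ρ + ⟦ f ⟧ ρ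
  ⟦ e :* f ⟧ ρ  = ⟦ e ⟧ ρ * ⟦ f ⟧ ρ
  ⟦ :- e ⟧ ρ    = - ⟦ e ⟧ ρ
  ⟦ e :^ n ⟧ ρ  = ⟦ e ⟧ ρ ^ n

  private
    -- Exponent vectors without trailing zeros: `varM` ends in 1 and `_·_` only adds exponents, so
    -- equal monomials are equal lists.
    Mono : Set
    Mono = List ℕ

    Poly : Set
    Poly = List (ℤ × Mono)

    _==_ : Mono → Mono → Bool
    []      == []      = true
    []      == (_ ∷ _) = false
    (_ ∷ _) == []      = false
    (i ∷ m) == (j ∷ n) = if i ≡ᵇ j then m == n else false

    -- A monomial order: multiplication by a monomial keeps a polynomial sorted, so that `merge`
    -- meets all like terms.
    _<<_ : Mono → Mono → Bool
    _       << []      = false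
    []      << (_ ∷ _) = true
    (i ∷ m) << (j ∷ n) = if i ≡ᵇ j then m << n else i <ᵇ j

    _·_ : Mono → Mono → Mono
    []      · n       = n
    (i ∷ m) · []      = i ∷ m
    (i ∷ m) · (j ∷ n) = (i ℕ.+ j) ∷ (m · n)

    merge : Poly → Poly → Poly
    merge₁ : ℤ → Mono → Poly → Poly → Poly
    merge [] q = q
    merge ((c , m) ∷ p) q = merge₁ c m p q
    merge₁ c m p [] = (c , m) ∷ p
    merge₁ c m p ((d , n) ∷ q) =
      if m == n then (c ℤ.+ d , m) ∷ merge p q
      else if m << n then (c , m) ∷ merge p ((d , n) ∷ q)
      else (d , n) ∷ merge₁ c m p q

    scaleP : ℤ → Mono → Poly → Poly
    scaleP c m = map λ { (d , n) → c ℤ.* d , m · n }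

    mulP : Poly → Poly → Poly
    mulP []            q = []
    mulP ((c , m) ∷ p) q = merge (scaleP c m q) (mulP p q)

    powP : Poly → ℕ → Poly
    powP p zero    = (+ 1 , []) ∷ []
    powP p (suc n) = mulP p (powP p n)

    varM : ∀ {n} → Fin n → Mono
    varM zero    = 1 ∷ []
    varM (suc i) = 0 ∷ varM i

    normP : ∀ {n} → Expr n → Poly
    normP (var i)  = (+ 1 , varM i) ∷ []
    normP (con z)  = (z , []) ∷ []
    normP (e :+ f) = merge (normP e) (normP f)
    normP (e :* f) = mulP (normP e) (normP f)
    normP (:- e)   = scaleP (ℤ.- + 1) [] (normP e)
    normP (e :^ n) = powP (normP e) n

    -- Terms that cancel in `merge` stay in the list with coefficient 0.
    isZero : Poly → Bool
    isZero []              = true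
    isZero ((+ 0 , _) ∷ p) = isZero p
    isZero _               = false

    module _ {n} (ρ : Vec Carrier n) where

      -- Exponents beyond the environment are interpreted as 1.
      ⟦_⟧ᴹ : Mono → ∀ {k} → Vec Carrier k → Carrier
      ⟦ [] ⟧ᴹ    σ       = 1#
      ⟦ i ∷ m ⟧ᴹ []      = 1#
      ⟦ i ∷ m ⟧ᴹ (x ∷ σ) = x ^ i * ⟦ m ⟧ᴹ σ

      ⟦_⟧ᴾ : Poly → Carrier
      ⟦ [] ⟧ᴾ          = 0#
      ⟦ (c , m) ∷ p ⟧ᴾ = ι c * ⟦ m ⟧ᴹ ρ + ⟦ p ⟧ᴾ

      ==-sound : ∀ m n → (m == n) ≡ true → m ≡ n
      ==-sound []      []      _ = refl
      ==-sound (i ∷ m) (j ∷ n) p with i ≡ᵇ j in eq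
      ... | true = cong₂ _∷_ (ℕₚ.≡ᵇ⇒≡ i j (subst T (≡.sym eq) tt)) (==-sound m n p)

      ^-+ : ∀ x i j → x ^ (i ℕ.+ j) ≈ x ^ i * x ^ j
      ^-+ x zero    j = ≈sym (*-identityˡ _)
      ^-+ x (suc i) j = ≈trans (*-congˡ (^-+ x i j)) (≈sym (*-assoc x _ _))

      ·-sound : ∀ m n {k} (σ : Vec Carrier k) → ⟦ m · n ⟧ᴹ σ ≈ ⟦ m ⟧ᴹ σ * ⟦ n ⟧ᴹ σ
      ·-sound []      n       σ       = ≈sym (*-identityˡ _)
      ·-sound (i ∷ m) []      []      = ≈sym (*-identityˡ _)
      ·-sound (i ∷ m) []      (x ∷ σ) = ≈sym (*-identityʳ _)
      ·-sound (i ∷ m) (j ∷ n) []      = ≈sym (*-identityˡ _)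
      ·-sound (i ∷ m) (j ∷ n) (x ∷ σ) = begin
        x ^ (i ℕ.+ j) * ⟦ m · n ⟧ᴹ σ                  ≈⟨ *-cong (^-+ x i j) (·-sound m n σ) ⟩
        (x ^ i * x ^ j) * (⟦ m ⟧ᴹ σ * ⟦ n ⟧ᴹ σ)       ≈⟨ *-CSG.interchange _ _ _ _ ⟩
        (x ^ i * ⟦ m ⟧ᴹ σ) * (x ^ j * ⟦ n ⟧ᴹ σ) ∎

      add-like : ∀ c d m p q → ι (c ℤ.+ d) * ⟦ m ⟧ᴹ ρ + (p + q) ≈ (ι c * ⟦ m ⟧ᴹ ρ + p) + (ι d * ⟦ m ⟧ᴹ ρ + q)
      add-like c d m p q = begin
        ι (c ℤ.+ d) * ⟦ m ⟧ᴹ ρ + (p + q)                       ≈⟨ +-congʳ (*-congʳ (ι-+ c d)) ⟩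
        (ι c + ι d) * ⟦ m ⟧ᴹ ρ + (p + q)                       ≈⟨ +-congʳ (distribʳ _ _ _) ⟩
        (ι c * ⟦ m ⟧ᴹ ρ + ι d * ⟦ m ⟧ᴹ ρ) + (p + q)            ≈⟨ +-CSG.interchange _ _ _ _ ⟩
        (ι c * ⟦ m ⟧ᴹ ρ + p) + (ι d * ⟦ m ⟧ᴹ ρ + q) ∎

      merge-sound : ∀ p q → ⟦ merge p q ⟧ᴾ ≈ ⟦ p ⟧ᴾ + ⟦ q ⟧ᴾ
      merge₁-sound : ∀ c m p q → ⟦ merge₁ c m p q ⟧ᴾ ≈ (ι c * ⟦ m ⟧ᴹ ρ + ⟦ p ⟧ᴾ) + ⟦ q ⟧ᴾ
      merge-sound []            q = ≈sym (+-identityˡ _)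
      merge-sound ((c , m) ∷ p) q = merge₁-sound c m p q
      merge₁-sound c m p [] = ≈sym (+-identityʳ _)
      merge₁-sound c m p ((d , n) ∷ q) with m == n in eq
      ... | true rewrite ==-sound m n eq = ≈trans (+-congˡ (merge-sound p q)) (add-like c d n _ _)
      ... | false with m << n
      ...   | true  = ≈trans (+-congˡ (merge-sound p ((d , n) ∷ q))) (≈sym (+-assoc _ _ _))
      ...   | false = ≈trans (+-congˡ (merge₁-sound c m p q)) (+-CSG.x∙yz≈y∙xz _ _ _)

      scaleP-sound : ∀ c m p → ⟦ scaleP c m p ⟧ᴾ ≈ (ι c * ⟦ m ⟧ᴹ ρ) * ⟦ p ⟧ᴾ
      scaleP-sound c m []            = ≈sym (zeroʳ _)
      scaleP-sound c m ((d , n) ∷ p) = begin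
        ι (c ℤ.* d) * ⟦ m · n ⟧ᴹ ρ + ⟦ scaleP c m p ⟧ᴾ
          ≈⟨ +-cong (*-cong (ι-* c d) (·-sound m n ρ)) (scaleP-sound c m p) ⟩
        (ι c * ι d) * (⟦ m ⟧ᴹ ρ * ⟦ n ⟧ᴹ ρ) + (ι c * ⟦ m ⟧ᴹ ρ) * ⟦ p ⟧ᴾ
          ≈⟨ +-congʳ (*-CSG.interchange _ _ _ _) ⟩
        (ι c * ⟦ m ⟧ᴹ ρ) * (ι d * ⟦ n ⟧ᴹ ρ) + (ι c * ⟦ m ⟧ᴹ ρ) * ⟦ p ⟧ᴾ
          ≈⟨ distribˡ _ _ _ ⟨
        (ι c * ⟦ m ⟧ᴹ ρ) * (ι d * ⟦ n ⟧ᴹ ρ + ⟦ p ⟧ᴾ) ∎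

      mulP-sound : ∀ p q → ⟦ mulP p q ⟧ᴾ ≈ ⟦ p ⟧ᴾ * ⟦ q ⟧ᴾ
      mulP-sound []            q = ≈sym (zeroˡ _)
      mulP-sound ((c , m) ∷ p) q = begin
        ⟦ merge (scaleP c m q) (mulP p q) ⟧ᴾ            ≈⟨ merge-sound (scaleP c m q) (mulP p q) ⟩
        ⟦ scaleP c m q ⟧ᴾ + ⟦ mulP p q ⟧ᴾ               ≈⟨ +-cong (scaleP-sound c m q) (mulP-sound p q) ⟩
        (ι c * ⟦ m ⟧ᴹ ρ) * ⟦ q ⟧ᴾ + ⟦ p ⟧ᴾ * ⟦ q ⟧ᴾ    ≈⟨ distribʳ _ _ _ ⟨
        (ι c * ⟦ m ⟧ᴹ ρ + ⟦ p ⟧ᴾ) * ⟦ q ⟧ᴾ ∎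

      one-sound : ⟦ (+ 1 , []) ∷ [] ⟧ᴾ ≈ 1#
      one-sound = ≈trans (+-identityʳ _) (≈trans (*-identityʳ _) ι-1)

      powP-sound : ∀ p k → ⟦ powP p k ⟧ᴾ ≈ ⟦ p ⟧ᴾ ^ k
      powP-sound p zero    = one-sound
      powP-sound p (suc k) = ≈trans (mulP-sound p (powP p k)) (*-congˡ (powP-sound p k))

      varM-sound : ∀ {k} (i : Fin k) (σ : Vec Carrier k) → ⟦ varM i ⟧ᴹ σ ≈ lookup σ i
      varM-sound zero    (x ∷ σ) = ≈trans (*-identityʳ _) (*-identityʳ _)
      varM-sound (suc i) (x ∷ σ) = ≈trans (*-identityˡ _) (varM-sound i σ)

      ^-cong : ∀ {x y} k → x ≈ y → x ^ k ≈ y ^ k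
      ^-cong zero    p = ≈refl
      ^-cong (suc k) p = *-cong p (^-cong k p)

      ι-neg1 : ι (ℤ.- + 1) ≈ - 1#
      ι-neg1 = begin
        ι (ℤ.- + 1)                       ≈⟨ +-identityʳ _ ⟨
        ι (ℤ.- + 1) + 0#                  ≈⟨ +-congˡ (-‿inverseʳ 1#) ⟨
        ι (ℤ.- + 1) + (1# + - 1#)         ≈⟨ +-assoc _ _ _ ⟨
        (ι (ℤ.- + 1) + 1#) + - 1#         ≈⟨ +-congʳ (+-congˡ ι-1) ⟨
        (ι (ℤ.- + 1) + ι (+ 1)) + - 1#    ≈⟨ +-congʳ (≈trans (≈sym (ι-+ (ℤ.- + 1) (+ 1))) ι-0) ⟩
        0# + - 1#                         ≈⟨ +-identityˡ _ ⟩
        - 1# ∎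

      normP-sound : ∀ (e : Expr n) → ⟦ normP e ⟧ᴾ ≈ ⟦ e ⟧ ρ
      normP-sound (var i)  = ≈trans (+-identityʳ _) (≈trans (*-cong ι-1 (varM-sound i ρ)) (*-identityˡ _))
      normP-sound (con z)  = ≈trans (+-identityʳ _) (*-identityʳ _)
      normP-sound (e :+ f) = ≈trans (merge-sound (normP e) (normP f)) (+-cong (normP-sound e) (normP-sound f))
      normP-sound (e :* f) = ≈trans (mulP-sound (normP e) (normP f)) (*-cong (normP-sound e) (normP-sound f))
      normP-sound (:- e)   = ≈trans (scaleP-sound (ℤ.- + 1) [] (normP e))
        (≈trans (*-cong (≈trans (*-identityʳ _) ι-neg1) (normP-sound e)) (-1*x≈-x _))
      normP-sound (e :^ k) = ≈trans (powP-sound (normP e) k) (^-cong k (normP-sound e))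

      isZero-sound : ∀ p → isZero p ≡ true → ⟦ p ⟧ᴾ ≈ 0#
      isZero-sound []              _  = ≈refl
      isZero-sound ((+ 0 , m) ∷ p) eq = ≈trans (+-cong (≈trans (*-congʳ ι-0) (zeroˡ _)) (isZero-sound p eq)) (+-identityˡ _)

  vars : ∀ n → Vec (Expr n) n
  vars n = Vec.map var (allFin n)

  infix 4 _≟ᴾ_
  _≟ᴾ_ : ∀ {n} → Expr n → Expr n → Bool
  l ≟ᴾ r = isZero (normP (l :- r))

  -‿zero⇒≈ : ∀ {x y} → x + - y ≈ 0# → x ≈ y
  -‿zero⇒≈ {x} {y} p = begin
    x                ≈⟨ +-identityʳ x ⟨
    x + 0#           ≈⟨ +-congˡ (-‿inverseˡ y) ⟨
    x + (- y + y)    ≈⟨ +-assoc x (- y) y ⟨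
    (x + - y) + y    ≈⟨ +-congʳ p ⟩
    0# + y           ≈⟨ +-identityˡ y ⟩
    y ∎

  ≟ᴾ-sound : ∀ {n} (l r : Expr n) → (l ≟ᴾ r) ≡ true → ∀ ρ → ⟦ l ⟧ ρ ≈ ⟦ r ⟧ ρ
  ≟ᴾ-sound l r eq ρ = -‿zero⇒≈ (≈trans (≈sym (normP-sound ρ (l :- r))) (isZero-sound ρ (normP (l :- r)) eq))

  solve : ∀ n (f : N-ary n (Expr n) (Expr n × Expr n)) → (proj₁ (f $ⁿ vars n) ≟ᴾ proj₂ (f $ⁿ vars n)) ≡ true →
          ∀Vec n (λ ρ → ⟦ proj₁ (f $ⁿ vars n) ⟧ ρ ≈ ⟦ proj₂ (f $ⁿ vars n) ⟧ ρ)
  solve n f eq = ∀Vec-intro n (≟ᴾ-sound (proj₁ (f $ⁿ vars n)) (proj₂ (f $ⁿ vars n)) eq)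

-- k - j by recursion, so that `diff (suc k) (suc j)` reduces to `diff k j`; the induction on j in
-- `finite-triple-product` rests on this reduction.
diff : ℕ → ℕ → ℤ
diff k       zero    = + k
diff zero    (suc j) = -[1+ j ]
diff (suc k) (suc j) = diff k j

-- Gaussian binomials and the finite triple product

module FiniteTripleProduct (𝓡 : ℤ-Algebra) where

  open ℤ-Algebra 𝓡
  open PolySolver 𝓡
  open import Relation.Binary.Reasoning.Setoid setoid

  ∑ ∏ : ℕ → (ℕ → Carrier) → Carrier
  ∑ zero    f = 0#
  ∑ (suc n) f = f 0 + ∑ n (λ k → f (suc k))
  ∏ zero    f = 1#
  ∏ (suc n) f = ∏ n f * f n

  ∑-cong : ∀ n {f g} → (∀ k → f k ≈ g k) → ∑ n f ≈ ∑ n g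
  ∑-cong zero    p = ≈refl
  ∑-cong (suc n) p = +-cong (p 0) (∑-cong n (λ k → p (suc k)))

  ∏-cong : ∀ n {f g} → (∀ k → f k ≈ g k) → ∏ n f ≈ ∏ n g
  ∏-cong zero    p = ≈refl
  ∏-cong (suc n) p = *-cong (∏-cong n p) (p n)

  ∏-head : ∀ n f → ∏ (suc n) f ≈ f 0 * ∏ n (λ k → f (suc k))
  ∏-head zero    f = *-comm _ _
  ∏-head (suc n) f = ≈trans (*-congʳ (∏-head n f)) (*-assoc _ _ _)

  ∑-+ : ∀ n f g → ∑ n f + ∑ n g ≈ ∑ n (λ k → f k + g k)
  ∑-+ zero    f g = +-identityˡ 0#
  ∑-+ (suc n) f g = ≈trans (interchange (f 0) _ (g 0) _) (+-congˡ (∑-+ n _ _))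
    where
    interchange : ∀ x y z w → (x + y) + (z + w) ≈ (x + z) + (y + w)
    interchange = solve 4 (λ x y z w → (x :+ y) :+ (z :+ w) := (x :+ z) :+ (y :+ w)) refl

  ∑-*ʳ : ∀ n f x → ∑ n f * x ≈ ∑ n (λ k → f k * x)
  ∑-*ʳ zero    f x = zeroˡ x
  ∑-*ʳ (suc n) f x = ≈trans (distribʳ x _ _) (+-congˡ (∑-*ʳ n _ x))

  module _ (p : Carrier) where

    -- The Gaussian binomial coefficient, given by the q-Pascal rule since quotients of Pochhammer
    -- products cannot be formed in a ring.
    gauss : ℕ → ℕ → Carrier
    gauss n       zero    = 1#
    gauss zero    (suc k) = 0#
    gauss (suc n) (suc k) = gauss n k + p ^ suc k * gauss n (suc k)

    poch : ℕ → Carrier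
    poch n = ∏ n (λ m → 1# + - (p ^ suc m))

    gauss-zero : ∀ n d → gauss n (suc (n ℕ.+ d)) ≈ 0#
    gauss-zero zero    d = ≈refl
    gauss-zero (suc n) d = begin
      gauss n (suc (n ℕ.+ d)) + p ^ suc (suc (n ℕ.+ d)) * gauss n (suc (suc (n ℕ.+ d)))
        ≈⟨ +-cong (gauss-zero n d) (*-congˡ (≈trans (reflexive (cong (λ t → gauss n (suc t)) (sym (ℕₚ.+-suc n d)))) (gauss-zero n (suc d)))) ⟩
      0# + p ^ suc (suc (n ℕ.+ d)) * 0#  ≈⟨ ≈trans (+-identityˡ _) (zeroʳ _) ⟩
      0# ∎

    poch-suc : ∀ n → poch (suc n) ≈ poch n * (1# + - (p ^ suc n))
    poch-suc n = ≈refl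

    ^-+ : ∀ x i j → x ^ (i ℕ.+ j) ≈ x ^ i * x ^ j
    ^-+ x zero    j = ≈sym (*-identityˡ _)
    ^-+ x (suc i) j = ≈trans (*-congˡ (^-+ x i j)) (≈sym (*-assoc x _ _))

    -- The quotient formula with denominators cleared. The induction step is 1 - PQ = (1 - P) + P(1
    -- - Q) for the powers P and Q of p with exponents k + 1 and l + 1.
    gauss-poch : ∀ k l → gauss (k ℕ.+ l) k * poch k * poch l ≈ poch (k ℕ.+ l)
    gauss-poch zero    l    = ≈trans (*-congʳ (*-identityˡ _)) (*-identityˡ _)
    gauss-poch (suc k) zero rewrite ℕₚ.+-identityʳ k = begin
      (gauss k k + p ^ suc k * gauss k (suc k)) * poch (suc k) * 1#
        ≈⟨ *-congʳ (*-congʳ (+-congˡ (*-congˡ (≈trans (reflexive (cong (λ t → gauss k (suc t)) (sym (ℕₚ.+-identityʳ k)))) (gauss-zero k 0))))) ⟩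
      (gauss k k + p ^ suc k * 0#) * poch (suc k) * 1#
        ≈⟨ *-congʳ (*-congˡ (poch-suc k)) ⟩
      (gauss k k + p ^ suc k * 0#) * (poch k * (1# + - (p ^ suc k))) * 1#
        ≈⟨ *-cong (*-congʳ (+-congˡ (*-congˡ (≈sym ι-0)))) (≈sym ι-1) ⟩
      (gauss k k + p ^ suc k * ι (+ 0)) * (poch k * (1# + - (p ^ suc k))) * ι (+ 1)
        ≈⟨ solve 4 (λ g q f o → (g :+ q :* con (+ 0)) :* (f :* o) :* con (+ 1) := (g :* f :* con (+ 1)) :* o) refl
             (gauss k k) (p ^ suc k) (poch k) (1# + - (p ^ suc k)) ⟩
      (gauss k k * poch k * ι (+ 1)) * (1# + - (p ^ suc k))
        ≈⟨ *-congʳ (≈trans (*-congˡ ι-1) (≈trans (reflexive (cong (λ t → gauss t k * poch k * 1#) (sym (ℕₚ.+-identityʳ k))))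
             (≈trans (gauss-poch k 0) (reflexive (cong poch (ℕₚ.+-identityʳ k)))))) ⟩
      poch k * (1# + - (p ^ suc k)) ∎
    gauss-poch (suc k) (suc l) = begin
      (gauss n k + p ^ suc k * gauss n (suc k)) * poch (suc k) * poch (suc l)
        ≈⟨ solve 6 (λ g P h f u v → (g :+ P :* h) :* (f :* u) :* v := (g :* f :* v) :* u :+ P :* (h :* (f :* u) :* v)) refl
             (gauss n k) (p ^ suc k) (gauss n (suc k)) (poch k) (1# + - (p ^ suc k)) (poch (suc l)) ⟩
      (gauss n k * poch k * poch (suc l)) * (1# + - (p ^ suc k)) + p ^ suc k * (gauss n (suc k) * poch (suc k) * (poch l * (1# + - (p ^ suc l))))
        ≈⟨ +-cong (*-congʳ (gauss-poch k (suc l))) (*-congˡ (≈sym (*-assoc _ _ _))) ⟩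
      poch n * (1# + - (p ^ suc k)) + p ^ suc k * ((gauss n (suc k) * poch (suc k) * poch l) * (1# + - (p ^ suc l)))
        ≈⟨ +-congˡ (*-congˡ (*-congʳ (≈trans (reflexive (cong (λ t → gauss t (suc k) * poch (suc k) * poch l) (ℕₚ.+-suc k l)))
             (≈trans (gauss-poch (suc k) l) (reflexive (cong poch (sym (ℕₚ.+-suc k l)))))))) ⟩
      poch n * (1# + - (p ^ suc k)) + p ^ suc k * (poch n * (1# + - (p ^ suc l)))
        ≈⟨ +-cong (*-congˡ (+-congʳ (≈sym ι-1))) (*-congˡ (*-congˡ (+-congʳ (≈sym ι-1)))) ⟩
      poch n * (ι (+ 1) + - (p ^ suc k)) + p ^ suc k * (poch n * (ι (+ 1) + - (p ^ suc l)))
        ≈⟨ solve 3 (λ f P Q → f :* (con (+ 1) :- P) :+ P :* (f :* (con (+ 1) :- Q)) := f :* (con (+ 1) :- P :* Q)) refl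
             (poch n) (p ^ suc k) (p ^ suc l) ⟩
      poch n * (ι (+ 1) + - (p ^ suc k * p ^ suc l))
        ≈⟨ *-congˡ (+-cong ι-1 (-‿cong (≈sym (^-+ p (suc k) (suc l))))) ⟩
      poch n * (1# + - (p ^ suc n)) ∎
      where n = k ℕ.+ suc l

    -- z^k p^(k(k-1)/2), the monomial in the q-binomial theorem.
    powTri : Carrier → ℕ → Carrier
    powTri z zero    = 1#
    powTri z (suc k) = powTri z k * (z * p ^ k)

    powTri-shift : ∀ z k → powTri (z * p) k ≈ p ^ k * powTri z k
    powTri-shift z zero    = ≈sym (*-identityˡ _)
    powTri-shift z (suc k) = ≈trans (*-congʳ (powTri-shift z k))
      (solve 4 (λ P t z p → (P :* t) :* (z :* p :* P) := p :* P :* (t :* (z :* P))) refl (p ^ k) (powTri z k) z p)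

    -- Peeling off the first factor 1 + z leaves the same product at zp. Gaussian binomials vanish
    -- beyond i, so the length M of the sum is free; the step uses it at two lengths, so that the
    -- shifted and the unshifted sum can be added termwise.
    q-binomial : ∀ i z M → i ℕ.< M → ∏ i (λ m → 1# + z * p ^ m) ≈ ∑ M (λ k → gauss i k * powTri z k)
    q-binomial zero z (suc M) _ = ≈sym (≈trans (+-cong (*-identityˡ _) (≈trans (∑-cong M (λ k → zeroˡ _)) (∑-zero M))) (+-identityʳ _))
      where
      ∑-zero : ∀ n → ∑ n (λ _ → 0#) ≈ 0#
      ∑-zero zero    = ≈refl
      ∑-zero (suc n) = ≈trans (+-identityˡ _) (∑-zero n)
    q-binomial (suc i) z (suc M) (s≤s i<M) = begin
      ∏ (suc i) (λ m → 1# + z * p ^ m)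
        ≈⟨ ∏-head i _ ⟩
      (1# + z * 1#) * ∏ i (λ m → 1# + z * (p * p ^ m))
        ≈⟨ *-cong (+-congˡ (*-identityʳ z)) (∏-cong i (λ m → +-congˡ (≈sym (*-assoc z p _)))) ⟩
      (1# + z) * B
        ≈⟨ ≈trans (distribʳ B 1# z) (+-cong (*-identityˡ B) (*-comm z B)) ⟩
      B + B * z
        ≈⟨ +-cong (q-binomial i (z * p) (suc M) (ℕₚ.m≤n⇒m≤1+n i<M))
                  (≈trans (*-congʳ (q-binomial i (z * p) M i<M)) (∑-*ʳ M _ z)) ⟩
      (1# * 1# + ∑ M (λ k → gauss i (suc k) * powTri (z * p) (suc k))) + ∑ M (λ k → gauss i k * powTri (z * p) k * z)
        ≈⟨ ≈trans (+-assoc _ _ _) (+-congˡ (∑-+ M _ _)) ⟩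
      1# * 1# + ∑ M (λ k → gauss i (suc k) * powTri (z * p) (suc k) + gauss i k * powTri (z * p) k * z)
        ≈⟨ +-congˡ (∑-cong M step) ⟩
      1# * 1# + ∑ M (λ k → gauss (suc i) (suc k) * powTri z (suc k)) ∎
      where
      B = ∏ i (λ m → 1# + z * p * p ^ m)
      step : ∀ k → gauss i (suc k) * powTri (z * p) (suc k) + gauss i k * powTri (z * p) k * z ≈ gauss (suc i) (suc k) * powTri z (suc k)
      step k = ≈trans (+-cong (*-congˡ (powTri-shift z (suc k))) (*-congʳ (*-congˡ (powTri-shift z k))))
        (solve 6 (λ g′ g P p t z → g′ :* (p :* P :* (t :* (z :* P))) :+ g :* (P :* t) :* z := (g :+ p :* P :* g′) :* (t :* (z :* P))) refl
          (gauss i (suc k)) (gauss i k) (p ^ k) p (powTri z k) z)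

  module _ (a b : Carrier) where

    private
      p : Carrier
      p = a * b

    -- The term a^(t(t+1)/2) b^(t(t-1)/2) of Ramanujan's theta function f(a, b). The two signs of t
    -- are separated because a and b have no inverses.
    mono : ℤ → Carrier
    mono (+ n)    = powTri p a n
    mono -[1+ n ] = powTri p b (suc n)

    mono-step : ∀ k j → mono (diff k j) * (b * p ^ j) ≈ p ^ k * mono (diff k (suc j))
    mono-step zero    zero    = ≈sym (*-identityˡ _)
    mono-step zero    (suc j) = ≈sym (*-identityˡ _)
    mono-step (suc k) zero    = ≈trans (*-congˡ (*-identityʳ b))
      (solve 4 (λ t a b P → t :* (a :* P) :* b := a :* b :* P :* t) refl (powTri p a k) a b (p ^ k))
    mono-step (suc k) (suc j) = begin
      mono (diff k j) * (b * (p * p ^ j))     ≈⟨ solve 4 (λ t b p P → t :* (b :* (p :* P)) := p :* (t :* (b :* P))) refl (mono (diff k j)) b p (p ^ j) ⟩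
      p * (mono (diff k j) * (b * p ^ j))     ≈⟨ *-congˡ (mono-step k j) ⟩
      p * (p ^ k * mono (diff k (suc j)))     ≈⟨ *-assoc _ _ _ ⟨
      p * p ^ k * mono (diff k (suc j)) ∎

    -- The usual proof substitutes z = a p^(-j) in the q-binomial theorem. Without an inverse of p
    -- the second product is built up by induction on j: by `mono-step` the new factor 1 + b p^j
    -- shifts the exponent and supplies the p^k of the q-Pascal rule.
    finite-triple-product : ∀ i j M → i ℕ.+ j ℕ.< M →
      ∏ i (λ m → 1# + a * p ^ m) * ∏ j (λ m → 1# + b * p ^ m) ≈ ∑ M (λ k → gauss p (i ℕ.+ j) k * mono (diff k j))
    finite-triple-product i zero M i<M rewrite ℕₚ.+-identityʳ i =
      ≈trans (*-identityʳ _) (q-binomial p i a M i<M)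
    finite-triple-product i (suc j) (suc M) i<M rewrite ℕₚ.+-suc i j = begin
      U * (V * (1# + b * p ^ j))
        ≈⟨ ≈trans (≈sym (*-assoc _ _ _)) (≈trans (distribˡ _ _ _) (+-congʳ (*-identityʳ _))) ⟩
      U * V + U * V * (b * p ^ j)
        ≈⟨ +-cong (finite-triple-product i j M (ℕ.s≤s⁻¹ i<M))
                  (≈trans (*-congʳ (finite-triple-product i j (suc M) (ℕₚ.m≤n⇒m≤1+n (ℕ.s≤s⁻¹ i<M)))) (∑-*ʳ (suc M) (λ k → gauss p n k * mono (diff k j)) (b * p ^ j))) ⟩
      ∑ M (λ k → gauss p n k * mono (diff k j)) + ∑ (suc M) (λ k → gauss p n k * mono (diff k j) * (b * p ^ j))
        ≈⟨ +-congˡ (∑-cong (suc M) (λ k → ≈trans (*-assoc (gauss p n k) _ _) (*-congˡ (mono-step k j)))) ⟩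
      ∑ M (λ k → gauss p n k * mono (diff k j)) + (1# * (1# * mono (diff 0 (suc j))) + ∑ M (λ k → gauss p n (suc k) * (p ^ suc k * mono (diff k j))))
        ≈⟨ solve 3 (λ x y z → x :+ (y :+ z) := y :+ (x :+ z)) refl _ _ _ ⟩
      1# * (1# * mono (diff 0 (suc j))) + (∑ M (λ k → gauss p n k * mono (diff k j)) + ∑ M (λ k → gauss p n (suc k) * (p ^ suc k * mono (diff k j))))
        ≈⟨ +-cong (*-congˡ (*-identityˡ _)) (≈trans (∑-+ M _ _) (∑-cong M λ k →
             solve 4 (λ g t h P → g :* t :+ h :* (P :* t) := (g :+ P :* h) :* t) refl (gauss p n k) (mono (diff k j)) (gauss p n (suc k)) (p ^ suc k))) ⟩
      1# * mono (diff 0 (suc j)) + ∑ M (λ k → gauss p (suc n) (suc k) * mono (diff k j)) ∎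
      where
      n = i ℕ.+ j
      U = ∏ i (λ m → 1# + a * p ^ m)
      V = ∏ j (λ m → 1# + b * p ^ m)

open ≡.≡-Reasoning
open import Data.Integer using (_+_; _-_; _*_; -_)

-- The ring ℤ[[q]]

infix 4 _≈_
record _≈_ (f g : Series) : Set where
  constructor pointwise
  field at : ∀ k → f k ≡ g k
open _≈_ public

tailS : Series → Series
tailS f k = f (suc k)

constS : ℤ → Series
constS z zero    = z
constS z (suc _) = + 0

infixl 6 _+S_
infixl 7 _*S_
infix 8 -S_

-- Opaque, so that products are not unfolded to convolutions when terms are compared; `*S-head` and
-- `*S-tail` are the interface to the coefficients.
opaque
  _+S_ : Series → Series → Series
  (f +S g) k = f k + g k

  -S_ : Series → Series
  (-S f) k = - f k

  _*S_ : Series → Series → Series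
  f *S g = f ⊛ g

  +S-at : ∀ f g k → (f +S g) k ≡ f k + g k
  +S-at f g k = refl

  -S-at : ∀ f k → (-S f) k ≡ - f k
  -S-at f k = refl

  *S-def : ∀ f g → f *S g ≈ f ⊛ g
  *S-def f g = pointwise λ _ → refl

  *S-head : ∀ f g → (f *S g) 0 ≡ f 0 * g 0
  *S-head f g = ℤₚ.+-identityʳ _

  -- Substitute f = f(0) + q · tail f. This is a recursion of the Cauchy product in the index, and
  -- the ring laws follow from it by induction on the coefficient k.
  *S-tail : ∀ f g k → (f *S g) (suc k) ≡ f 0 * g (suc k) + (tailS f *S g) k
  *S-tail f g k = cong (λ l → f 0 * g (suc k) + sumℤ l)
    (trans (Listₚ.map-applyUpTo suc (λ i → f i * g (suc k ∸ i)) (suc k))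
      (sym (Listₚ.map-upTo (λ i → f (suc i) * g (k ∸ i)) (suc k))))

private
  +-swap : ∀ a b c d → (a + b) + (c + d) ≡ (a + c) + (b + d)
  +-swap = solve-∀

*S-congᵏ : ∀ k {f f′ g g′} → (∀ i → i ℕ.≤ k → f i ≡ f′ i) → (∀ i → i ℕ.≤ k → g i ≡ g′ i) →
           (f *S g) k ≡ (f′ *S g′) k
*S-congᵏ zero {f} {f′} {g} {g′} p q =
  trans (*S-head f g) (trans (cong₂ _*_ (p 0 z≤n) (q 0 z≤n)) (sym (*S-head f′ g′)))
*S-congᵏ (suc k) {f} {f′} {g} {g′} p q =
  trans (*S-tail f g k) (trans
    (cong₂ _+_ (cong₂ _*_ (p 0 z≤n) (q (suc k) ℕₚ.≤-refl))
      (*S-congᵏ k (λ i l → p (suc i) (s≤s l)) (λ i l → q i (ℕₚ.m≤n⇒m≤1+n l))))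
    (sym (*S-tail f′ g′ k)))

private
  distribʳᵏ : ∀ k f g h → ((f +S g) *S h) k ≡ (f *S h) k + (g *S h) k
  distribʳᵏ zero f g h = begin
    ((f +S g) *S h) 0 ≡⟨ *S-head (f +S g) h ⟩
    (f +S g) 0 * h 0 ≡⟨ cong (_* h 0) (+S-at f g 0) ⟩
    (f 0 + g 0) * h 0 ≡⟨ ℤₚ.*-distribʳ-+ (h 0) (f 0) (g 0) ⟩
    f 0 * h 0 + g 0 * h 0 ≡⟨ cong₂ _+_ (*S-head f h) (*S-head g h) ⟨
    (f *S h) 0 + (g *S h) 0 ∎
  distribʳᵏ (suc k) f g h = begin
    ((f +S g) *S h) (suc k)
      ≡⟨ *S-tail (f +S g) h k ⟩
    (f +S g) 0 * h (suc k) + (tailS (f +S g) *S h) k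
      ≡⟨ cong₂ _+_ (trans (cong (_* h (suc k)) (+S-at f g 0)) (ℤₚ.*-distribʳ-+ (h (suc k)) (f 0) (g 0)))
           (trans (*S-congᵏ k {g = h} (λ i _ → trans (+S-at f g (suc i)) (sym (+S-at (tailS f) (tailS g) i))) (λ _ _ → refl))
                  (distribʳᵏ k (tailS f) (tailS g) h)) ⟩
    (f 0 * h (suc k) + g 0 * h (suc k)) + ((tailS f *S h) k + (tailS g *S h) k)
      ≡⟨ +-swap (f 0 * h (suc k)) (g 0 * h (suc k)) ((tailS f *S h) k) ((tailS g *S h) k) ⟩
    (f 0 * h (suc k) + (tailS f *S h) k) + (g 0 * h (suc k) + (tailS g *S h) k)
      ≡⟨ cong₂ _+_ (*S-tail f h k) (*S-tail g h k) ⟨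
    (f *S h) (suc k) + (g *S h) (suc k) ∎

scale : ℤ → Series → Series
scale z f k = z * f k

private
  scaleˡᵏ : ∀ k z f g → (scale z f *S g) k ≡ z * (f *S g) k
  scaleˡᵏ zero z f g = trans (*S-head (scale z f) g)
    (trans (ℤₚ.*-assoc z (f 0) (g 0)) (cong (z *_) (sym (*S-head f g))))
  scaleˡᵏ (suc k) z f g = begin
    (scale z f *S g) (suc k) ≡⟨ *S-tail (scale z f) g k ⟩
    z * f 0 * g (suc k) + (scale z (tailS f) *S g) k
      ≡⟨ cong₂ _+_ (ℤₚ.*-assoc z (f 0) (g (suc k))) (scaleˡᵏ k z (tailS f) g) ⟩
    z * (f 0 * g (suc k)) + z * (tailS f *S g) k ≡⟨ ℤₚ.*-distribˡ-+ z _ _ ⟨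
    z * (f 0 * g (suc k) + (tailS f *S g) k) ≡⟨ cong (z *_) (*S-tail f g k) ⟨
    z * (f *S g) (suc k) ∎

  *S-tail′ : ∀ k f g → (f *S g) (suc k) ≡ f (suc k) * g 0 + (f *S tailS g) k
  *S-tail′ zero f g = begin
    (f *S g) 1 ≡⟨ *S-tail f g 0 ⟩
    f 0 * g 1 + (tailS f *S g) 0 ≡⟨ cong (λ t → f 0 * g 1 + t) (*S-head (tailS f) g) ⟩
    f 0 * g 1 + f 1 * g 0 ≡⟨ ℤₚ.+-comm (f 0 * g 1) _ ⟩
    f 1 * g 0 + f 0 * g 1 ≡⟨ cong (λ t → f 1 * g 0 + t) (*S-head f (tailS g)) ⟨
    f 1 * g 0 + (f *S tailS g) 0 ∎
  *S-tail′ (suc k) f g = begin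
    (f *S g) (suc (suc k))
      ≡⟨ *S-tail f g (suc k) ⟩
    f 0 * g (suc (suc k)) + (tailS f *S g) (suc k)
      ≡⟨ cong (λ t → f 0 * g (suc (suc k)) + t) (*S-tail′ k (tailS f) g) ⟩
    f 0 * g (suc (suc k)) + (f (suc (suc k)) * g 0 + (tailS f *S tailS g) k)
      ≡⟨ rot (f 0 * g (suc (suc k))) (f (suc (suc k)) * g 0) ((tailS f *S tailS g) k) ⟩
    f (suc (suc k)) * g 0 + (f 0 * g (suc (suc k)) + (tailS f *S tailS g) k)
      ≡⟨ cong (λ t → f (suc (suc k)) * g 0 + t) (*S-tail f (tailS g) k) ⟨
    f (suc (suc k)) * g 0 + (f *S tailS g) (suc k) ∎
    where
    rot : ∀ a b c → a + (b + c) ≡ b + (a + c)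
    rot = solve-∀

  commᵏ : ∀ k f g → (f *S g) k ≡ (g *S f) k
  commᵏ zero f g = trans (*S-head f g) (trans (ℤₚ.*-comm (f 0) (g 0)) (sym (*S-head g f)))
  commᵏ (suc k) f g = begin
    (f *S g) (suc k) ≡⟨ *S-tail f g k ⟩
    f 0 * g (suc k) + (tailS f *S g) k ≡⟨ cong₂ _+_ (ℤₚ.*-comm (f 0) _) (commᵏ k (tailS f) g) ⟩
    g (suc k) * f 0 + (g *S tailS f) k ≡⟨ *S-tail′ k g f ⟨
    (g *S f) (suc k) ∎

  assocᵏ : ∀ k f g h → ((f *S g) *S h) k ≡ (f *S (g *S h)) k
  assocᵏ zero f g h = begin
    ((f *S g) *S h) 0 ≡⟨ *S-head (f *S g) h ⟩
    (f *S g) 0 * h 0 ≡⟨ cong (_* h 0) (*S-head f g) ⟩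
    f 0 * g 0 * h 0 ≡⟨ ℤₚ.*-assoc (f 0) (g 0) (h 0) ⟩
    f 0 * (g 0 * h 0) ≡⟨ cong (f 0 *_) (*S-head g h) ⟨
    f 0 * (g *S h) 0 ≡⟨ *S-head f (g *S h) ⟨
    (f *S (g *S h)) 0 ∎
  assocᵏ (suc k) f g h = begin
    ((f *S g) *S h) (suc k)
      ≡⟨ *S-tail (f *S g) h k ⟩
    (f *S g) 0 * h (suc k) + (tailS (f *S g) *S h) k
      ≡⟨ cong₂ _+_ (cong (_* h (suc k)) (*S-head f g))
           (*S-congᵏ k {g = h} (λ i _ → trans (*S-tail f g i) (sym (+S-at (scale (f 0) (tailS g)) (tailS f *S g) i))) (λ _ _ → refl)) ⟩
    f 0 * g 0 * h (suc k) + ((scale (f 0) (tailS g) +S (tailS f *S g)) *S h) k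
      ≡⟨ cong (λ t → f 0 * g 0 * h (suc k) + t) (distribʳᵏ k (scale (f 0) (tailS g)) (tailS f *S g) h) ⟩
    f 0 * g 0 * h (suc k) + ((scale (f 0) (tailS g) *S h) k + ((tailS f *S g) *S h) k)
      ≡⟨ cong (λ t → f 0 * g 0 * h (suc k) + t) (cong₂ _+_ (scaleˡᵏ k (f 0) (tailS g) h) (assocᵏ k (tailS f) g h)) ⟩
    f 0 * g 0 * h (suc k) + (f 0 * (tailS g *S h) k + (tailS f *S (g *S h)) k)
      ≡⟨ collect (f 0) (g 0) (h (suc k)) ((tailS g *S h) k) ((tailS f *S (g *S h)) k) ⟩
    f 0 * (g 0 * h (suc k) + (tailS g *S h) k) + (tailS f *S (g *S h)) k
      ≡⟨ cong (λ t → f 0 * t + (tailS f *S (g *S h)) k) (*S-tail g h k) ⟨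
    f 0 * (g *S h) (suc k) + (tailS f *S (g *S h)) k
      ≡⟨ *S-tail f (g *S h) k ⟨
    (f *S (g *S h)) (suc k) ∎
    where
    collect : ∀ a b c d e → a * b * c + (a * d + e) ≡ a * (b * c + d) + e
    collect = solve-∀

  zeroˡᵏ : ∀ k g → (constS (+ 0) *S g) k ≡ + 0
  zeroˡᵏ zero g = *S-head (constS (+ 0)) g
  zeroˡᵏ (suc k) g = trans (*S-tail (constS (+ 0)) g k) (trans (ℤₚ.+-identityˡ _)
    (trans (*S-congᵏ k {f′ = constS (+ 0)} {g = g} (λ { zero _ → refl ; (suc _) _ → refl }) (λ _ _ → refl)) (zeroˡᵏ k g)))

constS-*ᵏ : ∀ k z g → (constS z *S g) k ≡ z * g k
constS-*ᵏ zero z g = *S-head (constS z) g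
constS-*ᵏ (suc k) z g = trans (*S-tail (constS z) g k) (trans (cong (λ t → z * g (suc k) + t)
  (trans (*S-congᵏ k {f′ = constS (+ 0)} {g = g} (λ { zero _ → refl ; (suc _) _ → refl }) (λ _ _ → refl)) (zeroˡᵏ k g)))
  (ℤₚ.+-identityʳ _))

seriesRing : CommutativeRing _ _
seriesRing = record
  { Carrier = Series ; _≈_ = _≈_ ; _+_ = _+S_ ; _*_ = _*S_ ; -_ = -S_ ; 0# = constS (+ 0) ; 1# = constS (+ 1)
  ; isCommutativeRing = record
    { isRing = record
      { +-isAbelianGroup = record
        { isGroup = record
          { isMonoid = record
            { isSemigroup = record
              { isMagma = record
                { isEquivalence = record
                  { refl = pointwise λ _ → refl
                  ; sym = λ p → pointwise λ k → sym (at p k)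
                  ; trans = λ p q → pointwise λ k → trans (at p k) (at q k) }
                ; ∙-cong = λ {f} {g} {h} {i} p q → pointwise λ k →
                    trans (+S-at f h k) (trans (cong₂ _+_ (at p k) (at q k)) (sym (+S-at g i k))) }
              ; assoc = λ f g h → pointwise λ k → begin
                  ((f +S g) +S h) k ≡⟨ trans (+S-at (f +S g) h k) (cong (_+ h k) (+S-at f g k)) ⟩
                  f k + g k + h k ≡⟨ ℤₚ.+-assoc (f k) (g k) (h k) ⟩
                  f k + (g k + h k) ≡⟨ trans (+S-at f (g +S h) k) (cong (λ t → f k + t) (+S-at g h k)) ⟨
                  (f +S (g +S h)) k ∎ }
            ; identity = (λ f → pointwise λ k → trans (+S-at (constS (+ 0)) f k) (trans (cong (_+ f k) (zero-at k)) (ℤₚ.+-identityˡ _)))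
                       , (λ f → pointwise λ k → trans (+S-at f (constS (+ 0)) k) (trans (cong (λ t → f k + t) (zero-at k)) (ℤₚ.+-identityʳ _))) }
          ; inverse = (λ f → pointwise λ k → trans (+S-at (-S f) f k) (trans (cong (_+ f k) (-S-at f k)) (trans (ℤₚ.+-inverseˡ (f k)) (sym (zero-at k)))))
                    , (λ f → pointwise λ k → trans (+S-at f (-S f) k) (trans (cong (λ t → f k + t) (-S-at f k)) (trans (ℤₚ.+-inverseʳ (f k)) (sym (zero-at k)))))
          ; ⁻¹-cong = λ {f} {g} p → pointwise λ k → trans (-S-at f k) (trans (cong -_ (at p k)) (sym (-S-at g k))) }
        ; comm = λ f g → pointwise λ k → trans (+S-at f g k) (trans (ℤₚ.+-comm (f k) (g k)) (sym (+S-at g f k))) }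
      ; *-cong = λ p q → pointwise λ k → *S-congᵏ k (λ i _ → at p i) (λ i _ → at q i)
      ; *-assoc = λ f g h → pointwise λ k → assocᵏ k f g h
      ; *-identity = idˡ , (λ f → pointwise λ k → trans (commᵏ k f (constS (+ 1))) (at (idˡ f) k))
      ; distrib = (λ f g h → pointwise λ k → begin
                      (f *S (g +S h)) k ≡⟨ commᵏ k f (g +S h) ⟩
                      ((g +S h) *S f) k ≡⟨ distribʳᵏ k g h f ⟩
                      (g *S f) k + (h *S f) k ≡⟨ cong₂ _+_ (commᵏ k g f) (commᵏ k h f) ⟩
                      (f *S g) k + (f *S h) k ≡⟨ +S-at (f *S g) (f *S h) k ⟨
                      (f *S g +S f *S h) k ∎)
                , (λ f g h → pointwise λ k → trans (distribʳᵏ k g h f) (sym (+S-at (g *S f) (h *S f) k)))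
      }
    ; *-comm = λ f g → pointwise λ k → commᵏ k f g }
  }
  where
  zero-at : ∀ k → constS (+ 0) k ≡ + 0
  zero-at zero    = refl
  zero-at (suc k) = refl
  idˡ : ∀ f → constS (+ 1) *S f ≈ f
  idˡ f = pointwise λ k → trans (constS-*ᵏ k (+ 1) f) (ℤₚ.*-identityˡ (f k))

open CommutativeRing seriesRing public using (setoid; +-cong; +-congˡ; +-congʳ; *-cong; *-congˡ; *-congʳ; -‿cong)
  renaming (refl to ≈-refl; sym to ≈-sym; trans to ≈-trans; *-comm to *S-comm; *-assoc to *S-assoc; *-identityˡ to *S-identityˡ; *-identityʳ to *S-identityʳ;
            +-identityˡ to +S-identityˡ; +-identityʳ to +S-identityʳ; distribˡ to *S-distribˡ; distribʳ to *S-distribʳ; zeroˡ to *S-zeroˡ; zeroʳ to *S-zeroʳ)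

constS-+ : ∀ x y → constS (x + y) ≈ constS x +S constS y
constS-+ x y = pointwise λ { zero → sym (+S-at (constS x) (constS y) 0) ; (suc k) → sym (+S-at (constS x) (constS y) (suc k)) }

constS-* : ∀ x y → constS (x * y) ≈ constS x *S constS y
constS-* x y = pointwise λ { zero → sym (constS-*ᵏ 0 x (constS y)) ; (suc k) → sym (trans (constS-*ᵏ (suc k) x (constS y)) (ℤₚ.*-zeroʳ x)) }

seriesAlgebra : ℤ-Algebra
seriesAlgebra = record { commutativeRing = seriesRing ; ι = constS ; ι-+ = constS-+ ; ι-* = constS-* ; ι-0 = ≈-refl ; ι-1 = ≈-refl }

open PolySolver seriesAlgebra public hiding (-‿zero⇒≈)

open FiniteTripleProduct seriesAlgebra public

constS-zero : ∀ k → constS (+ 0) k ≡ + 0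
constS-zero zero    = refl
constS-zero (suc k) = refl

-- Powers of q, congruence modulo q^N, cancellation

shiftS : ℕ → Series → Series
shiftS zero    f n       = f n
shiftS (suc e) f zero    = + 0
shiftS (suc e) f (suc n) = shiftS e f n

qpow : ℕ → Series
qpow zero            = constS (+ 1)
qpow (suc e) zero    = + 0
qpow (suc e) (suc n) = qpow e n

qpow-*-shift : ∀ e f → qpow e *S f ≈ shiftS e f
qpow-*-shift e f = pointwise (go e)
  where
  go : ∀ e k → (qpow e *S f) k ≡ shiftS e f k
  go zero    k       = at (*S-identityˡ f) k
  go (suc e) zero    = *S-head (qpow (suc e)) f
  go (suc e) (suc k) = trans (*S-tail (qpow (suc e)) f k) (trans (ℤₚ.+-identityˡ _) (go e k))

shiftS-at : ∀ e f n → shiftS e f (e ℕ.+ n) ≡ f n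
shiftS-at zero    f n = refl
shiftS-at (suc e) f n = shiftS-at e f n

shiftS-< : ∀ e f n → n ℕ.< e → shiftS e f n ≡ + 0
shiftS-< (suc e) f zero    _       = refl
shiftS-< (suc e) f (suc n) (s≤s l) = shiftS-< e f n l

qpow-+ : ∀ a b → qpow a *S qpow b ≈ qpow (a ℕ.+ b)
qpow-+ a b = ≈-trans (qpow-*-shift a (qpow b)) (pointwise (go a))
  where
  go : ∀ a k → shiftS a (qpow b) k ≡ qpow (a ℕ.+ b) k
  go zero    k       = refl
  go (suc a) zero    = refl
  go (suc a) (suc k) = go a k

qpow-^ : ∀ a n → qpow a ^ n ≈ qpow (n ℕ.* a)
qpow-^ a zero    = ≈-refl
qpow-^ a (suc n) = ≈-trans (*-congˡ (qpow-^ a n)) (qpow-+ a (n ℕ.* a))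

infix 4 _≈[_]_
-- Congruence modulo q^N. Limits are expressed only by such congruences for all N.
record _≈[_]_ (f : Series) (N : ℕ) (g : Series) : Set where
  constructor below
  field at< : ∀ k → k ℕ.< N → f k ≡ g k
open _≈[_]_ public

≈⇒≈[] : ∀ {N f g} → f ≈ g → f ≈[ N ] g
≈⇒≈[] p = below λ k _ → at p k

≈[]⇒≈ : ∀ {f g} → (∀ N → f ≈[ N ] g) → f ≈ g
≈[]⇒≈ p = pointwise λ k → at< (p (suc k)) k ℕₚ.≤-refl

modSetoid : ℕ → Setoid _ _
modSetoid N = record
  { Carrier = Series ; _≈_ = _≈[ N ]_
  ; isEquivalence = record
    { refl = below λ _ _ → refl
    ; sym = λ p → below λ k l → sym (at< p k l)
    ; trans = λ p q → below λ k l → trans (at< p k l) (at< q k l) } }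

module Mod {N} = Setoid (modSetoid N) renaming (refl to ≈[]-refl; sym to ≈[]-sym; trans to ≈[]-trans) hiding (Carrier; _≈_; isEquivalence)
open Mod public using (≈[]-refl; ≈[]-sym; ≈[]-trans)

≈[]-weaken : ∀ {M N f g} → M ℕ.≤ N → f ≈[ N ] g → f ≈[ M ] g
≈[]-weaken l p = below λ k k<M → at< p k (ℕₚ.≤-trans k<M l)

+-cong[] : ∀ {N f f′ g g′} → f ≈[ N ] f′ → g ≈[ N ] g′ → f +S g ≈[ N ] f′ +S g′
+-cong[] {f = f} {f′} {g} {g′} p q = below λ k l →
  trans (+S-at f g k) (trans (cong₂ _+_ (at< p k l) (at< q k l)) (sym (+S-at f′ g′ k)))

*-cong[] : ∀ {N f f′ g g′} → f ≈[ N ] f′ → g ≈[ N ] g′ → f *S g ≈[ N ] f′ *S g′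
*-cong[] p q = below λ k l → *S-congᵏ k (λ i i≤k → at< p i (ℕₚ.≤-<-trans i≤k l)) (λ i i≤k → at< q i (ℕₚ.≤-<-trans i≤k l))

qpow-cong[] : ∀ e {N f g} → f ≈[ N ] g → qpow e *S f ≈[ e ℕ.+ N ] qpow e *S g
qpow-cong[] e {N} {f} {g} p = ≈[]-trans (≈⇒≈[] (qpow-*-shift e f)) (≈[]-trans (below (go e)) (≈⇒≈[] (≈-sym (qpow-*-shift e g))))
  where
  go : ∀ e k → k ℕ.< e ℕ.+ N → shiftS e f k ≡ shiftS e g k
  go zero    k       l       = at< p k l
  go (suc e) zero    l       = refl
  go (suc e) (suc k) (s≤s l) = go e k l

qpow-small : ∀ e → qpow e ≈[ e ] constS (+ 0)
qpow-small e = below λ k l → trans (at (≈-sym (*S-identityʳ (qpow e))) k)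
  (trans (at (qpow-*-shift e (constS (+ 1))) k) (trans (shiftS-< e (constS (+ 1)) k l) (sym (constS-zero k))))

*S-leading : ∀ c h n → (∀ i → i ℕ.< n → h i ≡ + 0) → (c *S h) n ≡ c 0 * h n
*S-leading c h zero    z = *S-head c h
*S-leading c h (suc n) z = trans (*S-tail c h n) (trans (cong (λ t → c 0 * h (suc n) + t)
  (trans (*S-congᵏ n {f = tailS c} {g′ = constS (+ 0)} (λ _ _ → refl) (λ i l → trans (z i (s≤s l)) (sym (constS-zero i))))
    (trans (at (*S-zeroʳ (tailS c)) n) (constS-zero n)))) (ℤₚ.+-identityʳ _))

-- Once the coefficients of h below n are known to vanish, the n-th coefficient of the product is
-- c(0) h(n), and ℤ has no zero divisors.
unit-cancel-zero : ∀ c h → c 0 ≢ + 0 → c *S h ≈ constS (+ 0) → h ≈ constS (+ 0)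
unit-cancel-zero c h c≢0 ch≈0 = pointwise λ n → trans (<-rec (λ n → h n ≡ + 0) step n) (sym (constS-zero n))
  where
  step : ∀ n → (∀ {i} → i ℕ.< n → h i ≡ + 0) → h n ≡ + 0
  step n rec with ℤₚ.i*j≡0⇒i≡0∨j≡0 (c 0) (trans (sym (*S-leading c h n (λ i → rec))) (trans (at ch≈0 n) (constS-zero n)))
  ... | inj₁ p = ⊥-elim (c≢0 p)
  ... | inj₂ p = p

qpow-cancel-zero : ∀ e h → qpow e *S h ≈ constS (+ 0) → h ≈ constS (+ 0)
qpow-cancel-zero e h p = pointwise λ n → begin
  h n ≡⟨ shiftS-at e h n ⟨
  shiftS e h (e ℕ.+ n) ≡⟨ at (qpow-*-shift e h) (e ℕ.+ n) ⟨
  (qpow e *S h) (e ℕ.+ n) ≡⟨ at p (e ℕ.+ n) ⟩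
  constS (+ 0) (e ℕ.+ n) ≡⟨ trans (constS-zero (e ℕ.+ n)) (sym (constS-zero n)) ⟩
  constS (+ 0) n ∎

≈⇒-≈0 : ∀ {f g} → f ≈ g → f +S -S g ≈ constS (+ 0)
≈⇒-≈0 {f} {g} p = ≈-trans (+-congʳ p) (solve 1 (λ g → g :- g := con (+ 0)) refl g)

-≈0⇒≈ : ∀ {f g} → f +S -S g ≈ constS (+ 0) → f ≈ g
-≈0⇒≈ {f} {g} p = ≈-trans (solve 2 (λ f g → f := (f :- g) :+ g) refl f g) (≈-trans (+-congʳ p) (+S-identityˡ g))

unit-cancel : ∀ {c f g} → c 0 ≢ + 0 → c *S f ≈ c *S g → f ≈ g
unit-cancel {c} {f} {g} c≢0 p = -≈0⇒≈ (unit-cancel-zero c (f +S -S g) c≢0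
  (≈-trans (solve 3 (λ c f g → c :* (f :- g) := c :* f :- c :* g) refl c f g) (≈⇒-≈0 p)))

-- The substitutions q ↦ -q and q ↦ q^k

sgn : ℕ → ℤ
sgn zero    = + 1
sgn (suc n) = - sgn n

alt : Series → Series
alt f n = sgn n * f n

alt-cong : ∀ {f g} → f ≈ g → alt f ≈ alt g
alt-cong p = pointwise λ k → cong (sgn k *_) (at p k)

alt-+ : ∀ f g → alt (f +S g) ≈ alt f +S alt g
alt-+ f g = pointwise λ k → trans (cong (sgn k *_) (+S-at f g k))
  (trans (ℤₚ.*-distribˡ-+ (sgn k) (f k) (g k)) (sym (+S-at (alt f) (alt g) k)))

alt-neg : ∀ f → alt (-S f) ≈ -S alt f
alt-neg f = pointwise λ k → trans (cong (sgn k *_) (-S-at f k))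
  (trans (sym (ℤₚ.neg-distribʳ-* (sgn k) (f k))) (sym (-S-at (alt f) k)))

alt-const : ∀ z → alt (constS z) ≈ constS z
alt-const z = pointwise λ { zero → ℤₚ.*-identityˡ z ; (suc k) → ℤₚ.*-zeroʳ (sgn (suc k)) }

alt-tail : ∀ f → tailS (alt f) ≈ -S alt (tailS f)
alt-tail f = pointwise λ k → trans (sym (ℤₚ.neg-distribˡ-* (sgn k) (f (suc k)))) (sym (-S-at (alt (tailS f)) k))

alt-* : ∀ f g → alt (f *S g) ≈ alt f *S alt g
alt-* f g = pointwise λ k → go k f
  where
  head : ∀ s x y → s * (+ 1 * x * y) ≡ + 1 * x * (s * y)
  head s x y = trans (cong (λ t → s * (t * y)) (ℤₚ.*-identityˡ x)) (trans (trans (sym (ℤₚ.*-assoc s x y))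
    (trans (cong (_* y) (ℤₚ.*-comm s x)) (ℤₚ.*-assoc x s y))) (cong (λ t → t * (s * y)) (sym (ℤₚ.*-identityˡ x))))
  go : ∀ k f → alt (f *S g) k ≡ (alt f *S alt g) k
  go zero f = begin
    + 1 * (f *S g) 0 ≡⟨ trans (ℤₚ.*-identityˡ _) (*S-head f g) ⟩
    f 0 * g 0 ≡⟨ cong₂ _*_ (ℤₚ.*-identityˡ (f 0)) (ℤₚ.*-identityˡ (g 0)) ⟨
    alt f 0 * alt g 0 ≡⟨ *S-head (alt f) (alt g) ⟨
    (alt f *S alt g) 0 ∎
  go (suc k) f = begin
    sgn (suc k) * (f *S g) (suc k)
      ≡⟨ cong (sgn (suc k) *_) (*S-tail f g k) ⟩
    sgn (suc k) * (f 0 * g (suc k) + (tailS f *S g) k)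
      ≡⟨ ℤₚ.*-distribˡ-+ (sgn (suc k)) _ _ ⟩
    sgn (suc k) * (f 0 * g (suc k)) + (- sgn k) * (tailS f *S g) k
      ≡⟨ cong₂ _+_ (trans (cong (λ t → sgn (suc k) * (t * g (suc k))) (sym (ℤₚ.*-identityˡ (f 0)))) (head (sgn (suc k)) (f 0) (g (suc k))))
           (trans (sym (ℤₚ.neg-distribˡ-* (sgn k) _)) (cong -_ (go k (tailS f)))) ⟩
    alt f 0 * alt g (suc k) + - (alt (tailS f) *S alt g) k
      ≡⟨ cong (λ t → alt f 0 * alt g (suc k) + t) (trans (sym (-S-at (alt (tailS f) *S alt g) k))
           (at (≈-trans (solve 2 (λ x y → :- (x :* y) := (:- x) :* y) refl (alt (tailS f)) (alt g)) (*-congʳ (≈-sym (alt-tail f)))) k)) ⟩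
    alt f 0 * alt g (suc k) + (tailS (alt f) *S alt g) k
      ≡⟨ *S-tail (alt f) (alt g) k ⟨
    (alt f *S alt g) (suc k) ∎

sgn² : ∀ n → sgn n * sgn n ≡ + 1
sgn² zero    = refl
sgn² (suc n) = trans (sym (ℤₚ.neg-distribˡ-* (sgn n) (- sgn n))) (trans (cong -_ (sym (ℤₚ.neg-distribʳ-* (sgn n) (sgn n)))) (trans (ℤₚ.neg-involutive _) (sgn² n)))

alt-alt : ∀ f → alt (alt f) ≈ f
alt-alt f = pointwise λ k → trans (sym (ℤₚ.*-assoc (sgn k) (sgn k) (f k))) (trans (cong (_* f k) (sgn² k)) (ℤₚ.*-identityˡ (f k)))

alt-qpow : ∀ e → alt (qpow e) ≈ constS (sgn e) *S qpow e
alt-qpow e = pointwise λ k → trans (go e k) (sym (constS-*ᵏ k (sgn e) (qpow e)))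
  where
  go : ∀ e k → sgn k * qpow e k ≡ sgn e * qpow e k
  go zero    zero    = refl
  go zero    (suc k) = ℤₚ.*-zeroʳ (sgn (suc k))
  go (suc e) zero    = sym (ℤₚ.*-zeroʳ (sgn (suc e)))
  go (suc e) (suc k) = trans (sym (ℤₚ.neg-distribˡ-* (sgn k) (qpow e k))) (trans (cong -_ (go e k)) (ℤₚ.neg-distribˡ-* (sgn e) (qpow e k)))

-- dil k f is f(qᵏ); the counter c runs over the zero coefficients between multiples of k.
private
  dilAux : ℕ → ℕ → Series → Series
  dilAux k zero    f zero    = f 0
  dilAux k zero    f (suc n) = dilAux k k (tailS f) n
  dilAux k (suc c) f zero    = + 0
  dilAux k (suc c) f (suc n) = dilAux k c f n

dil : (k : ℕ) → .{{NonZero k}} → Series → Series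
dil (suc k) f = dilAux k 0 f

-- f = f(0) + q · tail f, taken at q^k. In this form `qpow-induction` applies: operations obeying
-- the same recursion behind q^k agree.
dil-unfold : ∀ k .{{_ : NonZero k}} f → dil k f ≈ constS (f 0) +S qpow k *S dil k (tailS f)
dil-unfold (suc k) f = pointwise λ n → trans (go n) (trans (cong (λ t → constS (f 0) n + t) (sym (at (qpow-*-shift (suc k) (dilAux k 0 (tailS f))) n)))
    (sym (+S-at (constS (f 0)) (qpow (suc k) *S dilAux k 0 (tailS f)) n)))
  where
  aux : ∀ c n g → dilAux k c g n ≡ shiftS c (dilAux k 0 g) n
  aux zero    n       g = refl
  aux (suc c) zero    g = refl
  aux (suc c) (suc n) g = aux c n g
  go : ∀ n → dilAux k 0 f n ≡ constS (f 0) n + shiftS (suc k) (dilAux k 0 (tailS f)) n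
  go zero    = sym (ℤₚ.+-identityʳ (f 0))
  go (suc n) = trans (aux k n (tailS f)) (sym (ℤₚ.+-identityˡ _))

dil-cong : ∀ k .{{_ : NonZero k}} {f g} → f ≈ g → dil k f ≈ dil k g
dil-cong (suc k) p = pointwise λ n → go 0 n p
  where
  go : ∀ c n {f g} → f ≈ g → dilAux k c f n ≡ dilAux k c g n
  go zero    zero    p = at p 0
  go zero    (suc n) p = go k n (pointwise λ i → at p (suc i))
  go (suc c) zero    p = refl
  go (suc c) (suc n) p = go c n p

dil-cong[] : ∀ k .{{_ : NonZero k}} {N f g} → f ≈[ N ] g → dil k f ≈[ N ] dil k g
dil-cong[] (suc k) p = below λ n l → go 0 n (λ i i≤n → at< p i (ℕₚ.≤-<-trans i≤n l))
  where
  go : ∀ c n {f g : Series} → (∀ i → i ℕ.≤ n → f i ≡ g i) → dilAux k c f n ≡ dilAux k c g n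
  go zero    zero    p = p 0 z≤n
  go zero    (suc n) p = go k n (λ i l → p (suc i) (s≤s l))
  go (suc c) zero    p = refl
  go (suc c) (suc n) p = go c n (λ i l → p i (ℕₚ.m≤n⇒m≤1+n l))

private
  -- A family of equations indexed by D whose right-hand sides refer to each other only behind qᵏ has a unique solution.
  qpow-induction : ∀ {D : Set} k .{{_ : NonZero k}} (F G : D → Series) (a : D → Series) (s : Series) (next : D → D) →
    (∀ d → F d ≈ a d +S s *S (qpow k *S F (next d))) → (∀ d → G d ≈ a d +S s *S (qpow k *S G (next d))) → ∀ d → F d ≈ G d
  qpow-induction (suc k) F G a s next pF pG d = ≈[]⇒≈ λ N → go N d
    where
    go : ∀ N d → F d ≈[ N ] G d
    go zero    d = below λ _ ()
    go (suc N) d = ≈[]-trans (≈⇒≈[] (pF d)) (≈[]-trans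
      (+-cong[] ≈[]-refl (*-cong[] ≈[]-refl (≈[]-weaken (s≤s (ℕₚ.m≤n+m N k)) (qpow-cong[] (suc k) (go N (next d))))))
      (≈⇒≈[] (≈-sym (pG d))))

dil-+ : ∀ k .{{_ : NonZero k}} f g → dil k (f +S g) ≈ dil k f +S dil k g
dil-+ k f g = qpow-induction k (λ d → dil k (proj₁ d +S proj₂ d)) (λ d → dil k (proj₁ d) +S dil k (proj₂ d))
  (λ d → constS (proj₁ d 0 + proj₂ d 0)) (constS (+ 1)) (λ d → tailS (proj₁ d) , tailS (proj₂ d))
  (λ d → ≈-trans (dil-unfold k (proj₁ d +S proj₂ d)) (+-cong (pointwise λ j → cong (λ z → constS z j) (+S-at (proj₁ d) (proj₂ d) 0))
    (≈-trans (*-congˡ (dil-cong k (pointwise λ i → trans (+S-at (proj₁ d) (proj₂ d) (suc i)) (sym (+S-at (tailS (proj₁ d)) (tailS (proj₂ d)) i)))))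
      (≈-sym (*S-identityˡ _)))))
  (λ d → ≈-trans (+-cong (dil-unfold k (proj₁ d)) (dil-unfold k (proj₂ d)))
    (≈-trans (solve 5 (λ x y q u v → (x :+ q :* u) :+ (y :+ q :* v) := (x :+ y) :+ con (+ 1) :* (q :* (u :+ v))) refl _ _ _ _ _)
      (+-congʳ (≈-sym (constS-+ (proj₁ d 0) (proj₂ d 0)))))) (f , g)

dil-* : ∀ k .{{_ : NonZero k}} f g → dil k (f *S g) ≈ dil k f *S dil k g
dil-* k f g = qpow-induction k (λ f → dil k (f *S g)) (λ f → dil k f *S dil k g)
  (λ f → constS (f 0) *S dil k g) (constS (+ 1)) tailS
  (λ f → ≈-trans (dil-unfold k (f *S g)) (≈-trans (+-congˡ (*-congˡ (≈-trans (dil-cong k (tail-* f)) (dil-+ k _ _))))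
     (≈-trans (+-cong (pointwise λ j → trans (cong (λ z → constS z j) (*S-head f g)) (at (constS-* (f 0) (g 0)) j)) (*-congˡ (+-congʳ (dil-scale (f 0) (tailS g)))))
     (≈-trans (solve 5 (λ x y q t u → x :* y :+ q :* (x :* t :+ u) := x :* (y :+ q :* t) :+ con (+ 1) :* (q :* u)) refl
        (constS (f 0)) (constS (g 0)) (qpow k) (dil k (tailS g)) (dil k (tailS f *S g)))
       (+-congʳ (*-congˡ (≈-sym (dil-unfold k g))))))))
  (λ f → ≈-trans (*-congʳ (dil-unfold k f))
     (solve 4 (λ x q t d → (x :+ q :* t) :* d := x :* d :+ con (+ 1) :* (q :* (t :* d))) refl (constS (f 0)) (qpow k) (dil k (tailS f)) (dil k g))) f
  where
  tail-* : ∀ f → tailS (f *S g) ≈ constS (f 0) *S tailS g +S tailS f *S g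
  tail-* f = pointwise λ i → trans (*S-tail f g i) (trans (cong (_+ (tailS f *S g) i) (sym (constS-*ᵏ i (f 0) (tailS g))))
    (sym (+S-at (constS (f 0) *S tailS g) (tailS f *S g) i)))
  dil-scale : ∀ z h → dil k (constS z *S h) ≈ constS z *S dil k h
  dil-scale z h = qpow-induction k (λ h → dil k (constS z *S h)) (λ h → constS z *S dil k h) (λ h → constS (z * h 0)) (constS (+ 1)) tailS
    (λ h → ≈-trans (dil-unfold k (constS z *S h)) (+-cong (pointwise λ j → cong (λ t → constS t j) (*S-head (constS z) h))
      (≈-trans (*-congˡ (dil-cong k (pointwise λ i → trans (constS-*ᵏ (suc i) z h) (sym (constS-*ᵏ i z (tailS h)))))) (≈-sym (*S-identityˡ _)))))
    (λ h → ≈-trans (*-congˡ (dil-unfold k h)) (≈-trans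
      (solve 4 (λ z x q t → z :* (x :+ q :* t) := z :* x :+ con (+ 1) :* (q :* (z :* t))) refl _ _ _ _)
      (+-congʳ (≈-sym (constS-* z (h 0)))))) h

dil-const : ∀ k .{{_ : NonZero k}} z → dil k (constS z) ≈ constS z
dil-const k z = ≈-trans (dil-unfold k (constS z)) (≈-trans (+-congˡ (≈-trans (*-congˡ zero-dil) (*S-zeroʳ (qpow k)))) (+S-identityʳ (constS z)))
  where
  zero-dil : dil k (tailS (constS z)) ≈ constS (+ 0)
  zero-dil = qpow-induction k (λ n → dil k (λ _ → + 0)) (λ n → constS (+ 0)) (λ n → constS (+ 0)) (constS (+ 1)) (λ n → n)
    (λ _ → ≈-trans (dil-unfold k (λ _ → + 0)) (+-congˡ (≈-sym (*S-identityˡ _))))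
    (λ _ → solve 1 (λ q → con (+ 0) := con (+ 0) :+ con (+ 1) :* (q :* con (+ 0))) refl (qpow k)) 0

dil-neg : ∀ k .{{_ : NonZero k}} f → dil k (-S f) ≈ -S dil k f
dil-neg k f = ≈-trans (dil-cong k (solve 1 (λ f → :- f := con (- + 1) :* f) refl f))
  (≈-trans (dil-* k (constS (- + 1)) f) (≈-trans (*-congʳ (dil-const k (- + 1))) (solve 1 (λ f → con (- + 1) :* f := :- f) refl (dil k f))))

dil-qpow : ∀ k .{{_ : NonZero k}} e → dil k (qpow e) ≈ qpow (k ℕ.* e)
dil-qpow k zero    = ≈-trans (dil-const k (+ 1)) (pointwise λ j → cong (λ t → qpow t j) (sym (ℕₚ.*-zeroʳ k)))
dil-qpow k (suc e) = ≈-trans (dil-unfold k (qpow (suc e))) (≈-trans (+S-identityˡ _) (≈-trans (*-congˡ (dil-qpow k e))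
  (≈-trans (qpow-+ k (k ℕ.* e)) (pointwise λ j → cong (λ t → qpow t j) (sym (ℕₚ.*-suc k e))))))

dil-dil : ∀ j k .{{_ : NonZero j}} .{{_ : NonZero k}} .{{_ : NonZero (j ℕ.* k)}} f → dil j (dil k f) ≈ dil (j ℕ.* k) f
dil-dil j k f = qpow-induction (j ℕ.* k) (λ f → dil j (dil k f)) (dil (j ℕ.* k)) (λ f → constS (f 0)) (constS (+ 1)) tailS
  (λ f → ≈-trans (dil-cong j (dil-unfold k f)) (≈-trans (dil-+ j _ _) (+-cong (dil-const j (f 0))
    (≈-trans (dil-* j _ _) (≈-trans (*-congʳ (dil-qpow j k)) (≈-sym (*S-identityˡ _)))))))
  (λ f → ≈-trans (dil-unfold (j ℕ.* k) f) (+-congˡ (≈-sym (*S-identityˡ _)))) f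

dil-at : ∀ k .{{_ : NonZero k}} f n → dil k f (n ℕ.* k) ≡ f n
dil-at (suc k) f zero    = refl
dil-at (suc k) f (suc n) = trans (at (dil-unfold (suc k) f) (suc k ℕ.+ n ℕ.* suc k))
  (trans (+S-at (constS (f 0)) (qpow (suc k) *S dil (suc k) (tailS f)) (suc k ℕ.+ n ℕ.* suc k)) (trans (ℤₚ.+-identityˡ _)
    (trans (at (qpow-*-shift (suc k) (dil (suc k) (tailS f))) (suc k ℕ.+ n ℕ.* suc k))
    (trans (shiftS-at (suc k) (dil (suc k) (tailS f)) (n ℕ.* suc k)) (dil-at (suc k) (tailS f) n)))))

dil-injective : ∀ k .{{_ : NonZero k}} {f g} → dil k f ≈ dil k g → f ≈ g
dil-injective k {f} {g} p = pointwise λ n → trans (sym (dil-at k f n)) (trans (at p (n ℕ.* k)) (dil-at k g n))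

alt-dil-even : ∀ k .{{_ : NonZero k}} → sgn k ≡ + 1 → ∀ f → alt (dil k f) ≈ dil k f
alt-dil-even k s f = qpow-induction k (λ f → alt (dil k f)) (dil k) (λ f → constS (f 0)) (constS (+ 1)) tailS
  (λ f → ≈-trans (alt-cong (dil-unfold k f)) (≈-trans (alt-+ _ _) (+-cong (alt-const (f 0)) (≈-trans (alt-* _ _)
    (≈-trans (*-congʳ (≈-trans (alt-qpow k) (*-congʳ (pointwise λ j → cong (λ t → constS t j) s)))) (*S-assoc _ _ _))))))
  (λ f → ≈-trans (dil-unfold k f) (+-congˡ (≈-sym (*S-identityˡ _)))) f

alt-dil-odd : ∀ k .{{_ : NonZero k}} → sgn k ≡ - + 1 → ∀ f → alt (dil k f) ≈ dil k (alt f)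
alt-dil-odd k s f = qpow-induction k (λ f → alt (dil k f)) (λ f → dil k (alt f)) (λ f → constS (f 0)) (constS (- + 1)) tailS
  (λ f → ≈-trans (alt-cong (dil-unfold k f)) (≈-trans (alt-+ _ _) (+-cong (alt-const (f 0)) (≈-trans (alt-* _ _)
    (≈-trans (*-congʳ (≈-trans (alt-qpow k) (*-congʳ (pointwise λ j → cong (λ t → constS t j) s)))) (*S-assoc _ _ _))))))
  (λ f → ≈-trans (dil-unfold k (alt f)) (+-cong (pointwise λ j → cong (λ t → constS t j) (ℤₚ.*-identityˡ (f 0)))
    (≈-trans (*-congˡ (≈-trans (dil-cong k (alt-tail f)) (dil-neg k _)))
      (solve 2 (λ q t → q :* (:- t) := con (- + 1) :* (q :* t)) refl (qpow k) (dil k (alt (tailS f))))))) f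

-- Infinite products

record Near1 (u : ℕ → Series) : Set where
  constructor near1
  field near : ∀ i → u i ≈[ suc i ] constS (+ 1)
open Near1

-- The coefficient of q^n is read from the product of the first n factors; for `Near1` families
-- every later factor is 1 modulo q^(n+1).
Π∞ : (ℕ → Series) → Series
Π∞ u n = ∏ n u n

∏-stable : ∀ {u} → Near1 u → ∀ N d → ∏ (d ℕ.+ N) u ≈[ suc N ] ∏ N u
∏-stable nu N zero    = ≈[]-refl
∏-stable nu N (suc d) = ≈[]-trans (*-cong[] (∏-stable nu N d) (≈[]-weaken (s≤s (ℕₚ.m≤n+m N d)) (near nu (d ℕ.+ N)))) (≈⇒≈[] (*S-identityʳ _))

Π∞-trunc : ∀ {u} → Near1 u → ∀ N M → N ℕ.≤ M → Π∞ u ≈[ suc N ] ∏ M u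
Π∞-trunc {u} nu N M N≤M = below λ k k≤N → sym (at< (subst (λ t → ∏ t u ≈[ suc k ] ∏ k u)
  (ℕₚ.m∸n+n≡m (ℕₚ.≤-trans (ℕₚ.≤-pred k≤N) N≤M)) (∏-stable nu k (M ∸ k))) k ℕₚ.≤-refl)

Π∞-unique : ∀ {u F} → Near1 u → (∀ N → F ≈[ suc N ] ∏ N u) → F ≈ Π∞ u
Π∞-unique nu p = pointwise λ k → at< (p k) k ℕₚ.≤-refl

Π∞-cong : ∀ {u v} → (∀ i → u i ≈ v i) → Π∞ u ≈ Π∞ v
Π∞-cong p = pointwise λ k → at (∏-cong k p) k

∏-* : ∀ n u v → ∏ n (λ i → u i *S v i) ≈ ∏ n u *S ∏ n v
∏-* zero    u v = ≈-sym (*S-identityˡ _)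
∏-* (suc n) u v = ≈-trans (*-congʳ (∏-* n u v)) (solve 4 (λ a b c d → (a :* b) :* (c :* d) := (a :* c) :* (b :* d)) refl _ _ _ _)

near1-* : ∀ {u v} → Near1 u → Near1 v → Near1 (λ i → u i *S v i)
near1-* nu nv = near1 λ i → ≈[]-trans (*-cong[] (near nu i) (near nv i)) (≈⇒≈[] (*S-identityˡ _))

Π∞-* : ∀ {u v} → Near1 u → Near1 v → Π∞ (λ i → u i *S v i) ≈ Π∞ u *S Π∞ v
Π∞-* {u} {v} nu nv = ≈-sym (Π∞-unique (near1-* nu nv) λ N →
  ≈[]-trans (*-cong[] (Π∞-trunc nu N N ℕₚ.≤-refl) (Π∞-trunc nv N N ℕₚ.≤-refl)) (≈⇒≈[] (≈-sym (∏-* N u v))))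

factor : ℤ → ℕ → Series
factor z e = constS (+ 1) +S constS z *S qpow e

factor-near : ∀ z {e N} → N ℕ.≤ e → factor z e ≈[ N ] constS (+ 1)
factor-near z {e} l = ≈[]-trans (+-cong[] ≈[]-refl (*-cong[] ≈[]-refl (≈[]-weaken l (qpow-small e))))
  (≈⇒≈[] (solve 1 (λ z → con (+ 1) :+ z :* con (+ 0) := con (+ 1)) refl (constS z)))

factor-exp : ∀ z {e f} → e ≡ f → factor z e ≈ factor z f
factor-exp z refl = ≈-refl

-- The product of 1 + z q^(di+r) over i ≥ 0, in Pochhammer notation (-z q^r; q^d)∞.
Prod : ℤ → (d r : ℕ) → Series
Prod z d r = Π∞ (λ i → factor z (d ℕ.* i ℕ.+ r))

prod-near : ∀ z d r .{{_ : NonZero d}} .{{_ : NonZero r}} → Near1 (λ i → factor z (d ℕ.* i ℕ.+ r))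
prod-near z (suc d) (suc r) = near1 λ i → factor-near z (subst (suc i ℕ.≤_) (sym (ℕₚ.+-suc (suc d ℕ.* i) r)) (s≤s (ℕₚ.≤-trans (ℕₚ.m≤m+n i (d ℕ.* i)) (ℕₚ.m≤m+n _ r))))

∏-+ : ∀ m n u → ∏ (n ℕ.+ m) u ≈ ∏ m u *S ∏ n (λ j → u (j ℕ.+ m))
∏-+ m zero    u = ≈-sym (*S-identityʳ _)
∏-+ m (suc n) u = ≈-trans (*-congʳ (∏-+ m n u)) (*S-assoc _ _ _)

∏-blocks : ∀ k n u → ∏ (n ℕ.* k) u ≈ ∏ n (λ i → ∏ k (λ j → u (j ℕ.+ i ℕ.* k)))
∏-blocks k zero    u = ≈-refl
∏-blocks k (suc n) u = ≈-trans (∏-+ (n ℕ.* k) k u) (*-congʳ (∏-blocks k n u))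

module _ {u : ℕ → Series} (nu : Near1 u) (k : ℕ) .{{_ : NonZero k}} where

  near1-stride : ∀ j → Near1 (λ i → u (j ℕ.+ i ℕ.* k))
  near1-stride j = near1 λ i → ≈[]-weaken (s≤s (ℕₚ.≤-trans (ℕₚ.m≤m*n i k) (ℕₚ.m≤n+m (i ℕ.* k) j))) (near nu (j ℕ.+ i ℕ.* k))

  near1-block : ∀ m → Near1 (λ i → ∏ m (λ j → u (j ℕ.+ i ℕ.* k)))
  near1-block zero    = near1 λ _ → ≈[]-refl
  near1-block (suc m) = near1-* (near1-block m) (near1-stride m)

  Π∞-block : ∀ m → Π∞ (λ i → ∏ m (λ j → u (j ℕ.+ i ℕ.* k))) ≈ ∏ m (λ j → Π∞ (λ i → u (j ℕ.+ i ℕ.* k)))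
  Π∞-block zero    = pointwise λ n → at (∏-one n) n
    where
    ∏-one : ∀ n → ∏ n (λ _ → constS (+ 1)) ≈ constS (+ 1)
    ∏-one zero    = ≈-refl
    ∏-one (suc n) = ≈-trans (*S-identityʳ _) (∏-one n)
  Π∞-block (suc m) = ≈-trans (Π∞-* (near1-block m) (near1-stride m)) (*-congʳ (Π∞-block m))

  -- Truncating after Nk factors cuts the product into N blocks of k consecutive factors, and the
  -- j-th members of the blocks form the j-th residue class.
  Π∞-dissect : Π∞ u ≈ ∏ k (λ j → Π∞ (λ i → u (j ℕ.+ i ℕ.* k)))
  Π∞-dissect = ≈-trans (Π∞-unique (near1-block k) λ N →
    ≈[]-trans (Π∞-trunc nu N (N ℕ.* k) (ℕₚ.m≤m*n N k)) (≈⇒≈[] (∏-blocks k N u))) (Π∞-block k)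

Prod-dissect : ∀ z k d r .{{_ : NonZero k}} .{{_ : NonZero d}} .{{_ : NonZero r}} →
  Prod z d r ≈ ∏ k (λ j → Prod z (k ℕ.* d) (d ℕ.* j ℕ.+ r))
Prod-dissect z k d r = ≈-trans (Π∞-dissect (prod-near z d r) k)
  (∏-cong k λ j → Π∞-cong λ i → factor-exp z (index k d r i j))
  where
  index : ∀ k d r i j → d ℕ.* (j ℕ.+ i ℕ.* k) ℕ.+ r ≡ k ℕ.* d ℕ.* i ℕ.+ (d ℕ.* j ℕ.+ r)
  index = ℕ-solve-∀

Prod-± : ∀ d r .{{_ : NonZero d}} .{{_ : NonZero r}} → Prod (+ 1) d r *S Prod (- + 1) d r ≈ Prod (- + 1) (2 ℕ.* d) (2 ℕ.* r)
Prod-± d r = ≈-trans (≈-sym (Π∞-* (prod-near (+ 1) d r) (prod-near (- + 1) d r)))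
  (Π∞-cong λ i → ≈-trans (solve 1 (λ q → (con (+ 1) :+ con (+ 1) :* q) :* (con (+ 1) :+ con (- + 1) :* q) := con (+ 1) :+ con (- + 1) :* (q :* q)) refl (qpow (d ℕ.* i ℕ.+ r)))
    (+-congˡ (*-congˡ (≈-trans (qpow-+ (d ℕ.* i ℕ.+ r) (d ℕ.* i ℕ.+ r)) (pointwise λ n → cong (λ t → qpow t n) (double d i r))))))
  where
  double : ∀ d i r → (d ℕ.* i ℕ.+ r) ℕ.+ (d ℕ.* i ℕ.+ r) ≡ 2 ℕ.* d ℕ.* i ℕ.+ 2 ℕ.* r
  double = ℕ-solve-∀

Prod-dil : ∀ z k d r .{{_ : NonZero k}} .{{_ : NonZero d}} .{{_ : NonZero r}} .{{_ : NonZero (k ℕ.* d)}} .{{_ : NonZero (k ℕ.* r)}} →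
  dil k (Prod z d r) ≈ Prod z (k ℕ.* d) (k ℕ.* r)
Prod-dil z k d r = Π∞-unique (prod-near z (k ℕ.* d) (k ℕ.* r)) λ N →
  ≈[]-trans (dil-cong[] k (Π∞-trunc (prod-near z d r) N N ℕₚ.≤-refl)) (≈⇒≈[] (go N))
  where
  index : ∀ k d r i → k ℕ.* (d ℕ.* i ℕ.+ r) ≡ k ℕ.* d ℕ.* i ℕ.+ k ℕ.* r
  index = ℕ-solve-∀
  step : ∀ i → dil k (factor z (d ℕ.* i ℕ.+ r)) ≈ factor z (k ℕ.* d ℕ.* i ℕ.+ k ℕ.* r)
  step i = ≈-trans (dil-+ k _ _) (+-cong (dil-const k (+ 1)) (≈-trans (dil-* k _ _) (*-cong (dil-const k z)
    (≈-trans (dil-qpow k _) (pointwise λ n → cong (λ t → qpow t n) (index k d r i))))))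
  go : ∀ N → dil k (∏ N (λ i → factor z (d ℕ.* i ℕ.+ r))) ≈ ∏ N (λ i → factor z (k ℕ.* d ℕ.* i ℕ.+ k ℕ.* r))
  go zero    = dil-const k (+ 1)
  go (suc N) = ≈-trans (dil-* k _ _) (*-cong (go N) (step N))

Euler : Series
Euler = Prod (- + 1) 1 1

-- η(kz) without its power of q.
E : (k : ℕ) → .{{NonZero k}} → Series
E k = dil k Euler

E-Prod : ∀ k .{{_ : NonZero k}} .{{_ : NonZero (k ℕ.* 1)}} → E k ≈ Prod (- + 1) (k ℕ.* 1) (k ℕ.* 1)
E-Prod k = Prod-dil (- + 1) k 1 1

-- Sums over the fibres of an exponent function

sumOver : ∀ {A : Set} → List A → (A → ℤ) → ℤ
sumOver L f = sumℤ (map f L)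

sumOver-cong : ∀ {A : Set} (L : List A) {f g : A → ℤ} → (∀ a → f a ≡ g a) → sumOver L f ≡ sumOver L g
sumOver-cong []      p = refl
sumOver-cong (a ∷ L) p = cong₂ _+_ (p a) (sumOver-cong L p)

sumOver-+ : ∀ {A : Set} (L : List A) (f g : A → ℤ) → sumOver L (λ a → f a + g a) ≡ sumOver L f + sumOver L g
sumOver-+ []      f g = refl
sumOver-+ (a ∷ L) f g = trans (cong (λ t → f a + g a + t) (sumOver-+ L f g)) (swap (f a) (g a) (sumOver L f) (sumOver L g))
  where
  swap : ∀ a b c d → (a + b) + (c + d) ≡ (a + c) + (b + d)
  swap = solve-∀

sumOver-zero : ∀ {A : Set} (L : List A) → sumOver L (λ _ → + 0) ≡ + 0
sumOver-zero []      = refl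
sumOver-zero (a ∷ L) = trans (ℤₚ.+-identityˡ _) (sumOver-zero L)

sumOver-*ˡ : ∀ {A : Set} z (L : List A) (f : A → ℤ) → sumOver L (λ a → z * f a) ≡ z * sumOver L f
sumOver-*ˡ z []      f = sym (ℤₚ.*-zeroʳ z)
sumOver-*ˡ z (a ∷ L) f = trans (cong (λ t → z * f a + t) (sumOver-*ˡ z L f)) (sym (ℤₚ.*-distribˡ-+ z (f a) _))

sumOver-swap : ∀ {A B : Set} (L : List A) (M : List B) (f : A → B → ℤ) →
  sumOver L (λ a → sumOver M (f a)) ≡ sumOver M (λ b → sumOver L (λ a → f a b))
sumOver-swap []      M f = sym (sumOver-zero M)
sumOver-swap (a ∷ L) M f = trans (cong (λ t → sumOver M (f a) + t) (sumOver-swap L M f)) (sym (sumOver-+ M (f a) _))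

sumOver-map : ∀ {A B : Set} (h : A → B) (L : List A) (f : B → ℤ) → sumOver (map h L) f ≡ sumOver L (λ a → f (h a))
sumOver-map h L f = cong sumℤ (sym (Listₚ.map-∘ L))

sumOver-++ : ∀ {A : Set} (L M : List A) (f : A → ℤ) → sumOver (L ++ M) f ≡ sumOver L f + sumOver M f
sumOver-++ []      M f = sym (ℤₚ.+-identityˡ _)
sumOver-++ (a ∷ L) M f = trans (cong (λ t → f a + t) (sumOver-++ L M f)) (sym (ℤₚ.+-assoc (f a) _ _))

sumOver-product : ∀ {A B : Set} (L : List A) (M : List B) (f : A × B → ℤ) →
  sumOver (cartesianProduct L M) f ≡ sumOver L (λ a → sumOver M (λ b → f (a , b)))
sumOver-product []      M f = refl
sumOver-product (a ∷ L) M f = trans (sumOver-++ (map (a ,_) M) (cartesianProduct L M) f)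
  (cong₂ _+_ (sumOver-map (a ,_) M f) (sumOver-product L M f))

ind : ∀ {P : Set} → Dec P → ℤ
ind d = if does d then + 1 else + 0

ind-yes : ∀ {P : Set} (d : Dec P) → P → ind d ≡ + 1
ind-yes (yes _) p = refl
ind-yes (no ¬p) p = ⊥-elim (¬p p)

ind-no : ∀ {P : Set} (d : Dec P) → ¬ P → ind d ≡ + 0
ind-no (yes p) ¬p = ⊥-elim (¬p p)
ind-no (no _)  ¬p = refl

ind-⇔ : ∀ {P Q : Set} (d : Dec P) (e : Dec Q) → (P → Q) → (Q → P) → ind d ≡ ind e
ind-⇔ (yes p) e f g = sym (ind-yes e (f p))
ind-⇔ (no ¬p) e f g = sym (ind-no e (λ q → ¬p (g q)))

ind-*-cong : ∀ {P : Set} (d : Dec P) {x y : ℤ} → (P → x ≡ y) → ind d * x ≡ ind d * y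
ind-*-cong (yes p) f = cong (+ 1 *_) (f p)
ind-*-cong (no _)  f = refl

ind-*-one : ∀ {P : Set} (d : Dec P) x {y : ℤ} → (P → y ≡ + 1) → (ind d * x) * + 1 ≡ (ind d * x) * y
ind-*-one (yes p) x f = cong ((+ 1 * x) *_) (sym (f p))
ind-*-one (no _)  x f = refl

count : ∀ {A : Set} → DecidableEquality A → List A → A → ℤ
count _≟_ L a = sumOver L (λ b → ind (a ≟ b))

-- A finite list meeting every element of the fibre E⁻¹(N) exactly once; sums over the fibre do not depend on the choice of the list.
record Cover {A : Set} (_≟_ : DecidableEquality A) (E : A → ℕ) (N : ℕ) : Set where
  constructor cover
  field
    elements : List A
    once     : ∀ a → E a ≡ N → count _≟_ elements a ≡ + 1
open Cover

-- A cover may contain elements outside the fibre, with any multiplicity; the indicator removes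
-- them.
total : ∀ {A : Set} {_≟_ : DecidableEquality A} {E N} → Cover _≟_ E N → (A → ℤ) → ℤ
total {E = E} {N} C c = sumOver (elements C) (λ a → ind (E a ℕ.≟ N) * c a)

total-cong : ∀ {A : Set} {_≟_ : DecidableEquality A} {E N} (C : Cover _≟_ E N) {c c′ : A → ℤ} → (∀ a → c a ≡ c′ a) → total C c ≡ total C c′
total-cong {E = E} {N} C p = sumOver-cong (elements C) (λ a → cong (ind (E a ℕ.≟ N) *_) (p a))

total-+ : ∀ {A : Set} {_≟_ : DecidableEquality A} {E N} (C : Cover _≟_ E N) (c c′ : A → ℤ) →
  total C (λ a → c a + c′ a) ≡ total C c + total C c′
total-+ {E = E} {N} C c c′ = trans (sumOver-cong (elements C) (λ a → ℤₚ.*-distribˡ-+ (ind (E a ℕ.≟ N)) (c a) (c′ a)))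
  (sumOver-+ (elements C) (λ a → ind (E a ℕ.≟ N) * c a) (λ a → ind (E a ℕ.≟ N) * c′ a))

total-*ˡ : ∀ {A : Set} {_≟_ : DecidableEquality A} {E N} (C : Cover _≟_ E N) z (c : A → ℤ) →
  total C (λ a → z * c a) ≡ z * total C c
total-*ˡ {E = E} {N} C z c = trans (sumOver-cong (elements C) (λ a → swap (ind (E a ℕ.≟ N)) z (c a)))
  (sumOver-*ˡ z (elements C) (λ a → ind (E a ℕ.≟ N) * c a))
  where
  swap : ∀ i z c → i * (z * c) ≡ z * (i * c)
  swap = solve-∀

record _≅_ (A B : Set) : Set where
  constructor bijection
  field
    to        : A → B
    from      : B → A
    to-from   : ∀ b → to (from b) ≡ b
    from-to   : ∀ a → from (to a) ≡ a
open _≅_ public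

module _ {A B : Set} {_≟A_ : DecidableEquality A} {_≟B_ : DecidableEquality B} {EA : A → ℕ} {EB : B → ℕ} {M N : ℕ} where

  -- Into the sum over a the factor 1 = Σ_b [σ a = b] is inserted; after interchanging the sums the
  -- same indicator is read as [σ⁻¹ b = a]. With σ the identity this shows that the total does not
  -- depend on the cover.
  total-bijection : (CA : Cover _≟A_ EA M) (CB : Cover _≟B_ EB N) (σ : A ≅ B) {cA : A → ℤ} {cB : B → ℤ} →
    (∀ a → EA a ≡ M → EB (to σ a) ≡ N) → (∀ a → EB (to σ a) ≡ N → EA a ≡ M) →
    (∀ a → EA a ≡ M → cA a ≡ cB (to σ a)) → total CA cA ≡ total CB cB
  total-bijection CA CB σ {cA} {cB} E→ E← c→ = begin
    sumOver LA (λ a → ind (EA a ℕ.≟ M) * cA a)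
      ≡⟨ sumOver-cong LA (λ a → trans (sym (ℤₚ.*-identityʳ _)) (expandA a)) ⟩
    sumOver LA (λ a → sumOver LB (λ b → (ind (EA a ℕ.≟ M) * cA a) * ind (to σ a ≟B b)))
      ≡⟨ sumOver-swap LA LB _ ⟩
    sumOver LB (λ b → sumOver LA (λ a → (ind (EA a ℕ.≟ M) * cA a) * ind (to σ a ≟B b)))
      ≡⟨ sumOver-cong LB (λ b → sumOver-cong LA (λ a → match a b)) ⟩
    sumOver LB (λ b → sumOver LA (λ a → (ind (EB b ℕ.≟ N) * cB b) * ind (from σ b ≟A a)))
      ≡⟨ sumOver-cong LB (λ b → trans (sym (expandB b)) (ℤₚ.*-identityʳ _)) ⟩
    sumOver LB (λ b → ind (EB b ℕ.≟ N) * cB b) ∎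
    where
    LA = elements CA
    LB = elements CB
    expandA : ∀ a → (ind (EA a ℕ.≟ M) * cA a) * + 1 ≡ sumOver LB (λ b → (ind (EA a ℕ.≟ M) * cA a) * ind (to σ a ≟B b))
    expandA a = trans (ind-*-one (EA a ℕ.≟ M) (cA a) (λ p → once CB (to σ a) (E→ a p))) (sym (sumOver-*ˡ (ind (EA a ℕ.≟ M) * cA a) LB (λ b → ind (to σ a ≟B b))))
    expandB : ∀ b → (ind (EB b ℕ.≟ N) * cB b) * + 1 ≡ sumOver LA (λ a → (ind (EB b ℕ.≟ N) * cB b) * ind (from σ b ≟A a))
    expandB b = trans (ind-*-one (EB b ℕ.≟ N) (cB b) (λ p → once CA (from σ b) (E← (from σ b) (trans (cong EB (to-from σ b)) p)))) (sym (sumOver-*ˡ (ind (EB b ℕ.≟ N) * cB b) LA (λ a → ind (from σ b ≟A a))))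
    match : ∀ a b → (ind (EA a ℕ.≟ M) * cA a) * ind (to σ a ≟B b) ≡ (ind (EB b ℕ.≟ N) * cB b) * ind (from σ b ≟A a)
    match a b with to σ a ≟B b
    ... | yes refl = cong₂ _*_
            (trans (ind-*-cong (EA a ℕ.≟ M) (c→ a)) (cong (_* cB (to σ a)) (ind-⇔ (EA a ℕ.≟ M) (EB (to σ a) ℕ.≟ N) (E→ a) (E← a))))
            (sym (ind-yes (from σ (to σ a) ≟A a) (from-to σ a)))
    ... | no  ¬p = trans (ℤₚ.*-zeroʳ (ind (EA a ℕ.≟ M) * cA a)) (sym (trans (cong ((ind (EB b ℕ.≟ N) * cB b) *_)
            (ind-no (from σ b ≟A a) (λ q → ¬p (trans (cong (to σ) (sym q)) (to-from σ b))))) (ℤₚ.*-zeroʳ (ind (EB b ℕ.≟ N) * cB b))))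

pull : ∀ {A B : Set} {_≟A_ : DecidableEquality A} {_≟B_ : DecidableEquality B} {E : B → ℕ} {N} →
  Cover _≟B_ E N → (σ : A ≅ B) → Cover _≟A_ (λ a → E (to σ a)) N
pull {_≟A_ = _≟A_} {_≟B_} (cover L o) σ = cover (map (from σ) L) λ a p → trans (sumOver-map (from σ) L _)
  (trans (sumOver-cong L (λ b → ind-⇔ (a ≟A from σ b) (to σ a ≟B b)
    (λ q → trans (cong (to σ) q) (to-from σ b)) (λ q → trans (sym (from-to σ a)) (cong (from σ) q)))) (o (to σ a) p))

total-pull : ∀ {A B : Set} {_≟A_ : DecidableEquality A} {_≟B_ : DecidableEquality B} {E : B → ℕ} {N}
  (C : Cover _≟B_ E N) (σ : A ≅ B) (c : B → ℤ) → total (pull {_≟A_ = _≟A_} C σ) (λ a → c (to σ a)) ≡ total C c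
total-pull {_≟A_ = _≟A_} C σ c = total-bijection (pull {_≟A_ = _≟A_} C σ) C σ {λ a → c (to σ a)} {c} (λ _ p → p) (λ _ p → p) (λ _ _ → refl)

id-≅ : ∀ {A} → A ≅ A
id-≅ = bijection (λ a → a) (λ a → a) (λ _ → refl) (λ _ → refl)

infixr 9 _∘≅_
_∘≅_ : ∀ {A B C} → B ≅ C → A ≅ B → A ≅ C
σ ∘≅ τ = bijection (λ a → to σ (to τ a)) (λ c → from τ (from σ c))
  (λ c → trans (cong (to σ) (to-from τ (from σ c))) (to-from σ c))
  (λ a → trans (cong (from τ) (from-to σ (to τ a))) (from-to τ a))

∑Fin : ∀ d → (Fin d → ℤ) → ℤ
∑Fin zero    f = + 0
∑Fin (suc d) f = f zero + ∑Fin d (λ j → f (suc j))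

∑Fin-cong : ∀ d {f g : Fin d → ℤ} → (∀ j → f j ≡ g j) → ∑Fin d f ≡ ∑Fin d g
∑Fin-cong zero    p = refl
∑Fin-cong (suc d) p = cong₂ _+_ (p zero) (∑Fin-cong d (λ j → p (suc j)))

module _ {A : Set} {_≟_ : DecidableEquality A} {d : ℕ} where

  private
    _≟F_ : DecidableEquality (Fin d × A)
    _≟F_ = ≡-dec Fin._≟_ _≟_

    sliceList : Fin d → List (Fin d × A) → List A
    sliceList j [] = []
    sliceList j ((i , a) ∷ L) with i Fin.≟ j
    ... | yes _ = a ∷ sliceList j L
    ... | no  _ = sliceList j L

    sliceList-sum : ∀ j L (f : Fin d × A → ℤ) → sumOver (sliceList j L) (λ a → f (j , a)) ≡ sumOver L (λ { (i , a) → ind (i Fin.≟ j) * f (i , a) })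
    sliceList-sum j [] f = refl
    sliceList-sum j ((i , a) ∷ L) f with i Fin.≟ j
    ... | yes refl = cong₂ _+_ (sym (ℤₚ.*-identityˡ (f (j , a)))) (sliceList-sum j L f)
    ... | no  _    = trans (sliceList-sum j L f) (sym (ℤₚ.+-identityˡ _))

  slice : ∀ {E : Fin d × A → ℕ} {N} → Cover _≟F_ E N → (j : Fin d) → Cover _≟_ (λ a → E (j , a)) N
  slice (cover L o) j = cover (sliceList j L) λ a p → trans (trans (sumOver-cong (sliceList j L) (λ b →
      ind-⇔ (a ≟ b) ((j , a) ≟F (j , b)) (cong (j ,_)) ,-injectiveʳ)) (trans (sliceList-sum j L (λ b → ind ((j , a) ≟F b)))
        (sumOver-cong L (λ { (i , b) → drop i a b })))) (o (j , a) p)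
    where
    drop : ∀ i a b → ind (i Fin.≟ j) * ind ((j , a) ≟F (i , b)) ≡ ind ((j , a) ≟F (i , b))
    drop i a b with i Fin.≟ j
    ... | yes _ = ℤₚ.*-identityˡ _
    ... | no ¬p = sym (ind-no ((j , a) ≟F (i , b)) (λ q → ¬p (sym (,-injectiveˡ q))))

  total-slices : ∀ {E : Fin d × A → ℕ} {N} (C : Cover _≟F_ E N) (c : Fin d × A → ℤ) →
    total C c ≡ ∑Fin d (λ j → total (slice C j) (λ a → c (j , a)))
  total-slices {E} {N} C@(cover L o) c = sym (begin
    ∑Fin d (λ j → total (slice C j) (λ a → c (j , a)))
      ≡⟨ ∑Fin-cong d (λ j → sliceList-sum j L (λ b → ind (E b ℕ.≟ N) * c b)) ⟩
    ∑Fin d (λ j → sumOver L (λ { (i , a) → ind (i Fin.≟ j) * (ind (E (i , a) ℕ.≟ N) * c (i , a)) }))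
      ≡⟨ ∑Fin-swap d L _ ⟩
    sumOver L (λ b → ∑Fin d (λ j → ind (proj₁ b Fin.≟ j) * (ind (E b ℕ.≟ N) * c b)))
      ≡⟨ sumOver-cong L (λ { (i , a) → pick i (ind (E (i , a) ℕ.≟ N) * c (i , a)) }) ⟩
    sumOver L (λ b → ind (E b ℕ.≟ N) * c b) ∎)
    where
    ∑Fin-swap : ∀ {B : Set} d (L : List B) (f : Fin d → B → ℤ) → ∑Fin d (λ j → sumOver L (f j)) ≡ sumOver L (λ b → ∑Fin d (λ j → f j b))
    ∑Fin-swap zero    L f = sym (sumOver-zero L)
    ∑Fin-swap (suc d) L f = trans (cong (λ t → sumOver L (f zero) + t) (∑Fin-swap d L (λ j → f (suc j)))) (sym (sumOver-+ L _ _))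
    ∑Fin-none : ∀ d x → ∑Fin d (λ _ → + 0 * x) ≡ + 0
    ∑Fin-none zero    x = refl
    ∑Fin-none (suc d) x = trans (ℤₚ.+-identityˡ _) (∑Fin-none d x)
    pick : ∀ {d} (i : Fin d) x → ∑Fin d (λ j → ind (i Fin.≟ j) * x) ≡ x
    pick {suc d} zero x = trans (cong₂ _+_ (ℤₚ.*-identityˡ x)
      (trans (∑Fin-cong d (λ j → cong (_* x) (ind-no (zero Fin.≟ suc j) (λ ())))) (∑Fin-none d x))) (ℤₚ.+-identityʳ x)
    pick {suc d} (suc i) x = trans (cong₂ _+_ (cong (_* x) (ind-no (suc i Fin.≟ zero) (λ ())))
      (∑Fin-cong d (λ j → cong (_* x) (ind-⇔ (suc i Fin.≟ suc j) (i Fin.≟ j) Finₚ.suc-injective (cong suc))))) (trans (ℤₚ.+-identityˡ _) (pick i x))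

residues : ∀ d .{{_ : NonZero d}} → (Fin d × ℤ) ≅ ℤ
residues d@(suc _) = bijection join split join-split split-join
  where
  join : Fin d × ℤ → ℤ
  join (j , k) = + toℕ j + k * + d
  split : ℤ → Fin d × ℤ
  split i = fromℕ< (ℤᵈ.n%ℕd<d i d) , i ℤᵈ./ℕ d
  join-split : ∀ i → join (split i) ≡ i
  join-split i = trans (cong (λ t → + t + (i ℤᵈ./ℕ d) * + d) (Finₚ.toℕ-fromℕ< (ℤᵈ.n%ℕd<d i d))) (sym (ℤᵈ.a≡a%ℕn+[a/ℕn]*n i d))
  small : ∀ a b z → a ℕ.< d → b ℕ.< d → + a ≡ + b + z * + d → z ≡ + 0
  small a b (+ 0)       a<d b<d p = refl
  small a b (+ (suc z)) a<d b<d p = ⊥-elim (ℕₚ.<⇒≱ a<d (subst (d ℕ.≤_) (sym (ℤₚ.+-injective (trans p (cong (λ t → + b + t) (sym (ℤₚ.pos-* (suc z) d))))))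
    (ℕₚ.≤-trans (ℕₚ.m≤m+n d (z ℕ.* d)) (ℕₚ.m≤n+m _ b))))
  small a b -[1+ z ]    a<d b<d p = ⊥-elim (ℕₚ.<⇒≱ b<d (subst (d ℕ.≤_) (ℤₚ.+-injective q) (ℕₚ.≤-trans (ℕₚ.m≤m+n d (z ℕ.* d)) (ℕₚ.m≤n+m _ a))))
    where
    move : ∀ a b z d → a ≡ b + (- z) * d → a + z * d ≡ b
    move a b z d refl = cancel b z d
      where
      cancel : ∀ b z d → (b + (- z) * d) + z * d ≡ b
      cancel = solve-∀
    q : + (a ℕ.+ suc z ℕ.* d) ≡ + b
    q = trans (cong (λ t → + a + t) (ℤₚ.pos-* (suc z) d)) (move (+ a) (+ b) (+ (suc z)) (+ d) p)
  unique : ∀ j k j′ k′ → join (j , k) ≡ join (j′ , k′) → (j , k) ≡ (j′ , k′)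
  unique j k j′ k′ p = cong₂ _,_ (Finₚ.toℕ-injective (ℤₚ.+-injective (trans e (trans (cong (λ t → + toℕ j′ + t * + d) z) (ℤₚ.+-identityʳ (+ toℕ j′)))))) (sym (ℤₚ.i-j≡0⇒i≡j k′ k z))
    where
    move : ∀ a b k k′ d → a + k * d ≡ b + k′ * d → a ≡ b + (k′ - k) * d
    move a b k k′ d r = trans (lem a k d) (trans (cong (_- k * d) r) (lem′ b k′ k d))
      where
      lem : ∀ a k d → a ≡ (a + k * d) - k * d
      lem = solve-∀
      lem′ : ∀ b k′ k d → (b + k′ * d) - k * d ≡ b + (k′ - k) * d
      lem′ = solve-∀
    e : + toℕ j ≡ + toℕ j′ + (k′ - k) * + d
    e = move (+ toℕ j) (+ toℕ j′) k k′ (+ d) p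
    z : k′ - k ≡ + 0
    z = small (toℕ j) (toℕ j′) (k′ - k) (Finₚ.toℕ<n j) (Finₚ.toℕ<n j′) e
  split-join : ∀ x → split (join x) ≡ x
  split-join (j , k) = unique _ _ j k (join-split (join (j , k)))

-- Theta series and products of two of them

_≟ℤ²_ : DecidableEquality (ℤ × ℤ)
_≟ℤ²_ = ≡-dec ℤ._≟_ ℤ._≟_

qpow-at : ∀ e n → qpow e n ≡ ind (e ℕ.≟ n)
qpow-at zero    zero    = refl
qpow-at zero    (suc n) = refl
qpow-at (suc e) zero    = refl
qpow-at (suc e) (suc n) = trans (qpow-at e n) (ind-⇔ (e ℕ.≟ n) (suc e ℕ.≟ suc n) (cong suc) ℕₚ.suc-injective)

monomials : ∀ {A : Set} → List A → (A → ℤ) → (A → ℕ) → Series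
monomials []      c e = constS (+ 0)
monomials (a ∷ L) c e = constS (c a) *S qpow (e a) +S monomials L c e

monomials-at : ∀ {A : Set} (L : List A) c e n → monomials L c e n ≡ sumOver L (λ a → ind (e a ℕ.≟ n) * c a)
monomials-at []      c e n = constS-zero n
monomials-at (a ∷ L) c e n = trans (+S-at (constS (c a) *S qpow (e a)) (monomials L c e) n) (cong₂ _+_
  (trans (constS-*ᵏ n (c a) (qpow (e a))) (trans (ℤₚ.*-comm (c a) _) (cong (_* c a) (qpow-at (e a) n)))) (monomials-at L c e n))

monomials-++ : ∀ {A : Set} (L M : List A) c e → monomials (L ++ M) c e ≈ monomials L c e +S monomials M c e
monomials-++ []      M c e = ≈-sym (+S-identityˡ _)
monomials-++ (a ∷ L) M c e = ≈-trans (+-congˡ (monomials-++ L M c e)) (solve 3 (λ x y z → x :+ (y :+ z) := (x :+ y) :+ z) refl _ _ _)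

monomials-* : ∀ {A B : Set} (L : List A) (M : List B) c e c′ e′ → monomials L c e *S monomials M c′ e′ ≈
  monomials (cartesianProduct L M) (λ x → c (proj₁ x) * c′ (proj₂ x)) (λ x → e (proj₁ x) ℕ.+ e′ (proj₂ x))
monomials-* []      M c e c′ e′ = *S-zeroˡ _
monomials-* (a ∷ L) M c e c′ e′ = ≈-trans (*S-distribʳ _ _ _) (≈-trans (+-cong (row M) (monomials-* L M c e c′ e′))
  (≈-sym (monomials-++ (map (a ,_) M) (cartesianProduct L M) _ _)))
  where
  row : ∀ M → constS (c a) *S qpow (e a) *S monomials M c′ e′ ≈ monomials (map (a ,_) M) (λ x → c (proj₁ x) * c′ (proj₂ x)) (λ x → e (proj₁ x) ℕ.+ e′ (proj₂ x))
  row []      = *S-zeroʳ _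
  row (b ∷ M) = ≈-trans (solve 5 (λ c q c′ q′ r → c :* q :* (c′ :* q′ :+ r) := (c :* c′) :* (q :* q′) :+ c :* q :* r) refl (constS (c a)) (qpow (e a)) (constS (c′ b)) (qpow (e′ b)) (monomials M c′ e′))
    (+-cong (*-cong (≈-sym (constS-* (c a) (c′ b))) (qpow-+ (e a) (e′ b))) (row M))

monomials-shift : ∀ {A : Set} o (L : List A) c e → qpow o *S monomials L c e ≈ monomials L c (λ a → o ℕ.+ e a)
monomials-shift o []      c e = *S-zeroʳ _
monomials-shift o (a ∷ L) c e = ≈-trans (solve 4 (λ o c q r → o :* (c :* q :+ r) := c :* (o :* q) :+ o :* r) refl (qpow o) (constS (c a)) (qpow (e a)) (monomials L c e))
  (+-cong (*-congˡ (qpow-+ o (e a))) (monomials-shift o L c e))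

monomials-dil : ∀ {A : Set} k .{{_ : NonZero k}} (L : List A) c e → dil k (monomials L c e) ≈ monomials L c (λ a → k ℕ.* e a)
monomials-dil k []      c e = dil-const k (+ 0)
monomials-dil k (a ∷ L) c e = ≈-trans (dil-+ k _ _) (+-cong (≈-trans (dil-* k _ _) (*-cong (dil-const k (c a)) (dil-qpow k (e a)))) (monomials-dil k L c e))

-- The fibre of e over n then lies in [-n, n], which is also the range of summation in `Nrep`.
record Growing (e : ℤ → ℕ) : Set where
  constructor growing
  field bound : ∀ i → ∣ i ∣ ℕ.≤ e i
open Growing public

intRange-count : ∀ n i → ∣ i ∣ ℕ.≤ n → count ℤ._≟_ (intRange n) i ≡ + 1
intRange-count n i l = trans (sumOver-map (λ k → + k - + n) (upTo (suc (n ℕ.+ n))) (λ b → ind (i ℤ.≟ b)))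
  (trans (sumOver-cong (upTo (suc (n ℕ.+ n))) (λ k → ind-⇔ (i ℤ.≟ + k - + n) (position ℕ.≟ k) (fwd k) (bwd k)))
    (upTo-count (suc (n ℕ.+ n)) position (s≤s pos≤)))
  where
  n≤ : + 0 ℤ.≤ i + + n
  n≤ = subst (ℤ._≤ i + + n) (ℤₚ.+-inverseˡ (+ n)) (ℤₚ.+-monoˡ-≤ (+ n) (ℤₚ.≤-trans (ℤₚ.neg-mono-≤ (ℤ.+≤+ l)) (-∣i∣≤i i)))
    where
    -∣i∣≤i : ∀ i → - + ∣ i ∣ ℤ.≤ i
    -∣i∣≤i (+ zero)  = ℤₚ.≤-refl
    -∣i∣≤i (+ suc n) = ℤ.-≤+
    -∣i∣≤i -[1+ n ]  = ℤₚ.≤-refl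
  position : ℕ
  position = ∣ i + + n ∣
  position-eq : + position ≡ i + + n
  position-eq = ℤₚ.0≤i⇒+∣i∣≡i n≤
  pos≤ : position ℕ.≤ n ℕ.+ n
  pos≤ = ℕₚ.≤-trans (ℤₚ.∣i+j∣≤∣i∣+∣j∣ i (+ n)) (ℕₚ.+-monoˡ-≤ n l)
  cancel : ∀ a b → (a - b) + b ≡ a
  cancel = solve-∀
  cancel′ : ∀ a b → (a + b) - b ≡ a
  cancel′ = solve-∀
  fwd : ∀ k → i ≡ + k - + n → position ≡ k
  fwd k p = ℤₚ.+-injective (trans position-eq (trans (cong (_+ + n) p) (cancel (+ k) (+ n))))
  bwd : ∀ k → position ≡ k → i ≡ + k - + n
  bwd k p = trans (sym (cancel′ i (+ n))) (cong (_- + n) (trans (sym position-eq) (cong +_ p)))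
  upTo-count : ∀ M k → k ℕ.< M → sumOver (upTo M) (λ j → ind (k ℕ.≟ j)) ≡ + 1
  upTo-count M k k<M = trans (cong sumℤ (Listₚ.map-upTo (λ j → ind (k ℕ.≟ j)) M)) (go M k k<M)
    where
    zeros : ∀ M → sumℤ (applyUpTo (λ j → ind (0 ℕ.≟ suc j)) M) ≡ + 0
    zeros zero    = refl
    zeros (suc M) = trans (ℤₚ.+-identityˡ _) (zeros M)
    go : ∀ M k → k ℕ.< M → sumℤ (applyUpTo (λ j → ind (k ℕ.≟ j)) M) ≡ + 1
    go (suc M) zero    _       = cong (λ t → + 1 + t) (zeros M)
    go (suc M) (suc k) (s≤s l) = trans (ℤₚ.+-identityˡ _) (go M k l)

θ : (ℤ → ℤ) → (ℤ → ℕ) → Series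
θ c e n = sumOver (intRange n) (λ i → ind (e i ℕ.≟ n) * c i)

θ-cover : ∀ {e} → Growing e → ∀ M N → N ℕ.≤ M → Cover ℤ._≟_ e N
θ-cover g M N l = cover (intRange M) λ i p → intRange-count M i (ℕₚ.≤-trans (bound g i) (ℕₚ.≤-trans (ℕₚ.≤-reflexive p) l))

θ-total : ∀ {e} (g : Growing e) c n (C : Cover ℤ._≟_ e n) → θ c e n ≡ total C c
θ-total g c n C = total-bijection (θ-cover g n n ℕₚ.≤-refl) C id-≅ {c} {c} (λ _ p → p) (λ _ p → p) (λ _ _ → refl)

θ-trunc : ∀ {e} → Growing e → ∀ c N → θ c e ≈[ suc N ] monomials (intRange N) c e
θ-trunc {e} g c N = below λ k k≤N → trans (θ-total g c k (θ-cover g N k (ℕₚ.≤-pred k≤N))) (sym (monomials-at (intRange N) c e k))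

θ-unique : ∀ {e} → Growing e → ∀ c {f} → (∀ N → f ≈[ suc N ] monomials (intRange N) c e) → f ≈ θ c e
θ-unique g c p = pointwise λ k → trans (at< (p k) k ℕₚ.≤-refl) (sym (at< (θ-trunc g c k) k ℕₚ.≤-refl))

θ-dil : ∀ k .{{_ : NonZero k}} {e} → Growing e → ∀ c → dil k (θ c e) ≈ θ c (λ i → k ℕ.* e i)
θ-dil k@(suc _) {e} g c = θ-unique (growing λ i → ℕₚ.≤-trans (bound g i) (ℕₚ.m≤m+n (e i) _)) c λ N →
  ≈[]-trans (dil-cong[] k (θ-trunc g c N)) (≈⇒≈[] (monomials-dil k (intRange N) c e))

θ-cong : ∀ {c c′ e e′} → (∀ i → c i ≡ c′ i) → (∀ i → e i ≡ e′ i) → θ c e ≈ θ c′ e′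
θ-cong p q = pointwise λ n → sumOver-cong (intRange n) λ i → cong₂ (λ x y → ind (x ℕ.≟ n) * y) (q i) (p i)

-- Used for q ↦ -q, where s n = (-1)^n, and for q d/dq, where s n = n.
θ-diagonal : ∀ (s : ℕ → ℤ) c e → (λ n → s n * θ c e n) ≈ θ (λ i → s (e i) * c i) e
θ-diagonal s c e = pointwise λ n → trans (sym (sumOver-*ˡ (s n) (intRange n) (λ i → ind (e i ℕ.≟ n) * c i)))
  (sumOver-cong (intRange n) λ i → trans (swap (s n) (ind (e i ℕ.≟ n)) (c i)) (ind-*-cong (e i ℕ.≟ n) (λ p → cong (λ t → s t * c i) (sym p))))
  where
  swap : ∀ s i c → s * (i * c) ≡ i * (s * c)
  swap = solve-∀

-- The offset o becomes part of the exponent, so that q^o times a product of two theta series is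
-- again a plain sum over ℤ².
θ²-cover : ∀ {e e′} → Growing e → Growing e′ → ∀ o N → Cover _≟ℤ²_ (λ x → o ℕ.+ (e (proj₁ x) ℕ.+ e′ (proj₂ x))) N
θ²-cover {e} {e′} g g′ o N = cover (cartesianProduct (intRange N) (intRange N)) λ { (i , j) p → begin
    count _≟ℤ²_ (cartesianProduct (intRange N) (intRange N)) (i , j)
      ≡⟨ sumOver-product (intRange N) (intRange N) (λ b → ind ((i , j) ≟ℤ² b)) ⟩
    sumOver (intRange N) (λ k → sumOver (intRange N) (λ l → ind ((i , j) ≟ℤ² (k , l))))
      ≡⟨ sumOver-cong (intRange N) (λ k → sumOver-cong (intRange N) (λ l → split i j k l)) ⟩
    sumOver (intRange N) (λ k → sumOver (intRange N) (λ l → ind (i ℤ.≟ k) * ind (j ℤ.≟ l)))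
      ≡⟨ sumOver-cong (intRange N) (λ k → trans (sumOver-*ˡ (ind (i ℤ.≟ k)) (intRange N) (λ l → ind (j ℤ.≟ l)))
           (trans (cong (ind (i ℤ.≟ k) *_) (intRange-count N j (ℕₚ.≤-trans (bound g′ j) (subst (e′ j ℕ.≤_) p (ℕₚ.≤-trans (ℕₚ.m≤n+m (e′ j) (e i)) (ℕₚ.m≤n+m _ o))))))
             (ℤₚ.*-identityʳ (ind (i ℤ.≟ k))))) ⟩
    sumOver (intRange N) (λ k → ind (i ℤ.≟ k))
      ≡⟨ intRange-count N i (ℕₚ.≤-trans (bound g i) (subst (e i ℕ.≤_) p (ℕₚ.≤-trans (ℕₚ.m≤m+n (e i) (e′ j)) (ℕₚ.m≤n+m _ o)))) ⟩
    + 1 ∎ }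
  where
  split : ∀ i j k l → ind ((i , j) ≟ℤ² (k , l)) ≡ ind (i ℤ.≟ k) * ind (j ℤ.≟ l)
  split i j k l = go (i ℤ.≟ k) (j ℤ.≟ l)
    where
    go : (d : Dec (i ≡ k)) (d′ : Dec (j ≡ l)) → ind ((i , j) ≟ℤ² (k , l)) ≡ ind d * ind d′
    go (yes p) (yes q) = ind-yes ((i , j) ≟ℤ² (k , l)) (cong₂ _,_ p q)
    go (yes p) (no ¬q) = ind-no ((i , j) ≟ℤ² (k , l)) (λ r → ¬q (,-injectiveʳ r))
    go (no ¬p) d′      = ind-no ((i , j) ≟ℤ² (k , l)) (λ r → ¬p (,-injectiveˡ r))

θ²-at : ∀ {e e′} (g : Growing e) (g′ : Growing e′) o N c c′ →
  (qpow o *S (θ c e *S θ c′ e′)) N ≡ total (θ²-cover g g′ o N) (λ x → c (proj₁ x) * c′ (proj₂ x))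
θ²-at {e} {e′} g g′ o N c c′ = trans (at< lhs N ℕₚ.≤-refl) (monomials-at (cartesianProduct (intRange N) (intRange N)) _ _ N)
  where
  lhs : qpow o *S (θ c e *S θ c′ e′) ≈[ suc N ]
    monomials (cartesianProduct (intRange N) (intRange N)) (λ x → c (proj₁ x) * c′ (proj₂ x)) (λ x → o ℕ.+ (e (proj₁ x) ℕ.+ e′ (proj₂ x)))
  lhs = ≈[]-trans (*-cong[] ≈[]-refl (*-cong[] (θ-trunc g c N) (θ-trunc g′ c′ N)))
    (≈⇒≈[] (≈-trans (*-congˡ (monomials-* (intRange N) (intRange N) c e c′ e′)) (monomials-shift o (cartesianProduct (intRange N) (intRange N)) _ _)))

-- Jacobi's triple product

triangle : ℕ → ℕ
triangle zero    = 0
triangle (suc n) = n ℕ.+ triangle n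

-- The exponent A t(t+1)/2 + B t(t-1)/2 of q in the t-th term of the triple product with a = ±qᴬ and b = ±qᴮ.
jexp : ℕ → ℕ → ℤ → ℕ
jexp A B (+ n)    = A ℕ.* n ℕ.+ (A ℕ.+ B) ℕ.* triangle n
jexp A B -[1+ n ] = B ℕ.* suc n ℕ.+ (A ℕ.+ B) ℕ.* triangle (suc n)

-- `triangle n` is n(n-1)/2, not n(n+1)/2.
triangle-double : ∀ n → 2 ℕ.* triangle n ℕ.+ n ≡ n ℕ.* n
triangle-double zero    = refl
triangle-double (suc n) = trans (lem n (triangle n)) (trans (cong (λ t → t ℕ.+ (n ℕ.+ n ℕ.+ 1)) (triangle-double n)) (sqr n))
  where
  lem : ∀ n t → 2 ℕ.* (n ℕ.+ t) ℕ.+ suc n ≡ (2 ℕ.* t ℕ.+ n) ℕ.+ (n ℕ.+ n ℕ.+ 1)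
  lem = ℕ-solve-∀
  sqr : ∀ n → n ℕ.* n ℕ.+ (n ℕ.+ n ℕ.+ 1) ≡ suc n ℕ.* suc n
  sqr = ℕ-solve-∀

private
  jexp-double′ : ∀ A B n t → t + t + n ≡ n * n →
    (A * n + (A + B) * t) + (A * n + (A + B) * t) ≡ (A + B) * (n * n) + (A - B) * n
  jexp-double′ A B n t p = trans (lem A B n t) (cong (λ x → (A + B) * x + (A - B) * n) p)
    where
    lem : ∀ A B n t → (A * n + (A + B) * t) + (A * n + (A + B) * t) ≡ (A + B) * (t + t + n) + (A - B) * n
    lem = solve-∀

  pos-linear : ∀ A B n t → + (A ℕ.* n ℕ.+ (A ℕ.+ B) ℕ.* t) ≡ + A * + n + (+ A + + B) * + t
  pos-linear A B n t = cong₂ _+_ (ℤₚ.pos-* A n) (ℤₚ.pos-* (A ℕ.+ B) t)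

  triangle-doubleℤ : ∀ n → + triangle n + + triangle n + + n ≡ + n * + n
  triangle-doubleℤ n = trans (cong +_ (trans (cong (λ t → triangle n ℕ.+ t ℕ.+ n) (sym (ℕₚ.+-identityʳ _))) (triangle-double n))) (ℤₚ.pos-* n n)

-- Doubling removes the halves and turns the two branches of `jexp` into one polynomial in t, so
-- that exponents can be compared by the ring solver.
jexp-double : ∀ A B t → + jexp A B t + + jexp A B t ≡ (+ A + + B) * (t * t) + (+ A - + B) * t
jexp-double A B (+ n)    = trans (cong₂ _+_ (pos-linear A B n (triangle n)) (pos-linear A B n (triangle n)))
  (jexp-double′ (+ A) (+ B) (+ n) (+ triangle n) (triangle-doubleℤ n))
jexp-double A B -[1+ n ] = trans (cong₂ _+_ eq eq) (trans (jexp-double′ (+ B) (+ A) (+ suc n) (+ triangle (suc n)) (triangle-doubleℤ (suc n)))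
    (flip (+ A) (+ B) (+ suc n)))
  where
  eq : + jexp A B -[1+ n ] ≡ + B * + suc n + (+ B + + A) * + triangle (suc n)
  eq = trans (cong (λ t → + (B ℕ.* suc n ℕ.+ t ℕ.* triangle (suc n))) (ℕₚ.+-comm A B)) (pos-linear B A (suc n) (triangle (suc n)))
  flip : ∀ A B n → (B + A) * (n * n) + (B - A) * n ≡ (A + B) * ((- n) * (- n)) + (A - B) * (- n)
  flip = solve-∀

jexp-growing : ∀ A B .{{_ : NonZero A}} .{{_ : NonZero B}} → Growing (jexp A B)
jexp-growing (suc A) (suc B) = growing λ
  { (+ n)    → ℕₚ.≤-trans (ℕₚ.m≤m+n n (A ℕ.* n)) (ℕₚ.m≤m+n _ _)
  ; -[1+ n ] → ℕₚ.≤-trans (ℕₚ.m≤m+n (suc n) (B ℕ.* suc n)) (ℕₚ.m≤m+n _ _) }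

unit-cancel[] : ∀ {N} c {f g} → c 0 ≢ + 0 → c *S f ≈[ N ] c *S g → f ≈[ N ] g
unit-cancel[] {N} c {f} {g} c≢0 p = below λ n l → ℤₚ.i-j≡0⇒i≡j (f n) (g n) (<-rec (λ n → n ℕ.< N → f n - g n ≡ + 0) step n l)
  where
  h : Series
  h = f +S -S g
  h-at : ∀ n → h n ≡ f n - g n
  h-at n = trans (+S-at f (-S g) n) (cong (λ t → f n + t) (-S-at g n))
  ch : ∀ n → n ℕ.< N → (c *S h) n ≡ + 0
  ch n l = trans (at (solve 3 (λ c f g → c :* (f :- g) := c :* f :- c :* g) refl c f g) n) (trans (+S-at (c *S f) (-S (c *S g)) n)
    (trans (cong (λ t → (c *S f) n + t) (-S-at (c *S g) n)) (ℤₚ.i≡j⇒i-j≡0 (at< p n l))))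
  step : ∀ n → (∀ {i} → i ℕ.< n → i ℕ.< N → f i - g i ≡ + 0) → n ℕ.< N → f n - g n ≡ + 0
  step n rec l with ℤₚ.i*j≡0⇒i≡0∨j≡0 (c 0) (trans (sym (*S-leading c h n (λ i i<n → trans (h-at i) (rec i<n (ℕₚ.<-trans i<n l))))) (ch n l))
  ... | inj₁ q = ⊥-elim (c≢0 q)
  ... | inj₂ q = trans (sym (h-at n)) q

module GaussLimit (D : ℕ) .{{_ : NonZero D}} (p : Series) (p≈ : p ≈ qpow D) where

  P∞ : Series
  P∞ = Prod (- + 1) D D

  poch-∏ : ∀ n → poch p n ≈ ∏ n (λ i → factor (- + 1) (D ℕ.* i ℕ.+ D))
  poch-∏ n = ∏-cong n λ m → +-congˡ (≈-trans (-‿cong (pow m)) (solve 1 (λ q → :- q := con (- + 1) :* q) refl _))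
    where
    pow : ∀ m → p ^ suc m ≈ qpow (D ℕ.* m ℕ.+ D)
    pow m = ≈-trans (pcong (suc m)) (≈-trans (qpow-^ D (suc m)) (pointwise λ k → cong (λ t → qpow t k) (index D m)))
      where
      pcong : ∀ n → p ^ n ≈ qpow D ^ n
      pcong zero    = ≈-refl
      pcong (suc n) = *-cong p≈ (pcong n)
      index : ∀ D m → suc m ℕ.* D ≡ D ℕ.* m ℕ.+ D
      index = ℕ-solve-∀

  P∞-poch : ∀ N M → N ℕ.≤ M → P∞ ≈[ suc N ] poch p M
  P∞-poch N M l = ≈[]-trans (Π∞-trunc (prod-near (- + 1) D D) N M l) (≈⇒≈[] (≈-sym (poch-∏ M)))

  -- In `gauss-poch` all three Pochhammer products equal `P∞` modulo q^(m+1); one factor `P∞` is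
  -- then cancelled.
  gauss-limit : ∀ k l m → m ℕ.≤ k → m ℕ.≤ l → gauss p (k ℕ.+ l) k *S P∞ ≈[ suc m ] constS (+ 1)
  gauss-limit k l m m≤k m≤l = unit-cancel[] P∞ (λ ()) (≈[]-trans
    (≈⇒≈[] (solve 2 (λ g P → P :* (g :* P) := g :* P :* P) refl (gauss p (k ℕ.+ l) k) P∞))
    (≈[]-trans (*-cong[] (*-cong[] ≈[]-refl (P∞-poch m k m≤k)) (P∞-poch m l m≤l))
    (≈[]-trans (≈⇒≈[] (gauss-poch p k l))
    (≈[]-trans (≈[]-sym (P∞-poch m (k ℕ.+ l) (ℕₚ.≤-trans m≤k (ℕₚ.m≤m+n k l)))) (≈⇒≈[] (≈-sym (*S-identityʳ P∞)))))))

  ∣diff∣ : ∀ k N → k ℕ.≤ N → ∣ diff k N ∣ ℕ.+ k ≡ N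
  ∣diff∣ zero    zero    _       = refl
  ∣diff∣ zero    (suc N) _       = ℕₚ.+-identityʳ _
  ∣diff∣ (suc k) (suc N) (s≤s l) = trans (ℕₚ.+-suc _ k) (cong suc (∣diff∣ k N l))

  ∣diff∣′ : ∀ k N → N ℕ.≤ k → ∣ diff k N ∣ ℕ.+ N ≡ k
  ∣diff∣′ k       zero    _       = ℕₚ.+-identityʳ k
  ∣diff∣′ (suc k) (suc N) (s≤s l) = trans (ℕₚ.+-suc _ N) (cong suc (∣diff∣′ k N l))

  -- Let t = k - N. The Gaussian binomial times `P∞` is 1 only up to the power min(k, 2N - k) + 1 of
  -- q, which is poor at the ends of the sum. Since |t| + min(k, 2N - k) = N, the factor q^(e t)
  -- makes up for the loss, except for the slack δ in the growth of e.
  gauss-term : ∀ N k δ (c : ℤ → ℤ) (e : ℤ → ℕ) → k ℕ.< suc (N ℕ.+ N) → (∀ t → ∣ t ∣ ℕ.≤ e t ℕ.+ δ) →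
    gauss p (N ℕ.+ N) k *S P∞ *S (constS (c (diff k N)) *S qpow (e (diff k N))) ≈[ suc N ∸ δ ] constS (c (diff k N)) *S qpow (e (diff k N))
  gauss-term N k δ c e k< e≥ = ≈[]-trans (≈⇒≈[] (solve 3 (λ g c q → g :* (c :* q) := c :* (q :* g)) refl (gauss p (N ℕ.+ N) k *S P∞) (constS (c t)) (qpow (e t))))
    (*-cong[] ≈[]-refl (≈[]-trans core (≈⇒≈[] (*S-identityʳ _))))
    where
    t = diff k N
    bounded : ∀ m → ∣ t ∣ ℕ.+ m ≡ N → suc N ∸ δ ℕ.≤ e t ℕ.+ suc m
    bounded m q = ℕₚ.m≤n+o⇒m∸n≤o (suc N) δ (subst (suc N ℕ.≤_) (arith δ (e t) m) (s≤s (subst (ℕ._≤ e t ℕ.+ δ ℕ.+ m) q (ℕₚ.+-monoˡ-≤ m (e≥ t)))))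
      where
      arith : ∀ δ e m → suc (e ℕ.+ δ ℕ.+ m) ≡ δ ℕ.+ (e ℕ.+ suc m)
      arith = ℕ-solve-∀
    core : qpow (e t) *S (gauss p (N ℕ.+ N) k *S P∞) ≈[ suc N ∸ δ ] qpow (e t) *S constS (+ 1)
    core with ℕₚ.≤-total k N
    ... | inj₁ k≤N = ≈[]-weaken (bounded k (∣diff∣ k N k≤N)) (qpow-cong[] (e t) (subst (λ n → gauss p n k *S P∞ ≈[ suc k ] constS (+ 1))
                       (ℕₚ.m+[n∸m]≡n (ℕₚ.≤-trans k≤N (ℕₚ.m≤m+n N N))) (gauss-limit k (N ℕ.+ N ∸ k) k ℕₚ.≤-refl
                         (ℕₚ.≤-trans k≤N (subst (N ℕ.≤_) (sym (ℕₚ.+-∸-assoc N k≤N)) (ℕₚ.m≤m+n N _))))))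
    ... | inj₂ N≤k = ≈[]-weaken (bounded l (ℕₚ.+-cancelʳ-≡ N (∣ t ∣ ℕ.+ l) N (trans (rearr ∣ t ∣ l N) (trans (cong (ℕ._+ l) (∣diff∣′ k N N≤k)) (ℕₚ.m+[n∸m]≡n (ℕₚ.≤-pred k<))))))
                       (qpow-cong[] (e t) (subst (λ n → gauss p n k *S P∞ ≈[ suc l ] constS (+ 1)) (ℕₚ.m+[n∸m]≡n (ℕₚ.≤-pred k<))
                         (gauss-limit k l l (ℕₚ.≤-trans (ℕₚ.m≤n+o⇒m∸n≤o (N ℕ.+ N) k (ℕₚ.+-mono-≤ N≤k N≤k)) ℕₚ.≤-refl) ℕₚ.≤-refl)))
      where
      l = N ℕ.+ N ∸ k
      rearr : ∀ t l N → t ℕ.+ l ℕ.+ N ≡ t ℕ.+ N ℕ.+ l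
      rearr = ℕ-solve-∀

  ∑-cong[] : ∀ {M} n {f g : ℕ → Series} → (∀ k → k ℕ.< n → f k ≈[ M ] g k) → ∑ n f ≈[ M ] ∑ n g
  ∑-cong[] zero    q = ≈[]-refl
  ∑-cong[] (suc n) q = +-cong[] (q 0 (s≤s z≤n)) (∑-cong[] n (λ k l → q (suc k) (s≤s l)))

  diff-minus : ∀ k N → diff k N ≡ + k - + N
  diff-minus k       zero    = sym (ℤₚ.+-identityʳ (+ k))
  diff-minus zero    (suc N) = refl
  diff-minus (suc k) (suc N) = trans (diff-minus k N) (trans (ℤₚ.m-n≡m⊖n k N) (trans (sym (ℤₚ.[1+m]⊖[1+n]≡m⊖n k N)) (sym (ℤₚ.m-n≡m⊖n (suc k) (suc N)))))

  ∑-monomials : ∀ N c e → ∑ (suc (N ℕ.+ N)) (λ k → constS (c (diff k N)) *S qpow (e (diff k N))) ≈ monomials (intRange N) c e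
  ∑-monomials N c e = ≈-trans (∑-cong (suc (N ℕ.+ N)) (λ k → pointwise λ j → cong (λ t → (constS (c t) *S qpow (e t)) j) (diff-minus k N)))
    (≈-trans (go (suc (N ℕ.+ N)) (λ i → + i - + N)) (pointwise λ j → cong (λ L → monomials L c e j) (sym (Listₚ.map-upTo (λ i → + i - + N) (suc (N ℕ.+ N))))))
    where
    go : ∀ n (h : ℕ → ℤ) → ∑ n (λ k → constS (c (h k)) *S qpow (e (h k))) ≈ monomials (applyUpTo h n) c e
    go zero    h = ≈-refl
    go (suc n) h = +-congˡ (go n (λ k → h (suc k)))

  gauss-sum-limit : ∀ N δ (c : ℤ → ℤ) (e : ℤ → ℕ) (g : ℤ → Series) → (∀ t → g t ≈ constS (c t) *S qpow (e t)) → (∀ t → ∣ t ∣ ℕ.≤ e t ℕ.+ δ) →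
    ∑ (suc (N ℕ.+ N)) (λ k → gauss p (N ℕ.+ N) k *S g (diff k N)) *S P∞ ≈[ suc N ∸ δ ] monomials (intRange N) c e
  gauss-sum-limit N δ c e g g≈ e≥ = ≈[]-trans (≈⇒≈[] (∑-*ʳ (suc (N ℕ.+ N)) (λ k → gauss p (N ℕ.+ N) k *S g (diff k N)) P∞)) (≈[]-trans
    (∑-cong[] (suc (N ℕ.+ N)) λ k k< → ≈[]-trans (≈⇒≈[] (≈-trans (*-congʳ (*-congˡ (g≈ (diff k N))))
        (solve 3 (λ g x P → g :* x :* P := g :* P :* x) refl (gauss p (N ℕ.+ N) k) _ P∞))) (gauss-term N k δ c e k< e≥))
    (≈⇒≈[] (∑-monomials N c e)))

signPow : ℤ → ℤ → ℤ
signPow ε t = ε ℤ.^ ∣ t ∣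

-- The finite identity with a = εq^A, b = εq^B and N factors of each kind is multiplied by `P∞`,
-- which sends the Gaussian binomials to 1. Because ε² = 1, the base ab = q^(A+B) carries no sign.
jacobi-triple-product : ∀ ε A B .{{_ : NonZero A}} .{{_ : NonZero B}} .{{_ : NonZero (A ℕ.+ B)}} → ε * ε ≡ + 1 →
  θ (signPow ε) (jexp A B) ≈ Prod (- + 1) (A ℕ.+ B) (A ℕ.+ B) *S (Prod ε (A ℕ.+ B) A *S Prod ε (A ℕ.+ B) B)
jacobi-triple-product ε A B ε² = ≈-sym (θ-unique (jexp-growing A B) (signPow ε) λ N →
  ≈[]-trans (≈[]-trans (*-cong[] ≈[]-refl (*-cong[] (Π∞-trunc (prod-near ε D A) N N ℕₚ.≤-refl) (Π∞-trunc (prod-near ε D B) N N ℕₚ.≤-refl)))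
    (≈⇒≈[] (≈-trans (*S-comm _ _) (*-congʳ (≈-trans (*-cong (∏-cong N (fac A a a≈)) (∏-cong N (fac B b b≈)))
      (finite-triple-product a b N N (suc (N ℕ.+ N)) ℕₚ.≤-refl))))))
    (gauss-sum-limit N 0 (signPow ε) (jexp A B) (mono a b) mono≈ (λ t → ℕₚ.≤-trans (bound (jexp-growing A B) t) (ℕₚ.m≤m+n _ 0))))
  where
  D = A ℕ.+ B
  a b : Series
  a = constS ε *S qpow A
  b = constS ε *S qpow B
  a≈ : a ≈ constS ε *S qpow A
  a≈ = ≈-refl
  b≈ : b ≈ constS ε *S qpow B
  b≈ = ≈-refl
  p≈ : a *S b ≈ qpow D
  p≈ = ≈-trans (solve 3 (λ e x y → e :* x :* (e :* y) := e :* e :* (x :* y)) refl (constS ε) (qpow A) (qpow B))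
    (≈-trans (*-cong (≈-trans (≈-sym (constS-* ε ε)) (pointwise λ j → cong (λ z → constS z j) ε²)) (qpow-+ A B)) (*S-identityˡ _))
  open GaussLimit D (a *S b) p≈
  pow : ∀ m → (a *S b) ^ m ≈ qpow (m ℕ.* D)
  pow zero    = ≈-refl
  pow (suc m) = ≈-trans (*-cong p≈ (pow m)) (qpow-+ D (m ℕ.* D))
  fac : ∀ C c → c ≈ constS ε *S qpow C → ∀ m → factor ε (D ℕ.* m ℕ.+ C) ≈ constS (+ 1) +S c *S (a *S b) ^ m
  fac C c c≈ m = +-congˡ (≈-sym (≈-trans (*-cong c≈ (pow m)) (≈-trans (*S-assoc _ _ _) (*-congˡ (≈-trans (qpow-+ C (m ℕ.* D)) (pointwise λ j → cong (λ t → qpow t j) (index C m D)))))))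
    where
    index : ∀ C m D → C ℕ.+ m ℕ.* D ≡ D ℕ.* m ℕ.+ C
    index = ℕ-solve-∀
  powTri≈ : ∀ C c → c ≈ constS ε *S qpow C → ∀ n → powTri (a *S b) c n ≈ constS (ε ℤ.^ n) *S qpow (C ℕ.* n ℕ.+ D ℕ.* triangle n)
  powTri≈ C c c≈ zero    = ≈-trans (≈-sym (*S-identityˡ _)) (*-congˡ (pointwise λ j → cong (λ t → qpow t j) (sym (cong₂ ℕ._+_ (ℕₚ.*-zeroʳ C) (ℕₚ.*-zeroʳ D)))))
  powTri≈ C c c≈ (suc n) = ≈-trans (*-cong (powTri≈ C c c≈ n) (*-cong c≈ (pow n)))
    (≈-trans (solve 5 (λ e x f y z → (e :* x) :* (f :* y :* z) := (f :* e) :* (x :* (y :* z))) refl (constS (ε ℤ.^ n)) _ (constS ε) _ _)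
    (*-cong (≈-sym (constS-* ε (ε ℤ.^ n))) (≈-trans (*-congˡ (qpow-+ C (n ℕ.* D))) (≈-trans (qpow-+ (C ℕ.* n ℕ.+ D ℕ.* triangle n) (C ℕ.+ n ℕ.* D)) (pointwise λ j → cong (λ t → qpow t j) (index C n D (triangle n)))))))
    where
    index : ∀ C n D t → C ℕ.* n ℕ.+ D ℕ.* t ℕ.+ (C ℕ.+ n ℕ.* D) ≡ C ℕ.* suc n ℕ.+ D ℕ.* (n ℕ.+ t)
    index = ℕ-solve-∀
  mono≈ : ∀ t → mono a b t ≈ constS (signPow ε t) *S qpow (jexp A B t)
  mono≈ (+ n)    = powTri≈ A a a≈ n
  mono≈ -[1+ n ] = powTri≈ B b b≈ (suc n)

sgnℤ : ℤ → ℤ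
sgnℤ = signPow (- + 1)

private
  -1^ : ℕ → ℤ
  -1^ n = (- + 1) ℤ.^ n

  -1^² : ∀ n → -1^ n * -1^ n ≡ + 1
  -1^² zero    = refl
  -1^² (suc n) = trans (lem (-1^ n)) (-1^² n)
    where
    lem : ∀ x → (- + 1 * x) * (- + 1 * x) ≡ x * x
    lem = solve-∀

  sgnℤ-⊖ : ∀ m n → sgnℤ (m ℤ.⊖ n) ≡ -1^ m * -1^ n
  sgnℤ-⊖ m       zero    = sym (ℤₚ.*-identityʳ _)
  sgnℤ-⊖ zero    (suc n) = sym (ℤₚ.*-identityˡ _)
  sgnℤ-⊖ (suc m) (suc n) = trans (cong sgnℤ (ℤₚ.[1+m]⊖[1+n]≡m⊖n m n)) (trans (sgnℤ-⊖ m n) (lem (-1^ m) (-1^ n)))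
    where
    lem : ∀ x y → x * y ≡ (- + 1 * x) * (- + 1 * y)
    lem = solve-∀

sgnℤ-+ : ∀ s t → sgnℤ (s + t) ≡ sgnℤ s * sgnℤ t
sgnℤ-+ (+ m)    (+ n)    = ℤₚ.^-distribˡ-+-* (- + 1) m n
sgnℤ-+ (+ m)    -[1+ n ] = sgnℤ-⊖ m (suc n)
sgnℤ-+ -[1+ m ] (+ n)    = trans (sgnℤ-⊖ n (suc m)) (ℤₚ.*-comm (-1^ n) _)
sgnℤ-+ -[1+ m ] -[1+ n ] = trans (cong (λ t → -1^ (suc t)) (sym (ℕₚ.+-suc m n))) (ℤₚ.^-distribˡ-+-* (- + 1) (suc m) (suc n))

sgnℤ-neg : ∀ t → sgnℤ (- t) ≡ sgnℤ t
sgnℤ-neg t = cong -1^ (ℤₚ.∣-i∣≡∣i∣ t)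

sgnℤ² : ∀ t → sgnℤ t * sgnℤ t ≡ + 1
sgnℤ² t = -1^² ∣ t ∣

sgnℤ-even : ∀ t → sgnℤ (t + t) ≡ + 1
sgnℤ-even t = trans (sgnℤ-+ t t) (sgnℤ² t)

double-injective : ∀ m n → + m + + m ≡ + n + + n → m ≡ n
double-injective m n p = ℕₚ.*-cancelʳ-≡ m n 2 (trans (lem m) (trans (ℤₚ.+-injective p) (sym (lem n))))
  where
  lem : ∀ m → m ℕ.* 2 ≡ m ℕ.+ m
  lem = ℕ-solve-∀

total-neg : ∀ {A : Set} {_≟_ : DecidableEquality A} {E N} (C : Cover _≟_ E N) (c : A → ℤ) →
  total C (λ a → - c a) ≡ - total C c
total-neg C c = trans (total-cong C (λ a → lem (c a))) (trans (total-*ˡ C (- + 1) c) (sym (lem (total C c))))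
  where
  lem : ∀ x → - x ≡ (- + 1) * x
  lem = solve-∀

-- Dual numbers and Jacobi's formula for the cube of Euler's product

module DualNumbers where

  -- The pair (f, f′) stands for f + εf′ with ε² = 0, so the second component of a product is the
  -- product rule.
  Dual : Set
  Dual = Series × Series

  infix 4 _≈ᴰ_
  record _≈ᴰ_ (x y : Dual) : Set where
    constructor _،_
    field
      fst≈ : proj₁ x ≈ proj₁ y
      snd≈ : proj₂ x ≈ proj₂ y
  open _≈ᴰ_ public

  infixl 6 _+ᴰ_
  infixl 7 _*ᴰ_
  _+ᴰ_ _*ᴰ_ : Dual → Dual → Dual
  (f , f′) +ᴰ (g , g′) = f +S g , f′ +S g′
  (f , f′) *ᴰ (g , g′) = f *S g , f *S g′ +S f′ *S g

  -ᴰ_ : Dual → Dual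
  -ᴰ (f , f′) = -S f , -S f′

  ιᴰ : ℤ → Dual
  ιᴰ z = constS z , constS (+ 0)

  dualRing : CommutativeRing _ _
  dualRing = record
    { Carrier = Dual ; _≈_ = _≈ᴰ_ ; _+_ = _+ᴰ_ ; _*_ = _*ᴰ_ ; -_ = -ᴰ_ ; 0# = ιᴰ (+ 0) ; 1# = ιᴰ (+ 1)
    ; isCommutativeRing = record
      { isRing = record
        { +-isAbelianGroup = record
          { isGroup = record
            { isMonoid = record
              { isSemigroup = record
                { isMagma = record
                  { isEquivalence = record
                    { refl = ≈-refl ، ≈-refl
                    ; sym = λ p → ≈-sym (fst≈ p) ، ≈-sym (snd≈ p)
                    ; trans = λ p q → ≈-trans (fst≈ p) (fst≈ q) ، ≈-trans (snd≈ p) (snd≈ q) }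
                  ; ∙-cong = λ p q → +-cong (fst≈ p) (fst≈ q) ، +-cong (snd≈ p) (snd≈ q) }
                ; assoc = λ { (f , f′) (g , g′) (h , h′) → S.+-assoc f g h ، S.+-assoc f′ g′ h′ } }
              ; identity = (λ { (f , f′) → S.+-identityˡ f ، S.+-identityˡ f′ }) , (λ { (f , f′) → S.+-identityʳ f ، S.+-identityʳ f′ }) }
            ; inverse = (λ { (f , f′) → S.-‿inverseˡ f ، S.-‿inverseˡ f′ }) , (λ { (f , f′) → S.-‿inverseʳ f ، S.-‿inverseʳ f′ })
            ; ⁻¹-cong = λ p → -‿cong (fst≈ p) ، -‿cong (snd≈ p) }
          ; comm = λ { (f , f′) (g , g′) → S.+-comm f g ، S.+-comm f′ g′ } }
        ; *-cong = λ p q → *-cong (fst≈ p) (fst≈ q) ، +-cong (*-cong (fst≈ p) (snd≈ q)) (*-cong (snd≈ p) (fst≈ q))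
        ; *-assoc = λ { (f , f′) (g , g′) (h , h′) → S.*-assoc f g h ،
            solve 6 (λ f f′ g g′ h h′ → f :* g :* h′ :+ (f :* g′ :+ f′ :* g) :* h := f :* (g :* h′ :+ g′ :* h) :+ f′ :* (g :* h)) refl f f′ g g′ h h′ }
        ; *-identity = (λ { (f , f′) → S.*-identityˡ f ، solve 2 (λ f f′ → con (+ 1) :* f′ :+ con (+ 0) :* f := f′) refl f f′ })
                     , (λ { (f , f′) → S.*-identityʳ f ، solve 2 (λ f f′ → f :* con (+ 0) :+ f′ :* con (+ 1) := f′) refl f f′ })
        ; distrib = (λ { (f , f′) (g , g′) (h , h′) → S.distribˡ f g h ،
                       solve 6 (λ f f′ g g′ h h′ → f :* (g′ :+ h′) :+ f′ :* (g :+ h) := (f :* g′ :+ f′ :* g) :+ (f :* h′ :+ f′ :* h)) refl f f′ g g′ h h′ })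
                  , (λ { (f , f′) (g , g′) (h , h′) → S.distribʳ f g h ،
                       solve 6 (λ f f′ g g′ h h′ → (g :+ h) :* f′ :+ (g′ :+ h′) :* f := (g :* f′ :+ g′ :* f) :+ (h :* f′ :+ h′ :* f)) refl f f′ g g′ h h′ }) }
      ; *-comm = λ { (f , f′) (g , g′) → S.*-comm f g ، solve 4 (λ f f′ g g′ → f :* g′ :+ f′ :* g := g :* f′ :+ g′ :* f) refl f f′ g g′ } }
    }
    where module S = CommutativeRing seriesRing

  ιᴰ-+ : ∀ x y → ιᴰ (x + y) ≈ᴰ ιᴰ x +ᴰ ιᴰ y
  ιᴰ-+ x y = constS-+ x y ، solve 0 (con (+ 0) := con (+ 0) :+ con (+ 0)) refl

  ιᴰ-* : ∀ x y → ιᴰ (x * y) ≈ᴰ ιᴰ x *ᴰ ιᴰ y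
  ιᴰ-* x y = constS-* x y ، solve 2 (λ x y → con (+ 0) := x :* con (+ 0) :+ con (+ 0) :* y) refl (constS x) (constS y)

  dualAlgebra : ℤ-Algebra
  dualAlgebra = record { commutativeRing = dualRing ; ι = ιᴰ ; ι-+ = ιᴰ-+ ; ι-* = ιᴰ-* ; ι-0 = CommutativeRing.refl dualRing ; ι-1 = CommutativeRing.refl dualRing }

  module D = FiniteTripleProduct dualAlgebra
  module DR = CommutativeRing dualRing
  module DP = PolySolver dualAlgebra

-- Jacobi's identity for the cube is the derivative of the triple product at a = -1;
-- the derivative is taken with dual numbers, a = -(1 + ε), b = -q(1 - ε), so that ab = q.
module EulerCube where
  open DualNumbers

  q : Series
  q = qpow 1

  a b : Dual
  a = constS (- + 1) , constS (- + 1)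
  b = -S q , q

  p : Dual
  p = a *ᴰ b

  -- The base of the Gaussian binomials is free of ε, so that differentiation affects only the
  -- monomials.
  p≈ : p ≈ᴰ (q , constS (+ 0))
  p≈ = solve 1 (λ q → con (- + 1) :* :- q := q) refl q ، solve 1 (λ q → con (- + 1) :* q :+ con (- + 1) :* :- q := con (+ 0)) refl q

  p^ : ∀ n → p DP.^ n ≈ᴰ (q ^ n , constS (+ 0))
  p^ zero    = DR.refl
  p^ (suc n) = DR.trans (DR.*-cong p≈ (p^ n)) (≈-refl ، solve 2 (λ x y → x :* con (+ 0) :+ con (+ 0) :* y := con (+ 0)) refl q (q ^ n))

  gaussᴰ : ∀ n k → D.gauss p n k ≈ᴰ (gauss q n k , constS (+ 0))
  gaussᴰ n       zero    = DR.refl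
  gaussᴰ zero    (suc k) = DR.refl
  gaussᴰ (suc n) (suc k) = DR.trans (DR.+-cong (gaussᴰ n k) (DR.*-cong (p^ (suc k)) (gaussᴰ n (suc k))))
    (≈-refl ، solve 2 (λ x y → con (+ 0) :+ (x :* con (+ 0) :+ con (+ 0) :* y) := con (+ 0)) refl (q ^ suc k) (gauss q n (suc k)))

  termᴰ : ℤ → ℕ → ℤ → Dual
  termᴰ z e t = constS z *S qpow e , constS (z * t) *S qpow e

  weight : ℤ → ℤ
  weight t = sgnℤ t * t

  q^ : ∀ n → q ^ n ≈ qpow n
  q^ n = ≈-trans (qpow-^ 1 n) (pointwise λ j → cong (λ t → qpow t j) (ℕₚ.*-identityʳ n))

  private
    constS-≡ : ∀ {x y} → x ≡ y → constS x ≈ constS y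
    constS-≡ refl = ≈-refl
    qpow-≡ : ∀ {x y} → x ≡ y → qpow x ≈ qpow y
    qpow-≡ refl = ≈-refl

  -- The factor t of the weight comes from (1 + ε)^t = 1 + tε, the sign from a = -(1 + ε).
  monoᴰ : ∀ t → D.mono a b t ≈ᴰ (constS (sgnℤ t) *S qpow (jexp 0 1 t) , constS (weight t) *S qpow (jexp 0 1 t))
  monoᴰ (+ n) = DR.trans (go n) (*-congˡ (qpow-≡ (sym (ℕₚ.+-identityʳ (triangle n)))) ، *-congˡ (qpow-≡ (sym (ℕₚ.+-identityʳ (triangle n)))))
    where
    go : ∀ n → D.powTri p a n ≈ᴰ termᴰ ((- + 1) ℤ.^ n) (triangle n) (+ n)
    go zero    = ≈-sym (*S-identityˡ _) ، solve 0 (con (+ 0) := con (+ 0) :* con (+ 1)) refl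
    go (suc n) = DR.trans (DR.*-cong (go n) (DR.*-cong (DR.refl {a}) (DR.trans (p^ n) (q^ n ، ≈-refl))))
      ( ≈-trans (solve 3 (λ s e f → s :* e :* (con (- + 1) :* f) := con (- + 1) :* s :* (f :* e)) refl (constS (s n)) (qpow (triangle n)) (qpow n))
          (*-cong (≈-sym (constS-* (- + 1) (s n))) (qpow-+ n (triangle n)))
      ، ≈-trans (solve 4 (λ s st e f → s :* e :* (con (- + 1) :* con (+ 0) :+ con (- + 1) :* f) :+ st :* e :* (con (- + 1) :* f)
                            := (con (- + 1) :* s :+ con (- + 1) :* st) :* (f :* e)) refl (constS (s n)) (constS (s n * + n)) (qpow (triangle n)) (qpow n))
          (*-cong (≈-trans (+-cong (≈-sym (constS-* (- + 1) (s n))) (≈-sym (constS-* (- + 1) (s n * + n)))) (≈-trans (≈-sym (constS-+ (- + 1 * s n) (- + 1 * (s n * + n))))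
             (constS-≡ (lem (s n) (+ n))))) (qpow-+ n (triangle n))) )
      where
      s : ℕ → ℤ
      s n = (- + 1) ℤ.^ n
      lem : ∀ s n → - + 1 * s + - + 1 * (s * n) ≡ (- + 1 * s) * (+ 1 + n)
      lem = solve-∀
  monoᴰ -[1+ m ] = DR.trans (go (suc m)) (*-congˡ (qpow-≡ (index m (triangle (suc m)))) ، *-congˡ (qpow-≡ (index m (triangle (suc m)))))
    where
    index : ∀ m t → suc m ℕ.+ t ≡ 1 ℕ.* suc m ℕ.+ (0 ℕ.+ 1) ℕ.* t
    index = ℕ-solve-∀
    go : ∀ n → D.powTri p b n ≈ᴰ termᴰ ((- + 1) ℤ.^ n) (n ℕ.+ triangle n) (- + n)
    go zero    = ≈-sym (*S-identityˡ _) ، solve 0 (con (+ 0) := con (+ 0) :* con (+ 1)) refl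
    go (suc n) = DR.trans (DR.*-cong (go n) (DR.*-cong (DR.refl {b}) (DR.trans (p^ n) (q^ n ، ≈-refl))))
      ( ≈-trans (solve 4 (λ s e f q → s :* e :* (:- q :* f) := con (- + 1) :* s :* (q :* (f :* e))) refl (constS (s n)) (qpow (n ℕ.+ triangle n)) (qpow n) q)
          (*-cong (≈-sym (constS-* (- + 1) (s n))) exps)
      ، ≈-trans (solve 5 (λ s st e f q → s :* e :* (:- q :* con (+ 0) :+ q :* f) :+ st :* e :* (:- q :* f)
                            := (s :+ con (- + 1) :* st) :* (q :* (f :* e))) refl (constS (s n)) (constS (s n * - + n)) (qpow (n ℕ.+ triangle n)) (qpow n) q)
          (*-cong (≈-trans (+-congˡ (≈-sym (constS-* (- + 1) (s n * - + n)))) (≈-trans (≈-sym (constS-+ (s n) (- + 1 * (s n * - + n))))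
             (constS-≡ (trans (lem (s n) (+ n)) (cong ((- + 1 * s n) *_) (cong -_ (refl {x = + suc n}))))))) exps) )
      where
      s : ℕ → ℤ
      s n = (- + 1) ℤ.^ n
      lem : ∀ s n → s + - + 1 * (s * - n) ≡ (- + 1 * s) * (- (+ 1 + n))
      lem = solve-∀
      exps : q *S (qpow n *S qpow (n ℕ.+ triangle n)) ≈ qpow (suc n ℕ.+ triangle (suc n))
      exps = ≈-trans (*-congˡ (qpow-+ n _)) (qpow-+ 1 _)

  -- The factor with m = 0 is 1 + a = -ε, so that in the others ε may be set to 0.
  leftᴰ : ∀ N → D.∏ (suc N) (λ m → ιᴰ (+ 1) +ᴰ a *ᴰ p DP.^ m) ≈ᴰ (constS (+ 0) , -S poch q N)
  leftᴰ zero    = solve 0 (con (+ 1) :* (con (+ 1) :+ con (- + 1) :* con (+ 1)) := con (+ 0)) refl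
                ، solve 0 (con (+ 1) :* (con (+ 0) :+ (con (- + 1) :* con (+ 0) :+ con (- + 1) :* con (+ 1))) :+ con (+ 0) :* (con (+ 1) :+ con (- + 1) :* con (+ 1)) := :- con (+ 1)) refl
  leftᴰ (suc N) = DR.trans (DR.*-cong (leftᴰ N) (DR.+-congˡ (DR.*-congˡ (p^ (suc N)))))
    ( solve 1 (λ f → con (+ 0) :* (con (+ 1) :+ con (- + 1) :* f) := con (+ 0)) refl (q ^ suc N)
    ، solve 2 (λ P f → con (+ 0) :* (con (+ 0) :+ (con (- + 1) :* con (+ 0) :+ con (- + 1) :* f)) :+ :- P :* (con (+ 1) :+ con (- + 1) :* f)
                  := :- (P :* (con (+ 1) :+ :- f))) refl (poch q N) (q ^ suc N) )

  -- The first component suffices, since this product is multiplied by a multiple of ε.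
  rightᴰ : ∀ N → proj₁ (D.∏ N (λ m → ιᴰ (+ 1) +ᴰ b *ᴰ p DP.^ m)) ≈ poch q N
  rightᴰ zero    = ≈-refl
  rightᴰ (suc N) = *-cong (rightᴰ N) (+-congˡ (≈-trans (*-congˡ (fst≈ (p^ N))) (solve 2 (λ q f → :- q :* f := :- (q :* f)) refl q (q ^ N))))

  ∑ᴰ : ∀ n (f : ℕ → Dual) → proj₂ (D.∑ n f) ≈ ∑ n (λ k → proj₂ (f k))
  ∑ᴰ zero    f = ≈-refl
  ∑ᴰ (suc n) f = +-congˡ (∑ᴰ n _)

  finite : ∀ N → -S (poch q N *S poch q (suc N)) ≈ ∑ (suc (suc N ℕ.+ suc N)) (λ k → gauss q (suc N ℕ.+ suc N) k *S (constS (weight (diff k (suc N))) *S qpow (jexp 0 1 (diff k (suc N)))))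
  finite N = ≈-trans (≈-trans (solve 3 (λ P Q R → :- (P :* Q) := con (+ 0) :* R :+ :- P :* Q) refl (poch q N) (poch q (suc N)) _)
      (snd≈ (DR.sym (DR.trans (DR.*-cong (leftᴰ N) (rightᴰ (suc N) ، ≈-refl)) (≈-refl ، ≈-refl)))))
    (≈-trans (snd≈ (D.finite-triple-product a b (suc N) (suc N) (suc (suc N ℕ.+ suc N)) ℕₚ.≤-refl))
    (≈-trans (∑ᴰ (suc (suc N ℕ.+ suc N)) (λ k → D.gauss p (suc N ℕ.+ suc N) k *ᴰ D.mono a b (diff k (suc N)))) (∑-cong (suc (suc N ℕ.+ suc N)) λ k →
      ≈-trans (snd≈ (DR.*-cong (gaussᴰ (suc N ℕ.+ suc N) k) (monoᴰ (diff k (suc N)))))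
        (solve 3 (λ g x y → g :* x :+ con (+ 0) :* y := g :* x) refl _ _ _))))

  open GaussLimit 1 q ≈-refl

  -- The exponent t(t-1)/2 is still 0 at t = 1; hence the slack δ = 1 and the larger range in
  -- `fibre`.
  slow : ∀ t → ∣ t ∣ ℕ.≤ jexp 0 1 t ℕ.+ 1
  slow (+ n)    = subst (λ s → n ℕ.≤ s ℕ.+ 1) (sym (ℕₚ.+-identityʳ (triangle n))) (n≤ n)
    where
    n≤ : ∀ n → n ℕ.≤ triangle n ℕ.+ 1
    n≤ zero          = z≤n
    n≤ (suc zero)    = ℕₚ.≤-refl
    n≤ (suc (suc n)) = subst (suc (suc n) ℕ.≤_) (ℕₚ.+-comm 1 (triangle (suc (suc n)))) (s≤s (ℕₚ.m≤m+n (suc n) _))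
  slow -[1+ n ] = ℕₚ.≤-trans (ℕₚ.≤-reflexive (sym (ℕₚ.*-identityˡ (suc n)))) (ℕₚ.≤-trans (ℕₚ.m≤m+n _ _) (ℕₚ.m≤m+n _ 1))

  limit : ∀ N → -S (Euler *S Euler *S Euler) ≈[ suc N ] monomials (intRange (suc N)) weight (jexp 0 1)
  limit N = ≈[]-trans (≈[]-trans (≈⇒≈[] (solve 1 (λ P → :- (P :* P :* P) := con (- + 1) :* (P :* P) :* P) refl P∞))
      (≈[]-trans (*-cong[] (*-cong[] ≈[]-refl (*-cong[] (P∞-poch N N ℕₚ.≤-refl) (P∞-poch N (suc N) (ℕₚ.n≤1+n N)))) ≈[]-refl)
        (≈⇒≈[] (*-congʳ (≈-trans (solve 1 (λ P → con (- + 1) :* P := :- P) refl _) (finite N))))))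
    (gauss-sum-limit (suc N) 1 weight (jexp 0 1) (λ t → constS (weight t) *S qpow (jexp 0 1 t)) (λ _ → ≈-refl) slow)

  fibre : ∀ n → Cover ℤ._≟_ (jexp 0 1) n
  fibre n = cover (intRange (suc n)) λ t p → intRange-count (suc n) t
    (ℕₚ.≤-trans (slow t) (ℕₚ.≤-reflexive (trans (ℕₚ.+-comm (jexp 0 1 t) 1) (cong suc p))))

  cube-at : ∀ n → (-S (Euler *S Euler *S Euler)) n ≡ total (fibre n) weight
  cube-at n = trans (at< (limit n) n ℕₚ.≤-refl) (monomials-at (intRange (suc n)) weight (jexp 0 1) n)

  dissected : ∀ n → Cover (≡-dec Fin._≟_ ℤ._≟_) (λ x → jexp 0 1 (to (residues 2) x)) n
  dissected n = pull (fibre n) (residues 2)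

  -- Jacobi's sum of (-1)^n (2n + 1) q^(n(n+1)/2) over n ≥ 0, with n = 2i for i ≥ 0 and n = -2i - 1
  -- for i < 0: over all integers i the sign is that of 4i + 1.
  J : Series
  J = θ (λ i → + 4 * i + + 1) (jexp 3 1)

  even-exp : ∀ i → jexp 3 1 i ≡ jexp 0 1 (+ 0 + (- i) * + 2)
  even-exp i = double-injective _ _ (trans (jexp-double 3 1 i) (trans (lem i) (sym (jexp-double 0 1 (+ 0 + (- i) * + 2)))))
    where
    lem : ∀ i → + 4 * (i * i) + + 2 * i ≡ + 1 * ((+ 0 + (- i) * + 2) * (+ 0 + (- i) * + 2)) + - + 1 * (+ 0 + (- i) * + 2)
    lem = solve-∀

  odd-exp : ∀ i → jexp 3 1 i ≡ jexp 0 1 (+ 1 + i * + 2)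
  odd-exp i = double-injective _ _ (trans (jexp-double 3 1 i) (trans (lem i) (sym (jexp-double 0 1 (+ 1 + i * + 2)))))
    where
    lem : ∀ i → + 4 * (i * i) + + 2 * i ≡ + 1 * ((+ 1 + i * + 2) * (+ 1 + i * + 2)) + - + 1 * (+ 1 + i * + 2)
    lem = solve-∀

  negate : ℤ ≅ ℤ
  negate = bijection -_ -_ ℤₚ.neg-involutive ℤₚ.neg-involutive

  sgnℤ-even+ : ∀ j i → sgnℤ (j + i * + 2) ≡ sgnℤ j
  sgnℤ-even+ j i = trans (sgnℤ-+ j (i * + 2)) (trans (cong (sgnℤ j *_) (trans (cong sgnℤ (lem i)) (sgnℤ-even i))) (ℤₚ.*-identityʳ (sgnℤ j)))
    where
    lem : ∀ i → i * + 2 ≡ i + i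
    lem = solve-∀

  -- The indices t = -2i and t = 2i + 1 share the exponent t(t-1)/2 = 2i² + i; their weights -2i and
  -- -(2i + 1) add up to -(4i + 1).
  cube : Euler *S Euler *S Euler ≈ J
  cube = ≈-trans (solve 1 (λ x → x := :- (:- x)) refl (Euler *S Euler *S Euler)) (pointwise λ n → trans (-S-at (-S (Euler *S Euler *S Euler)) n) (trans (cong -_ (main n)) (ℤₚ.neg-involutive (J n))))
    where
    g : Growing (jexp 3 1)
    g = jexp-growing 3 1
    main : ∀ n → (-S (Euler *S Euler *S Euler)) n ≡ - J n
    main n = begin
      (-S (Euler *S Euler *S Euler)) n
        ≡⟨ cube-at n ⟩
      total (fibre n) weight
        ≡⟨ total-pull {_≟A_ = ≡-dec Fin._≟_ ℤ._≟_} (fibre n) (residues 2) weight ⟨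
      total (dissected n) (λ x → weight (to (residues 2) x))
        ≡⟨ total-slices (dissected n) (λ x → weight (to (residues 2) x)) ⟩
      total (slice (dissected n) zero) (λ k → weight (+ 0 + k * + 2)) + (total (slice (dissected n) (suc zero)) (λ k → weight (+ 1 + k * + 2)) + + 0)
        ≡⟨ cong₂ _+_
             (total-bijection (θ-cover g n n ℕₚ.≤-refl) (slice (dissected n) zero) negate {λ i → - (+ 2 * i)} {λ k → weight (+ 0 + k * + 2)}
               (λ i p → trans (sym (even-exp i)) p) (λ i p → trans (even-exp i) p)
               (λ i _ → sym (trans (cong (_* (+ 0 + (- i) * + 2)) (sgnℤ-even+ (+ 0) (- i))) (evenW i))))
             (trans (total-bijection (θ-cover g n n ℕₚ.≤-refl) (slice (dissected n) (suc zero)) id-≅ {λ i → - (+ 1 + i * + 2)} {λ k → weight (+ 1 + k * + 2)}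
               (λ i p → trans (sym (odd-exp i)) p) (λ i p → trans (odd-exp i) p)
               (λ i _ → sym (trans (cong (_* (+ 1 + i * + 2)) (sgnℤ-even+ (+ 1) i)) (oddW i))))
              (sym (ℤₚ.+-identityʳ _))) ⟨
      total (θ-cover g n n ℕₚ.≤-refl) (λ i → - (+ 2 * i)) + total (θ-cover g n n ℕₚ.≤-refl) (λ i → - (+ 1 + i * + 2))
        ≡⟨ total-+ (θ-cover g n n ℕₚ.≤-refl) (λ i → - (+ 2 * i)) (λ i → - (+ 1 + i * + 2)) ⟨
      total (θ-cover g n n ℕₚ.≤-refl) (λ i → - (+ 2 * i) + - (+ 1 + i * + 2))
        ≡⟨ total-cong (θ-cover g n n ℕₚ.≤-refl) sumW ⟩
      total (θ-cover g n n ℕₚ.≤-refl) (λ i → - (+ 4 * i + + 1))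
        ≡⟨ total-neg (θ-cover g n n ℕₚ.≤-refl) (λ i → + 4 * i + + 1) ⟩
      - J n ∎
      where
      evenW : ∀ i → + 1 * (+ 0 + (- i) * + 2) ≡ - (+ 2 * i)
      evenW = solve-∀
      oddW : ∀ i → - + 1 * (+ 1 + i * + 2) ≡ - (+ 1 + i * + 2)
      oddW = solve-∀
      sumW : ∀ i → - (+ 2 * i) + - (+ 1 + i * + 2) ≡ - (+ 4 * i + + 1)
      sumW = solve-∀

open EulerCube using (negate; sgnℤ-even+)

-- Bijections of ℤ and ℤ² for matching lattice sums

reflect : ℤ → ℤ ≅ ℤ
reflect u = bijection (λ i → u - i) (λ i → u - i) (lem u) (lem u)
  where
  lem : ∀ u i → u - (u - i) ≡ i
  lem = solve-∀

translate : ℤ → ℤ ≅ ℤ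
translate u = bijection (λ i → i + u) (λ i → i - u) (lem u) (lem′ u)
  where
  lem : ∀ u i → (i - u) + u ≡ i
  lem = solve-∀
  lem′ : ∀ u i → (i + u) - u ≡ i
  lem′ = solve-∀

onFst : ∀ {A B C : Set} → A ≅ B → (A × C) ≅ (B × C)
onFst σ = bijection (λ x → to σ (proj₁ x) , proj₂ x) (λ x → from σ (proj₁ x) , proj₂ x)
  (λ x → cong (_, proj₂ x) (to-from σ (proj₁ x))) (λ x → cong (_, proj₂ x) (from-to σ (proj₁ x)))

swap-≅ : ∀ {A B : Set} → (A × B) ≅ (B × A)
swap-≅ = bijection (λ x → proj₂ x , proj₁ x) (λ x → proj₂ x , proj₁ x) (λ _ → refl) (λ _ → refl)

onSnd : ∀ {A B C : Set} → A ≅ B → (C × A) ≅ (C × B)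
onSnd σ = swap-≅ ∘≅ onFst σ ∘≅ swap-≅

fibrewise : (ℤ → ℤ ≅ ℤ) → (ℤ × ℤ) ≅ (ℤ × ℤ)
fibrewise σ = bijection (λ x → proj₁ x , to (σ (proj₁ x)) (proj₂ x)) (λ x → proj₁ x , from (σ (proj₁ x)) (proj₂ x))
  (λ x → cong (proj₁ x ,_) (to-from (σ (proj₁ x)) (proj₂ x))) (λ x → cong (proj₁ x ,_) (from-to (σ (proj₁ x)) (proj₂ x)))

shear : ℤ → (ℤ × ℤ) ≅ (ℤ × ℤ)
shear c = fibrewise (λ i → translate (c * i))

-- (i, j) ↦ (i + cj, j), whereas `shear c` is (i, j) ↦ (i, j + ci).
shear′ : ℤ → (ℤ × ℤ) ≅ (ℤ × ℤ)
shear′ c = swap-≅ ∘≅ shear c ∘≅ swap-≅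

assoc-≅ : ∀ {A B C : Set} → (A × (B × C)) ≅ ((A × B) × C)
assoc-≅ = bijection (λ x → (proj₁ x , proj₁ (proj₂ x)) , proj₂ (proj₂ x)) (λ x → proj₁ (proj₁ x) , (proj₂ (proj₁ x) , proj₂ x)) (λ _ → refl) (λ _ → refl)

residues₂ : ∀ d .{{_ : NonZero d}} → (Fin d × (ℤ × ℤ)) ≅ (ℤ × ℤ)
residues₂ d = onFst (residues d) ∘≅ assoc-≅

_≟Fin×ℤ_ : ∀ {d} → DecidableEquality (Fin d × ℤ)
_≟Fin×ℤ_ = ≡-dec Fin._≟_ ℤ._≟_

_≟Fin×ℤ²_ : ∀ {d} → DecidableEquality (Fin d × (ℤ × ℤ))
_≟Fin×ℤ²_ = ≡-dec Fin._≟_ _≟ℤ²_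

total-θ : ∀ {e E n} (g : Growing e) (C : Cover ℤ._≟_ E n) (σ : ℤ ≅ ℤ) (c : ℤ → ℤ) {cE : ℤ → ℤ} →
  (∀ i → e i ≡ E (to σ i)) → (∀ i → c i ≡ cE (to σ i)) → total C cE ≡ θ c e n
total-θ {n = n} g C σ c {cE} eqE eqc = sym (total-bijection (θ-cover g n n ℕₚ.≤-refl) C σ {c} {cE}
  (λ i p → trans (sym (eqE i)) p) (λ i p → trans (eqE i) p) (λ i _ → eqc i))

total-θ² : ∀ {e e′ E n} o (g : Growing e) (g′ : Growing e′) (C : Cover _≟ℤ²_ E n) (σ : (ℤ × ℤ) ≅ (ℤ × ℤ)) s (c c′ : ℤ → ℤ) {cE : ℤ × ℤ → ℤ} →
  (∀ i j → o ℕ.+ (e i ℕ.+ e′ j) ≡ E (to σ (i , j))) → (∀ i j → s * (c i * c′ j) ≡ cE (to σ (i , j))) →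
  total C cE ≡ s * (qpow o *S (θ c e *S θ c′ e′)) n
total-θ² {n = n} o g g′ C σ s c c′ {cE} eqE eqc = trans (sym (total-bijection K C σ {λ x → s * (c (proj₁ x) * c′ (proj₂ x))} {cE}
    (λ x p → trans (sym (eqE (proj₁ x) (proj₂ x))) p) (λ x p → trans (eqE (proj₁ x) (proj₂ x)) p) (λ x _ → eqc (proj₁ x) (proj₂ x))))
  (trans (total-*ˡ K s (λ x → c (proj₁ x) * c′ (proj₂ x))) (cong (s *_) (sym (θ²-at g g′ o n c c′))))
  where K = θ²-cover g g′ o n

growing-* : ∀ k .{{_ : NonZero k}} {e} → Growing e → Growing (λ i → k ℕ.* e i)
growing-* (suc k) {e} g = growing λ i → ℕₚ.≤-trans (bound g i) (ℕₚ.m≤m+n (e i) _)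

θ-shift : ∀ o {e} → Growing e → ∀ c → qpow o *S θ c e ≈ θ c (λ i → o ℕ.+ e i)
θ-shift o {e} g c = θ-unique (growing λ i → ℕₚ.≤-trans (bound g i) (ℕₚ.m≤n+m (e i) o)) c λ N →
  ≈[]-trans (*-cong[] ≈[]-refl (θ-trunc g c N)) (≈⇒≈[] (monomials-shift o (intRange N) c e))

-- The functions φ and ψ and the dissection of φ modulo 4

one : ℤ → ℤ
one _ = + 1

-- The exponents of ψ are 2i² + i over all integers i: these are the n(n+1)/2 for n ≥ 0, with n = 2i
-- or n = -2i - 1.
φ ψ : Series
φ = θ one (jexp 1 1)
ψ = θ one (jexp 3 1)

gφ : Growing (jexp 1 1)
gφ = jexp-growing 1 1

gψ : Growing (jexp 3 1)
gψ = jexp-growing 3 1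

jexp-square : ∀ t → + jexp 1 1 t ≡ t * t
jexp-square t = ℤₚ.*-cancelʳ-≡ (+ jexp 1 1 t) (t * t) (+ 2) (trans (lem (+ jexp 1 1 t)) (trans (jexp-double 1 1 t) (lem′ t)))
  where
  lem : ∀ x → x * + 2 ≡ x + x
  lem = solve-∀
  lem′ : ∀ t → (+ 1 + + 1) * (t * t) + (+ 1 - + 1) * t ≡ t * t * + 2
  lem′ = solve-∀

jexp-ψ : ∀ t → + jexp 3 1 t ≡ + 2 * (t * t) + t
jexp-ψ t = ℤₚ.*-cancelʳ-≡ (+ jexp 3 1 t) (+ 2 * (t * t) + t) (+ 2) (trans (lem (+ jexp 3 1 t)) (trans (jexp-double 3 1 t) (lem′ t)))
  where
  lem : ∀ x → x * + 2 ≡ x + x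
  lem = solve-∀
  lem′ : ∀ t → (+ 3 + + 1) * (t * t) + (+ 3 - + 1) * t ≡ (+ 2 * (t * t) + t) * + 2
  lem′ = solve-∀

private
  pos-*-eq : ∀ k n {x} → + n ≡ x → + (k ℕ.* n) ≡ + k * x
  pos-*-eq k n p = trans (ℤₚ.pos-* k n) (cong (+ k *_) p)

-- Even indices give φ(q⁴). Odd ones are 4i + 1 or -(4i + 1), both with square 1 + 8(2i² + i); this
-- accounts for the factor 2.
φ-dissect : φ ≈ dil 4 φ +S constS (+ 2) *S (qpow 1 *S dil 8 ψ)
φ-dissect = ≈-trans (pointwise main) (≈-sym (+-cong (θ-dil 4 gφ one) (*-congˡ (≈-trans (*-congˡ (θ-dil 8 gψ one)) (θ-shift 1 (growing-* 8 gψ) one)))))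
  where
  e₄ e₈ : ℤ → ℕ
  e₄ i = 4 ℕ.* jexp 1 1 i
  e₈ i = 1 ℕ.+ 8 ℕ.* jexp 3 1 i
  g₈ : Growing e₈
  g₈ = growing λ i → ℕₚ.≤-trans (bound (growing-* 8 gψ) i) (ℕₚ.n≤1+n _)
  evens : ∀ i → e₄ i ≡ jexp 1 1 (+ 0 + i * + 2)
  evens i = ℤₚ.+-injective (trans (pos-*-eq 4 _ (jexp-square i)) (trans (lem i) (sym (jexp-square (+ 0 + i * + 2)))))
    where
    lem : ∀ i → + 4 * (i * i) ≡ (+ 0 + i * + 2) * (+ 0 + i * + 2)
    lem = solve-∀
  odds₀ : ∀ i → e₈ i ≡ jexp 1 1 (+ 1 + (+ 0 + i * + 2) * + 2)
  odds₀ i = ℤₚ.+-injective (trans (cong (λ t → + 1 + t) (pos-*-eq 8 _ (jexp-ψ i))) (trans (lem i) (sym (jexp-square (+ 1 + (+ 0 + i * + 2) * + 2)))))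
    where
    lem : ∀ i → + 1 + + 8 * (+ 2 * (i * i) + i) ≡ (+ 1 + (+ 0 + i * + 2) * + 2) * (+ 1 + (+ 0 + i * + 2) * + 2)
    lem = solve-∀
  odds₁ : ∀ i → e₈ i ≡ jexp 1 1 (+ 1 + (+ 1 + (- + 1 - i) * + 2) * + 2)
  odds₁ i = ℤₚ.+-injective (trans (cong (λ t → + 1 + t) (pos-*-eq 8 _ (jexp-ψ i))) (trans (lem i) (sym (jexp-square (+ 1 + (+ 1 + (- + 1 - i) * + 2) * + 2)))))
    where
    lem : ∀ i → + 1 + + 8 * (+ 2 * (i * i) + i) ≡ (+ 1 + (+ 1 + (- + 1 - i) * + 2) * + 2) * (+ 1 + (+ 1 + (- + 1 - i) * + 2) * + 2)
    lem = solve-∀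
  main : ∀ n → φ n ≡ (θ one e₄ +S constS (+ 2) *S θ one e₈) n
  main n = begin
    total C one
      ≡⟨ total-pull {_≟A_ = _≟Fin×ℤ_} C (residues 2) one ⟨
    total C₂ one×
      ≡⟨ total-slices C₂ one× ⟩
    total (slice C₂ zero) one + (total C₃ one + + 0)
      ≡⟨ cong₂ (λ s t → s + (t + + 0)) (total-θ (growing-* 4 gφ) (slice C₂ zero) id-≅ one evens (λ _ → refl)) odd ⟩
    θ one e₄ n + (+ 2 * θ one e₈ n + + 0)
      ≡⟨ cong (λ t → θ one e₄ n + t) (ℤₚ.+-identityʳ (+ 2 * θ one e₈ n)) ⟩
    θ one e₄ n + + 2 * θ one e₈ n
      ≡⟨ trans (+S-at (θ one e₄) (constS (+ 2) *S θ one e₈) n) (cong (λ t → θ one e₄ n + t) (constS-*ᵏ n (+ 2) (θ one e₈))) ⟨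
    (θ one e₄ +S constS (+ 2) *S θ one e₈) n ∎
    where
    one× : ∀ {d} → Fin d × ℤ → ℤ
    one× _ = + 1
    C = θ-cover gφ n n ℕₚ.≤-refl
    C₂ = pull {_≟A_ = _≟Fin×ℤ_} C (residues 2)
    C₃ = slice C₂ (suc zero)
    C₄ = pull {_≟A_ = _≟Fin×ℤ_} C₃ (residues 2)
    odd : total C₃ one ≡ + 2 * θ one e₈ n
    odd = begin
      total C₃ one
        ≡⟨ total-pull {_≟A_ = _≟Fin×ℤ_} C₃ (residues 2) one ⟨
      total C₄ one×
        ≡⟨ total-slices C₄ one× ⟩
      total (slice C₄ zero) one + (total (slice C₄ (suc zero)) one + + 0)
        ≡⟨ cong₂ (λ s t → s + (t + + 0)) (total-θ g₈ (slice C₄ zero) id-≅ one odds₀ (λ _ → refl))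
             (total-θ g₈ (slice C₄ (suc zero)) (reflect (- + 1)) one odds₁ (λ _ → refl)) ⟩
      θ one e₈ n + (θ one e₈ n + + 0)
        ≡⟨ lem (θ one e₈ n) ⟩
      + 2 * θ one e₈ n ∎
      where
      lem : ∀ x → x + (x + + 0) ≡ + 2 * x
      lem = solve-∀

-- Relations of level 5 from lattice sums

f19 f37 : Series
f19 = θ one (jexp 9 1)
f37 = θ one (jexp 7 3)

private
  unhalf : ∀ x y → x + x ≡ y * + 2 → x ≡ y
  unhalf x y p = ℤₚ.*-cancelʳ-≡ x y (+ 2) (trans (lem x) p)
    where
    lem : ∀ x → x * + 2 ≡ x + x
    lem = solve-∀

jexp-91 : ∀ t → + jexp 9 1 t ≡ + 5 * (t * t) + + 4 * t
jexp-91 t = unhalf _ _ (trans (jexp-double 9 1 t) (lem t))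
  where
  lem : ∀ t → + 10 * (t * t) + + 8 * t ≡ (+ 5 * (t * t) + + 4 * t) * + 2
  lem = solve-∀

jexp-73 : ∀ t → + jexp 7 3 t ≡ + 5 * (t * t) + + 2 * t
jexp-73 t = unhalf _ _ (trans (jexp-double 7 3 t) (lem t))
  where
  lem : ∀ t → + 10 * (t * t) + + 4 * t ≡ (+ 5 * (t * t) + + 2 * t) * + 2
  lem = solve-∀

-- φ(q)² sums q^N(z) over the Gaussian integers z; the five residue classes modulo 2 + i are the class of 0,
-- which gives φ(q⁵)², and four classes permuted by the units.
φ²-dissect : φ *S φ ≈ dil 5 φ *S dil 5 φ +S constS (+ 4) *S (qpow 1 *S (f19 *S f37))
φ²-dissect = ≈-trans (≈-sym (*S-identityˡ _)) (≈-trans (pointwise main)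
  (+-congʳ (≈-trans (*S-identityˡ _) (≈-sym (*-cong (θ-dil 5 gφ one) (θ-dil 5 gφ one))))))
  where
  e₅ : ℤ → ℕ
  e₅ i = 5 ℕ.* jexp 1 1 i
  g₅ : Growing e₅
  g₅ = growing-* 5 gφ
  g₉ : Growing (jexp 9 1)
  g₉ = jexp-growing 9 1
  g₇ : Growing (jexp 7 3)
  g₇ = jexp-growing 7 3
  form : ∀ m n → + (0 ℕ.+ (jexp 1 1 m ℕ.+ jexp 1 1 n)) ≡ m * m + n * n
  form m n = cong₂ _+_ (jexp-square m) (jexp-square n)
  form₅ : ∀ i j → + (0 ℕ.+ (e₅ i ℕ.+ e₅ j)) ≡ + 5 * (i * i) + + 5 * (j * j)
  form₅ i j = cong₂ _+_ (pos-*-eq 5 _ (jexp-square i)) (pos-*-eq 5 _ (jexp-square j))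
  form₉₇ : ∀ i j → + (1 ℕ.+ (jexp 9 1 i ℕ.+ jexp 7 3 j)) ≡ + 1 + ((+ 5 * (i * i) + + 4 * i) + (+ 5 * (j * j) + + 2 * j))
  form₉₇ i j = cong (λ t → + 1 + t) (cong₂ _+_ (jexp-91 i) (jexp-73 j))
  -- Modulo 2 + i the unit i is congruent to -2, so the class of m + ni is m - 2n modulo 5; hence
  -- the coordinates m = j + 5l + 2n.
  ρ : (Fin 5 × (ℤ × ℤ)) ≅ (ℤ × ℤ)
  ρ = shear′ (+ 2) ∘≅ residues₂ 5
  -- On the class c the number (2 - i)(m + ni) has coordinates 2m + n ≡ 2c and 2n - m ≡ -c modulo 5.
  -- For c ≠ 0 these are, in some order and up to signs, 5i + 2 and 5j + 1 with new variables i and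
  -- j, and 5(m² + n²) = (5i + 2)² + (5j + 1)²; the bijections solve for m and n.
  ρ₀ ρ₁ ρ₂ ρ₃ ρ₄ : (ℤ × ℤ) ≅ (ℤ × ℤ)
  ρ₀ = shear (- + 2) ∘≅ swap-≅
  ρ₁ = ρ₀
  ρ₂ = shear (- + 2) ∘≅ onSnd (reflect (- + 1))
  ρ₃ = shear (- + 2) ∘≅ onSnd (translate (- + 1)) ∘≅ onFst (reflect (- + 1))
  ρ₄ = shear (- + 2) ∘≅ swap-≅ ∘≅ onSnd (reflect (- + 1)) ∘≅ onFst (reflect (- + 2))
  at-ρ : ∀ j x → + (0 ℕ.+ (jexp 1 1 (proj₁ (to ρ (j , x))) ℕ.+ jexp 1 1 (proj₂ (to ρ (j , x))))) ≡
    (((+ toℕ j + proj₁ x * + 5) + + 2 * proj₂ x) * ((+ toℕ j + proj₁ x * + 5) + + 2 * proj₂ x)) + proj₂ x * proj₂ x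
  at-ρ j x = form ((+ toℕ j + proj₁ x * + 5) + + 2 * proj₂ x) (proj₂ x)
  main : ∀ n → (qpow 0 *S (φ *S φ)) n ≡ (qpow 0 *S (θ one e₅ *S θ one e₅) +S constS (+ 4) *S (qpow 1 *S (f19 *S f37))) n
  main n = begin
    (qpow 0 *S (φ *S φ)) n
      ≡⟨ θ²-at gφ gφ 0 n one one ⟩
    total C one²
      ≡⟨ total-pull {_≟A_ = _≟Fin×ℤ²_} C ρ one² ⟨
    total C₅ one²
      ≡⟨ total-slices C₅ one² ⟩
    total (slice C₅ zero) one² + (total (slice C₅ (suc zero)) one² + (total (slice C₅ (suc (suc zero))) one² +
      (total (slice C₅ (suc (suc (suc zero)))) one² + (total (slice C₅ (suc (suc (suc (suc zero))))) one² + + 0))))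
      ≡⟨ cong₂ _+_ (total-θ² 0 g₅ g₅ (slice C₅ zero) ρ₀ (+ 1) one one
            (λ i j → ℤₚ.+-injective (trans (form₅ i j) (trans (lem₀ i j) (sym (at-ρ zero (to ρ₀ (i , j))))))) (λ _ _ → refl))
         (cong₂ _+_ (total-θ² 1 g₉ g₇ (slice C₅ (suc zero)) ρ₁ (+ 1) one one
            (λ i j → ℤₚ.+-injective (trans (form₉₇ i j) (trans (lem₁ i j) (sym (at-ρ (suc zero) (to ρ₁ (i , j))))))) (λ _ _ → refl))
         (cong₂ _+_ (total-θ² 1 g₉ g₇ (slice C₅ (suc (suc zero))) ρ₂ (+ 1) one one
            (λ i j → ℤₚ.+-injective (trans (form₉₇ i j) (trans (lem₂ i j) (sym (at-ρ (suc (suc zero)) (to ρ₂ (i , j))))))) (λ _ _ → refl))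
         (cong₂ _+_ (total-θ² 1 g₉ g₇ (slice C₅ (suc (suc (suc zero)))) ρ₃ (+ 1) one one
            (λ i j → ℤₚ.+-injective (trans (form₉₇ i j) (trans (lem₃ i j) (sym (at-ρ (suc (suc (suc zero))) (to ρ₃ (i , j))))))) (λ _ _ → refl))
         (cong (_+ + 0) (total-θ² 1 g₉ g₇ (slice C₅ (suc (suc (suc (suc zero))))) ρ₄ (+ 1) one one
            (λ i j → ℤₚ.+-injective (trans (form₉₇ i j) (trans (lem₄ i j) (sym (at-ρ (suc (suc (suc (suc zero)))) (to ρ₄ (i , j))))))) (λ _ _ → refl)))))) ⟩
    + 1 * S₀ + (+ 1 * S₁ + (+ 1 * S₁ + (+ 1 * S₁ + (+ 1 * S₁ + + 0))))
      ≡⟨ collect S₀ S₁ ⟩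
    S₀ + + 4 * S₁
      ≡⟨ trans (+S-at (qpow 0 *S (θ one e₅ *S θ one e₅)) (constS (+ 4) *S (qpow 1 *S (f19 *S f37))) n) (cong (λ t → S₀ + t) (constS-*ᵏ n (+ 4) (qpow 1 *S (f19 *S f37)))) ⟨
    (qpow 0 *S (θ one e₅ *S θ one e₅) +S constS (+ 4) *S (qpow 1 *S (f19 *S f37))) n ∎
    where
    one² : ∀ {A : Set} → A → ℤ
    one² _ = + 1
    C = θ²-cover gφ gφ 0 n
    C₅ = pull {_≟A_ = _≟Fin×ℤ²_} C ρ
    S₀ = (qpow 0 *S (θ one e₅ *S θ one e₅)) n
    S₁ = (qpow 1 *S (f19 *S f37)) n
    collect : ∀ a b → + 1 * a + (+ 1 * b + (+ 1 * b + (+ 1 * b + (+ 1 * b + + 0)))) ≡ a + + 4 * b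
    collect = solve-∀
    lem₀ : ∀ i j → + 5 * (i * i) + + 5 * (j * j) ≡
      (((+ 0 + j * + 5) + + 2 * (i + - + 2 * j)) * ((+ 0 + j * + 5) + + 2 * (i + - + 2 * j))) + (i + - + 2 * j) * (i + - + 2 * j)
    lem₀ = solve-∀
    lem₁ : ∀ i j → + 1 + ((+ 5 * (i * i) + + 4 * i) + (+ 5 * (j * j) + + 2 * j)) ≡
      (((+ 1 + j * + 5) + + 2 * (i + - + 2 * j)) * ((+ 1 + j * + 5) + + 2 * (i + - + 2 * j))) + (i + - + 2 * j) * (i + - + 2 * j)
    lem₁ = solve-∀
    lem₂ : ∀ i j → let n = (- + 1 - j) + - + 2 * i in + 1 + ((+ 5 * (i * i) + + 4 * i) + (+ 5 * (j * j) + + 2 * j)) ≡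
      (((+ 2 + i * + 5) + + 2 * n) * ((+ 2 + i * + 5) + + 2 * n)) + n * n
    lem₂ = solve-∀
    lem₃ : ∀ i j → let k = - + 1 - i ; n = (j + - + 1) + - + 2 * k in + 1 + ((+ 5 * (i * i) + + 4 * i) + (+ 5 * (j * j) + + 2 * j)) ≡
      (((+ 3 + k * + 5) + + 2 * n) * ((+ 3 + k * + 5) + + 2 * n)) + n * n
    lem₃ = solve-∀
    lem₄ : ∀ i j → let k = - + 1 - j ; n = (- + 2 - i) + - + 2 * k in + 1 + ((+ 5 * (i * i) + + 4 * i) + (+ 5 * (j * j) + + 2 * j)) ≡
      (((+ 4 + k * + 5) + + 2 * n) * ((+ 4 + k * + 5) + + 2 * n)) + n * n
    lem₄ = solve-∀

open EulerCube using (J)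

total-zero : ∀ {A : Set} {_≟_ : DecidableEquality A} {E N} (C : Cover _≟_ E N) {c : A → ℤ} → (∀ a → c a ≡ + 0) → total C c ≡ + 0
total-zero C p = trans (total-cong C p) (total-*ˡ C (+ 0) (λ _ → + 0))

total-antisymmetric : ∀ {A : Set} {_≟_ : DecidableEquality A} {E N} (C : Cover _≟_ E N) (ι : A ≅ A) (c : A → ℤ) →
  (∀ a → E a ≡ E (to ι a)) → (∀ a → c a ≡ - c (to ι a)) → total C c ≡ + 0
total-antisymmetric C ι c eqE eqc = self-neg _ (trans (total-bijection C C ι {c} {λ a → - c a}
  (λ a p → trans (sym (eqE a)) p) (λ a p → trans (eqE a) p) (λ a _ → eqc a)) (total-neg C c))
  where
  self-neg : ∀ x → x ≡ - x → x ≡ + 0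
  self-neg (+ zero) _ = refl

sgnφ : ∀ t → sgn (jexp 1 1 t) ≡ sgnℤ t
sgnφ t = trans (sgn-pow (jexp 1 1 t)) (trans (cong sgnℤ (jexp-square t)) (go t))
  where
  sgn-pow : ∀ n → sgn n ≡ sgnℤ (+ n)
  sgn-pow zero    = refl
  sgn-pow (suc n) = trans (cong -_ (sgn-pow n)) (sym (ℤₚ.-1*i≡-i _))
  mult : ∀ n t → sgnℤ (+ n * t) ≡ sgnℤ t ℤ.^ n
  mult zero    t = cong sgnℤ (ℤₚ.*-zeroˡ t)
  mult (suc n) t = trans (cong sgnℤ (lem (+ n) t)) (trans (sgnℤ-+ t (+ n * t)) (cong (sgnℤ t *_) (mult n t)))
    where
    lem : ∀ n t → (+ 1 + n) * t ≡ t + n * t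
    lem = solve-∀
  odd-power : ∀ n → sgnℤ (+ n) ℤ.^ n ≡ sgnℤ (+ n)
  odd-power zero    = refl
  odd-power (suc n) = trans (ℤₚ.^-*-assoc (- + 1) (suc n) (suc n)) (trans (cong ((- + 1) ℤ.^_) (sym (triangle-double (suc n))))
    (trans (ℤₚ.^-distribˡ-+-* (- + 1) (2 ℕ.* triangle (suc n)) (suc n)) (trans (cong (_* sgnℤ (+ suc n))
      (trans (sym (ℤₚ.^-*-assoc (- + 1) 2 (triangle (suc n)))) (ℤₚ.^-zeroˡ (triangle (suc n))))) (ℤₚ.*-identityˡ _))))
  go : ∀ t → sgnℤ (t * t) ≡ sgnℤ t
  go (+ n)    = trans (mult n (+ n)) (odd-power n)
  go -[1+ n ] = trans (cong sgnℤ (lem (+ suc n))) (go (+ suc n))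
    where
    lem : ∀ x → (- x) * (- x) ≡ x * x
    lem = solve-∀

alt-φ : alt φ ≈ θ sgnℤ (jexp 1 1)
alt-φ = ≈-trans (θ-diagonal sgn one (jexp 1 1)) (θ-cong {λ i → sgn (jexp 1 1 i) * one i} {sgnℤ} {jexp 1 1} {jexp 1 1} (λ i → trans (ℤₚ.*-identityʳ (sgn (jexp 1 1 i))) (sgnφ i)) (λ _ → refl))

pentagonal : Series
pentagonal = θ sgnℤ (jexp 2 1)

-- The left-hand side is a sum over m² + 5n². The terms with 3 ∤ m + n are matched with products of pentagonal numbers through
-- 6(m² + 5n²) = (m - 5n)² + 5(m + n)²; those with m + n = 3k cancel under n ↦ k - n.
φφ₅-dissect : φ *S dil 5 (alt φ) +S -S (alt φ *S dil 5 φ) ≈ constS (+ 4) *S (qpow 1 *S (dil 4 pentagonal *S dil 20 pentagonal))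
φφ₅-dissect = ≈-trans (+-cong (≈-trans (*-congˡ (≈-trans (dil-cong 5 alt-φ) (θ-dil 5 gφ sgnℤ))) (≈-sym (*S-identityˡ _)))
    (-‿cong (≈-trans (*-cong alt-φ (θ-dil 5 gφ one)) (≈-sym (*S-identityˡ _)))))
  (≈-trans (pointwise main) (*-congˡ (*-congˡ (≈-sym (*-cong (θ-dil 4 g₂₁ sgnℤ) (θ-dil 20 g₂₁ sgnℤ))))))
  where
  g₂₁ : Growing (jexp 2 1)
  g₂₁ = jexp-growing 2 1
  e₅ e₄ e₂₀ : ℤ → ℕ
  e₅ i  = 5 ℕ.* jexp 1 1 i
  e₄ i  = 4 ℕ.* jexp 2 1 i
  e₂₀ i = 20 ℕ.* jexp 2 1 i
  g₅ : Growing e₅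
  g₅ = growing-* 5 gφ
  form : ∀ m n → + (0 ℕ.+ (jexp 1 1 m ℕ.+ e₅ n)) ≡ m * m + + 5 * (n * n)
  form m n = cong₂ _+_ (jexp-square m) (pos-*-eq 5 _ (jexp-square n))
  twice : ∀ k t → + (2 ℕ.* k ℕ.* jexp 2 1 t) ≡ + k * (+ 3 * (t * t) + t)
  twice k t = trans (trans (ℤₚ.pos-* (2 ℕ.* k) (jexp 2 1 t)) (cong (_* + jexp 2 1 t) (ℤₚ.pos-* 2 k))) (trans (lem (+ k) (+ jexp 2 1 t))
    (cong (+ k *_) (trans (jexp-double 2 1 t) (lem′ t))))
    where
    lem : ∀ k x → + 2 * k * x ≡ k * (x + x)
    lem = solve-∀
    lem′ : ∀ t → + 3 * (t * t) + + 1 * t ≡ + 3 * (t * t) + t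
    lem′ = solve-∀
  form′ : ∀ i j → + (1 ℕ.+ (e₄ i ℕ.+ e₂₀ j)) ≡ + 1 + (+ 2 * (+ 3 * (i * i) + i) + + 10 * (+ 3 * (j * j) + j))
  form′ i j = cong (λ t → + 1 + t) (cong₂ _+_ (twice 2 i) (twice 10 j))
  -- The finite index is the class of m + n modulo 6, so m = j + 6l - n.
  ρ : (Fin 6 × (ℤ × ℤ)) ≅ (ℤ × ℤ)
  ρ = shear′ (- + 1) ∘≅ residues₂ 6
  M : ℤ → ℤ × ℤ → ℤ
  M j x = (j + proj₁ x * + 6) + - + 1 * proj₂ x
  sgn-M : ∀ j x → sgnℤ (M j x) ≡ sgnℤ j * sgnℤ (proj₂ x)
  sgn-M j (l , n) = trans (sgnℤ-+ (j + l * + 6) (- + 1 * n)) (cong₂ _*_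
    (trans (cong (λ t → sgnℤ (j + t)) (six l)) (sgnℤ-even+ j (+ 3 * l)))
    (trans (cong sgnℤ (ℤₚ.-1*i≡-i n)) (sgnℤ-neg n)))
    where
    six : ∀ l → l * + 6 ≡ + 3 * l * + 2
    six = solve-∀
  w : ℤ × ℤ → ℤ
  w x = sgnℤ (proj₂ x) - sgnℤ (proj₁ x)
  -- If m + n is even, then (-1)^m = (-1)^n; only the classes 1, 3 and 5 contribute.
  w-even : ∀ (j : Fin 6) → sgnℤ (+ toℕ j) ≡ + 1 → ∀ x → w (to ρ (j , x)) ≡ + 0
  w-even j s x = trans (cong (λ t → sgnℤ (proj₂ x) - t) (trans (sgn-M (+ toℕ j) x) (trans (cong (_* sgnℤ (proj₂ x)) s) (ℤₚ.*-identityˡ _)))) (ℤₚ.+-inverseʳ (sgnℤ (proj₂ x)))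
  w-odd : ∀ (j : Fin 6) → sgnℤ (+ toℕ j) ≡ - + 1 → ∀ x → w (to ρ (j , x)) ≡ + 2 * sgnℤ (proj₂ x)
  w-odd j s x = trans (cong (λ t → sgnℤ (proj₂ x) - t) (trans (sgn-M (+ toℕ j) x) (cong (_* sgnℤ (proj₂ x)) s))) (lem (sgnℤ (proj₂ x)))
    where
    lem : ∀ x → x - (- + 1 * x) ≡ + 2 * x
    lem = solve-∀
  -- `ρ₁` and `ρ₅` solve m - 5n = ±(6i + 1), m + n = ±(6j + 1), with the upper sign for class 1 and
  -- the lower one for class 5. `ρ₃` is the reflection n ↦ k - n on the points with m + n = 3k, k
  -- odd.
  ρ₁ ρ₃ ρ₅ : (ℤ × ℤ) ≅ (ℤ × ℤ)
  ρ₁ = shear (+ 1) ∘≅ swap-≅ ∘≅ onFst negate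
  ρ₅ = onFst (reflect (- + 1)) ∘≅ shear (- + 1) ∘≅ swap-≅
  ρ₃ = fibrewise (λ l → reflect (+ 1 + l * + 2))
  at-ρ : ∀ j x → + (0 ℕ.+ (jexp 1 1 (proj₁ (to ρ (j , x))) ℕ.+ e₅ (proj₂ (to ρ (j , x))))) ≡ M (+ toℕ j) x * M (+ toℕ j) x + + 5 * (proj₂ x * proj₂ x)
  at-ρ j x = form (M (+ toℕ j) x) (proj₂ x)
  main : ∀ n → (qpow 0 *S (θ one (jexp 1 1) *S θ sgnℤ e₅) +S -S (qpow 0 *S (θ sgnℤ (jexp 1 1) *S θ one e₅))) n ≡ (constS (+ 4) *S (qpow 1 *S (θ sgnℤ e₄ *S θ sgnℤ e₂₀))) n
  main n = begin
    (qpow 0 *S (θ one (jexp 1 1) *S θ sgnℤ e₅) +S -S (qpow 0 *S (θ sgnℤ (jexp 1 1) *S θ one e₅))) n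
      ≡⟨ trans (+S-at (qpow 0 *S (θ one (jexp 1 1) *S θ sgnℤ e₅)) (-S (qpow 0 *S (θ sgnℤ (jexp 1 1) *S θ one e₅))) n)
           (cong₂ _+_ (θ²-at gφ g₅ 0 n one sgnℤ) (trans (-S-at (qpow 0 *S (θ sgnℤ (jexp 1 1) *S θ one e₅)) n) (cong -_ (θ²-at gφ g₅ 0 n sgnℤ one)))) ⟩
    total C (λ x → + 1 * sgnℤ (proj₂ x)) + - total C (λ x → sgnℤ (proj₁ x) * + 1)
      ≡⟨ cong (λ t → total C (λ x → + 1 * sgnℤ (proj₂ x)) + t) (total-neg C (λ x → sgnℤ (proj₁ x) * + 1)) ⟨
    total C (λ x → + 1 * sgnℤ (proj₂ x)) + total C (λ x → - (sgnℤ (proj₁ x) * + 1))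
      ≡⟨ total-+ C (λ x → + 1 * sgnℤ (proj₂ x)) (λ x → - (sgnℤ (proj₁ x) * + 1)) ⟨
    total C (λ x → + 1 * sgnℤ (proj₂ x) + - (sgnℤ (proj₁ x) * + 1))
      ≡⟨ total-cong C (λ x → tidy (sgnℤ (proj₂ x)) (sgnℤ (proj₁ x))) ⟩
    total C w
      ≡⟨ total-pull {_≟A_ = _≟Fin×ℤ²_} C ρ w ⟨
    total C₆ (λ x → w (to ρ x))
      ≡⟨ total-slices C₆ (λ x → w (to ρ x)) ⟩
    total (sl zero) (wt zero) + (total (sl (suc zero)) (wt (suc zero)) + (total (sl (suc (suc zero))) (wt (suc (suc zero))) +
      (total (sl (suc (suc (suc zero)))) (wt (suc (suc (suc zero)))) + (total (sl (suc (suc (suc (suc zero))))) (wt (suc (suc (suc (suc zero))))) +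
      (total (sl (suc (suc (suc (suc (suc zero)))))) (wt (suc (suc (suc (suc (suc zero)))))) + + 0)))))
      ≡⟨ cong₂ _+_ (total-zero (sl zero) (w-even zero refl))
        (cong₂ _+_ (total-θ² 1 (growing-* 4 g₂₁) (growing-* 20 g₂₁) (sl (suc zero)) ρ₁ (+ 2) sgnℤ sgnℤ
           (λ i j → ℤₚ.+-injective (trans (form′ i j) (trans (lem₁ i j) (sym (at-ρ (suc zero) (to ρ₁ (i , j)))))))
           (λ i j → sym (trans (w-odd (suc zero) refl (to ρ₁ (i , j))) (cong (+ 2 *_) (trans (sgnℤ-+ (- i) (+ 1 * j)) (cong₂ _*_ (sgnℤ-neg i) (cong sgnℤ (ℤₚ.*-identityˡ j))))))))
        (cong₂ _+_ (total-zero (sl (suc (suc zero))) (w-even (suc (suc zero)) refl))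
        (cong₂ _+_ (total-antisymmetric (sl (suc (suc (suc zero)))) ρ₃ (wt (suc (suc (suc zero))))
           (λ x → ℤₚ.+-injective (trans (at-ρ (suc (suc (suc zero))) x) (trans (lem₃ (proj₁ x) (proj₂ x)) (sym (at-ρ (suc (suc (suc zero))) (to ρ₃ x))))))
           (λ x → trans (w-odd (suc (suc (suc zero))) refl x) (sym (trans (cong -_ (trans (w-odd (suc (suc (suc zero))) refl (to ρ₃ x)) (cong (+ 2 *_) (flip (proj₁ x) (proj₂ x))))) (neg2 (sgnℤ (proj₂ x)))))))
        (cong₂ _+_ (total-zero (sl (suc (suc (suc (suc zero))))) (w-even (suc (suc (suc (suc zero)))) refl))
        (cong (_+ + 0) (total-θ² 1 (growing-* 4 g₂₁) (growing-* 20 g₂₁) (sl (suc (suc (suc (suc (suc zero)))))) ρ₅ (+ 2) sgnℤ sgnℤ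
           (λ i j → ℤₚ.+-injective (trans (form′ i j) (trans (lem₅ i j) (sym (at-ρ (suc (suc (suc (suc (suc zero))))) (to ρ₅ (i , j)))))))
           (λ i j → sym (trans (w-odd (suc (suc (suc (suc (suc zero))))) refl (to ρ₅ (i , j))) (cong (+ 2 *_) (trans (sgnℤ-+ i (- + 1 * j)) (cong (sgnℤ i *_) (trans (cong sgnℤ (ℤₚ.-1*i≡-i j)) (sgnℤ-neg j)))))))))))) ) ⟩
    + 0 + (+ 2 * S₁ + (+ 0 + (+ 0 + (+ 0 + (+ 2 * S₁ + + 0)))))
      ≡⟨ collect S₁ ⟩
    + 4 * S₁
      ≡⟨ constS-*ᵏ n (+ 4) (qpow 1 *S (θ sgnℤ e₄ *S θ sgnℤ e₂₀)) ⟨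
    (constS (+ 4) *S (qpow 1 *S (θ sgnℤ e₄ *S θ sgnℤ e₂₀))) n ∎
    where
    C = θ²-cover gφ g₅ 0 n
    C₆ = pull {_≟A_ = _≟Fin×ℤ²_} C ρ
    sl : (j : Fin 6) → Cover _≟ℤ²_ (λ x → 0 ℕ.+ (jexp 1 1 (proj₁ (to ρ (j , x))) ℕ.+ e₅ (proj₂ (to ρ (j , x))))) n
    sl = slice C₆
    wt : Fin 6 → ℤ × ℤ → ℤ
    wt j x = w (to ρ (j , x))
    S₁ = (qpow 1 *S (θ sgnℤ e₄ *S θ sgnℤ e₂₀)) n
    tidy : ∀ a b → + 1 * a + - (b * + 1) ≡ a - b
    tidy = solve-∀
    collect : ∀ a → + 0 + (+ 2 * a + (+ 0 + (+ 0 + (+ 0 + (+ 2 * a + + 0))))) ≡ + 4 * a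
    collect = solve-∀
    neg2 : ∀ x → - (+ 2 * (- x)) ≡ + 2 * x
    neg2 = solve-∀
    flip : ∀ l k → sgnℤ ((+ 1 + l * + 2) - k) ≡ - sgnℤ k
    flip l k = trans (sgnℤ-+ (+ 1 + l * + 2) (- k)) (trans (cong₂ _*_ (sgnℤ-even+ (+ 1) l) (sgnℤ-neg k)) (ℤₚ.-1*i≡-i (sgnℤ k)))
    lem₁ : ∀ i j → let k = - i + + 1 * j ; m = (+ 1 + j * + 6) + - + 1 * k in
      + 1 + (+ 2 * (+ 3 * (i * i) + i) + + 10 * (+ 3 * (j * j) + j)) ≡ m * m + + 5 * (k * k)
    lem₁ = solve-∀
    lem₅ : ∀ i j → let k = i + - + 1 * j ; m = (+ 5 + (- + 1 - j) * + 6) + - + 1 * k in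
      + 1 + (+ 2 * (+ 3 * (i * i) + i) + + 10 * (+ 3 * (j * j) + j)) ≡ m * m + + 5 * (k * k)
    lem₅ = solve-∀
    lem₃ : ∀ l k → let m = (+ 3 + l * + 6) + - + 1 * k ; k′ = (+ 1 + l * + 2) - k ; m′ = (+ 3 + l * + 6) + - + 1 * k′ in
      m * m + + 5 * (k * k) ≡ m′ * m′ + + 5 * (k′ * k′)
    lem₃ = solve-∀

-- A Wronskian of two theta functions of modulus 8

G₁ G₃ : Series
G₁ = θ sgnℤ (jexp 7 1)
G₃ = θ sgnℤ (jexp 5 3)

-- The derivation q d/dq.
D : Series → Series
D f n = + n * f n

D-θ : ∀ c e → D (θ c e) ≈ θ (λ i → + e i * c i) e
D-θ c e = θ-diagonal +_ c e

-- With u = 8m + 3 and v = 8n + 1 the weight is (u² - v²)/8 = (u - v)(u + v)/8, and (u ± v)/2 are the new variables.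
G-wronskian : G₁ *S G₃ +S constS (+ 2) *S (D G₁ *S G₃ +S -S (G₁ *S D G₃)) ≈ J *S dil 4 J
G-wronskian = ≈-trans (≈-trans (+-congˡ (*-congˡ (+-cong (*-congʳ (D-θ sgnℤ (jexp 7 1))) (-‿cong (*-congˡ (D-θ sgnℤ (jexp 5 3)))))))
    (solve 3 (λ x y z → x :+ con (+ 2) :* (y :- z) := con (+ 1) :* x :+ (con (+ 2) :* (con (+ 1) :* y) :- con (+ 2) :* (con (+ 1) :* z))) refl _ _ _))
  (≈-trans (pointwise main) (≈-trans (*S-identityˡ _) (*-congˡ (≈-sym (θ-dil 4 gψ wJ)))))
  where
  wJ w₁ w₃ : ℤ → ℤ
  wJ i = + 4 * i + + 1
  w₁ i = + jexp 7 1 i * sgnℤ i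
  w₃ i = + jexp 5 3 i * sgnℤ i
  e₄ : ℤ → ℕ
  e₄ i = 4 ℕ.* jexp 3 1 i
  g₄ : Growing e₄
  g₄ = growing-* 4 gψ
  g₇ : Growing (jexp 7 1)
  g₇ = jexp-growing 7 1
  g₅ : Growing (jexp 5 3)
  g₅ = jexp-growing 5 3
  exp₇ : ∀ t → + jexp 7 1 t ≡ + 4 * (t * t) + + 3 * t
  exp₇ t = unhalf _ _ (trans (jexp-double 7 1 t) (lem t))
    where
    lem : ∀ t → + 8 * (t * t) + + 6 * t ≡ (+ 4 * (t * t) + + 3 * t) * + 2
    lem = solve-∀
  exp₅ : ∀ t → + jexp 5 3 t ≡ + 4 * (t * t) + t
  exp₅ t = unhalf _ _ (trans (jexp-double 5 3 t) (lem t))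
    where
    lem : ∀ t → + 8 * (t * t) + + 2 * t ≡ (+ 4 * (t * t) + t) * + 2
    lem = solve-∀
  form : ∀ m n → + (0 ℕ.+ (jexp 7 1 m ℕ.+ jexp 5 3 n)) ≡ (+ 4 * (m * m) + + 3 * m) + (+ 4 * (n * n) + n)
  form m n = cong₂ _+_ (exp₇ m) (exp₅ n)
  form′ : ∀ i j → + (0 ℕ.+ (jexp 3 1 i ℕ.+ e₄ j)) ≡ (+ 2 * (i * i) + i) + + 4 * (+ 2 * (j * j) + j)
  form′ i j = cong₂ _+_ (jexp-ψ i) (pos-*-eq 4 _ (jexp-ψ j))
  w : ℤ × ℤ → ℤ
  w x = sgnℤ (proj₁ x) * sgnℤ (proj₂ x) * ((+ 1 + + 2 * + jexp 7 1 (proj₁ x)) - + 2 * + jexp 5 3 (proj₂ x))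
  w′ : ℤ × ℤ → ℤ
  w′ x = wJ (proj₁ x) * wJ (proj₂ x)
  ρ : (Fin 2 × (ℤ × ℤ)) ≅ (ℤ × ℤ)
  ρ = shear′ (+ 1) ∘≅ residues₂ 2
  -- With I = m - n the weight is (-1)^I (4I + 1)(4n + 2I + 1). For I = 2i the last factor is 4j + 1
  -- with j = n + i; for I = 2i + 1 it is -(4j + 1) with j = -1 - i - n, and the minus sign cancels
  -- (-1)^I. So both parities of I give the weight of J(q) J(q⁴).
  ρ₀ ρ₁ : (ℤ × ℤ) ≅ (ℤ × ℤ)
  ρ₀ = shear (- + 1)
  ρ₁ = fibrewise (λ i → reflect (- + 1 - i))
  w-eq : ∀ j i n → w (to ρ (j , (i , n))) ≡ sgnℤ (+ toℕ j) * (let I = + toℕ j + i * + 2 in (+ 4 * I + + 1) * (+ 4 * n + + 2 * I + + 1))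
  w-eq j i n = cong₂ _*_
    (trans (cong (_* sgnℤ n) (sgnℤ-+ I (+ 1 * n))) (trans (ℤₚ.*-assoc (sgnℤ I) (sgnℤ (+ 1 * n)) (sgnℤ n))
      (trans (cong₂ _*_ (sgnℤ-even+ (+ toℕ j) i) (trans (cong (λ t → sgnℤ t * sgnℤ n) (ℤₚ.*-identityˡ n)) (sgnℤ² n))) (ℤₚ.*-identityʳ (sgnℤ (+ toℕ j))))))
    (trans (cong₂ (λ s t → (+ 1 + + 2 * s) - + 2 * t) (exp₇ (I + + 1 * n)) (exp₅ n)) (lem I n))
    where
    I = + toℕ j + i * + 2
    lem : ∀ I n → let m = I + + 1 * n in (+ 1 + + 2 * (+ 4 * (m * m) + + 3 * m)) - + 2 * (+ 4 * (n * n) + n) ≡ (+ 4 * I + + 1) * (+ 4 * n + + 2 * I + + 1)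
    lem = solve-∀
  main : ∀ n → (qpow 0 *S (G₁ *S G₃) +S (constS (+ 2) *S (qpow 0 *S (θ w₁ (jexp 7 1) *S G₃)) +S -S (constS (+ 2) *S (qpow 0 *S (G₁ *S θ w₃ (jexp 5 3)))))) n ≡ (qpow 0 *S (J *S θ wJ e₄)) n
  main n = begin
    (qpow 0 *S (G₁ *S G₃) +S (constS (+ 2) *S (qpow 0 *S (θ w₁ (jexp 7 1) *S G₃)) +S -S (constS (+ 2) *S (qpow 0 *S (G₁ *S θ w₃ (jexp 5 3)))))) n
      ≡⟨ trans (+S-at (qpow 0 *S (G₁ *S G₃)) _ n) (cong₂ _+_ (θ²-at g₇ g₅ 0 n sgnℤ sgnℤ)
          (trans (+S-at (constS (+ 2) *S (qpow 0 *S (θ w₁ (jexp 7 1) *S G₃))) _ n) (cong₂ _+_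
            (trans (constS-*ᵏ n (+ 2) (qpow 0 *S (θ w₁ (jexp 7 1) *S G₃))) (cong (+ 2 *_) (θ²-at g₇ g₅ 0 n w₁ sgnℤ)))
            (trans (-S-at (constS (+ 2) *S (qpow 0 *S (G₁ *S θ w₃ (jexp 5 3)))) n) (trans (cong -_ (trans (constS-*ᵏ n (+ 2) (qpow 0 *S (G₁ *S θ w₃ (jexp 5 3))))
              (cong (+ 2 *_) (θ²-at g₇ g₅ 0 n sgnℤ w₃)))) (minus2 T₃)))))) ⟩
    T₁ + (+ 2 * T₂ + (- + 2) * T₃)
      ≡⟨ cong₂ (λ s t → T₁ + (s + t)) (sym (total-*ˡ C (+ 2) v₂)) (sym (total-*ˡ C (- + 2) v₃)) ⟩
    T₁ + (total C (λ x → + 2 * v₂ x) + total C (λ x → (- + 2) * v₃ x))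
      ≡⟨ cong (λ t → T₁ + t) (total-+ C (λ x → + 2 * v₂ x) (λ x → (- + 2) * v₃ x)) ⟨
    T₁ + total C (λ x → + 2 * v₂ x + (- + 2) * v₃ x)
      ≡⟨ total-+ C v₁ (λ x → + 2 * v₂ x + (- + 2) * v₃ x) ⟨
    total C (λ x → v₁ x + (+ 2 * v₂ x + (- + 2) * v₃ x))
      ≡⟨ total-cong C (λ x → tidy (sgnℤ (proj₁ x)) (sgnℤ (proj₂ x)) (+ jexp 7 1 (proj₁ x)) (+ jexp 5 3 (proj₂ x))) ⟩
    total C w
      ≡⟨ total-pull {_≟A_ = _≟Fin×ℤ²_} C ρ w ⟨
    total C₂ (λ x → w (to ρ x))
      ≡⟨ total-slices C₂ (λ x → w (to ρ x)) ⟩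
    total (slice C₂ zero) (λ x → w (to ρ (zero , x))) + (total (slice C₂ (suc zero)) (λ x → w (to ρ (suc zero , x))) + + 0)
      ≡⟨ cong₂ (λ s t → s + (t + + 0))
          (total-bijection (slice C₃ zero) (slice C₂ zero) ρ₀ {λ x → w′ (to (residues₂ 2) (zero , x))} {λ x → w (to ρ (zero , x))}
            (λ x p → trans (sym (exp₀ (proj₁ x) (proj₂ x))) p) (λ x p → trans (exp₀ (proj₁ x) (proj₂ x)) p)
            (λ x _ → sym (trans (w-eq zero (proj₁ x) (proj₂ (to ρ₀ x))) (wt₀ (proj₁ x) (proj₂ x)))))
          (total-bijection (slice C₃ (suc zero)) (slice C₂ (suc zero)) ρ₁ {λ x → w′ (to (residues₂ 2) (suc zero , x))} {λ x → w (to ρ (suc zero , x))}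
            (λ x p → trans (sym (exp₁ (proj₁ x) (proj₂ x))) p) (λ x p → trans (exp₁ (proj₁ x) (proj₂ x)) p)
            (λ x _ → sym (trans (w-eq (suc zero) (proj₁ x) (proj₂ (to ρ₁ x))) (wt₁ (proj₁ x) (proj₂ x))))) ⟨
    total (slice C₃ zero) (λ x → w′ (to (residues₂ 2) (zero , x))) + (total (slice C₃ (suc zero)) (λ x → w′ (to (residues₂ 2) (suc zero , x))) + + 0)
      ≡⟨ total-slices C₃ (λ x → w′ (to (residues₂ 2) x)) ⟨
    total C₃ (λ x → w′ (to (residues₂ 2) x))
      ≡⟨ total-pull {_≟A_ = _≟Fin×ℤ²_} C′ (residues₂ 2) w′ ⟩
    total C′ w′
      ≡⟨ θ²-at gψ g₄ 0 n wJ wJ ⟨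
    (qpow 0 *S (J *S θ wJ e₄)) n ∎
    where
    C = θ²-cover g₇ g₅ 0 n
    C′ = θ²-cover gψ g₄ 0 n
    C₂ = pull {_≟A_ = _≟Fin×ℤ²_} C ρ
    C₃ = pull {_≟A_ = _≟Fin×ℤ²_} C′ (residues₂ 2)
    v₁ v₂ v₃ : ℤ × ℤ → ℤ
    v₁ x = sgnℤ (proj₁ x) * sgnℤ (proj₂ x)
    v₂ x = w₁ (proj₁ x) * sgnℤ (proj₂ x)
    v₃ x = sgnℤ (proj₁ x) * w₃ (proj₂ x)
    T₁ = total C v₁
    T₂ = total C v₂
    T₃ = total C v₃
    minus2 : ∀ x → - (+ 2 * x) ≡ (- + 2) * x
    minus2 = solve-∀
    tidy : ∀ s t a b → s * t + (+ 2 * (a * s * t) + (- + 2) * (s * (b * t))) ≡ s * t * ((+ 1 + + 2 * a) - + 2 * b)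
    tidy = solve-∀
    exp₀ : ∀ i j → 0 ℕ.+ (jexp 3 1 (+ 0 + i * + 2) ℕ.+ e₄ j) ≡ 0 ℕ.+ (jexp 7 1 ((+ 0 + i * + 2) + + 1 * (j + - + 1 * i)) ℕ.+ jexp 5 3 (j + - + 1 * i))
    exp₀ i j = ℤₚ.+-injective (trans (form′ (+ 0 + i * + 2) j) (trans (lem i j) (sym (form ((+ 0 + i * + 2) + + 1 * (j + - + 1 * i)) (j + - + 1 * i)))))
      where
      lem : ∀ i j → let I = + 0 + i * + 2 ; k = j + - + 1 * i ; m = I + + 1 * k in
        (+ 2 * (I * I) + I) + + 4 * (+ 2 * (j * j) + j) ≡ (+ 4 * (m * m) + + 3 * m) + (+ 4 * (k * k) + k)
      lem = solve-∀
    exp₁ : ∀ i j → 0 ℕ.+ (jexp 3 1 (+ 1 + i * + 2) ℕ.+ e₄ j) ≡ 0 ℕ.+ (jexp 7 1 ((+ 1 + i * + 2) + + 1 * ((- + 1 - i) - j)) ℕ.+ jexp 5 3 ((- + 1 - i) - j))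
    exp₁ i j = ℤₚ.+-injective (trans (form′ (+ 1 + i * + 2) j) (trans (lem i j) (sym (form ((+ 1 + i * + 2) + + 1 * ((- + 1 - i) - j)) ((- + 1 - i) - j)))))
      where
      lem : ∀ i j → let I = + 1 + i * + 2 ; k = (- + 1 - i) - j ; m = I + + 1 * k in
        (+ 2 * (I * I) + I) + + 4 * (+ 2 * (j * j) + j) ≡ (+ 4 * (m * m) + + 3 * m) + (+ 4 * (k * k) + k)
      lem = solve-∀
    wt₀ : ∀ i j → + 1 * ((+ 4 * (+ 0 + i * + 2) + + 1) * (+ 4 * (j + - + 1 * i) + + 2 * (+ 0 + i * + 2) + + 1)) ≡
      (+ 4 * (+ 0 + i * + 2) + + 1) * (+ 4 * j + + 1)
    wt₀ = solve-∀
    wt₁ : ∀ i j → - + 1 * ((+ 4 * (+ 1 + i * + 2) + + 1) * (+ 4 * ((- + 1 - i) - j) + + 2 * (+ 1 + i * + 2) + + 1)) ≡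
      (+ 4 * (+ 1 + i * + 2) + + 1) * (+ 4 * j + + 1)
    wt₁ = solve-∀

-- The common interface of `dil k` and `alt`, along which polynomial relations are transported.
record RingMap : Set where
  field
    map-S    : Series → Series
    map-cong : ∀ {f g} → f ≈ g → map-S f ≈ map-S g
    map-+    : ∀ f g → map-S (f +S g) ≈ map-S f +S map-S g
    map-*    : ∀ f g → map-S (f *S g) ≈ map-S f *S map-S g
    map-neg  : ∀ f → map-S (-S f) ≈ -S map-S f
    map-con  : ∀ z → map-S (constS z) ≈ constS z
open RingMap public

dilate : (k : ℕ) → .{{NonZero k}} → RingMap
dilate k = record { map-S = dil k ; map-cong = dil-cong k ; map-+ = dil-+ k ; map-* = dil-* k ; map-neg = dil-neg k ; map-con = dil-const k }

alternate : RingMap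
alternate = record { map-S = alt ; map-cong = alt-cong ; map-+ = alt-+ ; map-* = alt-* ; map-neg = alt-neg ; map-con = alt-const }

-- Theta functions as quotients of Euler products

ε₁ ε₂ ε₄ ε₅ ε₈ ε₁₀ ε₂₀ ε₄₀ : Series
ε₁  = Euler
ε₂  = E 2
ε₄  = E 4
ε₅  = E 5
ε₈  = E 8
ε₁₀ = E 10
ε₂₀ = E 20
ε₄₀ = E 40

private
  P⁺ P⁻ : ℕ → ℕ → Series
  P⁺ = Prod (+ 1)
  P⁻ = Prod (- + 1)

-- (q; q²)∞ and (-q; q²)∞.
odds odds⁺ : Series
odds  = P⁻ 2 1
odds⁺ = P⁺ 2 1

ε₁-odds : ε₁ ≈ odds *S ε₂
ε₁-odds = ≈-trans (Prod-dissect (- + 1) 2 1 1) (*-cong (*S-identityˡ _) (≈-sym (E-Prod 2)))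

ε₂-odds : ε₂ ≈ odds⁺ *S odds *S ε₄
ε₂-odds = ≈-trans (E-Prod 2) (≈-trans (Prod-dissect (- + 1) 2 2 2) (*-cong (≈-trans (*S-identityˡ _) (≈-sym (Prod-± 2 1))) (≈-sym (E-Prod 4))))

odds⁺-eta : odds⁺ *S ε₁ *S ε₄ ≈ ε₂ *S ε₂
odds⁺-eta = ≈-trans (*-congʳ (*-congˡ ε₁-odds)) (≈-trans (solve 4 (λ odds⁺ o ε₂ ε₄ → odds⁺ :* (o :* ε₂) :* ε₄ := ε₂ :* (odds⁺ :* o :* ε₄)) refl odds⁺ odds ε₂ ε₄) (*-congˡ (≈-sym ε₂-odds)))

private
  jtp⁺ : ∀ A B .{{_ : NonZero A}} .{{_ : NonZero B}} .{{_ : NonZero (A ℕ.+ B)}} → θ one (jexp A B) ≈ P⁻ (A ℕ.+ B) (A ℕ.+ B) *S (P⁺ (A ℕ.+ B) A *S P⁺ (A ℕ.+ B) B)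
  jtp⁺ A B = ≈-trans (θ-cong {one} {signPow (+ 1)} {jexp A B} {jexp A B} (λ i → sym (ℤₚ.^-zeroˡ ∣ i ∣)) (λ _ → refl)) (jacobi-triple-product (+ 1) A B refl)

  jtp⁻ : ∀ A B .{{_ : NonZero A}} .{{_ : NonZero B}} .{{_ : NonZero (A ℕ.+ B)}} → θ sgnℤ (jexp A B) ≈ P⁻ (A ℕ.+ B) (A ℕ.+ B) *S (P⁻ (A ℕ.+ B) A *S P⁻ (A ℕ.+ B) B)
  jtp⁻ A B = jacobi-triple-product (- + 1) A B refl

φ-eta : φ ≈ ε₂ *S (odds⁺ *S odds⁺)
φ-eta = ≈-trans (jtp⁺ 1 1) (*-congʳ (≈-sym (E-Prod 2)))

altφ-eta : alt φ *S ε₂ ≈ ε₁ *S ε₁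
altφ-eta = ≈-trans (*-congʳ (≈-trans alt-φ (≈-trans (jtp⁻ 1 1) (*-congʳ (≈-sym (E-Prod 2))))))
  (≈-trans (solve 2 (λ e o → e :* (o :* o) :* e := o :* e :* (o :* e)) refl ε₂ odds) (≈-sym (*-cong ε₁-odds ε₁-odds)))

ψ-eta : ψ ≈ ε₄ *S odds⁺
ψ-eta = ≈-trans (jtp⁺ 3 1) (*-cong (≈-sym (E-Prod 4)) (≈-trans (solve 2 (λ x y → x :* y := con (+ 1) :* y :* x) refl _ _) (≈-sym (Prod-dissect (+ 1) 2 2 1))))

-- Euler's pentagonal number theorem: the three products run over the exponents in the three classes
-- modulo 3.
pentagonal-eta : pentagonal ≈ ε₁
pentagonal-eta = ≈-trans (jtp⁻ 2 1) (≈-trans (solve 3 (λ x y z → x :* (y :* z) := con (+ 1) :* z :* y :* x) refl _ _ _) (≈-sym (Prod-dissect (- + 1) 3 1 1)))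

odds⁺₅ : Series
odds⁺₅ = dil 5 odds⁺

odds⁺₅-eta : odds⁺₅ *S ε₅ *S ε₂₀ ≈ ε₁₀ *S ε₁₀
odds⁺₅-eta = ≈-trans (≈-sym (*-congˡ (dil-dil 5 4 Euler))) (≈-trans (≈-sym (≈-trans (dil-* 5 _ _) (*-congʳ (dil-* 5 _ _))))
  (≈-trans (dil-cong 5 odds⁺-eta) (≈-trans (dil-* 5 _ _) (*-cong (dil-dil 5 2 Euler) (dil-dil 5 2 Euler)))))

-- The classes 1, 3, 7, 9 modulo 10 occur in `f19` and `f37`, and the class 5 is `odds⁺₅`; all
-- together they give (-q; q²)∞ times ε₁₀². Then `odds⁺₅` is eliminated through `odds⁺₅-eta`.
f19f37-eta : f19 *S f37 ≈ odds⁺ *S ε₅ *S ε₂₀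
f19f37-eta = unit-cancel {ε₁₀} (λ ()) (unit-cancel {ε₁₀} (λ ()) (≈-trans (≈-trans
  (solve 3 (λ e f g → e :* (e :* (f :* g)) := e :* e :* (f :* g)) refl ε₁₀ f19 f37) (*-congʳ (≈-sym odds⁺₅-eta)))
  (≈-trans (solve 5 (λ odds⁺₅ ε₅ ε₂₀ f g → odds⁺₅ :* ε₅ :* ε₂₀ :* (f :* g) := f :* g :* odds⁺₅ :* (ε₅ :* ε₂₀)) refl odds⁺₅ ε₅ ε₂₀ f19 f37)
  (≈-trans (*-congʳ product) (solve 4 (λ e odds⁺ ε₅ ε₂₀ → e :* e :* odds⁺ :* (ε₅ :* ε₂₀) := e :* (e :* (odds⁺ :* ε₅ :* ε₂₀))) refl ε₁₀ odds⁺ ε₅ ε₂₀)))))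
  where
  product : f19 *S f37 *S odds⁺₅ ≈ ε₁₀ *S ε₁₀ *S odds⁺
  product = ≈-trans (*-cong (*-cong (≈-trans (jtp⁺ 9 1) (*-congʳ (≈-sym (E-Prod 10)))) (≈-trans (jtp⁺ 7 3) (*-congʳ (≈-sym (E-Prod 10))))) (Prod-dil (+ 1) 5 2 1))
    (≈-trans (solve 6 (λ e a b c d f → e :* (a :* b) :* (e :* (c :* d)) :* f := e :* e :* (con (+ 1) :* b :* d :* f :* c :* a)) refl ε₁₀ (P⁺ 10 9) (P⁺ 10 1) (P⁺ 10 7) (P⁺ 10 3) (P⁺ 10 5))
      (*-congˡ (≈-sym (Prod-dissect (+ 1) 5 2 1))))

G-eta : G₁ *S G₃ *S ε₂ ≈ ε₁ *S (ε₈ *S ε₈)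
G-eta = ≈-trans (*-congʳ (*-cong (≈-trans (jtp⁻ 7 1) (*-congʳ (≈-sym (E-Prod 8)))) (≈-trans (jtp⁻ 5 3) (*-congʳ (≈-sym (E-Prod 8))))))
  (≈-trans (solve 6 (λ e a b c d f → e :* (a :* b) :* (e :* (c :* d)) :* f := con (+ 1) :* b :* d :* c :* a :* f :* (e :* e)) refl ε₈ (P⁻ 8 7) (P⁻ 8 1) (P⁻ 8 5) (P⁻ 8 3) ε₂)
    (*-congʳ (≈-trans (*-congʳ (≈-sym (Prod-dissect (- + 1) 4 2 1))) (≈-sym ε₁-odds))))

alt-odds : alt odds ≈ odds⁺
alt-odds = Π∞-unique (prod-near (+ 1) 2 1) λ N → ≈[]-trans (below λ k l → cong (sgn k *_) (at< (Π∞-trunc (prod-near (- + 1) 2 1) N N ℕₚ.≤-refl) k l)) (≈⇒≈[] (go N))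
  where
  odd : ∀ i → sgn (2 ℕ.* i ℕ.+ 1) ≡ - + 1
  odd zero    = refl
  odd (suc i) = trans (cong sgn (lem i)) (trans (ℤₚ.neg-involutive (sgn (2 ℕ.* i ℕ.+ 1))) (odd i))
    where
    lem : ∀ i → 2 ℕ.* suc i ℕ.+ 1 ≡ suc (suc (2 ℕ.* i ℕ.+ 1))
    lem = ℕ-solve-∀
  step : ∀ i → alt (factor (- + 1) (2 ℕ.* i ℕ.+ 1)) ≈ factor (+ 1) (2 ℕ.* i ℕ.+ 1)
  step i = ≈-trans (alt-+ _ _) (+-cong (alt-const (+ 1)) (≈-trans (alt-* _ _) (≈-trans (*-cong (alt-const (- + 1))
    (≈-trans (alt-qpow (2 ℕ.* i ℕ.+ 1)) (*-congʳ (pointwise λ j → cong (λ t → constS t j) (odd i)))))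
    (solve 1 (λ q → con (- + 1) :* (con (- + 1) :* q) := con (+ 1) :* q) refl (qpow (2 ℕ.* i ℕ.+ 1))))))
  go : ∀ N → alt (∏ N (λ i → factor (- + 1) (2 ℕ.* i ℕ.+ 1))) ≈ ∏ N (λ i → factor (+ 1) (2 ℕ.* i ℕ.+ 1))
  go zero    = alt-const (+ 1)
  go (suc N) = ≈-trans (alt-* _ _) (*-cong (go N) (step N))

alt-ε₁ : alt ε₁ ≈ odds⁺ *S ε₂
alt-ε₁ = ≈-trans (alt-cong ε₁-odds) (≈-trans (alt-* odds ε₂) (*-cong alt-odds (alt-dil-even 2 refl Euler)))

-- Relations between fixed series are kept as syntax, so that their polynomial consequences are checked by evaluation.
module Equations {k : ℕ} (ρ : Vec Series k) (constants : Vec ℤ k) (constants-correct : ∀ i → lookup ρ i 0 ≡ lookup constants i) where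

  infix 4 _≐_
  record _≐_ (l r : Expr k) : Set where
    constructor holds
    field value : ⟦ l ⟧ ρ ≈ ⟦ r ⟧ ρ
  open _≐_ public

  infixr 8 _·_
  _·_ : ℕ → Expr k → Expr k
  c · e = con (+ c) :* e

  infix 5.5 _✕_
  record Step : Set where
    constructor _✕_
    field
      coefficient : Expr k
      {lhs rhs}   : Expr k
      equation    : lhs ≐ rhs

  combination : List Step → Expr k
  combination []      = con (+ 0)
  combination (s ∷ L) = Step.coefficient s :* (Step.lhs s :- Step.rhs s) :+ combination L

  combination-zero : ∀ L → ⟦ combination L ⟧ ρ ≈ constS (+ 0)
  combination-zero []      = ≈-refl
  combination-zero (s ∷ L) = ≈-trans (+-cong (≈-trans (*-congˡ (≈⇒-≈0 (value (Step.equation s)))) (*S-zeroʳ _)) (combination-zero L)) (+S-identityˡ _)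

  -- The list of cofactors certifies that l - r lies in the ideal of the known relations;
  -- verification is the evaluation of one polynomial identity.
  combine : ∀ {l r} L → (l :- r ≟ᴾ combination L) ≡ true → l ≐ r
  combine {l} {r} L eq = holds (-≈0⇒≈ (≈-trans (≟ᴾ-sound (l :- r) (combination L) eq ρ) (combination-zero L)))

  -- Computed on syntax, so that a nonzero constant term is refuted to be 0 by the absurd pattern.
  constantTerm : Expr k → ℤ
  constantTerm (var i)  = lookup constants i
  constantTerm (con z)  = z
  constantTerm (e :+ f) = constantTerm e + constantTerm f
  constantTerm (e :* f) = constantTerm e * constantTerm f
  constantTerm (:- e)   = - constantTerm e
  constantTerm (e :^ j) = constantTerm e ℤ.^ j

  constantTerm-correct : ∀ e → ⟦ e ⟧ ρ 0 ≡ constantTerm e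
  constantTerm-correct (var i)  = constants-correct i
  constantTerm-correct (con z)  = refl
  constantTerm-correct (e :+ f) = trans (+S-at (⟦ e ⟧ ρ) (⟦ f ⟧ ρ) 0) (cong₂ _+_ (constantTerm-correct e) (constantTerm-correct f))
  constantTerm-correct (e :* f) = trans (*S-head (⟦ e ⟧ ρ) (⟦ f ⟧ ρ)) (cong₂ _*_ (constantTerm-correct e) (constantTerm-correct f))
  constantTerm-correct (:- e)   = trans (-S-at (⟦ e ⟧ ρ) 0) (cong -_ (constantTerm-correct e))
  constantTerm-correct (e :^ j) = go j
    where
    go : ∀ j → (⟦ e ⟧ ρ ^ j) 0 ≡ constantTerm e ℤ.^ j
    go zero    = refl
    go (suc j) = trans (*S-head (⟦ e ⟧ ρ) (⟦ e ⟧ ρ ^ j)) (cong₂ _*_ (constantTerm-correct e) (go j))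

  cancel : ∀ c {l r} → constantTerm c ≢ + 0 → c :* l ≐ c :* r → l ≐ r
  cancel c nz p = holds (unit-cancel (λ z → nz (trans (sym (constantTerm-correct c)) z)) (value p))

  private
    from-product : ∀ d {l r} → ⟦ d ⟧ ρ *S ⟦ l :- r ⟧ ρ ≈ constS (+ 0) → constantTerm d ≢ + 0 → l ≐ r
    from-product d {l} {r} p nz = holds (-≈0⇒≈ (unit-cancel-zero (⟦ d ⟧ ρ) (⟦ l :- r ⟧ ρ) (λ z → nz (trans (sym (constantTerm-correct d)) z)) p))

    squares : ∀ {l r} → l :* l ≐ r :* r → ⟦ l :+ r ⟧ ρ *S ⟦ l :- r ⟧ ρ ≈ constS (+ 0)
    squares {l} {r} p = ≈-trans (solve 2 (λ l r → (l :+ r) :* (l :- r) := l :* l :- r :* r) refl (⟦ l ⟧ ρ) (⟦ r ⟧ ρ)) (≈⇒-≈0 (value p))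

  -- Of the two factors of l² - r² the factor l + r is cancelled; this chooses the sign of the root.
  square-root : ∀ {l r} → constantTerm (l :+ r) ≢ + 0 → l :* l ≐ r :* r → l ≐ r
  square-root {l} {r} nz p = from-product (l :+ r) (squares p) nz

  module _ (q : Expr k) (q-value : ⟦ q ⟧ ρ ≈ qpow 1) where

    private
      cancel-q-zero : ∀ h → ⟦ q ⟧ ρ *S h ≈ constS (+ 0) → h ≈ constS (+ 0)
      cancel-q-zero h p = qpow-cancel-zero 1 h (≈-trans (*-congʳ (≈-sym q-value)) p)

    cancel-q : ∀ {l r} → q :* l ≐ q :* r → l ≐ r
    cancel-q {l} {r} p = holds (-≈0⇒≈ (cancel-q-zero (⟦ l :- r ⟧ ρ)
      (≈-trans (solve 3 (λ q l r → q :* (l :- r) := q :* l :- q :* r) refl (⟦ q ⟧ ρ) (⟦ l ⟧ ρ) (⟦ r ⟧ ρ)) (≈⇒-≈0 (value p)))))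

    -- For roots without constant term, where the sign is read from the coefficient of q.
    square-root-q : ∀ {l r} u → l :+ r ≐ q :* u → constantTerm u ≢ + 0 → l :* l ≐ r :* r → l ≐ r
    square-root-q {l} {r} u s nz p = from-product u (cancel-q-zero _
      (≈-trans (≈-sym (*S-assoc _ _ _)) (≈-trans (*-congʳ (≈-sym (value s))) (squares p)))) nz

  infix 5.5 _↦_by_
  record Rule (T : RingMap) : Set where
    constructor _↦_by_
    field
      source target : Expr k
      image         : map-S T (⟦ source ⟧ ρ) ≈ ⟦ target ⟧ ρ

  -- `nothing` if some variable has no rule: the image of a variable under the substitution need not
  -- be expressible in the variables.
  Image : RingMap → Expr k → Set
  Image T e = Maybe (Σ (Expr k) λ e′ → map-S T (⟦ e ⟧ ρ) ≈ ⟦ e′ ⟧ ρ)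

  module _ {T : RingMap} (rules : List (Rule T)) where

    imageVar : List (Rule T) → ∀ i → Image T (var i)
    imageVar []                       i = nothing
    imageVar ((var j ↦ e by p) ∷ L) i with j Fin.≟ i
    ... | yes refl = just (e , p)
    ... | no _     = imageVar L i
    imageVar (_ ∷ L)                  i = imageVar L i

    imageOf : ∀ e → Image T e
    imageOf (var i) = imageVar rules i
    imageOf (con z) = just (con z , map-con T z)
    imageOf (e :+ f) with imageOf e | imageOf f
    ... | just (e′ , p) | just (f′ , p′) = just (e′ :+ f′ , ≈-trans (map-+ T _ _) (+-cong p p′))
    ... | _             | _              = nothing
    imageOf (e :* f) with imageOf e | imageOf f
    ... | just (e′ , p) | just (f′ , p′) = just (e′ :* f′ , ≈-trans (map-* T _ _) (*-cong p p′))
    ... | _             | _              = nothing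
    imageOf (:- e) with imageOf e
    ... | just (e′ , p) = just (:- e′ , ≈-trans (map-neg T _) (-‿cong p))
    ... | nothing       = nothing
    imageOf (e :^ j) with imageOf e
    ... | just (e′ , p) = just (e′ :^ j , go j)
      where
      go : ∀ j → map-S T (⟦ e ⟧ ρ ^ j) ≈ ⟦ e′ ⟧ ρ ^ j
      go zero    = map-con T (+ 1)
      go (suc j) = ≈-trans (map-* T _ _) (*-cong p (go j))
    ... | nothing       = nothing

    is : ∀ e → Image T e → Expr k → Bool
    is _ (just (e′ , _)) f = e′ ≟ᴾ f
    is _ nothing         f = false

    maps? : Expr k → Expr k → Bool
    maps? e f = is e (imageOf e) f

    mapsTo : ∀ e f → maps? e f ≡ true → map-S T (⟦ e ⟧ ρ) ≈ ⟦ f ⟧ ρ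
    mapsTo e f = go (imageOf e)
      where
      go : ∀ im → is e im f ≡ true → map-S T (⟦ e ⟧ ρ) ≈ ⟦ f ⟧ ρ
      go (just (e′ , p)) eq = ≈-trans p (≟ᴾ-sound e′ f eq ρ)
      go nothing         ()

    transport : ∀ {l r L R} → l ≐ r → maps? (l :- r) (L :- R) ≡ true → L ≐ R
    transport {l} {r} {L} {R} p eq = holds (-≈0⇒≈ (≈-trans (≈-sym (mapsTo (l :- r) (L :- R) eq)) (≈-trans (map-cong T (≈⇒-≈0 (value p))) (map-con T (+ 0)))))

  -- The substitution q^d ↦ q in a relation between series in q^d; it is legitimate because `dil d`
  -- is injective.
  undilate : ∀ d .{{_ : NonZero d}} (rules : List (Rule (dilate d))) {l r L R} → L ≐ R → maps? rules (l :- r) (L :- R) ≡ true → l ≐ r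
  undilate d rules {l} {r} {L} {R} p eq = holds (-≈0⇒≈ (dil-injective d (≈-trans (mapsTo rules (l :- r) (L :- R) eq) (≈-trans (≈⇒-≈0 (value p)) (≈-sym (dil-const d (+ 0)))))))

-- Logarithmic derivatives and Lambert series

geom-eta : ∀ d .{{_ : NonZero d}} → factor (- + 1) d *S geomS d ≈ constS (+ 1)
geom-eta d@(suc _) = ≈-trans (solve 2 (λ q g → (con (+ 1) :+ con (- + 1) :* q) :* g := g :- q :* g) refl (qpow d) (geomS d))
  (pointwise λ k → trans (+S-at (geomS d) (-S (qpow d *S geomS d)) k) (trans (cong (λ t → geomS d k + t)
    (trans (-S-at (qpow d *S geomS d) k) (cong -_ (at (qpow-*-shift d (geomS d)) k)))) (go k)))
  where
  shifted : ∀ n → geomS d (d ℕ.+ n) ≡ geomS d n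
  shifted n = ind-⇔ (d ∣? d ℕ.+ n) (d ∣? n) (λ p → ∣m+n∣m⇒∣n p ∣-refl) (λ p → ∣m∣n⇒∣m+n ∣-refl p)
  go : ∀ k → geomS d k - shiftS d (geomS d) k ≡ constS (+ 1) k
  go k with k ℕₚ.<? d
  ... | no k≮d = trans (cong (λ t → geomS d t - shiftS d (geomS d) t) (sym k≡)) (trans (cong₂ _-_ (shifted n) (shiftS-at d (geomS d) n)) (trans (ℤₚ.+-inverseʳ (geomS d n)) (cong (constS (+ 1)) {d ℕ.+ n} k≡)))
    where
    n = k ∸ d
    k≡ : d ℕ.+ n ≡ k
    k≡ = ℕₚ.m+[n∸m]≡n (ℕₚ.≮⇒≥ k≮d)
  ... | yes k<d = trans (cong (λ t → geomS d k - t) (shiftS-< d (geomS d) k k<d)) (trans (ℤₚ.+-identityʳ (geomS d k)) (small k k<d))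
    where
    small : ∀ k → k ℕ.< d → geomS d k ≡ constS (+ 1) k
    small zero    _ = ind-yes (d ∣? 0) (d ∣0)
    small (suc k) l = ind-no (d ∣? suc k) (λ p → ℕₚ.<⇒≱ l (∣⇒≤ p))

D-cong : ∀ {f g} → f ≈ g → D f ≈ D g
D-cong p = pointwise λ k → cong (+ k *_) (at p k)

D-cong[] : ∀ {N f g} → f ≈[ N ] g → D f ≈[ N ] D g
D-cong[] p = below λ k l → cong (+ k *_) (at< p k l)

D-* : ∀ f g → D (f *S g) ≈ D f *S g +S f *S D g
D-* f g = pointwise λ k → trans (go k f) (sym (+S-at (D f *S g) (f *S D g) k))
  where
  tail-D : ∀ f → tailS (D f) ≈ D (tailS f) +S tailS f
  tail-D f = pointwise λ k → trans (lem (+ k) (f (suc k))) (sym (+S-at (D (tailS f)) (tailS f) k))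
    where
    lem : ∀ k x → (+ 1 + k) * x ≡ k * x + x
    lem = solve-∀
  go : ∀ k f → + k * (f *S g) k ≡ (D f *S g) k + (f *S D g) k
  go zero f = sym (cong₂ _+_ (trans (*S-head (D f) g) refl) (trans (*S-head f (D g)) (ℤₚ.*-zeroʳ (f 0))))
  go (suc k) f = begin
    + suc k * (f *S g) (suc k)
      ≡⟨ cong (+ suc k *_) (*S-tail f g k) ⟩
    + suc k * (f 0 * g (suc k) + X)
      ≡⟨ lem₁ (+ k) (f 0) (g (suc k)) X ⟩
    f 0 * (+ suc k * g (suc k)) + (+ k * X + X)
      ≡⟨ cong (λ t → f 0 * (+ suc k * g (suc k)) + (t + X)) (go k (tailS f)) ⟩
    f 0 * (+ suc k * g (suc k)) + (((D (tailS f) *S g) k + (tailS f *S D g) k) + X)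
      ≡⟨ lem₂ (f 0) (D g (suc k)) ((D (tailS f) *S g) k) ((tailS f *S D g) k) X ⟩
    (+ 0 * g (suc k) + ((D (tailS f) *S g) k + X)) + (f 0 * D g (suc k) + (tailS f *S D g) k)
      ≡⟨ cong₂ _+_ (trans (cong (λ t → + 0 * g (suc k) + t) tail-eq) (sym (*S-tail (D f) g k))) (sym (*S-tail f (D g) k)) ⟩
    (D f *S g) (suc k) + (f *S D g) (suc k) ∎
    where
    X = (tailS f *S g) k
    lem₁ : ∀ k a b x → (+ 1 + k) * (a * b + x) ≡ a * ((+ 1 + k) * b) + (k * x + x)
    lem₁ = solve-∀
    lem₂ : ∀ a b c d x → a * b + ((c + d) + x) ≡ (+ 0 + (c + x)) + (a * b + d)
    lem₂ = solve-∀
    tail-eq : (D (tailS f) *S g) k + X ≡ (tailS (D f) *S g) k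
    tail-eq = trans (sym (+S-at (D (tailS f) *S g) (tailS f *S g) k)) (at (≈-trans (≈-sym (*S-distribʳ _ _ _)) (*-congʳ (≈-sym (tail-D f)))) k)

-- e qᵉ/(1 - qᵉ)
lambert : ℕ → Series
lambert e = constS (+ e) *S (geomS e +S -S constS (+ 1))

lambert-at : ∀ e n → lambert e (suc n) ≡ + e * ind (e ∣? suc n)
lambert-at e n = trans (constS-*ᵏ (suc n) (+ e) (geomS e +S -S constS (+ 1))) (cong (+ e *_)
  (trans (+S-at (geomS e) (-S constS (+ 1)) (suc n)) (trans (cong (λ t → geomS e (suc n) + t) (-S-at (constS (+ 1)) (suc n))) (ℤₚ.+-identityʳ _))))

lambert-zero : ∀ e → lambert e 0 ≡ + 0
lambert-zero e = trans (constS-*ᵏ 0 (+ e) (geomS e +S -S constS (+ 1))) (trans (cong (+ e *_)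
  (trans (+S-at (geomS e) (-S constS (+ 1)) 0) (trans (cong₂ _+_ (ind-yes (e ∣? 0) (e ∣0)) (-S-at (constS (+ 1)) 0)) refl))) (ℤₚ.*-zeroʳ (+ e)))

lambert-small : ∀ e → lambert e ≈[ e ] constS (+ 0)
lambert-small e = below λ { zero _ → lambert-zero e
  ; (suc n) l → trans (lambert-at e n) (trans (cong (+ e *_) (ind-no (e ∣? suc n) (λ p → ℕₚ.<⇒≱ l (∣⇒≤ p)))) (ℤₚ.*-zeroʳ (+ e))) }

D-factor : ∀ e .{{_ : NonZero e}} → D (factor (- + 1) e) ≈ -S (factor (- + 1) e *S lambert e)
D-factor e = ≈-trans (pointwise D-at) (≈-trans
  (solve 3 (λ e q f → con (- + 1) :* (e :* q) := :- (e :* (con (+ 1) :- f)) :+ e :* (con (+ 1) :- f :- q)) refl (constS (+ e)) (qpow e) f)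
  (≈-trans (+-cong (-‿cong (*-congˡ (+-congʳ (≈-sym (geom-eta e))))) (*-congˡ (solve 1 (λ q → con (+ 1) :- (con (+ 1) :+ con (- + 1) :* q) :- q := con (+ 0)) refl (qpow e))))
    (solve 3 (λ e f g → :- (e :* (f :* g :- f)) :+ e :* con (+ 0) := :- (f :* (e :* (g :- con (+ 1))))) refl (constS (+ e)) f (geomS e))))
  where
  f = factor (- + 1) e
  D-at : ∀ k → D f k ≡ (constS (- + 1) *S (constS (+ e) *S qpow e)) k
  D-at k = trans (cong (+ k *_) (trans (+S-at (constS (+ 1)) (constS (- + 1) *S qpow e) k) (cong (λ t → constS (+ 1) k + t) (trans (constS-*ᵏ k (- + 1) (qpow e)) (cong (- + 1 *_) (qpow-at e k))))))
    (trans (eq (e ℕ.≟ k)) (sym (trans (constS-*ᵏ k (- + 1) (constS (+ e) *S qpow e)) (cong (- + 1 *_) (trans (constS-*ᵏ k (+ e) (qpow e)) (cong (+ e *_) (qpow-at e k)))))))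
    where
    const-vanish : ∀ k → + k * constS (+ 1) k ≡ + 0
    const-vanish zero    = refl
    const-vanish (suc k) = ℤₚ.*-zeroʳ (+ suc k)
    lem : ∀ k c i → k * (c + - + 1 * i) ≡ k * c + - + 1 * (i * k)
    lem = solve-∀
    eq : (d : Dec (e ≡ k)) → + k * (constS (+ 1) k + - + 1 * ind d) ≡ - + 1 * (+ e * ind d)
    eq d = trans (lem (+ k) (constS (+ 1) k) (ind d)) (trans (cong₂ _+_ (const-vanish k) (cong (- + 1 *_) (trans (ind-*-cong d (λ p → cong +_ (sym p))) (ℤₚ.*-comm (ind d) (+ e))))) (ℤₚ.+-identityˡ _))

-- The sum of e q^e/(1 - q^e) over e = di + r with i ≥ 0; a summand starts at q^e and e exceeds i,
-- so n summands settle the coefficient of q^n.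
Λ : (d r : ℕ) → Series
Λ d r n = ∑ n (λ i → lambert (d ℕ.* i ℕ.+ r)) n

∑-snoc : ∀ n (f : ℕ → Series) → ∑ (suc n) f ≈ ∑ n f +S f n
∑-snoc zero    f = solve 1 (λ x → x :+ con (+ 0) := con (+ 0) :+ x) refl (f 0)
∑-snoc (suc n) f = ≈-trans (+-congˡ (∑-snoc n (λ k → f (suc k)))) (solve 3 (λ x y z → x :+ (y :+ z) := (x :+ y) :+ z) refl _ _ _)

∑-stable : ∀ (f : ℕ → Series) → (∀ i → f i ≈[ suc i ] constS (+ 0)) → ∀ N d → ∑ (d ℕ.+ N) f ≈[ suc N ] ∑ N f
∑-stable f small N zero    = ≈[]-refl
∑-stable f small N (suc d) = ≈[]-trans (≈⇒≈[] (∑-snoc (d ℕ.+ N) f)) (≈[]-trans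
  (+-cong[] (∑-stable f small N d) (≈[]-weaken (s≤s (ℕₚ.m≤n+m N d)) (small (d ℕ.+ N)))) (≈⇒≈[] (+S-identityʳ _)))

∑-diagonal : ∀ (f : ℕ → Series) → (∀ i → f i ≈[ suc i ] constS (+ 0)) → ∀ N M → N ℕ.≤ M → (λ n → ∑ n f n) ≈[ suc N ] ∑ M f
∑-diagonal f small N M N≤M = below λ k k≤N → sym (at< (subst (λ t → ∑ t f ≈[ suc k ] ∑ k f)
  (ℕₚ.m∸n+n≡m (ℕₚ.≤-trans (ℕₚ.≤-pred k≤N) N≤M)) (∑-stable f small k (M ∸ k))) k ℕₚ.≤-refl)

module _ (d r : ℕ) .{{nd : NonZero d}} .{{nr : NonZero r}} where

  exp≥ : ∀ i → suc i ℕ.≤ d ℕ.* i ℕ.+ r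
  exp≥ i = ℕₚ.≤-trans (ℕₚ.≤-reflexive (ℕₚ.+-comm 1 i)) (ℕₚ.+-mono-≤ (ℕₚ.m≤n*m i d) (ℕ.>-nonZero⁻¹ r))

  lambert-tail : ∀ i → lambert (d ℕ.* i ℕ.+ r) ≈[ suc i ] constS (+ 0)
  lambert-tail i = ≈[]-weaken (exp≥ i) (lambert-small (d ℕ.* i ℕ.+ r))

  Λ-trunc : ∀ N M → N ℕ.≤ M → Λ d r ≈[ suc N ] ∑ M (λ i → lambert (d ℕ.* i ℕ.+ r))
  Λ-trunc = ∑-diagonal (λ i → lambert (d ℕ.* i ℕ.+ r)) lambert-tail

  D-∏ : ∀ N → D (∏ N (λ i → factor (- + 1) (d ℕ.* i ℕ.+ r))) ≈ -S (∏ N (λ i → factor (- + 1) (d ℕ.* i ℕ.+ r)) *S ∑ N (λ i → lambert (d ℕ.* i ℕ.+ r)))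
  D-∏ zero    = pointwise λ k → trans (vanish k) (sym (at (solve 0 (:- (con (+ 1) :* con (+ 0)) := con (+ 0)) refl) k))
    where
    vanish : ∀ k → + k * constS (+ 1) k ≡ constS (+ 0) k
    vanish zero    = refl
    vanish (suc k) = ℤₚ.*-zeroʳ (+ suc k)
  D-∏ (suc N) = ≈-trans (D-* _ _) (≈-trans (+-cong (*-congʳ (D-∏ N)) (*-congˡ (D-factor (d ℕ.* N ℕ.+ r) {{ℕ.>-nonZero (ℕₚ.≤-trans (s≤s z≤n) (exp≥ N))}})))
    (≈-trans (solve 4 (λ P L f l → :- (P :* L) :* f :+ P :* :- (f :* l) := :- (P :* f :* (L :+ l))) refl _ _ _ _)
      (-‿cong (*-congˡ (≈-sym (∑-snoc N (λ i → lambert (d ℕ.* i ℕ.+ r))))))))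

  -- Logarithmic differentiation factor by factor, on the finite products and then modulo every q^N.
  D-Prod : D (Prod (- + 1) d r) ≈ -S (Prod (- + 1) d r *S Λ d r)
  D-Prod = ≈[]⇒≈ λ N → ≈[]-weaken (ℕₚ.n≤1+n N) (≈[]-trans (D-cong[] (Π∞-trunc (prod-near (- + 1) d r) N N ℕₚ.≤-refl)) (≈[]-trans (≈⇒≈[] (D-∏ N))
    (≈[]-sym (≈[]-trans (≈⇒≈[] (neg _)) (≈[]-trans (*-cong[] ≈[]-refl (*-cong[] (Π∞-trunc (prod-near (- + 1) d r) N N ℕₚ.≤-refl) (Λ-trunc N N ℕₚ.≤-refl))) (≈⇒≈[] (≈-sym (neg _))))))))
    where
    neg : ∀ f → -S f ≈ constS (- + 1) *S f
    neg f = solve 1 (λ f → :- f := con (- + 1) :* f) refl f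

χ₂-lambert : Series
χ₂-lambert = Λ 8 1 +S Λ 8 7 +S -S (Λ 8 3 +S Λ 8 5)

-- The left side is G₁G₃ times 1 plus twice the logarithmic derivative of G₁/G₃. The exponents 8i
-- are common to both functions and cancel; the exponents ±1 and ±3 modulo 8 receive the opposite
-- signs of χ₂.
wronskian-lambert : G₁ *S G₃ +S constS (+ 2) *S (D G₁ *S G₃ +S -S (G₁ *S D G₃)) ≈ G₁ *S G₃ *S (constS (+ 1) +S -S (constS (+ 2) *S χ₂-lambert))
wronskian-lambert = ≈-trans (+-congˡ (*-congˡ (+-cong (*-congʳ (dlog 7 1)) (-‿cong (*-congˡ (dlog 5 3))))))
  (solve 7 (λ G₁ G₃ L₈ L₇ L₁ L₅ L₃ → G₁ :* G₃ :+ con (+ 2) :* (:- (G₁ :* (L₈ :+ (L₇ :+ L₁))) :* G₃ :- G₁ :* :- (G₃ :* (L₈ :+ (L₅ :+ L₃)))) :=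
      G₁ :* G₃ :* (con (+ 1) :- con (+ 2) :* (L₁ :+ L₇ :- (L₃ :+ L₅)))) refl G₁ G₃ (Λ 8 8) (Λ 8 7) (Λ 8 1) (Λ 8 5) (Λ 8 3))
  where
  dlog : ∀ A B .{{_ : NonZero A}} .{{_ : NonZero B}} .{{_ : NonZero (A ℕ.+ B)}} →
    D (θ sgnℤ (jexp A B)) ≈ -S (θ sgnℤ (jexp A B) *S (Λ (A ℕ.+ B) (A ℕ.+ B) +S (Λ (A ℕ.+ B) A +S Λ (A ℕ.+ B) B)))
  dlog A B = ≈-trans (D-cong jtp) (≈-trans (D-* _ _) (≈-trans (+-cong (*-congʳ (D-Prod k k)) (*-congˡ (≈-trans (D-* _ _) (+-cong (*-congʳ (D-Prod k A)) (*-congˡ (D-Prod k B))))))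
    (≈-trans (solve 6 (λ P Q R L M N → :- (P :* L) :* (Q :* R) :+ P :* (:- (Q :* M) :* R :+ Q :* :- (R :* N)) := :- (P :* (Q :* R) :* (L :+ (M :+ N)))) refl
        (Prod (- + 1) k k) (Prod (- + 1) k A) (Prod (- + 1) k B) (Λ k k) (Λ k A) (Λ k B)) (-‿cong (*-congʳ (≈-sym jtp))))))
    where
    k = A ℕ.+ B
    jtp = jacobi-triple-product (- + 1) A B refl

-- The character χ₂ and the divisor sums

χ₂-mod : ∀ m n → m % 8 ≡ n % 8 → χ₂ m ≡ χ₂ n
χ₂-mod m n p with m % 8 | n % 8 | p
... | 0 | .0 | refl = refl
... | 1 | .1 | refl = refl
... | 2 | .2 | refl = refl
... | 3 | .3 | refl = refl
... | 4 | .4 | refl = refl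
... | 5 | .5 | refl = refl
... | 6 | .6 | refl = refl
... | 7 | .7 | refl = refl
... | suc (suc (suc (suc (suc (suc (suc (suc _))))))) | _ | refl = refl

χ₂-period : ∀ r i → χ₂ (r ℕ.+ i ℕ.* 8) ≡ χ₂ r
χ₂-period r i = χ₂-mod (r ℕ.+ i ℕ.* 8) r ([m+kn]%n≡m%n r i 8)

private
  small : ∀ n → Fin 8
  small n = fromℕ< (m%n<n n 8)

  small-% : ∀ n → toℕ (small n) ≡ n % 8
  small-% n = Finₚ.toℕ-fromℕ< (m%n<n n 8)

  χ₂-small : ∀ n → χ₂ n ≡ χ₂ (toℕ (small n))
  χ₂-small n = χ₂-mod n (toℕ (small n)) (trans (sym (m%n%n≡m%n n 8)) (cong (_% 8) (sym (small-% n))))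

χ₂-* : ∀ m n → χ₂ (m ℕ.* n) ≡ χ₂ m * χ₂ n
χ₂-* m n = trans (χ₂-mod (m ℕ.* n) (toℕ (small m) ℕ.* toℕ (small n)) (trans (%-distribˡ-* m n 8)
    (trans (cong₂ (λ s t → (s ℕ.* t) % 8) (sym (small-% m)) (sym (small-% n))) refl)))
  (trans (table (small m) (small n)) (sym (cong₂ _*_ (χ₂-small m) (χ₂-small n))))
  where
  table : ∀ (r s : Fin 8) → χ₂ (toℕ r ℕ.* toℕ s) ≡ χ₂ (toℕ r) * χ₂ (toℕ s)
  table = toWitness {a? = Finₚ.all? λ r → Finₚ.all? λ s → χ₂ (toℕ r ℕ.* toℕ s) ℤ.≟ χ₂ (toℕ r) * χ₂ (toℕ s)} tt

χ₂-even : ∀ n → χ₂ (n ℕ.* 2) ≡ + 0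
χ₂-even n = trans (χ₂-* n 2) (ℤₚ.*-zeroʳ (χ₂ n))

χ₂-odd² : ∀ n → χ₂ (suc (n ℕ.* 2)) * χ₂ (suc (n ℕ.* 2)) ≡ + 1
χ₂-odd² n = trans (cong₂ _*_ eq eq) (table (small n))
  where
  eq : χ₂ (suc (n ℕ.* 2)) ≡ χ₂ (suc (toℕ (small n) ℕ.* 2))
  eq = trans (cong (λ t → χ₂ (suc (t ℕ.* 2))) (ℕᵈ n)) (trans (cong χ₂ (lem (n % 8) (n / 8))) (trans (χ₂-period (suc (n % 8 ℕ.* 2)) (n / 8 ℕ.* 2)) (cong (λ t → χ₂ (suc (t ℕ.* 2))) (sym (small-% n)))))
    where
    open import Data.Nat.DivMod using (m≡m%n+[m/n]*n)
    ℕᵈ : ∀ n → n ≡ n % 8 ℕ.+ n / 8 ℕ.* 8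
    ℕᵈ n = m≡m%n+[m/n]*n n 8
    lem : ∀ r k → suc ((r ℕ.+ k ℕ.* 8) ℕ.* 2) ≡ suc (r ℕ.* 2) ℕ.+ k ℕ.* 2 ℕ.* 8
    lem = ℕ-solve-∀
  table : ∀ (r : Fin 8) → χ₂ (suc (toℕ r ℕ.* 2)) * χ₂ (suc (toℕ r ℕ.* 2)) ≡ + 1
  table = toWitness {a? = Finₚ.all? λ r → χ₂ (suc (toℕ r ℕ.* 2)) * χ₂ (suc (toℕ r ℕ.* 2)) ℤ.≟ + 1} tt

sum-cong : ∀ n {f g : ℕ → ℤ} → (∀ k → f k ≡ g k) → sumℤ (applyUpTo f n) ≡ sumℤ (applyUpTo g n)
sum-cong zero    p = refl
sum-cong (suc n) p = cong₂ _+_ (p 0) (sum-cong n (λ k → p (suc k)))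

sum-*ˡ : ∀ z n (f : ℕ → ℤ) → sumℤ (applyUpTo (λ k → z * f k) n) ≡ z * sumℤ (applyUpTo f n)
sum-*ˡ z zero    f = sym (ℤₚ.*-zeroʳ z)
sum-*ˡ z (suc n) f = trans (cong (λ t → z * f 0 + t) (sum-*ˡ z n (λ k → f (suc k)))) (sym (ℤₚ.*-distribˡ-+ z (f 0) _))

sum-pairs : ∀ n (f : ℕ → ℤ) → sumℤ (applyUpTo f (n ℕ.* 2)) ≡ sumℤ (applyUpTo (λ i → f (i ℕ.* 2) + f (suc (i ℕ.* 2))) n)
sum-pairs zero    f = refl
sum-pairs (suc n) f = trans (cong (λ t → f 0 + (f 1 + t)) (sum-pairs n (λ k → f (suc (suc k))))) (sym (ℤₚ.+-assoc (f 0) (f 1) _))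

σ₀₂ σ₂₀ : Series
σ₀₂ = σ χ₀ χ₂
σ₂₀ = σ χ₂ χ₀

if-ind : ∀ {P : Set} (d : Dec P) {x y : ℤ} → x ≡ y → (if does d then x else + 0) ≡ ind d * y
if-ind (yes _) p = trans p (sym (ℤₚ.*-identityˡ _))
if-ind (no _)  p = refl

sum-map-cong : ∀ {t g : ℕ → ℤ} m (h : ℕ → ℕ) → (∀ k → t (h k) ≡ g k) → sumℤ (map t (applyUpTo h m)) ≡ sumℤ (applyUpTo g m)
sum-map-cong zero    h p = refl
sum-map-cong (suc m) h p = cong₂ _+_ (p 0) (sum-map-cong m (λ k → h (suc k)) (λ k → p (suc k)))

σ-at : ∀ χ ψ n → σ χ ψ n ≡ sumℤ (applyUpTo (λ k → ind (suc k ∣? n) * (ψ (suc k) * χ (n / suc k) * + suc k)) n)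
σ-at χ ψ n = trans (ℤₚ.+-identityˡ _) (sum-map-cong n suc (λ k → if-ind (suc k ∣? n) refl))

σ₀₂-at : ∀ n → σ₀₂ n ≡ sumℤ (applyUpTo (λ k → ind (suc k ∣? n) * (χ₂ (suc k) * + suc k)) n)
σ₀₂-at n = trans (σ-at χ₀ χ₂ n) (sum-cong n λ k → cong (λ t → ind (suc k ∣? n) * (t * + suc k)) (ℤₚ.*-identityʳ (χ₂ (suc k))))

σ₂₀-at : ∀ n → σ₂₀ n ≡ sumℤ (applyUpTo (λ k → ind (suc k ∣? n) * (χ₂ (n / suc k) * + suc k)) n)
σ₂₀-at n = trans (σ-at χ₂ χ₀ n) (sum-cong n λ k → cong (λ t → ind (suc k ∣? n) * (t * + suc k)) (ℤₚ.*-identityˡ (χ₂ (n / suc k))))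

-- Summing over divisors first gives the Lambert series of χ₂(m) m q^m/(1 - q^m). It is truncated
-- after 8N terms and cut into blocks of eight, in which only the classes 1, 7 (sign +) and 3, 5
-- (sign -) survive.
σ₀₂-lambert : σ₀₂ ≈ χ₂-lambert
σ₀₂-lambert = ≈[]⇒≈ λ N → ≈[]-weaken (ℕₚ.n≤1+n N) (≈[]-trans (≈⇒≈[] diag) (≈[]-trans (∑-diagonal f small-f N (N ℕ.* 8) (ℕₚ.m≤m*n N 8))
  (≈[]-trans (≈⇒≈[] (≈-trans (∑-blocks 8 N f) (≈-trans (∑-cong N block) (≈-sym (≈-trans (+-cong (∑-+ N _ _) (≈-trans (*-congʳ (∑-+ N _ _)) (∑-*ʳ N _ _))) (∑-+ N _ _))))))
    (≈[]-trans (+-cong[] (+-cong[] (back 1 N) (back 7 N)) (*-cong[] (+-cong[] (back 3 N) (back 5 N)) ≈[]-refl))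
      (≈⇒≈[] (+-congˡ (solve 1 (λ x → x :* con (- + 1) := :- x) refl _)))))))
  where
  f : ℕ → Series
  f k = constS (χ₂ (suc k)) *S lambert (suc k)
  small-f : ∀ i → f i ≈[ suc i ] constS (+ 0)
  small-f i = ≈[]-trans (*-cong[] ≈[]-refl (lambert-small (suc i))) (≈⇒≈[] (*S-zeroʳ _))
  back : ∀ r .{{_ : NonZero r}} N → ∑ N (λ i → lambert (8 ℕ.* i ℕ.+ r)) ≈[ suc N ] Λ 8 r
  back r N = ≈[]-sym (Λ-trunc 8 r N N ℕₚ.≤-refl)
  ∑-at : ∀ m n → ∑ m f n ≡ sumℤ (applyUpTo (λ k → f k n) m)
  ∑-at m n = go m f
    where
    go : ∀ m (f : ℕ → Series) → ∑ m f n ≡ sumℤ (applyUpTo (λ k → f k n) m)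
    go zero    f = constS-zero n
    go (suc m) f = trans (+S-at (f 0) (∑ m (λ k → f (suc k))) n) (cong (λ t → f 0 n + t) (go m (λ k → f (suc k))))
  diag : σ₀₂ ≈ (λ n → ∑ n f n)
  diag = pointwise λ { zero → refl ; (suc n) → trans (σ₀₂-at (suc n)) (trans (sum-cong (suc n) (λ k → sym (trans (constS-*ᵏ (suc n) (χ₂ (suc k)) (lambert (suc k)))
    (trans (cong (χ₂ (suc k) *_) (lambert-at (suc k) n)) (lem (χ₂ (suc k)) (+ suc k) (ind (suc k ∣? suc n))))))) (sym (∑-at (suc n) (suc n)))) }
    where
    lem : ∀ c e i → c * (e * i) ≡ i * (c * e)
    lem = solve-∀
  ∑-+-split : ∀ m n (f : ℕ → Series) → ∑ (m ℕ.+ n) f ≈ ∑ m f +S ∑ n (λ j → f (j ℕ.+ m))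
  ∑-+-split zero    n f = ≈-sym (≈-trans (+S-identityˡ _) (∑-cong n λ j → pointwise λ i → cong (λ t → f t i) (ℕₚ.+-identityʳ j)))
  ∑-+-split (suc m) n f = ≈-trans (+-congˡ (∑-+-split m n (λ k → f (suc k)))) (≈-trans (solve 3 (λ x y z → x :+ (y :+ z) := (x :+ y) :+ z) refl _ _ _)
    (+-congˡ (∑-cong n λ j → pointwise λ i → cong (λ t → f t i) (sym (ℕₚ.+-suc j m)))))
  ∑-blocks : ∀ k n (f : ℕ → Series) → ∑ (n ℕ.* k) f ≈ ∑ n (λ i → ∑ k (λ j → f (j ℕ.+ i ℕ.* k)))
  ∑-blocks k zero    f = ≈-refl
  ∑-blocks k (suc n) f = ≈-trans (∑-+-split k (n ℕ.* k) f) (+-cong (∑-cong k λ j → pointwise λ i → cong (λ t → f t i) (sym (ℕₚ.+-identityʳ j)))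
    (≈-trans (∑-blocks k n (λ j → f (j ℕ.+ k))) (∑-cong n λ i → ∑-cong k λ j → pointwise λ l → cong (λ t → f t l) (assoc j i k))))
    where
    assoc : ∀ j i k → (j ℕ.+ i ℕ.* k) ℕ.+ k ≡ j ℕ.+ (k ℕ.+ i ℕ.* k)
    assoc = ℕ-solve-∀
  block : ∀ i → ∑ 8 (λ j → f (j ℕ.+ i ℕ.* 8)) ≈
    (lambert (8 ℕ.* i ℕ.+ 1) +S lambert (8 ℕ.* i ℕ.+ 7)) +S (lambert (8 ℕ.* i ℕ.+ 3) +S lambert (8 ℕ.* i ℕ.+ 5)) *S constS (- + 1)
  block i = ≈-trans (∑-cong 8 λ j → *-cong (pointwise λ l → cong (λ t → constS t l) (χ₂-period (suc j) i)) (pointwise λ l → cong (λ t → lambert t l) (index j i)))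
    (solve 8 (λ a b c d e f g h → con (+ 1) :* a :+ (con (+ 0) :* b :+ (con (- + 1) :* c :+ (con (+ 0) :* d :+ (con (- + 1) :* e :+ (con (+ 0) :* f :+ (con (+ 1) :* g :+ (con (+ 0) :* h :+ con (+ 0)))))))) :=
       (a :+ g) :+ (c :+ e) :* con (- + 1)) refl
       (lambert (8 ℕ.* i ℕ.+ 1)) (lambert (8 ℕ.* i ℕ.+ 2)) (lambert (8 ℕ.* i ℕ.+ 3)) (lambert (8 ℕ.* i ℕ.+ 4)) (lambert (8 ℕ.* i ℕ.+ 5)) (lambert (8 ℕ.* i ℕ.+ 6)) (lambert (8 ℕ.* i ℕ.+ 7)) (lambert (8 ℕ.* i ℕ.+ 8)))
    where
    index : ∀ j i → suc (j ℕ.+ i ℕ.* 8) ≡ 8 ℕ.* i ℕ.+ suc j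
    index = ℕ-solve-∀

dil-off : ∀ k .{{_ : NonZero k}} n f → ¬ (k ∣ n) → dil k f n ≡ + 0
dil-off k = <-rec (λ n → ∀ f → ¬ (k ∣ n) → dil k f n ≡ + 0) step
  where
  step : ∀ n → (∀ {m} → m ℕ.< n → ∀ f → ¬ (k ∣ m) → dil k f m ≡ + 0) → ∀ f → ¬ (k ∣ n) → dil k f n ≡ + 0
  step n rec f k∤n = trans (at (dil-unfold k f) n) (trans (+S-at (constS (f 0)) (qpow k *S dil k (tailS f)) n)
    (trans (cong₂ _+_ (nonzero n k∤n) (at (qpow-*-shift k (dil k (tailS f))) n)) (trans (ℤₚ.+-identityˡ _) (shifted (n ℕₚ.<? k)))))
    where
    nonzero : ∀ n → ¬ (k ∣ n) → constS (f 0) n ≡ + 0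
    nonzero zero    p = ⊥-elim (p (k ∣0))
    nonzero (suc n) p = refl
    shifted : Dec (n ℕ.< k) → shiftS k (dil k (tailS f)) n ≡ + 0
    shifted (yes n<k) = shiftS-< k (dil k (tailS f)) n n<k
    shifted (no n≮k)  = trans (cong (shiftS k (dil k (tailS f))) (sym n≡)) (trans (shiftS-at k (dil k (tailS f)) (n ∸ k))
        (rec (ℕₚ.∸-monoʳ-< {n} {k} {0} (ℕ.>-nonZero⁻¹ k) (ℕₚ.≮⇒≥ n≮k)) (tailS f) (λ p → k∤n (subst (k ∣_) n≡ (∣m∣n⇒∣m+n ∣-refl p)))))
      where
      n≡ : k ℕ.+ (n ∸ k) ≡ n
      n≡ = ℕₚ.m+[n∸m]≡n (ℕₚ.≮⇒≥ n≮k)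

twist : Series → Series
twist f n = χ₂ n * f n

-- An odd divisor m of 2j contributes 0, as 2j/m is even; in the proof χ₂(m) = ±1 is cancelled from
-- χ₂(2j/m) χ₂(m) = χ₂(2j) = 0. The even divisors are the doubles of the divisors of j.
σ₂₀-even : ∀ j → σ₂₀ (j ℕ.* 2) ≡ + 2 * σ₂₀ j
σ₂₀-even j = begin
  σ₂₀ (j ℕ.* 2)
    ≡⟨ σ₂₀-at (j ℕ.* 2) ⟩
  sumℤ (applyUpTo τ (j ℕ.* 2))
    ≡⟨ sum-pairs j τ ⟩
  sumℤ (applyUpTo (λ i → τ (i ℕ.* 2) + τ (suc (i ℕ.* 2))) j)
    ≡⟨ sum-cong j (λ i → trans (cong₂ _+_ (odd i) (even i)) (ℤₚ.+-identityˡ _)) ⟩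
  sumℤ (applyUpTo (λ i → + 2 * (ind (suc i ∣? j) * (χ₂ (j / suc i) * + suc i))) j)
    ≡⟨ sum-*ˡ (+ 2) j (λ i → ind (suc i ∣? j) * (χ₂ (j / suc i) * + suc i)) ⟩
  + 2 * sumℤ (applyUpTo (λ i → ind (suc i ∣? j) * (χ₂ (j / suc i) * + suc i)) j)
    ≡⟨ cong (+ 2 *_) (σ₂₀-at j) ⟨
  + 2 * σ₂₀ j ∎
  where
  τ : ℕ → ℤ
  τ k = ind (suc k ∣? j ℕ.* 2) * (χ₂ (j ℕ.* 2 / suc k) * + suc k)
  odd : ∀ i → τ (i ℕ.* 2) ≡ + 0
  odd i = trans (ind-*-cong (m ∣? j ℕ.* 2) {y = + 0} λ p → cong (_* + m) (vanish p)) (ℤₚ.*-zeroʳ (ind (m ∣? j ℕ.* 2)))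
    where
    m = suc (i ℕ.* 2)
    vanish : m ∣ j ℕ.* 2 → χ₂ (j ℕ.* 2 / m) ≡ + 0
    vanish p = begin
      χ₂ t ≡⟨ ℤₚ.*-identityʳ (χ₂ t) ⟨
      χ₂ t * + 1 ≡⟨ cong (χ₂ t *_) (χ₂-odd² i) ⟨
      χ₂ t * (χ₂ m * χ₂ m) ≡⟨ ℤₚ.*-assoc (χ₂ t) (χ₂ m) (χ₂ m) ⟨
      χ₂ t * χ₂ m * χ₂ m ≡⟨ cong (_* χ₂ m) (trans (sym (χ₂-* t m)) (trans (cong χ₂ (m/n*n≡m p)) (χ₂-even j))) ⟩
      + 0 ∎
      where t = j ℕ.* 2 / m
  even : ∀ i → τ (suc (i ℕ.* 2)) ≡ + 2 * (ind (suc i ∣? j) * (χ₂ (j / suc i) * + suc i))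
  even i = trans (cong₂ (λ s t → s * (t * + (suc i ℕ.* 2)))
      (ind-⇔ (suc i ℕ.* 2 ∣? j ℕ.* 2) (suc i ∣? j) (*-cancelʳ-∣ 2) (*-monoˡ-∣ 2))
      (cong χ₂ (m*n/o*n≡m/o j 2 (suc i))))
    (trans (cong (λ t → ind (suc i ∣? j) * (χ₂ (j / suc i) * t)) (ℤₚ.pos-* (suc i) 2)) (lem (ind (suc i ∣? j)) (χ₂ (j / suc i)) (+ suc i)))
    where
    lem : ∀ i c k → i * (c * (k * + 2)) ≡ + 2 * (i * (c * k))
    lem = solve-∀

-- For n odd all character values at divisors are ±1, so χ₂(n/m) = χ₂(n) χ₂(m).
σ₂₀-odd : ∀ j → σ₂₀ (suc (j ℕ.* 2)) ≡ χ₂ (suc (j ℕ.* 2)) * σ₀₂ (suc (j ℕ.* 2))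
σ₂₀-odd j = trans (σ₂₀-at n) (trans (sum-cong n (λ k → trans (ind-*-cong (suc k ∣? n) (λ p → term (suc k) p)) (lem (ind (suc k ∣? n)) (χ₂ n) (χ₂ (suc k) * + suc k))))
    (trans (sum-*ˡ (χ₂ n) n (λ k → ind (suc k ∣? n) * (χ₂ (suc k) * + suc k))) (cong (χ₂ n *_) (sym (σ₀₂-at n)))))
  where
  n = suc (j ℕ.* 2)
  lem : ∀ i c x → i * (c * x) ≡ c * (i * x)
  lem = solve-∀
  term : ∀ m .{{_ : NonZero m}} → m ∣ n → χ₂ (n / m) * + m ≡ χ₂ n * (χ₂ m * + m)
  term m p = trans (cong (_* + m) main) (ℤₚ.*-assoc (χ₂ n) (χ₂ m) (+ m))
    where
    t = n / m
    n≡ : χ₂ n ≡ χ₂ t * χ₂ m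
    n≡ = trans (cong χ₂ (sym (m/n*n≡m p))) (χ₂-* t m)
    square : ∀ r → χ₂ (toℕ {8} r) * χ₂ (toℕ r) * χ₂ (toℕ r) ≡ χ₂ (toℕ r)
    square = toWitness {a? = Finₚ.all? λ r → χ₂ (toℕ {8} r) * χ₂ (toℕ r) * χ₂ (toℕ r) ℤ.≟ χ₂ (toℕ r)} tt
    cube : ∀ r → χ₂ r * χ₂ r * χ₂ r ≡ χ₂ r
    cube r = trans (cong (λ t → t * t * t) (χ₂-small r)) (trans (square (small r)) (sym (χ₂-small r)))
    rearr : ∀ t m → (t * m) * (t * m) * t ≡ (t * t * t) * m * m
    rearr = solve-∀
    main : χ₂ t ≡ χ₂ n * χ₂ m
    main = begin
      χ₂ t ≡⟨ ℤₚ.*-identityˡ (χ₂ t) ⟨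
      + 1 * χ₂ t ≡⟨ cong (_* χ₂ t) (trans (sym (χ₂-odd² j)) (cong₂ _*_ n≡ n≡)) ⟩
      (χ₂ t * χ₂ m) * (χ₂ t * χ₂ m) * χ₂ t ≡⟨ rearr (χ₂ t) (χ₂ m) ⟩
      (χ₂ t * χ₂ t * χ₂ t) * χ₂ m * χ₂ m ≡⟨ cong (λ s → s * χ₂ m * χ₂ m) (cube t) ⟩
      χ₂ t * χ₂ m * χ₂ m ≡⟨ cong (_* χ₂ m) n≡ ⟨
      χ₂ n * χ₂ m ∎

data Parity : ℕ → Set where
  even : ∀ j → Parity (j ℕ.* 2)
  odd  : ∀ j → Parity (suc (j ℕ.* 2))

parity : ∀ n → Parity n
parity zero = even 0
parity (suc n) with parity n
... | even j = odd j
... | odd j  = even (suc j)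

odd∤ : ∀ j → ¬ (2 ∣ suc (j ℕ.* 2))
odd∤ zero    p = ℕₚ.<⇒≱ (s≤s (s≤s z≤n)) (∣⇒≤ p)
odd∤ (suc j) p = odd∤ j (∣m+n∣m⇒∣n p ∣-refl)

twist-σ₂₀ : σ₂₀ +S -S (constS (+ 2) *S dil 2 σ₂₀) ≈ twist σ₀₂
twist-σ₂₀ = pointwise λ n → trans (+S-at σ₂₀ (-S (constS (+ 2) *S dil 2 σ₂₀)) n) (trans (cong (λ t → σ₂₀ n + t)
    (trans (-S-at (constS (+ 2) *S dil 2 σ₂₀) n) (cong -_ (constS-*ᵏ n (+ 2) (dil 2 σ₂₀))))) (go (parity n)))
  where
  go : ∀ {n} → Parity n → σ₂₀ n - + 2 * dil 2 σ₂₀ n ≡ χ₂ n * σ₀₂ n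
  go (even j) = trans (cong₂ (λ s t → s - + 2 * t) (σ₂₀-even j) (dil-at 2 σ₂₀ j)) (trans (ℤₚ.+-inverseʳ (+ 2 * σ₂₀ j)) (sym (cong (_* σ₀₂ (j ℕ.* 2)) (χ₂-even j))))
  go (odd j)  = trans (cong (λ t → σ₂₀ (suc (j ℕ.* 2)) - + 2 * t) (dil-off 2 (suc (j ℕ.* 2)) σ₂₀ (odd∤ j))) (trans (ℤₚ.+-identityʳ _) (σ₂₀-odd j))

twist-cong : ∀ {f g} → f ≈ g → twist f ≈ twist g
twist-cong p = pointwise λ k → cong (χ₂ k *_) (at p k)

twist-+ : ∀ f g → twist (f +S g) ≈ twist f +S twist g
twist-+ f g = pointwise λ k → trans (cong (χ₂ k *_) (+S-at f g k)) (trans (ℤₚ.*-distribˡ-+ (χ₂ k) (f k) (g k)) (sym (+S-at (twist f) (twist g) k)))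

twist-scale : ∀ z f → twist (constS z *S f) ≈ constS z *S twist f
twist-scale z f = pointwise λ k → trans (cong (χ₂ k *_) (constS-*ᵏ k z f)) (trans (lem (χ₂ k) z (f k)) (sym (constS-*ᵏ k z (twist f))))
  where
  lem : ∀ c z x → c * (z * x) ≡ z * (c * x)
  lem = solve-∀

twist-dil2 : ∀ f → twist (dil 2 f) ≈ constS (+ 0)
twist-dil2 f = pointwise λ n → trans (go (parity n)) (sym (constS-zero n))
  where
  go : ∀ {n} → Parity n → χ₂ n * dil 2 f n ≡ + 0
  go (even j) = cong (_* dil 2 f (j ℕ.* 2)) (χ₂-even j)
  go (odd j)  = trans (cong (χ₂ (suc (j ℕ.* 2)) *_) (dil-off 2 (suc (j ℕ.* 2)) f (odd∤ j))) (ℤₚ.*-zeroʳ (χ₂ (suc (j ℕ.* 2))))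

-- All exponents lie in the class of i modulo 8, on which χ₂ is constant.
twist-class : ∀ i f → twist (qpow i *S dil 8 f) ≈ constS (χ₂ i) *S (qpow i *S dil 8 f)
twist-class i f = pointwise λ n → trans (trans (cong (χ₂ n *_) (at (qpow-*-shift i (dil 8 f)) n)) (trans (go n (n ℕₚ.<? i)) (cong (χ₂ i *_) (sym (at (qpow-*-shift i (dil 8 f)) n)))))
    (sym (constS-*ᵏ n (χ₂ i) (qpow i *S dil 8 f)))
  where
  multiple : ∀ k → Dec (8 ∣ k) → χ₂ (i ℕ.+ k) * dil 8 f k ≡ χ₂ i * dil 8 f k
  multiple k (yes (divides l refl)) = cong (_* dil 8 f k) (χ₂-period i l)
  multiple k (no ∤)                 = trans (cong (χ₂ (i ℕ.+ k) *_) z) (trans (ℤₚ.*-zeroʳ (χ₂ (i ℕ.+ k))) (sym (trans (cong (χ₂ i *_) z) (ℤₚ.*-zeroʳ (χ₂ i)))))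
    where z = dil-off 8 k f ∤
  go : ∀ n → Dec (n ℕ.< i) → χ₂ n * shiftS i (dil 8 f) n ≡ χ₂ i * shiftS i (dil 8 f) n
  go n (yes n<i) = trans (cong (χ₂ n *_) z) (trans (ℤₚ.*-zeroʳ (χ₂ n)) (sym (trans (cong (χ₂ i *_) z) (ℤₚ.*-zeroʳ (χ₂ i)))))
    where z = shiftS-< i (dil 8 f) n n<i
  go n (no n≮i) = subst (λ n → χ₂ n * shiftS i (dil 8 f) n ≡ χ₂ i * shiftS i (dil 8 f) n) (ℕₚ.m+[n∸m]≡n (ℕₚ.≮⇒≥ n≮i))
    (trans (cong (χ₂ (i ℕ.+ (n ∸ i)) *_) (shiftS-at i (dil 8 f) (n ∸ i))) (trans (multiple (n ∸ i) (8 ∣? n ∸ i)) (cong (χ₂ i *_) (sym (shiftS-at i (dil 8 f) (n ∸ i))))))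

dil-one : ∀ f → dil 1 f ≈ f
dil-one f = pointwise λ n → trans (cong (dil 1 f) (sym (ℕₚ.*-identityʳ n))) (dil-at 1 f n)

-- The defined quantities as coefficients of series

count-sum : ∀ {A : Set} (L : List A) (f : A → ℕ) → + foldr ℕ._+_ 0 (map f L) ≡ sumOver L (λ a → + f a)
count-sum []      f = refl
count-sum (a ∷ L) f = cong (λ t → + f a + t) (count-sum L f)

-- Modulo q^(n+1) each φ(q^a) is a finite sum over the range [-n, n] of `Nrep`, so both sides become
-- the same fourfold sum of indicators.
N-coefficient : ∀ a₁ a₂ a₃ a₄ .{{_ : NonZero a₁}} .{{_ : NonZero a₂}} .{{_ : NonZero a₃}} .{{_ : NonZero a₄}} n →
  N a₁ a₂ a₃ a₄ n ≡ (dil a₁ φ *S (dil a₂ φ *S (dil a₃ φ *S dil a₄ φ))) n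
N-coefficient a₁ a₂ a₃ a₄ n = sym (begin
  (dil a₁ φ *S (dil a₂ φ *S (dil a₃ φ *S dil a₄ φ))) n
    ≡⟨ at< (*-cong[] (trunc a₁) (*-cong[] (trunc a₂) (*-cong[] (trunc a₃) (trunc a₄)))) n ℕₚ.≤-refl ⟩
  (mono₁ a₁ *S (mono₁ a₂ *S (mono₁ a₃ *S mono₁ a₄))) n
    ≡⟨ at (≈-trans (*-congˡ (≈-trans (*-congˡ (monomials-* L L one (e a₃) one (e a₄))) (monomials-* L (cartesianProduct L L) one (e a₂) _ _)))
         (monomials-* L (cartesianProduct L (cartesianProduct L L)) one (e a₁) _ _)) n ⟩
  monomials (cartesianProduct L (cartesianProduct L (cartesianProduct L L))) (λ _ → + 1) E₄ n
    ≡⟨ monomials-at (cartesianProduct L (cartesianProduct L (cartesianProduct L L))) (λ _ → + 1) E₄ n ⟩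
  sumOver (cartesianProduct L (cartesianProduct L (cartesianProduct L L))) F
    ≡⟨ sumOver-product L (cartesianProduct L (cartesianProduct L L)) F ⟩
  sumOver L (λ i → sumOver (cartesianProduct L (cartesianProduct L L)) (λ y → F (i , y)))
    ≡⟨ sumOver-cong L (λ i → trans (sumOver-product L (cartesianProduct L L) (λ y → F (i , y)))
         (sumOver-cong L (λ j → trans (sumOver-product L L (λ y → F (i , (j , y)))) (sumOver-cong L (λ k → sumOver-cong L (λ l → sym (indicator-eq i j k l))))))) ⟩
  sumOver L (λ i → sumOver L (λ j → sumOver L (λ k → sumOver L (λ l → + I i j k l))))
    ≡⟨ trans (count-sum L _) (sumOver-cong L (λ i → trans (count-sum L _) (sumOver-cong L (λ j → trans (count-sum L _) (sumOver-cong L (λ k → count-sum L _)))))) ⟨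
  N a₁ a₂ a₃ a₄ n ∎)
  where
  L = intRange n
  e : ℕ → ℤ → ℕ
  e a i = a ℕ.* jexp 1 1 i
  mono₁ : ℕ → Series
  mono₁ a = monomials L one (e a)
  trunc : ∀ a .{{_ : NonZero a}} → dil a φ ≈[ suc n ] mono₁ a
  trunc a = ≈[]-trans (≈⇒≈[] (θ-dil a gφ one)) (θ-trunc (growing-* a gφ) one n)
  E₄ : ℤ × (ℤ × (ℤ × ℤ)) → ℕ
  E₄ x = e a₁ (proj₁ x) ℕ.+ (e a₂ (proj₁ (proj₂ x)) ℕ.+ (e a₃ (proj₁ (proj₂ (proj₂ x))) ℕ.+ e a₄ (proj₂ (proj₂ (proj₂ x)))))
  F : ℤ × (ℤ × (ℤ × ℤ)) → ℤ
  F x = ind (E₄ x ℕ.≟ n) * + 1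
  I : ℤ → ℤ → ℤ → ℤ → ℕ
  I i j k l = indicator (does (quadForm a₁ a₂ a₃ a₄ i j k l ℤ.≟ + n))
  form : ∀ i j k l → + E₄ (i , (j , (k , l))) ≡ quadForm a₁ a₂ a₃ a₄ i j k l
  form i j k l = trans (cong₂ _+_ (p a₁ i) (cong₂ _+_ (p a₂ j) (cong₂ _+_ (p a₃ k) (p a₄ l)))) (assoc (+ a₁ * sq i) (+ a₂ * sq j) (+ a₃ * sq k) (+ a₄ * sq l))
    where
    p : ∀ a i → + e a i ≡ + a * sq i
    p a i = trans (ℤₚ.pos-* a (jexp 1 1 i)) (cong (+ a *_) (jexp-square i))
    assoc : ∀ a b c d → a + (b + (c + d)) ≡ a + b + c + d
    assoc = solve-∀
  indicator-ind : ∀ {P : Set} (d : Dec P) → + indicator (does d) ≡ ind d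
  indicator-ind (yes _) = refl
  indicator-ind (no _)  = refl
  indicator-eq : ∀ i j k l → + I i j k l ≡ F (i , (j , (k , l)))
  indicator-eq i j k l = trans (indicator-ind (quadForm a₁ a₂ a₃ a₄ i j k l ℤ.≟ + n)) (trans
    (ind-⇔ (quadForm a₁ a₂ a₃ a₄ i j k l ℤ.≟ + n) (E₄ (i , (j , (k , l))) ℕ.≟ n)
      (λ p → ℤₚ.+-injective (trans (form i j k l) p)) (λ p → trans (sym (form i j k l)) (cong +_ p))) (sym (ℤₚ.*-identityʳ _)))

σfrac-dil : ∀ χ ψ n .{{_ : NonZero n}} d .{{_ : NonZero d}} → σfrac χ ψ n d ≡ dil d (σ χ ψ) n
σfrac-dil χ ψ n@(suc _) d@(suc _) = go (d ∣? n)
  where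
  go : (p : Dec (d ∣ n)) → (if does p then σ χ ψ (n / d) else + 0) ≡ dil d (σ χ ψ) n
  go (yes (divides k eq)) = trans (cong (σ χ ψ) (trans (cong (_/ d) eq) (m*n/n≡m k d))) (trans (sym (dil-at d (σ χ ψ) k)) (cong (dil d (σ χ ψ)) (sym eq)))
  go (no ∤)               = sym (dil-off d n (σ χ ψ) ∤)

oneMinus-factor : ∀ d .{{_ : NonZero d}} → oneMinus d ≈ factor (- + 1) d
oneMinus-factor d@(suc _) = pointwise λ
  { zero    → sym (trans (+S-at (constS (+ 1)) (constS (- + 1) *S qpow d) 0) (cong (λ t → + 1 + t) (constS-*ᵏ 0 (- + 1) (qpow d))))
  ; (suc k) → sym (trans (+S-at (constS (+ 1)) (constS (- + 1) *S qpow d) (suc k)) (trans (ℤₚ.+-identityˡ _) (trans (constS-*ᵏ (suc k) (- + 1) (qpow d))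
      (trans (cong (- + 1 *_) (trans (qpow-at d (suc k)) (ind-⇔ (d ℕ.≟ suc k) (suc k ℕ.≟ d) sym sym))) (minus (suc k ℕ.≟ d)))))) }
  where
  minus : ∀ {P : Set} (p : Dec P) → - + 1 * ind p ≡ (if does p then - + 1 else + 0)
  minus (yes _) = refl
  minus (no _)  = refl

powS-^ : ∀ f r → powS f r ≈ f ^ r
powS-^ f zero    = pointwise λ { zero → refl ; (suc _) → refl }
powS-^ f (suc r) = ≈-trans (≈-sym (*S-def f (powS f r))) (*-congˡ (powS-^ f r))

^-near : ∀ {f N} r → f ≈[ N ] constS (+ 1) → f ^ r ≈[ N ] constS (+ 1)
^-near zero    p = ≈[]-refl
^-near (suc r) p = ≈[]-trans (*-cong[] p (^-near r p)) (≈⇒≈[] (*S-identityˡ _))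

geomS-near : ∀ d .{{_ : NonZero d}} → geomS d ≈[ d ] constS (+ 1)
geomS-near d@(suc _) = below λ { zero _ → ind-yes (d ∣? 0) (divides 0 refl) ; (suc k) l → ind-no (d ∣? suc k) (λ p → ℕₚ.<⇒≱ l (∣⇒≤ p)) }

-- The factors (1 - q^(δ(i+1)))^r of the r-th power of η(δz), without the power of q.
etaTerm : ℕ → ℤ → ℕ → Series
etaTerm δ (+ r)    i = factor (- + 1) (δ ℕ.* suc i) ^ r
etaTerm δ -[1+ r ] i = geomS (δ ℕ.* suc i) ^ suc r

module _ (δ : ℕ) .{{_ : NonZero δ}} where

  private
    instance
      nz : ∀ {i} → NonZero (δ ℕ.* suc i)
      nz {i} = ℕₚ.m*n≢0 δ (suc i)

    i< : ∀ i → suc i ℕ.≤ δ ℕ.* suc i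
    i< i = ℕₚ.m≤n*m (suc i) δ

  factorPow-term : ∀ r i → factorPow (δ ℕ.* suc i) r ≈ etaTerm δ r i
  factorPow-term (+ r)    i = ≈-trans (powS-^ _ r) (^-cong′ r (oneMinus-factor (δ ℕ.* suc i)))
    where
    ^-cong′ : ∀ {f g} k → f ≈ g → f ^ k ≈ g ^ k
    ^-cong′ zero    p = ≈-refl
    ^-cong′ (suc k) p = *-cong p (^-cong′ k p)
  factorPow-term -[1+ r ] i = powS-^ _ (suc r)

  etaTerm-near : ∀ r → Near1 (etaTerm δ r)
  etaTerm-near (+ r)    = near1 λ i → ^-near r (factor-near (- + 1) (i< i))
  etaTerm-near -[1+ r ] = near1 λ i → ^-near (suc r) (≈[]-weaken (i< i) (geomS-near (δ ℕ.* suc i)))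

  etaPower : ℤ → Series
  etaPower r = Π∞ (etaTerm δ r)

  etaFactorTrunc-∏ : ∀ r K → etaFactorTrunc δ r K ≈ ∏ K (etaTerm δ r)
  etaFactorTrunc-∏ r zero    = pointwise λ { zero → refl ; (suc _) → refl }
  etaFactorTrunc-∏ r (suc K) = ≈-trans (≈-sym (*S-def _ _)) (≈-trans (*-cong (factorPow-term r K) (etaFactorTrunc-∏ r K)) (*S-comm _ _))

  etaPower-trunc : ∀ r K → etaFactorTrunc δ r K ≈[ suc K ] etaPower r
  etaPower-trunc r K = ≈[]-trans (≈⇒≈[] (etaFactorTrunc-∏ r K)) (≈[]-sym (Π∞-trunc (etaTerm-near r) K K ℕₚ.≤-refl))

  E-etaPower : etaPower (+ 1) ≈ E δ
  E-etaPower = ≈-trans (Π∞-cong λ i → ≈-trans (*S-identityʳ _) (factor-exp (- + 1) (lem δ i))) (≈-sym (E-Prod δ {{_}} {{ℕₚ.m*n≢0 δ 1}}))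
    where
    lem : ∀ δ i → δ ℕ.* suc i ≡ δ ℕ.* 1 ℕ.* i ℕ.+ δ ℕ.* 1
    lem = ℕ-solve-∀

  etaPower-pos : ∀ r → etaPower (+ r) ≈ E δ ^ r
  etaPower-pos zero    = pointwise λ n → at (ones n) n
    where
    ones : ∀ n → ∏ n (etaTerm δ (+ 0)) ≈ constS (+ 1)
    ones zero    = ≈-refl
    ones (suc n) = ≈-trans (*S-identityʳ _) (ones n)
  etaPower-pos (suc r) = ≈-trans (Π∞-cong λ i → *-congʳ (≈-sym (*S-identityʳ (factor (- + 1) (δ ℕ.* suc i)))))
    (≈-trans (Π∞-* (etaTerm-near (+ 1)) (etaTerm-near (+ r))) (*-cong E-etaPower (etaPower-pos r)))

  -- Each factor is a geometric series times 1 - q^(δm). A negative power of η enters later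
  -- arguments only through this product.
  etaPower-inverse : etaPower -[1+ 0 ] *S E δ ≈ constS (+ 1)
  etaPower-inverse = ≈-trans (*-congˡ (≈-sym E-etaPower)) (≈-trans (≈-sym (Π∞-* (etaTerm-near -[1+ 0 ]) (etaTerm-near (+ 1))))
    (≈-trans (Π∞-cong λ i → ≈-trans (solve 2 (λ g f → g :* con (+ 1) :* (f :* con (+ 1)) := f :* g) refl (geomS (δ ℕ.* suc i)) (factor (- + 1) (δ ℕ.* suc i))) (geom-eta (δ ℕ.* suc i))) (etaPower-pos 0)))

  etaPower-neg : ∀ r → etaPower -[1+ suc r ] ≈ etaPower -[1+ 0 ] *S etaPower -[1+ r ]
  etaPower-neg r = ≈-trans (Π∞-cong λ i → *-congʳ (≈-sym (*S-identityʳ (geomS (δ ℕ.* suc i))))) (Π∞-* (etaTerm-near -[1+ 0 ]) (etaTerm-near -[1+ r ]))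

-- Carries δ ≠ 0 for every pair, without which the factors 1 - q^(δm) would not tend to 1.
data EtaFactors : EtaQuotient → Set where
  []  : EtaFactors []
  _∷_ : ∀ {δ r e} → NonZero δ → EtaFactors e → EtaFactors ((δ , r) ∷ e)

etaProduct : ∀ {e} → EtaFactors e → Series
etaProduct []                       = constS (+ 1)
etaProduct (_∷_ {δ} {r} δ≢0 factors) = etaPower δ {{δ≢0}} r *S etaProduct factors

etaProduct-trunc : ∀ {e} (p : EtaFactors e) K → etaProdTrunc e K ≈[ suc K ] etaProduct p
etaProduct-trunc []                         K = below λ { zero _ → refl ; (suc _) _ → refl }
etaProduct-trunc (_∷_ {δ} {r} δ≢0 factors) K = ≈[]-trans (≈⇒≈[] (≈-sym (*S-def _ _))) (*-cong[] (etaPower-trunc δ {{δ≢0}} r K) (etaProduct-trunc factors K))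

-- The product truncated at n is exact below q^(n+1), and the coefficient read from it has index n
-- minus the shift.
etaCoeff-series : ∀ {e} (p : EtaFactors e) → etaCoeff e ≈ qpow (etaShift e) *S etaProduct p
etaCoeff-series {e} p = pointwise λ n → trans (coeff n (n ℕ.<ᵇ etaShift e) refl) (sym (at (qpow-*-shift (etaShift e) (etaProduct p)) n))
  where
  open import Data.Bool using (T)
  open import Data.Unit using (tt)
  coeff : ∀ n b → (n ℕ.<ᵇ etaShift e) ≡ b → (if b then + 0 else etaProdTrunc e n (n ∸ etaShift e)) ≡ shiftS (etaShift e) (etaProduct p) n
  coeff n true  q = sym (shiftS-< (etaShift e) (etaProduct p) n (ℕₚ.<ᵇ⇒< n (etaShift e) (subst T (sym q) tt)))
  coeff n false q = trans (at< (etaProduct-trunc p n) (n ∸ etaShift e) (s≤s (ℕₚ.m∸n≤m n (etaShift e))))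
    (trans (sym (shiftS-at (etaShift e) (etaProduct p) (n ∸ etaShift e))) (cong (shiftS (etaShift e) (etaProduct p)) (ℕₚ.m+[n∸m]≡n {etaShift e} {n} (ℕₚ.≮⇒≥ λ l → subst T q (ℕₚ.<⇒<ᵇ l)))))

dil-q : ∀ k .{{_ : NonZero k}} → dil k (qpow 1) ≈ qpow 1 ^ k
dil-q k = ≈-trans (dil-qpow k 1) (≈-trans (pointwise λ j → cong (λ t → qpow t j) (ℕₚ.*-identityʳ k)) (≈-sym (EulerCube.q^ k)))

alt-q : alt (qpow 1) ≈ -S qpow 1
alt-q = ≈-trans (alt-qpow 1) (solve 1 (λ q → con (- + 1) :* q := :- q) refl (qpow 1))

-- Odd coefficients vanish, f(0) = 2f(0), and f(2j) = 2f(j) descends. Hence a series B is determined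
-- by B(q) - 2B(q²).
dil2-fixed : ∀ f → f ≈ constS (+ 2) *S dil 2 f → f ≈ constS (+ 0)
dil2-fixed f p = pointwise λ n → trans (<-rec (λ n → f n ≡ + 0) step n) (sym (constS-zero n))
  where
  eq : ∀ n → f n ≡ + 2 * dil 2 f n
  eq n = trans (at p n) (constS-*ᵏ n (+ 2) (dil 2 f))
  self-double : ∀ x → x ≡ + 2 * x → x ≡ + 0
  self-double x q = trans (lem x) (trans (cong (_- x) (sym q)) (ℤₚ.+-inverseʳ x))
    where
    lem : ∀ x → x ≡ + 2 * x - x
    lem = solve-∀
  step : ∀ n → (∀ {i} → i ℕ.< n → f i ≡ + 0) → f n ≡ + 0
  step n rec with parity n
  ... | even zero    = self-double (f 0) (eq 0)
  ... | even (suc j) = trans (eq (suc j ℕ.* 2)) (trans (cong (+ 2 *_) (trans (dil-at 2 f (suc j)) (rec (s≤s (s≤s (ℕₚ.m≤m*n j 2)))))) refl)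
  ... | odd j        = trans (eq (suc (j ℕ.* 2))) (trans (cong (+ 2 *_) (dil-off 2 (suc (j ℕ.* 2)) f (odd∤ j))) refl)

-- Relations between theta functions of level 40

module Level40 where

  variables : Vec Series 41
  variables = φ ∷ dil 2 φ ∷ dil 5 φ ∷ dil 10 φ ∷ alt φ ∷ dil 5 (alt φ) ∷ dil 2 (alt φ) ∷ dil 10 (alt φ) ∷ qpow 1 ∷ dil 4 ψ ∷ dil 20 ψ ∷ dil 2 ψ
    ∷ dil 10 ψ ∷ dil 4 φ ∷ dil 20 φ ∷ dil 8 ψ ∷ dil 40 ψ ∷ ε₁ ∷ ε₂ ∷ ε₄ ∷ ε₅ ∷ ε₈ ∷ ε₁₀ ∷ ε₂₀ ∷ ε₄₀ ∷ odds⁺ ∷ dil 2 odds⁺ ∷ odds⁺₅ ∷ ψ ∷ dil 8 φ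
    ∷ dil 16 ψ ∷ G₁ ∷ G₃ ∷ σ₀₂ ∷ σ₂₀ ∷ dil 5 σ₀₂ ∷ dil 5 σ₂₀ ∷ c₁ ∷ c₂ ∷ c₃ ∷ c₄ ∷ []

  constants : Vec ℤ 41
  constants = + 1 ∷ + 1 ∷ + 1 ∷ + 1 ∷ + 1 ∷ + 1 ∷ + 1 ∷ + 1 ∷ + 0 ∷ + 1 ∷ + 1 ∷ + 1 ∷ + 1 ∷ + 1 ∷ + 1 ∷ + 1 ∷ + 1 ∷ + 1 ∷ + 1 ∷ + 1 ∷ + 1 ∷ + 1 ∷ + 1
    ∷ + 1 ∷ + 1 ∷ + 1 ∷ + 1 ∷ + 1 ∷ + 1 ∷ + 1 ∷ + 1 ∷ + 1 ∷ + 1 ∷ + 0 ∷ + 0 ∷ + 0 ∷ + 0 ∷ + 0 ∷ + 0 ∷ + 0 ∷ + 0 ∷ []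

  constants-correct : ∀ i → lookup variables i 0 ≡ lookup constants i
  constants-correct = go variables constants (refl ∷ refl ∷ refl ∷ refl ∷ refl ∷ refl ∷ refl ∷ refl ∷ refl ∷ refl ∷ refl ∷ refl ∷ refl ∷ refl ∷ refl ∷ refl ∷ refl ∷ refl ∷ refl ∷ refl ∷ refl ∷ refl ∷ refl ∷ refl ∷ refl ∷ refl ∷ refl ∷ refl ∷ refl ∷ refl ∷ refl ∷ refl ∷ refl ∷ refl ∷ refl ∷ refl ∷ refl ∷ refl ∷ refl ∷ refl ∷ refl ∷ [])
    where
    open import Data.Vec.Relation.Binary.Pointwise.Inductive using (Pointwise; []; _∷_)
    go : ∀ {n} (ρ : Vec Series n) (z : Vec ℤ n) → Pointwise (λ f x → f 0 ≡ x) ρ z → ∀ i → lookup ρ i 0 ≡ lookup z i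
    go _ _ (p ∷ ps) zero    = p
    go _ _ (p ∷ ps) (suc i) = go _ _ ps i

  open Equations variables constants constants-correct public

  -- x, y, a, b are φ at q, q², q⁵, q¹⁰, and w, z, v, c are φ at -q, -q², -q⁵, -q¹⁰; s, P, S are φ
  -- at q⁴, q⁸, q²⁰. `ψ1`, h, g, `ψ8`, H, R, G, `ψ40` are ψ at q, q², q⁴, q⁸, q¹⁰, q¹⁶, q²⁰, q⁴⁰.
  -- Here `χ` is the product (-q; q²)∞, not a character.
  x y a b w v z c q g G h H s S ψ8 ψ40 e1 e2 e4 e5 e8 e10 e20 e40 χ χ2 χ5 ψ1 P R G1 G3 A B A5 B5 c1 c2 c3 c4 : Expr 41
  x = var (# 0)
  y = var (# 1)
  a = var (# 2)
  b = var (# 3)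
  w = var (# 4)
  v = var (# 5)
  z = var (# 6)
  c = var (# 7)
  q = var (# 8)
  g = var (# 9)
  G = var (# 10)
  h = var (# 11)
  H = var (# 12)
  s = var (# 13)
  S = var (# 14)
  ψ8 = var (# 15)
  ψ40 = var (# 16)
  e1 = var (# 17)
  e2 = var (# 18)
  e4 = var (# 19)
  e5 = var (# 20)
  e8 = var (# 21)
  e10 = var (# 22)
  e20 = var (# 23)
  e40 = var (# 24)
  χ = var (# 25)
  χ2 = var (# 26)
  χ5 = var (# 27)
  ψ1 = var (# 28)
  P = var (# 29)
  R = var (# 30)
  G1 = var (# 31)
  G3 = var (# 32)
  A = var (# 33)
  B = var (# 34)
  A5 = var (# 35)
  B5 = var (# 36)
  c1 = var (# 37)
  c2 = var (# 38)
  c3 = var (# 39)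
  c4 = var (# 40)

  -- 4m = x² - w² and 4n = a² - v² by the relations below, and r² = mn. All of m, n, r change sign
  -- under q ↦ -q.
  m n r u : Expr 41
  m = 2 · (q :* g :^ 2)
  n = 2 · (q :^ 5 :* G :^ 2)
  r = 2 · (q :^ 3 :* (g :* G))
  u = q :^ 2 :* (g :* (h :* H))

  d2 : List (Rule (dilate 2))
  d2 = x ↦ y by ≈-refl ∷ w ↦ z by ≈-refl ∷ y ↦ s by dil-dil 2 2 φ ∷ a ↦ b by dil-dil 2 5 φ ∷ v ↦ c by dil-dil 2 5 (alt φ) ∷ q ↦ q :^ 2 by dil-q 2
    ∷ e1 ↦ e2 by ≈-refl ∷ e2 ↦ e4 by dil-dil 2 2 Euler ∷ e4 ↦ e8 by dil-dil 2 4 Euler ∷ e5 ↦ e10 by dil-dil 2 5 Euler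
    ∷ e10 ↦ e20 by dil-dil 2 10 Euler ∷ e20 ↦ e40 by dil-dil 2 20 Euler ∷ χ ↦ χ2 by ≈-refl ∷ ψ1 ↦ h by ≈-refl ∷ h ↦ g by dil-dil 2 2 ψ
    ∷ g ↦ ψ8 by dil-dil 2 4 ψ ∷ H ↦ G by dil-dil 2 10 ψ ∷ s ↦ P by dil-dil 2 4 φ ∷ ψ8 ↦ R by dil-dil 2 8 ψ ∷ []

  d4 : List (Rule (dilate 4))
  d4 = x ↦ s by ≈-refl ∷ e1 ↦ e4 by ≈-refl ∷ e5 ↦ e20 by dil-dil 4 5 Euler ∷ h ↦ ψ8 by dil-dil 4 2 ψ ∷ a ↦ S by dil-dil 4 5 φ
    ∷ H ↦ ψ40 by dil-dil 4 10 ψ ∷ ψ1 ↦ g by ≈-refl ∷ e2 ↦ e8 by dil-dil 4 2 Euler ∷ y ↦ P by dil-dil 4 2 φ ∷ g ↦ R by dil-dil 4 4 ψ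
    ∷ q ↦ q :^ 4 by dil-q 4 ∷ []

  d5 : List (Rule (dilate 5))
  d5 = x ↦ a by ≈-refl ∷ w ↦ v by ≈-refl ∷ s ↦ S by dil-dil 5 4 φ ∷ ψ8 ↦ ψ40 by dil-dil 5 8 ψ ∷ q ↦ q :^ 5 by dil-q 5 ∷ y ↦ b by dil-dil 5 2 φ
    ∷ g ↦ G by dil-dil 5 4 ψ ∷ z ↦ c by dil-dil 5 2 (alt φ) ∷ e1 ↦ e5 by ≈-refl ∷ e2 ↦ e10 by dil-dil 5 2 Euler ∷ A ↦ A5 by ≈-refl ∷ B ↦ B5 by ≈-refl
    ∷ []

  d8 : List (Rule (dilate 8))
  d8 = ψ1 ↦ ψ8 by ≈-refl ∷ h ↦ R by dil-dil 8 2 ψ ∷ x ↦ P by ≈-refl ∷ []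

  d10 : List (Rule (dilate 10))
  d10 = w ↦ c by ≈-refl ∷ e2 ↦ e20 by dil-dil 10 2 Euler ∷ e1 ↦ e10 by ≈-refl ∷ ψ1 ↦ H by ≈-refl ∷ x ↦ b by ≈-refl ∷ h ↦ G by dil-dil 10 2 ψ ∷ []

  d20 : List (Rule (dilate 20))
  d20 = ψ1 ↦ G by ≈-refl ∷ e1 ↦ e20 by ≈-refl ∷ e2 ↦ e40 by dil-dil 20 2 Euler ∷ []

  α : List (Rule alternate)
  α = x ↦ w by ≈-refl ∷ w ↦ x by alt-alt φ ∷ a ↦ v by alt-dil-odd 5 refl φ ∷ v ↦ a by ≈-trans (alt-dil-odd 5 refl (alt φ)) (dil-cong 5 (alt-alt φ))
    ∷ q ↦ :- q by alt-q ∷ e1 ↦ χ :* e2 by alt-ε₁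
    ∷ e5 ↦ χ5 :* e10 by ≈-trans (alt-dil-odd 5 refl Euler) (≈-trans (dil-cong 5 alt-ε₁) (≈-trans (dil-* 5 odds⁺ ε₂) (*-congˡ (dil-dil 5 2 Euler))))
    ∷ s ↦ s by alt-dil-even 4 refl φ ∷ y ↦ y by alt-dil-even 2 refl φ ∷ g ↦ g by alt-dil-even 4 refl ψ ∷ ψ8 ↦ ψ8 by alt-dil-even 8 refl ψ
    ∷ e2 ↦ e2 by alt-dil-even 2 refl Euler ∷ e4 ↦ e4 by alt-dil-even 4 refl Euler ∷ e10 ↦ e10 by alt-dil-even 10 refl Euler
    ∷ e20 ↦ e20 by alt-dil-even 20 refl Euler ∷ []

  x-split : x ≐ s :+ 2 · (q :* ψ8)
  x-split = holds φ-dissect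

  w-split : w ≐ s :- 2 · (q :* ψ8)
  w-split = transport α x-split refl

  a-split : a ≐ S :+ 2 · (q :^ 5 :* ψ40)
  a-split = transport d5 x-split refl

  v-split : v ≐ S :- 2 · (q :^ 5 :* ψ40)
  v-split = transport d5 w-split refl

  y-split : y ≐ P :+ 2 · (q :^ 2 :* R)
  y-split = transport d2 x-split refl

  z-split : z ≐ P :- 2 · (q :^ 2 :* R)
  z-split = transport d2 w-split refl

  x-eta : x ≐ e2 :* (χ :* χ)
  x-eta = holds φ-eta

  w-eta : w :* e2 ≐ e1 :* e1
  w-eta = holds altφ-eta

  χ-eta : χ :* e1 :* e4 ≐ e2 :* e2
  χ-eta = holds odds⁺-eta

  χ5-eta : χ5 :* e5 :* e20 ≐ e10 :* e10
  χ5-eta = holds odds⁺₅-eta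

  ψ-product : ψ1 ≐ e4 :* χ
  ψ-product = holds ψ-eta

  z-eta : z :* e4 ≐ e2 :^ 2
  z-eta = transport d2 w-eta refl

  v-eta : v :* e10 ≐ e5 :^ 2
  v-eta = transport d5 w-eta refl

  c-eta : c :* e20 ≐ e10 :^ 2
  c-eta = transport d10 w-eta refl

  hZ : z :^ 2 ≐ x :* w
  hZ = cancel (e2 :* e4 :^ 2) (λ ()) (combine (e2 :^ 3 :+ e2 :* e4 :* z ✕ z-eta ∷ :- (e2 :* e4 :^ 2 :* w) ✕ x-eta
    ∷ :- (e2 :* e4 :^ 2 :* χ :^ 2) ✕ w-eta ∷ :- e2 :^ 3 :- e1 :* e2 :* e4 :* χ ✕ χ-eta ∷ []) refl)

  hC : c :^ 2 ≐ a :* v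
  hC = transport d5 hZ refl

  z² : z :^ 2 ≐ s :^ 2 :- 4 · (q :^ 2 :* ψ8 :^ 2)
  z² = combine (con (+ 1) ✕ hZ ∷ w ✕ x-split ∷ s :+ 2 · (q :* ψ8) ✕ w-split ∷ []) refl

  -- `z²` relates series in q² only; this is the same relation with q² replaced by q.
  hW : w :^ 2 ≐ y :^ 2 :- 2 · m
  hW = undilate 2 d2 z² refl

  hX : x :^ 2 ≐ y :^ 2 :+ 2 · m
  hX = transport α hW refl

  hV : v :^ 2 ≐ b :^ 2 :- 2 · n
  hV = transport d5 hW refl

  hA : a :^ 2 ≐ b :^ 2 :+ 2 · n
  hA = transport d5 hX refl

  ψ-eta₁ : ψ1 :* e1 ≐ e2 :^ 2
  ψ-eta₁ = combine (e1 ✕ ψ-product ∷ con (+ 1) ✕ χ-eta ∷ []) refl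

  h-eta : h :* e2 ≐ e4 :^ 2
  h-eta = transport d2 ψ-eta₁ refl

  g-eta : g :* e4 ≐ e8 :^ 2
  g-eta = transport d4 ψ-eta₁ refl

  H-eta : H :* e10 ≐ e20 :^ 2
  H-eta = transport d10 ψ-eta₁ refl

  G-eta₂₀ : G :* e20 ≐ e40 :^ 2
  G-eta₂₀ = transport d20 ψ-eta₁ refl

  ψ² : ψ1 :^ 2 ≐ x :* h
  ψ² = cancel e2 (λ ()) (combine (e2 :* ψ1 :+ e2 :* e4 :* χ ✕ ψ-product ∷ :- (e2 :* h) ✕ x-eta ∷ :- (e2 :* χ :^ 2) ✕ h-eta ∷ []) refl)

  h² : h :^ 2 ≐ y :* g
  h² = transport d2 ψ² refl

  g² : g :^ 2 ≐ s :* ψ8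
  g² = transport d4 ψ² refl

  H² : H :^ 2 ≐ b :* G
  H² = transport d10 ψ² refl

  p₄ : x :* v :- w :* a ≐ 4 · (q :* (e4 :* e20))
  p₄ = holds (≈-trans φφ₅-dissect (*-congˡ (*-congˡ (*-cong (dil-cong 4 pentagonal-eta) (dil-cong 20 pentagonal-eta)))))

  p₄-split : e4 :* e20 ≐ ψ8 :* S :- q :^ 4 :* s :* ψ40
  p₄-split = cancel (con (+ 4)) (λ ()) (cancel-q q ≈-refl (combine (con (- + 1) ✕ p₄ ∷ v ✕ x-split ∷ :- a ✕ w-split ∷ :- s :+ 2 · (q :* ψ8) ✕ a-split
    ∷ s :+ 2 · (q :* ψ8) ✕ v-split ∷ []) refl))

  -- Once 4q is cancelled from `p₄`, with φ dissected, only series in q⁴ remain.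
  p₁ : e1 :* e5 ≐ h :* a :- q :* x :* H
  p₁ = undilate 4 d4 p₄-split refl

  p₂ : e2 :* e10 ≐ g :* b :- q :^ 2 :* y :* G
  p₂ = transport d2 p₁ refl

  p₈ : y :* c :- z :* b ≐ 4 · (q :^ 2 :* e8 :* e40)
  p₈ = transport d2 p₄ refl

  x²-split : x :^ 2 ≐ a :^ 2 :+ 4 · (q :* (χ :* (e5 :* e20)))
  x²-split = combine (con (+ 1) ✕ split ∷ []) refl
    where
    split : x :* x ≐ a :* a :+ 4 · (q :* (χ :* e5 :* e20))
    split = holds (≈-trans φ²-dissect (+-congˡ (*-congˡ (*-congˡ f19f37-eta))))

  R₁ : e1 :* e4 :* (x :^ 2 :- a :^ 2) ≐ 4 · (q :* e2 :^ 2 :* e5 :* e20)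
  R₁ = combine (e1 :* e4 ✕ x²-split ∷ 4 · (e20 :* e5 :* q) ✕ χ-eta ∷ []) refl

  R₁-alt : χ :* e2 :* e4 :* (w :^ 2 :- v :^ 2) ≐ :- (4 · (q :* e2 :^ 2 :* χ5 :* e10 :* e20))
  R₁-alt = transport α R₁ refl

  R₁′ : e2 :* e5 :* (w :^ 2 :- v :^ 2) ≐ :- (4 · (q :* e1 :* e10 :^ 3))
  R₁′ = cancel (e2 :^ 2) (λ ()) (combine (e1 :* e5 ✕ R₁-alt ∷ e2 :* e5 :* v :^ 2 :- e2 :* e5 :* w :^ 2 ✕ χ-eta
    ∷ :- 4 · (e1 :* e10 :* e2 :^ 2 :* q) ✕ χ5-eta ∷ []) refl)

  R₁″ : e4 :* e10 :* (z :^ 2 :- c :^ 2) ≐ :- (4 · (q :^ 2 :* e2 :* e20 :^ 3))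
  R₁″ = transport d2 R₁′ refl

  -- Both sides are the same eta quotient, by `R₁`, `R₁′` and `R₁″`.
  XAWV : (x :^ 2 :- a :^ 2) :* (w :^ 2 :- v :^ 2) ≐ 4 · (c :^ 2 :* (z :^ 2 :- c :^ 2))
  XAWV = cancel (e1 :* e4 :^ 2 :* e2 :* e5 :* e10 :* e20 :^ 2) (λ ()) (combine (e2 :* e5 :* e4 :* e10 :* e20 :^ 2 :* (w :^ 2 :- v :^ 2) ✕ R₁
    ∷ 4 · (q :* e2 :^ 2 :* e5 :* e20 :^ 3 :* e4 :* e10) ✕ R₁′ ∷ :- 4 · (c :^ 2 :* e20 :^ 2 :* e1 :* e4 :* e2 :* e5) ✕ R₁″
    ∷ 16 · (c :* e1 :* e2 :^ 2 :* e20 :^ 4 :* e4 :* e5 :* q :^ 2) :+ 16 · (e1 :* e10 :^ 2 :* e2 :^ 2 :* e20 :^ 3 :* e4 :* e5 :* q :^ 2) ✕ c-eta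
    ∷ []) refl)

  -- `XAWV` supplies x²v² + w²a², and xw = z², av = c² the remaining terms.
  hQ : (x :* v :- w :* a) :* (x :* v :- w :* a) ≐ (z :^ 2 :- c :^ 2) :* (z :^ 2 :- 5 · c :^ 2)
  hQ = combine (con (- + 1) ✕ XAWV ∷ 2 · c :^ 2 :- w :* x :- z :^ 2 ✕ hZ ∷ :- (a :* v) :- c :^ 2 :+ 2 · (w :* x) ✕ hC ∷ []) refl

  Π-z : (z :^ 2 :- c :^ 2) :* (z :^ 2 :- 5 · c :^ 2) ≐ 16 · (q :^ 2 :* e4 :^ 2 :* e20 :^ 2)
  Π-z = combine (con (- + 1) ✕ hQ ∷ x :* v :- w :* a :+ 4 · (q :* e4 :* e20) ✕ p₄ ∷ []) refl

  Π-w : (w :^ 2 :- v :^ 2) :* (w :^ 2 :- 5 · v :^ 2) ≐ 16 · (q :* e2 :^ 2 :* e10 :^ 2)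
  Π-w = undilate 2 d2 Π-z refl

  -- Reached from `Π-z` by q² ↦ q and then q ↦ -q.
  Π-x : (x :^ 2 :- a :^ 2) :* (x :^ 2 :- 5 · a :^ 2) ≐ :- (16 · (q :* e2 :^ 2 :* e10 :^ 2))
  Π-x = transport α Π-w refl

  Π-y : (y :^ 2 :- b :^ 2) :* (y :^ 2 :- 5 · b :^ 2) ≐ :- (16 · (q :^ 2 :* e4 :^ 2 :* e20 :^ 2))
  Π-y = transport d2 Π-x refl

  hT : (x :* v :- w :* a) :* (x :* v :- w :* a) ≐ :- ((y :^ 2 :- b :^ 2) :* (y :^ 2 :- 5 · b :^ 2))
  hT = combine (x :* v :- w :* a :+ 4 · (q :* e4 :* e20) ✕ p₄ ∷ con (+ 1) ✕ Π-y ∷ []) refl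

  κ : 16 · (q :* e2 :^ 2 :* e10 :^ 2) ≐ 8 · (m :* b :^ 2 :+ n :* y :^ 2 :- 2 · (r :* y :* b))
  κ = combine (16 · (q :* (e2 :* e10 :+ g :* b :- q :^ 2 :* y :* G)) ✕ p₂ ∷ []) refl

  hP : (w :^ 2 :- v :^ 2) :* (w :^ 2 :- 5 · v :^ 2) ≐ 8 · (m :* b :^ 2 :+ n :* y :^ 2 :- 2 · (r :* y :* b))
  hP = combine (con (+ 1) ✕ Π-w ∷ con (+ 1) ✕ κ ∷ []) refl

  hP′ : (x :^ 2 :- a :^ 2) :* (x :^ 2 :- 5 · a :^ 2) ≐ :- (8 · (m :* b :^ 2 :+ n :* y :^ 2 :- 2 · (r :* y :* b)))
  hP′ = combine (con (+ 1) ✕ Π-x ∷ con (- + 1) ✕ κ ∷ []) refl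

  -- `hP` and `hP′` differ by q ↦ -q. With x², w² = y² ± 2m and a², v² = b² ± 2n, their sum keeps
  -- the terms even in m and n; their difference keeps the odd terms and is `K`.
  quadric : (y :^ 2 :- b :^ 2) :* (y :^ 2 :- 5 · b :^ 2) :+ 4 · ((m :- n) :* (m :- 5 · n)) ≐ con (+ 0)
  quadric = cancel (con (+ 2)) (λ ()) (combine (con (+ 1) ✕ hP ∷ con (+ 1) ✕ hP′ ∷ 6 · a :^ 2 :- x :^ 2 :- y :^ 2 :- 4 · (g :^ 2 :* q) ✕ hX
    ∷ 6 · v :^ 2 :- w :^ 2 :- y :^ 2 :+ 4 · (g :^ 2 :* q) ✕ hW
    ∷ :- 5 · a :^ 2 :- 5 · b :^ 2 :+ 6 · y :^ 2 :+ 24 · (g :^ 2 :* q) :- 20 · (G :^ 2 :* q :^ 5) ✕ hA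
    ∷ :- 5 · b :^ 2 :- 5 · v :^ 2 :+ 6 · y :^ 2 :- 24 · (g :^ 2 :* q) :+ 20 · (G :^ 2 :* q :^ 5) ✕ hV ∷ []) refl)

  K : 4 · (y :* b :* r) ≐ y :^ 2 :* (m :- n) :- b :^ 2 :* (m :- 5 · n)
  K = cancel (con (+ 16)) (λ ()) (combine (con (+ 2) ✕ hP ∷ con (- + 2) ✕ hP′ ∷ :- 12 · a :^ 2 :+ 2 · x :^ 2 :+ 2 · y :^ 2 :+ 8 · (g :^ 2 :* q) ✕ hX
    ∷ 12 · v :^ 2 :- 2 · w :^ 2 :- 2 · y :^ 2 :+ 8 · (g :^ 2 :* q) ✕ hW
    ∷ 10 · a :^ 2 :+ 10 · b :^ 2 :- 12 · y :^ 2 :- 48 · (g :^ 2 :* q) :+ 40 · (G :^ 2 :* q :^ 5) ✕ hA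
    ∷ :- 10 · b :^ 2 :- 10 · v :^ 2 :+ 12 · y :^ 2 :- 48 · (g :^ 2 :* q) :+ 40 · (G :^ 2 :* q :^ 5) ✕ hV ∷ []) refl)

  T² : (x :* v :- w :* a) :* (x :* v :- w :* a) ≐ 4 · ((m :- n) :* (m :- 5 · n))
  T² = combine (con (+ 1) ✕ hT ∷ con (- + 1) ✕ quadric ∷ []) refl

  -- The difference of the two terms on the right is 4ybr by `K`, so the square of their sum is
  -- known. It agrees with the left side because (xa - wv)² = (xv - wa)² + 16r², to which `T²`
  -- applies.
  N₀ : y :* b :* (x :* a :- w :* v) ≐ y :^ 2 :* (m :- n) :+ b :^ 2 :* (m :- 5 · n)
  -- Dissecting x, w, a, v shows that the two sides add up to q times this series, whose constant
  -- term is 4 + 2 + 2.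
  N₀ = square-root-q q ≈-refl (y :* b :* (4 · (ψ8 :* a) :+ 4 · (q :^ 4 :* w :* ψ40)) :+ y :^ 2 :* (2 · g :^ 2 :- 2 · (q :^ 4 :* G :^ 2)) :+ b :^ 2 :* (2 · g :^ 2 :- 10 · (q :^ 4 :* G :^ 2)))
    (combine (a :* b :* y ✕ x-split ∷ :- (b :* v :* y) :- 4 · (b :* q :^ 5 :* y :* ψ40) ✕ w-split ∷ b :* s :* y :- 2 · (b :* q :* y :* ψ8) ✕ a-split
      ∷ :- (b :* s :* y) :+ 2 · (b :* q :* y :* ψ8) ✕ v-split ∷ []) refl) (λ ())
    (combine (y :^ 2 :* b :^ 2 ✕ T² ∷ 4 · (y :* b :* r) :+ y :^ 2 :* (m :- n) :- b :^ 2 :* (m :- 5 · n) ✕ K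
      ∷ a :^ 2 :* b :^ 2 :* y :^ 2 :- b :^ 2 :* v :^ 2 :* y :^ 2 ✕ hX ∷ :- (a :^ 2 :* b :^ 2 :* y :^ 2) :+ b :^ 2 :* v :^ 2 :* y :^ 2 ✕ hW
      ∷ 8 · (b :^ 2 :* g :^ 2 :* q :* y :^ 2) ✕ hA ∷ :- 8 · (b :^ 2 :* g :^ 2 :* q :* y :^ 2) ✕ hV ∷ []) refl)

  N₁ : b :* (x :* a :- w :* v :+ 4 · r) ≐ 2 · (y :* (m :- n))
  N₁ = cancel y (λ ()) (combine (con (+ 1) ✕ N₀ ∷ con (+ 1) ✕ K ∷ []) refl)

  N₂ : y :* (x :* a :- w :* v :- 4 · r) ≐ 2 · (b :* (m :- 5 · n))
  N₂ = cancel b (λ ()) (combine (con (+ 1) ✕ N₀ ∷ con (- + 1) ✕ K ∷ []) refl)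

  F² : 4 · ((y :* b :- 2 · r) :* (y :* b :- 2 · r)) ≐ w :^ 4 :- 2 · (w :^ 2 :* v :^ 2) :+ 5 · v :^ 4
  F² = combine (con (- + 4) ✕ K ∷ con (- + 1) ✕ quadric ∷ 2 · v :^ 2 :- w :^ 2 :- y :^ 2 :+ 4 · (g :^ 2 :* q) ✕ hW
    ∷ :- 5 · b :^ 2 :- 5 · v :^ 2 :+ 2 · y :^ 2 :- 8 · (g :^ 2 :* q) :+ 20 · (G :^ 2 :* q :^ 5) ✕ hV ∷ []) refl

  xwav : 4 · (x :* w :* a :* v) ≐ a :^ 2 :* (5 · v :^ 2 :- w :^ 2) :- x :^ 2 :* (v :^ 2 :- w :^ 2)
  xwav = combine (con (+ 1) ✕ hQ ∷ :- 6 · c :^ 2 :+ w :* x :+ z :^ 2 ✕ hZ ∷ 5 · (a :* v) :+ 5 · c :^ 2 :- 6 · (w :* x) ✕ hC ∷ []) refl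

  -- The device of `N₀` again: `xwav` is the difference of the two terms on the right, and their sum
  -- is found from its square by `F²`. Both sides have constant term 4.
  C : 4 · (x :* a :* (y :* b :- 2 · r)) ≐ a :^ 2 :* (5 · v :^ 2 :- w :^ 2) :+ x :^ 2 :* (v :^ 2 :- w :^ 2)
  C = square-root (λ ()) (combine (4 · (x :^ 2 :* a :^ 2) ✕ F²
    ∷ 4 · (x :* w :* a :* v) :+ (a :^ 2 :* (5 · v :^ 2 :- w :^ 2) :- x :^ 2 :* (v :^ 2 :- w :^ 2)) ✕ xwav ∷ []) refl)

  C₁ : 2 · (x :* (y :* b :- 2 · r :+ w :* v)) ≐ a :* (5 · v :^ 2 :- w :^ 2)
  C₁ = cancel (2 · a) (λ ()) (combine (con (+ 1) ✕ C ∷ con (+ 1) ✕ xwav ∷ []) refl)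

  C₂ : 2 · (a :* (y :* b :- 2 · r :- w :* v)) ≐ x :* (v :^ 2 :- w :^ 2)
  C₂ = cancel (2 · x) (λ ()) (combine (con (+ 1) ✕ C ∷ con (- + 1) ✕ xwav ∷ []) refl)

  -- The primed relations are the images of `F²`, `xwav`, `C` and `C₁` under q ↦ -q, which exchanges
  -- x with w and a with v and negates r.
  F²′ : 4 · ((y :* b :+ 2 · r) :* (y :* b :+ 2 · r)) ≐ x :^ 4 :- 2 · (x :^ 2 :* a :^ 2) :+ 5 · a :^ 4
  F²′ = combine (con (+ 4) ✕ K ∷ con (- + 1) ✕ quadric ∷ 2 · a :^ 2 :- x :^ 2 :- y :^ 2 :- 4 · (g :^ 2 :* q) ✕ hX
    ∷ :- 5 · a :^ 2 :- 5 · b :^ 2 :+ 2 · y :^ 2 :+ 8 · (g :^ 2 :* q) :- 20 · (G :^ 2 :* q :^ 5) ✕ hA ∷ []) refl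

  xwav′ : 4 · (w :* x :* v :* a) ≐ v :^ 2 :* (5 · a :^ 2 :- x :^ 2) :- w :^ 2 :* (a :^ 2 :- x :^ 2)
  xwav′ = combine (con (+ 1) ✕ hQ ∷ :- 6 · c :^ 2 :+ w :* x :+ z :^ 2 ✕ hZ ∷ 5 · (a :* v) :+ 5 · c :^ 2 :- 6 · (w :* x) ✕ hC ∷ []) refl

  C′ : 4 · (w :* v :* (y :* b :+ 2 · r)) ≐ v :^ 2 :* (5 · a :^ 2 :- x :^ 2) :+ w :^ 2 :* (a :^ 2 :- x :^ 2)
  C′ = square-root (λ ()) (combine (4 · (w :^ 2 :* v :^ 2) ✕ F²′
    ∷ 4 · (w :* x :* v :* a) :+ (v :^ 2 :* (5 · a :^ 2 :- x :^ 2) :- w :^ 2 :* (a :^ 2 :- x :^ 2)) ✕ xwav′ ∷ []) refl)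

  C₁′ : 2 · (w :* (y :* b :+ 2 · r :+ x :* a)) ≐ v :* (5 · a :^ 2 :- x :^ 2)
  C₁′ = cancel (2 · v) (λ ()) (combine (con (+ 1) ✕ C′ ∷ con (+ 1) ✕ xwav′ ∷ []) refl)

  -- Again both sides are one eta quotient, by `R₁` and `R₁′`.
  hE : v :* z :* (w :^ 2 :- v :^ 2) ≐ w :* c :* (a :^ 2 :- x :^ 2)
  hE = cancel (e10 :* e4 :* e2 :* e5 :* e20 :* e1) (λ ()) (combine (v :* z :* e10 :* e4 :* e20 :* e1 ✕ R₁′ ∷ w :* c :* e10 :* e2 :* e5 :* e20 ✕ R₁
    ∷ :- 4 · (e1 :^ 2 :* e10 :^ 3 :* e20 :* e4 :* q :* z) ✕ v-eta ∷ :- 4 · (e1 :^ 2 :* e10 :^ 3 :* e20 :* e5 :^ 2 :* q) ✕ z-eta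
    ∷ 4 · (e10 :* e2 :^ 3 :* e20 :* e5 :^ 2 :* q :* w) ✕ c-eta ∷ 4 · (e10 :^ 3 :* e2 :^ 2 :* e20 :* e5 :^ 2 :* q) ✕ w-eta ∷ []) refl)

  -- `hP` and `hP′` make (w² - v²)(w² - 5v²) the negative of (x² - a²)(x² - 5a²); this is divided by
  -- `hE`. The divisor w² - v² has constant term 0, so `R₁′` first replaces it by q times a product
  -- that can be cancelled.
  E₁ : w :* c :* (5 · v :^ 2 :- w :^ 2) ≐ z :* v :* (5 · a :^ 2 :- x :^ 2)
  E₁ = cancel (4 · (e1 :* e10 :^ 3 :* v :* z)) (λ ()) (cancel-q q ≈-refl (combine (v :* z :* (w :* c :* (5 · v :^ 2 :- w :^ 2) :- z :* v :* (5 · a :^ 2 :- x :^ 2)) ✕ R₁′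
    ∷ e2 :* e5 :* w :* c :* z :* v ✕ hP ∷ e2 :* e5 :* w :* c :* z :* v ✕ hP′ ∷ e2 :* e5 :* z :* v :* (5 · a :^ 2 :- x :^ 2) ✕ hE ∷ []) refl))

  D₃ : c :* (5 · v :^ 2 :- w :^ 2) ≐ 2 · (z :* (y :* b :+ 2 · r :+ x :* a))
  D₃ = cancel w (λ ()) (combine (con (+ 1) ✕ E₁ ∷ :- z ✕ C₁′ ∷ []) refl)

  E₂ : x :* c :* (w :^ 2 :- v :^ 2) ≐ a :* z :* (a :^ 2 :- x :^ 2)
  E₂ = cancel (z :* v) (λ ()) (combine (x :* c ✕ hE ∷ :- (a :^ 3 :* v) :+ a :* v :* x :^ 2 ✕ hZ ∷ a :^ 2 :* w :* x :- w :* x :^ 3 ✕ hC ∷ []) refl)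

  E₃ : 4 · (w :* z :* c) ≐ 2 · (x :* (y :* b :+ 2 · r)) :+ a :* (5 · a :^ 2 :- 3 · x :^ 2)
  E₃ = cancel z (λ ()) (combine (x ✕ D₃ ∷ con (+ 5) ✕ E₂ ∷ 4 · (c :* w) ✕ hZ ∷ []) refl)

  K-y : 4 · (q :^ 2 :* y :* b :* g :* G) ≐ g :^ 2 :* (y :^ 2 :- b :^ 2) :- q :^ 4 :* G :^ 2 :* (y :^ 2 :- 5 · b :^ 2)
  K-y = cancel (con (+ 2)) (λ ()) (cancel-q q ≈-refl (combine (con (+ 1) ✕ K ∷ []) refl))

  -- `K` divided by 2q is a relation between series in q².
  K-x : 4 · (q :* x :* a :* h :* H) ≐ h :^ 2 :* (x :^ 2 :- a :^ 2) :- q :^ 2 :* H :^ 2 :* (x :^ 2 :- 5 · a :^ 2)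
  K-x = undilate 2 d2 K-y refl

  hU : 8 · (x :* a :* u) ≐ y :* m :* (x :^ 2 :- a :^ 2) :- b :* r :* (x :^ 2 :- 5 · a :^ 2)
  hU = combine (2 · (q :* g) ✕ K-x ∷ 2 · (q :* g :* (x :^ 2 :- a :^ 2)) ✕ h² ∷ :- 2 · (q :^ 3 :* g :* (x :^ 2 :- 5 · a :^ 2)) ✕ H² ∷ []) refl

  -- `Q₁` to `Q₄` reduce the mixed quartic forms occurring in the c_k to xy and ab times quadratic
  -- forms in thetas, that is, to the eight basic products.
  Q₁ : y :* a :* w :* v ≐ x :* y :* (w :^ 2 :- 2 · b :^ 2) :+ 2 · (a :* b :* (y :^ 2 :+ m :- 5 · n))
  Q₁ = combine (a ✕ N₂ ∷ :- y ✕ C₂ ∷ :- (x :* y) ✕ hA ∷ :- (x :* y) ✕ hV ∷ []) refl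

  Q₂ : 4 · (w :* z :* b :* c) ≐ 4 · (x :* y :* (m :- n)) :+ 2 · (a :* b :* (5 · b :^ 2 :- 3 · y :^ 2 :- 4 · m))
  Q₂ = combine (b ✕ E₃ ∷ 2 · x ✕ N₁ ∷ b ✕ C₁ ∷ :- 5 · (a :* b) ✕ hX ∷ :- (a :* b) ✕ hW ∷ 5 · (a :* b) ✕ hA ∷ 5 · (a :* b) ✕ hV ∷ []) refl

  Q₃ : 4 · (x :* b :* r) ≐ x :* y :* (4 · m :- 4 · n :- 2 · b :^ 2) :- a :* b :* (3 · y :^ 2 :+ 2 · m :+ 10 · n :- 5 · b :^ 2)
  Q₃ = combine (2 · x ✕ N₁ ∷ b ✕ C₁ ∷ :- 2 · (a :* b) ✕ hX ∷ :- (a :* b) ✕ hW ∷ 5 · (a :* b) ✕ hV ∷ []) refl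

  Q₄ : 16 · (a :* u) ≐ x :* y :* (w :^ 2 :- v :^ 2) :+ 5 · (a :* b :* (y :^ 2 :- b :^ 2)) :+ 2 · (a :* b :* (m :- 5 · n))
  Q₄ = cancel (2 · x) (λ ()) (combine (con (+ 4) ✕ hU ∷ :- 2 · (3 · y :^ 2 :- 5 · b :^ 2 :+ 6 · m :- 10 · n) ✕ N₁ ∷ :- 4 · (b :* w) ✕ C₁′
    ∷ :- (b :* x) ✕ C₁ ∷ 5 · (a :* b) ✕ C₂ ∷ 8 · y ✕ K ∷ :- 2 · y ✕ quadric
    ∷ 2 · (b :^ 2 :* y) :+ 6 · (b :* v :* w) :+ 2 · (v :^ 2 :* y) :- 2 · (w :^ 2 :* y) :+ 8 · (g :^ 2 :* q :* y) :- 16 · (G :* b :* g :* q :^ 3) ✕ hX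
    ∷ 4 · (a :* b :* x) :+ 8 · (b :^ 2 :* y) :- 2 · y :^ 3 :- 8 · (g :^ 2 :* q :* y) :+ 32 · (G :* b :* g :* q :^ 3) ✕ hW
    ∷ :- 10 · (b :^ 2 :* y) :- 10 · (b :* v :* w) :- 8 · (g :^ 2 :* q :* y) :+ 80 · (G :* b :* g :* q :^ 3) ✕ hA
    ∷ 2 · y :^ 3 :+ 8 · (g :^ 2 :* q :* y) ✕ hV ∷ []) refl)

  -- The series c_k as quartic forms in theta functions

  private
    E1-pow : ∀ j → E 1 ^ j ≈ ε₁ ^ j
    E1-pow zero    = ≈-refl
    E1-pow (suc j) = *-cong (dil-one Euler) (E1-pow j)
    E1-inverse : etaPower 1 -[1+ 0 ] *S ε₁ ≈ constS (+ 1)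
    E1-inverse = ≈-trans (*-congˡ (≈-sym (dil-one Euler))) (etaPower-inverse 1)

  -- Denominators are moved to the left. The power of q is the sum of the δ r_δ divided by 24; for
  -- c₁, c₂, c₃, c₄ the sums are 48, 48, 72, 24.
  c1-eta : c1 :* (e2 :* e20) ≐ q :^ 2 :* e1 :^ 2 :* e8 :* e10 :^ 2 :* e40
  c1-eta = holds (≈-trans (*-congʳ (≈-trans (etaCoeff-series {eq₁} (_ ∷ _ ∷ _ ∷ _ ∷ _ ∷ _ ∷ [])) (*-cong (≈-sym (EulerCube.q^ 2)) (*-cong (≈-trans (etaPower-pos 1 2) (E1-pow 2)) (*-cong (etaPower-pos 8 1) (*-cong (etaPower-pos 10 2) (*-cong (etaPower-pos 40 1) (*-cong ≈-refl (*-cong ≈-refl ≈-refl)))))))))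
    (≈-trans (solve 9 (λ q e1 e2 e8 e10 e20 e40 i2 i20 → q :^ 2 :* (e1 :^ 2 :* (e8 :^ 1 :* (e10 :^ 2 :* (e40 :^ 1 :* (i2 :* (i20 :* (con (+ 1)))))))) :* (e2 :* e20) := (q :^ 2 :* e1 :^ 2 :* e8 :* e10 :^ 2 :* e40) :* (i2 :* e2) :* (i20 :* e20)) refl (qpow 1) ε₁ ε₂ ε₈ ε₁₀ ε₂₀ ε₄₀ (etaPower 2 -[1+ 0 ]) (etaPower 20 -[1+ 0 ]))
      (≈-trans (*-cong (≈-trans (*-cong ≈-refl (etaPower-inverse 2)) (*S-identityʳ _)) (etaPower-inverse 20)) (*S-identityʳ _))))

  c2-eta : c2 :* (e4 :* e10) ≐ q :^ 2 :* e1 :* e5 :* e8 :^ 2 :* e20 :^ 2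
  c2-eta = holds (≈-trans (*-congʳ (≈-trans (etaCoeff-series {eq₂} (_ ∷ _ ∷ _ ∷ _ ∷ _ ∷ _ ∷ [])) (*-cong (≈-sym (EulerCube.q^ 2)) (*-cong (≈-trans (etaPower-pos 1 1) (E1-pow 1)) (*-cong (etaPower-pos 5 1) (*-cong (etaPower-pos 8 2) (*-cong (etaPower-pos 20 2) (*-cong ≈-refl (*-cong ≈-refl ≈-refl)))))))))
    (≈-trans (solve 9 (λ q e1 e4 e5 e8 e10 e20 i4 i10 → q :^ 2 :* (e1 :^ 1 :* (e5 :^ 1 :* (e8 :^ 2 :* (e20 :^ 2 :* (i4 :* (i10 :* (con (+ 1)))))))) :* (e4 :* e10) := (q :^ 2 :* e1 :* e5 :* e8 :^ 2 :* e20 :^ 2) :* (i4 :* e4) :* (i10 :* e10)) refl (qpow 1) ε₁ ε₄ ε₅ ε₈ ε₁₀ ε₂₀ (etaPower 4 -[1+ 0 ]) (etaPower 10 -[1+ 0 ]))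
      (≈-trans (*-cong (≈-trans (*-cong ≈-refl (etaPower-inverse 4)) (*S-identityʳ _)) (etaPower-inverse 10)) (*S-identityʳ _))))

  c3-eta : c3 :* (e1 :^ 2 :* e4 :^ 2 :* e20) ≐ q :^ 3 :* e2 :^ 6 :* e10 :* e40 :^ 2
  c3-eta = holds (≈-trans (*-congʳ (≈-trans (etaCoeff-series {eq₃} (_ ∷ _ ∷ _ ∷ _ ∷ _ ∷ _ ∷ [])) (*-cong (≈-sym (EulerCube.q^ 3)) (*-cong (etaPower-pos 2 6) (*-cong (etaPower-pos 10 1) (*-cong (etaPower-pos 40 2) (*-cong (etaPower-neg 1 0) (*-cong (etaPower-neg 4 0) (*-cong ≈-refl ≈-refl)))))))))
    (≈-trans (solve 10 (λ q e1 e2 e4 e10 e20 e40 i1 i4 i20 → q :^ 3 :* (e2 :^ 6 :* (e10 :^ 1 :* (e40 :^ 2 :* (i1 :* i1 :* (i4 :* i4 :* (i20 :* (con (+ 1)))))))) :* (e1 :^ 2 :* e4 :^ 2 :* e20) := (q :^ 3 :* e2 :^ 6 :* e10 :* e40 :^ 2) :* (i1 :* e1) :* (i1 :* e1) :* (i4 :* e4) :* (i4 :* e4) :* (i20 :* e20)) refl (qpow 1) ε₁ ε₂ ε₄ ε₁₀ ε₂₀ ε₄₀ (etaPower 1 -[1+ 0 ]) (etaPower 4 -[1+ 0 ]) (etaPower 20 -[1+ 0 ]))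
      (≈-trans (*-cong (≈-trans (*-cong (≈-trans (*-cong (≈-trans (*-cong (≈-trans (*-cong ≈-refl E1-inverse) (*S-identityʳ _)) E1-inverse) (*S-identityʳ _)) (etaPower-inverse 4)) (*S-identityʳ _)) (etaPower-inverse 4)) (*S-identityʳ _)) (etaPower-inverse 20)) (*S-identityʳ _))))

  c4-eta : c4 :* (e2 :^ 2 :* e8 :^ 2 :* e10) ≐ q :* e4 :^ 6 :* e5 :^ 2 :* e20
  c4-eta = holds (≈-trans (*-congʳ (≈-trans (etaCoeff-series {eq₄} (_ ∷ _ ∷ _ ∷ _ ∷ _ ∷ _ ∷ [])) (*-cong (≈-sym (EulerCube.q^ 1)) (*-cong (etaPower-pos 4 6) (*-cong (etaPower-pos 5 2) (*-cong (etaPower-pos 20 1) (*-cong (etaPower-neg 2 0) (*-cong (etaPower-neg 8 0) (*-cong ≈-refl ≈-refl)))))))))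
    (≈-trans (solve 10 (λ q e2 e4 e5 e8 e10 e20 i2 i8 i10 → q :^ 1 :* (e4 :^ 6 :* (e5 :^ 2 :* (e20 :^ 1 :* (i2 :* i2 :* (i8 :* i8 :* (i10 :* (con (+ 1)))))))) :* (e2 :^ 2 :* e8 :^ 2 :* e10) := (q :* e4 :^ 6 :* e5 :^ 2 :* e20) :* (i2 :* e2) :* (i2 :* e2) :* (i8 :* e8) :* (i8 :* e8) :* (i10 :* e10)) refl (qpow 1) ε₂ ε₄ ε₅ ε₈ ε₁₀ ε₂₀ (etaPower 2 -[1+ 0 ]) (etaPower 8 -[1+ 0 ]) (etaPower 10 -[1+ 0 ]))
      (≈-trans (*-cong (≈-trans (*-cong (≈-trans (*-cong (≈-trans (*-cong (≈-trans (*-cong ≈-refl (etaPower-inverse 2)) (*S-identityʳ _)) (etaPower-inverse 2)) (*S-identityʳ _)) (etaPower-inverse 8)) (*S-identityʳ _)) (etaPower-inverse 8)) (*S-identityʳ _)) (etaPower-inverse 10)) (*S-identityʳ _))))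

  x-eta₅ : x :* e1 :^ 2 :* e4 :^ 2 ≐ e2 :^ 5
  x-eta₅ = combine (e1 :^ 2 :* e4 :^ 2 ✕ x-eta ∷ e2 :^ 3 :+ e1 :* e2 :* e4 :* χ ✕ χ-eta ∷ []) refl

  y-eta₅ : y :* e2 :^ 2 :* e8 :^ 2 ≐ e4 :^ 5
  y-eta₅ = transport d2 x-eta₅ refl

  -- The Euler products of each c_k are grouped into thetas so that one pair at q^k and q^(5k) is
  -- left over, with k = 8, 1, 2, 4 for c₁, c₂, c₃, c₄; `p₈`, `p₁`, `p₂`, `p₄` then rewrite that
  -- pair in thetas.
  c1-theta : c1 ≐ q :^ 2 :* w :* c :* e8 :* e40
  c1-theta = cancel (e2 :* e20) (λ ()) (combine (con (+ 1) ✕ c1-eta ∷ :- (c :* e20 :* e40 :* e8 :* q :^ 2) ✕ w-eta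
    ∷ :- (e1 :^ 2 :* e40 :* e8 :* q :^ 2) ✕ c-eta ∷ []) refl)

  c2-theta : c2 ≐ q :^ 2 :* e1 :* e5 :* g :* H
  c2-theta = cancel (e4 :* e10) (λ ()) (combine (con (+ 1) ✕ c2-eta ∷ :- (H :* e1 :* e10 :* e5 :* q :^ 2) ✕ g-eta
    ∷ :- (e1 :* e5 :* e8 :^ 2 :* q :^ 2) ✕ H-eta ∷ []) refl)

  c3-theta : c3 ≐ q :^ 3 :* x :* e2 :* e10 :* G
  c3-theta = cancel (e1 :^ 2 :* e4 :^ 2 :* e20) (λ ()) (combine (con (+ 1) ✕ c3-eta ∷ :- (q :^ 3 :* e2 :* e10 :* G :* e20) ✕ x-eta₅
    ∷ :- (e10 :* e2 :^ 6 :* q :^ 3) ✕ G-eta₂₀ ∷ []) refl)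

  c4-theta : c4 ≐ q :* y :* v :* e4 :* e20
  c4-theta = cancel (e2 :^ 2 :* e8 :^ 2 :* e10) (λ ()) (combine (con (+ 1) ✕ c4-eta ∷ :- (q :* v :* e4 :* e20 :* e10) ✕ y-eta₅
    ∷ :- (e20 :* e4 :^ 6 :* q) ✕ v-eta ∷ []) refl)

  c1-form : 4 · c1 ≐ w :* y :* a :* v :- w :* z :* b :* c
  c1-form = combine (con (+ 4) ✕ c1-theta ∷ :- (w :* c) ✕ p₈ ∷ w :* y ✕ hC ∷ []) refl

  c2-form : 2 · c2 ≐ 2 · (a :* u) :- x :* b :* r
  c2-form = combine (con (+ 2) ✕ c2-theta ∷ 2 · (q :^ 2 :* g :* H) ✕ p₁ ∷ :- 2 · (q :^ 3 :* x :* g) ✕ H² ∷ []) refl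

  c3-form : 2 · c3 ≐ x :* b :* r :- x :* y :* n
  c3-form = combine (con (+ 2) ✕ c3-theta ∷ 2 · (q :^ 3 :* x :* G) ✕ p₂ ∷ []) refl

  c4-form : 4 · c4 ≐ y :* v :* (x :* v :- w :* a)
  c4-form = combine (con (+ 4) ✕ c4-theta ∷ :- (y :* v) ✕ p₄ ∷ []) refl

  -- The divisor sums A and B as theta products

  A-product : G1 :* G3 :* (con (+ 1) :- 2 · A) ≐ (e1 :* e1 :* e1) :* (e4 :* e4 :* e4)
  A-product = holds (≈-trans (*-congˡ (+-congˡ (-‿cong (*-congˡ σ₀₂-lambert)))) (≈-trans (≈-sym wronskian-lambert) (≈-trans G-wronskian
    (*-cong (≈-sym EulerCube.cube) (≈-trans (dil-cong 4 (≈-sym EulerCube.cube)) (≈-trans (dil-* 4 _ _) (*-congʳ (dil-* 4 _ _))))))))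

  G-product : G1 :* G3 :* e2 ≐ e1 :* (e8 :* e8)
  G-product = holds G-eta

  A-eta : e8 :^ 2 :* (con (+ 1) :- 2 · A) ≐ e1 :^ 2 :* e4 :^ 3 :* e2
  A-eta = cancel e1 (λ ()) (combine (e2 ✕ A-product ∷ :- (con (+ 1) :- 2 · A) ✕ G-product ∷ []) refl)

  y-eta : y ≐ e4 :* χ2 :^ 2
  y-eta = transport d2 x-eta refl

  χ2-eta : χ2 :* e2 :* e8 ≐ e4 :^ 2
  χ2-eta = transport d2 χ-eta refl

  A-theta : con (+ 1) :- 2 · A ≐ x :* y :* w :^ 2
  A-theta = cancel (e8 :^ 2 :* e2 :^ 4) (λ ()) (combine (e2 :^ 4 ✕ A-eta ∷ :- (e2 :^ 4 :* e8 :^ 2 :* w :^ 2 :* y) ✕ x-eta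
    ∷ :- (e2 :^ 5 :* e8 :^ 2 :* w :^ 2 :* χ :^ 2) ✕ y-eta
    ∷ :- (e1 :^ 2 :* e2 :^ 3 :* e4 :* e8 :^ 2 :* χ :^ 2 :* χ2 :^ 2) :- e2 :^ 4 :* e4 :* e8 :^ 2 :* w :* χ :^ 2 :* χ2 :^ 2 ✕ w-eta
    ∷ :- (e1 :^ 4 :* e2 :* e4 :^ 3 :* χ :^ 2) :- e1 :^ 4 :* e2 :^ 2 :* e4 :* e8 :* χ :^ 2 :* χ2 ✕ χ2-eta
    ∷ :- (e1 :^ 2 :* e2 :^ 3 :* e4 :^ 3) :- e1 :^ 3 :* e2 :* e4 :^ 4 :* χ ✕ χ-eta ∷ []) refl)

  s² : s :^ 2 ≐ P :^ 2 :+ 4 · (q :^ 4 :* R :^ 2)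
  s² = transport d4 hX refl

  t₁ t₃ t₅ t₇ : Expr 41
  t₁ = q :* ψ8 :* P :^ 3
  t₃ = q :^ 3 :* ψ8 :* R :* P :^ 2
  t₅ = q :^ 5 :* ψ8 :* R :^ 2 :* P
  t₇ = q :^ 7 :* ψ8 :* R :^ 3

  -- By `hZ` the product xyw² is yz²w. The odd part of w is -2qψ(q⁸), and y, z = φ(q⁸) ± 2q²ψ(q¹⁶)
  -- split yz² further, so each of the four terms is q^i times a series in q⁸.
  A-dissect : con (+ 1) :- 2 · A ≐ y :* z :^ 2 :* s :+ (:- 2 · t₁ :+ (4 · t₃ :+ (8 · t₅ :+ (:- 16 · t₇))))
  A-dissect = combine (con (+ 1) ✕ A-theta ∷ :- (y :* w) ✕ hZ ∷ y :* z :^ 2 ✕ w-split ∷ :- 2 · (q :* z :^ 2 :* ψ8) ✕ y-split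
    ∷ :- 2 · (P :^ 2 :* q :* ψ8) :- 2 · (P :* q :* z :* ψ8) :- 4 · (R :* q :^ 3 :* z :* ψ8) :+ 8 · (R :^ 2 :* q :^ 5 :* ψ8) ✕ z-split ∷ []) refl

  -- Reversing the signs in the classes 3 and 5 lets the sum factor again, as (P + 2q²R)(P² +
  -- 4q⁴R²).
  t-sum : t₁ :+ (2 · t₃ :+ (4 · t₅ :+ 8 · t₇)) ≐ q :* ψ8 :* y :* s :^ 2
  t-sum = combine (:- (q :* s :^ 2 :* ψ8) ✕ y-split ∷ :- (P :* q :* ψ8) :- 2 · (R :* q :^ 3 :* ψ8) ✕ s² ∷ []) refl

  private
    scaled : ∀ z {f g} → twist f ≈ g → twist (constS z *S f) ≈ constS z *S g
    scaled z {f} p = ≈-trans (twist-scale z f) (*-congˡ p)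

    class : ∀ i e f → maps? d8 e f ≡ true → twist (⟦ q :^ i :* f ⟧ variables) ≈ constS (χ₂ i) *S ⟦ q :^ i :* f ⟧ variables
    class i e f p = ≈-trans (twist-cong eq) (≈-trans (twist-class i _) (*-congˡ (≈-sym eq)))
      where
      eq : ⟦ q :^ i :* f ⟧ variables ≈ qpow i *S dil 8 (⟦ e ⟧ variables)
      eq = *-cong (EulerCube.q^ i) (≈-sym (mapsTo d8 e f p))

    twist-one : twist (constS (+ 1)) ≈ constS (+ 0)
    twist-one = pointwise λ { zero → refl ; (suc j) → ℤₚ.*-zeroʳ (χ₂ (suc j)) }

    -- The odd part of 1 - 2σ₀₂ has one term for each odd residue class modulo 8; χ₂ changes the sign of the classes 3 and 5.
    dissected : con (+ 1) :+ con (- + 2) :* A ≐ con (+ 1) :* (y :* z :^ 2 :* s)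
      :+ (con (- + 2) :* (q :^ 1 :* (ψ8 :* P :^ 3)) :+ (con (+ 4) :* (q :^ 3 :* (ψ8 :* R :* P :^ 2)) :+ (con (+ 8) :* (q :^ 5 :* (ψ8 :* R :^ 2 :* P)) :+ con (- + 16) :* (q :^ 7 :* (ψ8 :* R :^ 3)))))
    dissected = combine (con (+ 1) ✕ A-dissect ∷ []) refl

    regrouped : con (+ 1) :* con (+ 0)
      :+ (con (- + 2) :* (con (+ 1) :* (q :^ 1 :* (ψ8 :* P :^ 3))) :+ (con (+ 4) :* (con (- + 1) :* (q :^ 3 :* (ψ8 :* R :* P :^ 2)))
      :+ (con (+ 8) :* (con (- + 1) :* (q :^ 5 :* (ψ8 :* R :^ 2 :* P))) :+ con (- + 16) :* (con (+ 1) :* (q :^ 7 :* (ψ8 :* R :^ 3))))))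
      ≐ con (- + 2) :* (q :* (ψ8 :* (y :* s :^ 2)))
    regrouped = combine (con (- + 2) ✕ t-sum ∷ []) refl

    infixr 5 _⊕_
    _⊕_ : ∀ {f g f′ g′} → twist f ≈ f′ → twist g ≈ g′ → twist (f +S g) ≈ f′ +S g′
    p ⊕ p′ = ≈-trans (twist-+ _ _) (+-cong p p′)

  twist-σ₀₂ : twist σ₀₂ ≈ ⟦ q :* (ψ8 :* (y :* s :^ 2)) ⟧ variables
  twist-σ₀₂ = unit-cancel {constS (- + 2)} (λ ())
    (≈-trans (≈-sym (≈-trans (twist-one ⊕ twist-scale (- + 2) σ₀₂) (+S-identityˡ _)))
    (≈-trans (twist-cong (value dissected))
    (≈-trans (scaled (+ 1) (≈-trans (twist-cong (≈-sym (mapsTo d2 (x :* w :^ 2 :* y) (y :* z :^ 2 :* s) refl))) (twist-dil2 _))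
      ⊕ scaled (- + 2) (class 1 (ψ1 :* x :^ 3) (ψ8 :* P :^ 3) refl)
      ⊕ scaled (+ 4) (class 3 (ψ1 :* h :* x :^ 2) (ψ8 :* R :* P :^ 2) refl)
      ⊕ scaled (+ 8) (class 5 (ψ1 :* h :^ 2 :* x) (ψ8 :* R :^ 2 :* P) refl)
      ⊕ scaled (- + 16) (class 7 (ψ1 :* h :^ 3) (ψ8 :* R :^ 3) refl))
    (value regrouped))))

  B-rec : q :* (x :* y :* g :^ 2) :- 2 · (q :^ 2 :* (y :* s :* ψ8 :^ 2)) ≐ q :* (ψ8 :* (y :* s :^ 2))
  B-rec = combine (g :^ 2 :* q :* y ✕ x-split ∷ q :* s :* y :+ 2 · (q :^ 2 :* y :* ψ8) ✕ g² ∷ []) refl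

  -- By `twist-σ₂₀`, `twist-σ₀₂` and `B-rec` both sides have the same value of f(q) - 2f(q²);
  -- `dil2-fixed` is applied to their difference.
  B-theta : B ≐ q :* (x :* y :* g :^ 2)
  B-theta = holds (-≈0⇒≈ (dil2-fixed (σ₂₀ +S -S B̃) (≈-trans (-≈0⇒≈ (≈-trans
    (solve 4 (λ b t d e → (b :- t) :- con (+ 2) :* (d :- e) := (b :- con (+ 2) :* d) :- (t :- con (+ 2) :* e)) refl σ₂₀ B̃ (dil 2 σ₂₀) (dil 2 B̃))
    (≈⇒-≈0 (≈-trans twist-σ₂₀ (≈-trans twist-σ₀₂ (≈-sym (≈-trans (+-congˡ (-‿cong (*-congˡ (mapsTo d2 (q :* (x :* y :* g :^ 2)) (q :^ 2 :* (y :* s :* ψ8 :^ 2)) refl)))) (value B-rec))))))))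
    (*-congˡ (≈-sym (≈-trans (dil-+ 2 σ₂₀ (-S B̃)) (+-congˡ (dil-neg 2 B̃))))))))
    where
    B̃ : Series
    B̃ = ⟦ q :* (x :* y :* g :^ 2) ⟧ variables

  B-form : 2 · B ≐ x :* y :* m
  B-form = combine (con (+ 2) ✕ B-theta ∷ []) refl

  -- x² = w² + 4m, where xyw² = 1 - 2A and xym = 2B. With y² = w² + 2m the same argument gives
  -- `xy³`.
  x³y : x :^ 3 :* y ≐ con (+ 1) :- 2 · A :+ 8 · B
  x³y = combine (con (- + 1) ✕ A-theta ∷ con (- + 4) ✕ B-form ∷ x :* y ✕ hX ∷ :- (x :* y) ✕ hW ∷ []) refl

  xy³ : x :* y :^ 3 ≐ con (+ 1) :- 2 · A :+ 4 · B
  xy³ = combine (con (- + 1) ✕ A-theta ∷ con (- + 2) ✕ B-form ∷ :- (x :* y) ✕ hW ∷ []) refl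

  a³b : a :^ 3 :* b ≐ con (+ 1) :- 2 · A5 :+ 8 · B5
  a³b = transport d5 x³y refl

  ab³ : a :* b :^ 3 ≐ con (+ 1) :- 2 · A5 :+ 4 · B5
  ab³ = transport d5 xy³ refl

  -- The six products of theta functions

  T₁ : x :* (x :* (x :* y)) ≐ con (+ 1) :+ (con (- + 2) :* A :+ 8 · B)
  T₁ = combine (con (+ 1) ✕ x³y ∷ []) refl

  -- The cofactors of the c-forms and of `Q₁` to `Q₄` solve the linear system for the products aby²
  -- and abm, since x²ab = ab(y² + 2m).
  T₂ : 13 · (x :* (x :* (a :* b))) ≐ con (+ 13) :+ (2 · (2 · A :- 15 · A5 :+ 8 · B :+ 60 · B5) :+ 8 · (6 · c1 :- 4 · c2 :- 3 · c3 :+ 4 · c4))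
  T₂ = combine (con (- + 12) ✕ c1-form ∷ con (- + 4) ✕ Q₁ ∷ con (+ 3) ✕ Q₂ ∷ con (+ 16) ✕ c2-form ∷ con (+ 2) ✕ Q₄ ∷ con (+ 12) ✕ c3-form
    ∷ con (- + 1) ✕ Q₃ ∷ con (- + 8) ✕ c4-form ∷ con (+ 6) ✕ x³y ∷ con (- + 8) ✕ xy³ ∷ con (+ 15) ✕ a³b ∷ 13 · (a :* b) :- 6 · (x :* y) ✕ hX
    ∷ :- 2 · (x :* y) ✕ hW ∷ :- 15 · (a :* b) ✕ hA ∷ :- 10 · (x :* y) ✕ hV ∷ []) refl

  T₃ : x :* (y :* (y :* y)) ≐ con (+ 1) :+ (con (- + 2) :* A :+ 4 · B)
  T₃ = combine (con (+ 1) ✕ xy³ ∷ []) refl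

  T₄ : 13 · (x :* (y :* (a :* a))) ≐ con (+ 13) :+ ((:- (2 · (3 · A :+ 10 · A5 :- 12 · B :+ 40 · B5))) :+ 8 · (con (- + 2) :* c2 :- 5 · c3 :+ c4))
  T₄ = combine (con (+ 2) ✕ Q₁ ∷ con (+ 8) ✕ c2-form ∷ con (+ 1) ✕ Q₄ ∷ con (+ 20) ✕ c3-form ∷ con (+ 3) ✕ Q₃ ∷ con (- + 2) ✕ c4-form
    ∷ con (+ 3) ✕ x³y ∷ con (- + 30) ✕ a³b ∷ con (+ 40) ✕ ab³ ∷ :- 3 · (x :* y) ✕ hX ∷ 3 · (x :* y) ✕ hW ∷ 30 · (a :* b) :+ 13 · (x :* y) ✕ hA
    ∷ :- 3 · (x :* y) ✕ hV ∷ []) refl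

  -- Twice the identity is certified, which keeps the cofactors integral.
  T₅ : 13 · (x :* (y :* (b :* b))) ≐ con (+ 13) :+ (2 · (con (- + 3) :* A :- 10 · A5 :+ 6 · B :- 20 · B5) :+ 4 · (2 · c1 :- 2 · c3 :+ 5 · c4))
  T₅ = cancel (con (+ 2)) (λ ()) (combine (con (- + 4) ✕ c1-form ∷ con (+ 6) ✕ Q₁ ∷ con (+ 1) ✕ Q₂ ∷ con (+ 8) ✕ c3-form ∷ con (+ 2) ✕ Q₃
    ∷ con (- + 10) ✕ c4-form ∷ con (+ 6) ✕ xy³ ∷ con (- + 40) ✕ a³b ∷ con (+ 60) ✕ ab³ ∷ 6 · (x :* y) ✕ hW ∷ 40 · (a :* b) ✕ hA
    ∷ :- 10 · (x :* y) ✕ hV ∷ []) refl)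

  T₆ : 13 · (y :* (y :* (a :* b))) ≐ con (+ 13) :+ (2 · (2 · A :- 15 · A5 :+ 4 · B :+ 30 · B5) :+ 4 · (con (- + 4) :* c1 :+ 12 · c2 :+ 8 · c3 :- 3 · c4))
  T₆ = combine (con (+ 4) ✕ c1-form ∷ con (+ 1) ✕ Q₁ ∷ con (- + 1) ✕ Q₂ ∷ con (- + 24) ✕ c2-form ∷ con (- + 3) ✕ Q₄ ∷ con (- + 16) ✕ c3-form
    ∷ con (+ 2) ✕ Q₃ ∷ con (+ 3) ✕ c4-form ∷ con (+ 4) ✕ x³y ∷ con (- + 6) ✕ xy³ ∷ con (+ 15) ✕ ab³ ∷ :- 4 · (x :* y) ✕ hX ∷ :- 2 · (x :* y) ✕ hW
    ∷ 6 · (x :* y) ✕ hV ∷ []) refl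

-- Comparison of coefficients

at-+ : ∀ {f g n a b} → f n ≡ a → g n ≡ b → (f +S g) n ≡ a + b
at-+ {f} {g} {n} p r = trans (+S-at f g n) (cong₂ _+_ p r)

at-neg : ∀ {f n a} → f n ≡ a → (-S f) n ≡ - a
at-neg {f} {n} p = trans (-S-at f n) (cong -_ p)

at-scale : ∀ z {f n a} → f n ≡ a → (constS z *S f) n ≡ z * a
at-scale z {f} {n} p = trans (constS-*ᵏ n z f) (cong (z *_) p)

at-minus : ∀ {f g n a b} → f n ≡ a → g n ≡ b → (f +S -S g) n ≡ a - b
at-minus {g = g} p r = at-+ p (at-neg {g} r)

-- The constants 1 and 13 in `T₁` to `T₆` count the representation of 0 and affect no coefficient
-- with n ≥ 1.
at-const+ : ∀ z {f n a} .{{_ : NonZero n}} → f n ≡ a → (constS z +S f) n ≡ a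
at-const+ z {f} {suc n} p = trans (+S-at (constS z) f (suc n)) (trans (ℤₚ.+-identityˡ (f (suc n))) p)

theorem3p3 : (n : ℕ) → .{{_ : NonZero n}} →
    (N 1 1 1 2 n ≡ - + 2 * σ χ₀ χ₂ n + + 8 * σ χ₂ χ₀ n)
    × (+ 13 * N 1 1 5 10 n ≡
         + 2 * (+ 2 * σ χ₀ χ₂ n - + 15 * σfrac χ₀ χ₂ n 5 + + 8 * σ χ₂ χ₀ n + + 60 * σfrac χ₂ χ₀ n 5)
         + + 8 * (+ 6 * c₁ n - + 4 * c₂ n - + 3 * c₃ n + + 4 * c₄ n))
    × (N 1 2 2 2 n ≡ - + 2 * σ χ₀ χ₂ n + + 4 * σ χ₂ χ₀ n)
    × (+ 13 * N 1 2 5 5 n ≡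
         - (+ 2 * (+ 3 * σ χ₀ χ₂ n + + 10 * σfrac χ₀ χ₂ n 5 - + 12 * σ χ₂ χ₀ n + + 40 * σfrac χ₂ χ₀ n 5))
         + + 8 * (- + 2 * c₂ n - + 5 * c₃ n + c₄ n))
    × (+ 13 * N 1 2 10 10 n ≡
         + 2 * (- + 3 * σ χ₀ χ₂ n - + 10 * σfrac χ₀ χ₂ n 5 + + 6 * σ χ₂ χ₀ n - + 20 * σfrac χ₂ χ₀ n 5)
         + + 4 * (+ 2 * c₁ n - + 2 * c₃ n + + 5 * c₄ n))
    × (+ 13 * N 2 2 5 10 n ≡
         + 2 * (+ 2 * σ χ₀ χ₂ n - + 15 * σfrac χ₀ χ₂ n 5 + + 4 * σ χ₂ χ₀ n + + 30 * σfrac χ₂ χ₀ n 5)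
         + + 4 * (- + 4 * c₁ n + + 12 * c₂ n + + 8 * c₃ n - + 3 * c₄ n))
theorem3p3 n =
    trans (rep 1 1 1 2 x₁ x₁ x₁ ≈-refl) (trans (at (value T₁) n) (at-const+ (+ 1) (at-+ (at-scale (- + 2) sA) (at-scale (+ 8) sB))))
  , trans (rep₁₃ 1 1 5 10 x₁ x₁ ≈-refl ≈-refl) (trans (at (value T₂) n) (at-const+ (+ 13) (at-+
      (at-scale (+ 2) (at-+ (at-+ (at-minus (at-scale (+ 2) sA) (at-scale (+ 15) sA5)) (at-scale (+ 8) sB)) (at-scale (+ 60) sB5)))
      (at-scale (+ 8) (at-+ (at-minus (at-minus (at-scale (+ 6) (refl {x = c₁ n})) (at-scale (+ 4) (refl {x = c₂ n}))) (at-scale (+ 3) (refl {x = c₃ n}))) (at-scale (+ 4) (refl {x = c₄ n})))))))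
  , trans (rep 1 2 2 2 x₁ ≈-refl ≈-refl ≈-refl) (trans (at (value T₃) n) (at-const+ (+ 1) (at-+ (at-scale (- + 2) sA) (at-scale (+ 4) sB))))
  , trans (rep₁₃ 1 2 5 5 x₁ ≈-refl ≈-refl ≈-refl) (trans (at (value T₄) n) (at-const+ (+ 13) (at-+
      (at-neg (at-scale (+ 2) (at-+ (at-minus (at-+ (at-scale (+ 3) sA) (at-scale (+ 10) sA5)) (at-scale (+ 12) sB)) (at-scale (+ 40) sB5))))
      (at-scale (+ 8) (at-+ (at-minus (at-scale (- + 2) (refl {x = c₂ n})) (at-scale (+ 5) (refl {x = c₃ n}))) (refl {x = c₄ n}))))))
  , trans (rep₁₃ 1 2 10 10 x₁ ≈-refl ≈-refl ≈-refl) (trans (at (value T₅) n) (at-const+ (+ 13) (at-+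
      (at-scale (+ 2) (at-minus (at-+ (at-minus (at-scale (- + 3) sA) (at-scale (+ 10) sA5)) (at-scale (+ 6) sB)) (at-scale (+ 20) sB5)))
      (at-scale (+ 4) (at-+ (at-minus (at-scale (+ 2) (refl {x = c₁ n})) (at-scale (+ 2) (refl {x = c₃ n}))) (at-scale (+ 5) (refl {x = c₄ n})))))))
  , trans (rep₁₃ 2 2 5 10 ≈-refl ≈-refl ≈-refl ≈-refl) (trans (at (value T₆) n) (at-const+ (+ 13) (at-+
      (at-scale (+ 2) (at-+ (at-+ (at-minus (at-scale (+ 2) sA) (at-scale (+ 15) sA5)) (at-scale (+ 4) sB)) (at-scale (+ 30) sB5)))
      (at-scale (+ 4) (at-minus (at-+ (at-+ (at-scale (- + 4) (refl {x = c₁ n})) (at-scale (+ 12) (refl {x = c₂ n}))) (at-scale (+ 8) (refl {x = c₃ n}))) (at-scale (+ 3) (refl {x = c₄ n})))))))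
  where
  open Level40 using (value; T₁; T₂; T₃; T₄; T₅; T₆)
  x₁ : dil 1 φ ≈ φ
  x₁ = dil-one φ
  rep : ∀ a₁ a₂ a₃ a₄ .{{_ : NonZero a₁}} .{{_ : NonZero a₂}} .{{_ : NonZero a₃}} .{{_ : NonZero a₄}} {f₁ f₂ f₃ f₄} →
    dil a₁ φ ≈ f₁ → dil a₂ φ ≈ f₂ → dil a₃ φ ≈ f₃ → dil a₄ φ ≈ f₄ → N a₁ a₂ a₃ a₄ n ≡ (f₁ *S (f₂ *S (f₃ *S f₄))) n
  rep a₁ a₂ a₃ a₄ p₁ p₂ p₃ p₄ = trans (N-coefficient a₁ a₂ a₃ a₄ n) (at (*-cong p₁ (*-cong p₂ (*-cong p₃ p₄))) n)
  rep₁₃ : ∀ a₁ a₂ a₃ a₄ .{{_ : NonZero a₁}} .{{_ : NonZero a₂}} .{{_ : NonZero a₃}} .{{_ : NonZero a₄}} {f₁ f₂ f₃ f₄} →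
    dil a₁ φ ≈ f₁ → dil a₂ φ ≈ f₂ → dil a₃ φ ≈ f₃ → dil a₄ φ ≈ f₄ → + 13 * N a₁ a₂ a₃ a₄ n ≡ (constS (+ 13) *S (f₁ *S (f₂ *S (f₃ *S f₄)))) n
  rep₁₃ a₁ a₂ a₃ a₄ p₁ p₂ p₃ p₄ = sym (at-scale (+ 13) (sym (rep a₁ a₂ a₃ a₄ p₁ p₂ p₃ p₄)))
  sA : σ₀₂ n ≡ σ χ₀ χ₂ n
  sA = refl
  sB : σ₂₀ n ≡ σ χ₂ χ₀ n
  sB = refl
  sA5 : dil 5 σ₀₂ n ≡ σfrac χ₀ χ₂ n 5
  sA5 = sym (σfrac-dil χ₀ χ₂ n 5)
  sB5 : dil 5 σ₂₀ n ≡ σfrac χ₂ χ₀ n 5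
  sB5 = sym (σfrac-dil χ₂ χ₀ n 5)
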